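{- Let $\{f_\lambda\}$ and $\{g_\lambda\}$ each be one of the following linear bases of symmetric functions indexed by partitions: Schur functions $\{s_\lambda\}$, monomial symmetric functions $\{m_\lambda\}$, power sums $\{p_\lambda\}$, elementary symmetric functions $\{e_\lambda\}$, complete homogeneous symmetric functions $\{h_\lambda\}$. Define the plethysm coefficients $a^\lambda_{\mu\nu}$ by $f_\mu[g_\nu]=\sum_\lambda a^\lambda_{\mu\nu}s_\lambda$, where $f[g]$ denotes plethysm. Then the function $(\lambda,\mu,\nu)\mapsto a^\lambda_{\mu\nu}$ is in $\mathsf{GapP}$.
   Context: Partitions are encoded in unary. $f\in\#\mathsf{P}$ if $f(w)=\#\{u:(w,u)\in B\}$ for some polynomial-time decidable $B$ with polynomially bounded witnesses; $\mathsf{GapP}=\#\mathsf{P}-\#\mathsf{P}$. Plethysm is the standard operation on symmetric functions: if $g=\sum_i x^{\tau^{(i)}}$ is written as a sum of monomials (with multiplicity), then $f[g]=f(x^{\tau^{(1)}},x^{\tau^{(2)}},\ldots)$. -}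

module Defs where

open import Data.Bool using (Bool; true; false; _∧_; if_then_else_)
open import Data.Nat using (ℕ; zero; suc; _+_; _*_; _∸_; _^_; _≡ᵇ_; _≤ᵇ_; _<ᵇ_)
open import Data.Fin using (Fin; toℕ; _↑ˡ_; #_)
open import Data.List using (List; []; _∷_; _++_; map; concatMap; concat; filterᵇ; length; foldr; upTo; replicate; allFin)
open import Data.Vec as V using (Vec)
open import Data.Maybe using (Maybe; just; nothing)
open import Data.Sum using (_⊎_; inj₁; inj₂)
open import Data.Product using (Σ; _×_; _,_; ∃)
open import Data.Integer as ℤ using (ℤ; +_)
open import Relation.Binary.PropositionalEquality using (_≡_)
open import Relation.Nullary using (¬_)

all : {A : Set} → (A → Bool) → List A → Bool
all p = foldr (λ x b → p x ∧ b) true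

sum : List ℕ → ℕ
sum = foldr _+_ 0

allLists : ℕ → ℕ → List (List ℕ)
allLists zero    b = [] ∷ []
allLists (suc n) b = concatMap (λ x → map (x ∷_) (allLists n b)) (upTo (suc b))

allVecs : (N b : ℕ) → List (Vec ℕ N)
allVecs zero    b = V.[] ∷ []
allVecs (suc N) b = concatMap (λ x → map (x V.∷_) (allVecs N b)) (upTo (suc b))

countℕ : ℕ → List ℕ → ℕ
countℕ v xs = length (filterᵇ (v ≡ᵇ_) xs)

eqVecᵇ : ∀ {N} → Vec ℕ N → Vec ℕ N → Bool
eqVecᵇ V.[] V.[] = true
eqVecᵇ (x V.∷ xs) (y V.∷ ys) = (x ≡ᵇ y) ∧ eqVecᵇ xs ys

countMono : ∀ {N} → Vec ℕ N → List (Vec ℕ N) → ℕ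
countMono α L = length (filterᵇ (eqVecᵇ α) L)

sumℤ : List ℤ → ℤ
sumℤ = foldr ℤ._+_ (+ 0)

weaklyDecᵇ : List ℕ → Bool
weaklyDecᵇ (a ∷ b ∷ r) = (b ≤ᵇ a) ∧ weaklyDecᵇ (b ∷ r)
weaklyDecᵇ _ = true

weaklyIncᵇ : List ℕ → Bool
weaklyIncᵇ (a ∷ b ∷ r) = (a ≤ᵇ b) ∧ weaklyIncᵇ (b ∷ r)
weaklyIncᵇ _ = true

isPartitionᵇ : List ℕ → Bool
isPartitionᵇ la = weaklyDecᵇ la ∧ all (1 ≤ᵇ_) la

IsPartition : List ℕ → Set
IsPartition la = isPartitionᵇ la ≡ true

size : List ℕ → ℕ
size = sum

partitionsOf : ℕ → List (List ℕ)
partitionsOf d =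
  filterᵇ (λ la → isPartitionᵇ la ∧ (size la ≡ᵇ d))
          (concatMap (λ l → allLists l d) (upTo (suc d)))

-- Symmetric functions in N variables x_0,…,x_{N-1}.
-- All five bases have nonnegative integer monomial expansions, so a
-- basis element restricted to N variables is represented as a multiset
-- (list with multiplicity) of exponent vectors: x^α appears c times iff
-- its coefficient is c.

Monos : ℕ → Set
Monos N = List (Vec ℕ N)

sumV : ∀ {N} → Vec ℕ N → ℕ
sumV α = sum (V.toList α)

oneM : (N : ℕ) → Monos N
oneM N = V.replicate N 0 ∷ []

mulM : ∀ {N} → Monos N → Monos N → Monos N
mulM A B = concatMap (λ a → map (V.zipWith _+_ a) B) A

multiplicative : ∀ {N} → (ℕ → Monos N) → List ℕ → Monos N
multiplicative {N} f la = foldr (λ k acc → mulM (f k) acc) (oneM N) la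

hk : (N k : ℕ) → Monos N
hk N k = filterᵇ (λ α → sumV α ≡ᵇ k) (allVecs N k)

ek : (N k : ℕ) → Monos N
ek N k = filterᵇ (λ α → sumV α ≡ᵇ k) (allVecs N 1)

pk : (N k : ℕ) → Monos N
pk N k = map (λ i → V.tabulate (λ j → if toℕ i ≡ᵇ toℕ j then k else 0)) (allFin N)

monomialSym : (N : ℕ) → List ℕ → Monos N
monomialSym N la =
  filterᵇ (λ α → (sumV α ≡ᵇ size la) ∧
                 all (λ v → countℕ v (V.toList α) ≡ᵇ countℕ v la) (map suc (upTo (size la))))
          (allVecs N (size la))

-- Schur functions: s_λ(x_0..x_{N-1}) = Σ_{T ∈ SSYT(λ), entries < N} x^{content T}
-- A tableau is a list of rows (English notation), row i of length λ_i.
colStrictᵇ : List ℕ → List ℕ → Bool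
colStrictᵇ (a ∷ as) (b ∷ bs) = (a <ᵇ b) ∧ colStrictᵇ as bs
colStrictᵇ _ [] = true
colStrictᵇ [] (_ ∷ _) = false

colsStrictᵇ : List (List ℕ) → Bool
colsStrictᵇ (r ∷ r' ∷ rs) = colStrictᵇ r r' ∧ colsStrictᵇ (r' ∷ rs)
colsStrictᵇ _ = true

isSSYTᵇ : ℕ → List (List ℕ) → Bool
isSSYTᵇ N T = all weaklyIncᵇ T ∧ colsStrictᵇ T ∧ all (all (_<ᵇ N)) T

-- all fillings of shape λ with entries in {0,…,N-1} (and possibly 0 when N = 0;
-- those are removed by isSSYTᵇ)
fillings : ℕ → List ℕ → List (List (List ℕ))
fillings N la = foldr (λ r acc → concatMap (λ row → map (row ∷_) acc) (allLists r (N ∸ 1)))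
                      ([] ∷ []) la

content : (N : ℕ) → List (List ℕ) → Vec ℕ N
content N T = V.tabulate (λ i → countℕ (toℕ i) (concat T))

schur : (N : ℕ) → List ℕ → Monos N
schur N la = map (content N) (filterᵇ (isSSYTᵇ N) (fillings N la))

data Basis : Set where
  s m p e h : Basis

basisFn : Basis → (N : ℕ) → List ℕ → Monos N
basisFn s N la = schur N la
basisFn m N la = monomialSym N la
basisFn p N la = multiplicative (pk N) la
basisFn e N la = multiplicative (ek N) la
basisFn h N la = multiplicative (hk N) la

-- Plethysm f_μ[g_ν] restricted to N variables: write g_ν(x_0..x_{N-1}) as the
-- list of monomials x^{τ_1},…,x^{τ_M} (with multiplicity) and substitute them
-- for the M variables of f_μ(y_1..y_M): y^β ↦ x^{Σ_j β_j τ_j}.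
-- (Variables y_j, j > M, are substituted by monomials that vanish.)
plethysm : Basis → Basis → List ℕ → List ℕ → (N : ℕ) → Monos N
plethysm F G mu nu N = map substitute (basisFn F M mu)
  where
  τs : Monos N
  τs = basisFn G N nu
  M : ℕ
  M = length τs
  τv : Vec (Vec ℕ N) M
  τv = V.fromList τs
  substitute : Vec ℕ M → Vec ℕ N
  substitute β = foldr (V.zipWith _+_) (V.replicate N 0)
                       (V.toList (V.zipWith (λ k τ → V.map (k *_) τ) β τv))

-- c : partitions → ℤ is the Schur expansion of f_μ[g_ν], i.e.
-- f_μ[g_ν] = Σ_λ c_λ s_λ as symmetric functions (checked in every finite
-- number N of variables; the expansion is homogeneous of degree |μ||ν|).
IsSchurExpansionOfPlethysm : Basis → Basis → List ℕ → List ℕ → (List ℕ → ℤ) → Set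
IsSchurExpansionOfPlethysm F G mu nu c =
  (∀ la → IsPartition la → ¬ (size la ≡ size mu * size nu) → c la ≡ + 0) ×
  (∀ (N : ℕ) (α : Vec ℕ N) →
     + countMono α (plethysm F G mu nu N)
       ≡ sumℤ (map (λ la → c la ℤ.* + countMono α (schur N la))
                   (partitionsOf (size mu * size nu))))

IsPlethysmCoeff : Basis → Basis → (List ℕ → List ℕ → List ℕ → ℤ) → Set
IsPlethysmCoeff F G a =
  ∀ mu nu → IsPartition mu → IsPartition nu →
    IsSchurExpansionOfPlethysm F G mu nu (λ la → a la mu nu)

-- Complexity: deterministic single-tape Turing machines.
-- Input alphabet Fin 5; tape alphabet Fin (suc (5 + extra)) with blank = zero,
-- input symbol i encoded as suc (inject+ extra i).

data Move : Set where
  L R S : Move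

record TM : Set where
  field
    extra  : ℕ
    states : ℕ
    start  : Fin states
    -- transition: next state (inj₂ b = halt, accepting iff b), written symbol, move
    δ : Fin states → Fin (suc (5 + extra)) →
        (Fin states ⊎ Bool) × Fin (suc (5 + extra)) × Move

module _ (M : TM) where
  open TM M

  Γ : Set
  Γ = Fin (suc (5 + extra))

  blank : Γ
  blank = Fin.zero
    where import Data.Fin as Fin

  -- configuration: state, reversed left part, scanned symbol, right part
  Config : Set
  Config = Fin states × List Γ × Γ × List Γ

  step : Config → Config ⊎ Bool
  step (q , ls , a , rs) with δ q a
  ... | (inj₂ b , _ , _) = inj₂ b
  ... | (inj₁ q' , w , L) with ls
  ...   | []       = inj₁ (q' , [] , blank , w ∷ rs)
  ...   | l ∷ ls'  = inj₁ (q' , ls' , l , w ∷ rs)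
  step (q , ls , a , rs) | (inj₁ q' , w , R) with rs
  ...   | []       = inj₁ (q' , w ∷ ls , blank , [])
  ...   | r ∷ rs'  = inj₁ (q' , w ∷ ls , r , rs')
  step (q , ls , a , rs) | (inj₁ q' , w , S) = inj₁ (q' , ls , w , rs)

  runFrom : ℕ → Config → Maybe Bool
  runFrom zero    c = nothing
  runFrom (suc t) c with step c
  ... | inj₂ b  = just b
  ... | inj₁ c' = runFrom t c'

  initial : List (Fin 5) → Config
  initial []       = start , [] , blank , []
  initial (x ∷ xs) = start , [] , enc x , map enc xs
    where enc : Fin 5 → Γ
          enc i = Fin.suc (i ↑ˡ extra)
            where import Data.Fin as Fin

  run : ℕ → List (Fin 5) → Maybe Bool
  run t x = runFrom t (initial x)

-- time bound (n+2)^c  (every polynomial is eventually dominated by such a bound)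
timeBound : ℕ → ℕ → ℕ
timeBound c n = (n + 2) ^ c

PolyTimeDecider : TM → ℕ → Set
PolyTimeDecider M c = ∀ (x : List (Fin 5)) → ∃ λ b → run M (timeBound c (length x)) x ≡ just b

acceptsᵇ : TM → ℕ → List (Fin 5) → Bool
acceptsᵇ M c x with run M (timeBound c (length x)) x
... | just true = true
... | _         = false

Word : Set
Word = List (Fin 3)

bitStrings : ℕ → List (List Bool)
bitStrings zero    = [] ∷ []
bitStrings (suc n) = concatMap (λ u → (false ∷ u) ∷ (true ∷ u) ∷ []) (bitStrings n)

bitStringsUpTo : ℕ → List (List Bool)
bitStringsUpTo n = concatMap bitStrings (upTo (suc n))

pairEnc : Word → List Bool → List (Fin 5)
pairEnc w u = map (_↑ˡ 2) w ++ (# 3) ∷ map (λ b → if b then # 1 else # 0) u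

IsSharpP : (Word → ℕ) → Set
IsSharpP f = Σ TM λ M → Σ ℕ λ c → PolyTimeDecider M c ×
  (∀ w → f w ≡ length (filterᵇ (λ u → acceptsᵇ M c (pairEnc w u))
                               (bitStringsUpTo (timeBound c (length w)))))

-- unary encoding of partitions: 1^{λ1} , 1^{λ2} , … ;   (symbols #0 = 1, #1 = ',', #2 = ';')
encPartition : List ℕ → Word
encPartition la = concatMap (λ k → replicate k (# 0) ++ (# 1) ∷ []) la ++ (# 2) ∷ []

encTriple : List ℕ → List ℕ → List ℕ → Word
encTriple la mu nu = encPartition la ++ encPartition mu ++ encPartition nu

IsGapPTriple : (List ℕ → List ℕ → List ℕ → ℤ) → Set
IsGapPTriple a = Σ (Word → ℕ) λ g → Σ (Word → ℕ) λ g' → IsSharpP g × IsSharpP g' ×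
  (∀ la mu nu → IsPartition la → IsPartition mu → IsPartition nu →
     a la mu nu ≡ + g (encTriple la mu nu) ℤ.- + g' (encTriple la mu nu))

{-# OPTIONS --safe #-}
module Submission where

-- For a symmetric X, the coefficient of s_λ in X is the coefficient of x^λ in ∏_{i<j} (1 − x_j/x_i) · X, where ℓ(λ)
-- variables suffice; this follows from antisymmetry together with the branching rule for Schur functions.  Each basis
-- element is a sum over words subject to comparison conditions on the letters (shape conditions on a filling), so
-- f_μ[g_ν] is a sum over |μ||ν|-letter words, the outer conditions comparing whole inner words lexicographically.
-- Choosing moreover a subset of the pairs i < j expands the product.  Hence the plethysm coefficient counts, with sign
-- (−1)^{number of pairs}, bit strings satisfying a predicate built from bounded sums of comparisons, and such predicates
-- compile to polynomial-time Turing machines.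

open import Defs hiding (s; m; p; e; h; L; R; S; step)
open import Data.Bool using (Bool; true; false; _∧_; _∨_; not; if_then_else_)
open import Data.Nat using (ℕ; zero; suc; _+_; _*_; _∸_; _^_; _⊔_; _⊓_; _≤_; _<_; z≤n; s≤s; _≡ᵇ_; _≤ᵇ_; _<ᵇ_; _≤?_; _≟_)
open import Data.Fin using (Fin; toℕ; _↑ˡ_; #_)
open import Data.List using (List; []; _∷_; _++_; _∷ʳ_; map; concatMap; concat; filterᵇ; length; foldr; upTo; replicate; allFin; reverse; lookup; applyUpTo; zipWith; tabulate; take; drop; initLast; _∷ʳ′_)
open import Data.Vec using (Vec)
open import Data.Maybe using (Maybe; just; nothing)
open import Data.Sum using (_⊎_; inj₁; inj₂)
open import Data.Product using (Σ; _×_; _,_; ∃; proj₁; proj₂)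
open import Data.Unit using (⊤; tt)
open import Data.Empty using (⊥; ⊥-elim)
open import Data.Integer using (ℤ) renaming (+_ to pos; -[1+_] to negsuc; _+_ to _+ᶻ_; _*_ to _*ᶻ_; -_ to -ᶻ_; _-_ to _-ᶻ_)
open import Relation.Binary.PropositionalEquality using (_≡_; _≢_; refl; sym; trans; cong; cong₂; subst; subst₂; module ≡-Reasoning)
open import Relation.Binary.Definitions using (tri<; tri≈; tri>)
open import Relation.Nullary using (¬_; yes; no)
open import Function using (_∘_; id; const; _$_)
open import Data.List.Membership.Propositional using (_∈_)
open import Data.List.Membership.Propositional.Properties using (∈-map⁺; ∈-map⁻; ∈-concatMap⁺; ∈-concatMap⁻; ∈-++⁺ˡ; ∈-++⁺ʳ; ∈-++⁻; ∈-allFin)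
open import Data.List.Relation.Unary.All using (All; []; _∷_)
open import Data.List.Relation.Unary.Any using (here; there; index)
open import Data.List.Relation.Unary.Any.Properties using (lookup-index)
import Data.Fin as F
import Data.Integer as I
import Data.Integer.Properties as ℤP
import Data.Integer.Tactic.RingSolver as ℤS
import Data.List.Properties as LP
import Data.List.Relation.Unary.All as All
import Data.List.Relation.Unary.Any as Any
import Data.Nat.Induction as ℕI
import Data.Nat.Properties as ℕP
import Data.Nat.Tactic.RingSolver as ℕS
import Data.Vec as V
import Data.Vec.Properties as VP
import Induction.WellFounded as WF

-- Turing machines from composable fragments

-- Two obstacles shape the proof. The polynomial g_ν has exponentially many monomials, and a witness
-- must name |μ| of them. As f_μ is symmetric, the order in which they are substituted is
-- irrelevant, so they may be listed in the lexicographic order of the words producing them;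
-- comparing two variables of f_μ is then comparing two words of length |ν|, and no index into the
-- list is ever written. Secondly, a symmetric function is represented by one polynomial for each
-- number of variables, symmetric and compatible with setting a variable to zero; plethysm must
-- preserve this. Antisymmetry is used through the dot action on integer exponents: for symmetric X
-- the extracted coefficient changes sign under it and vanishes at its fixed points. After one
-- branching step only partitions, such fixed points and exponents with negative last entry occur,
-- which permits an induction on the number of variables. That the extracted coefficients really
-- expand X rests on triangularity: besides the coefficient at λ, only coefficients at exponents v
-- of smaller weight Σ i·v_i enter.

record Finite (A : Set) : Set where
  constructor finite
  field
    elems    : List A
    complete : ∀ a → a ∈ elems

open Finite

⊤-finite : Finite ⊤
⊤-finite = finite (tt ∷ []) λ _ → here refl

Bool-finite : Finite Bool
Bool-finite = finite (false ∷ true ∷ []) λ { false → here refl ; true → there (here refl) }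

Fin-finite : ∀ n → Finite (Fin n)
Fin-finite n = finite (allFin n) ∈-allFin

Σ-finite : {A : Set} {B : A → Set} → Finite A → (∀ a → Finite (B a)) → Finite (Σ A B)
Σ-finite fa fb = finite (concatMap (λ a → map (a ,_) (elems (fb a))) (elems fa)) λ { (a , b) →
  ∈-concatMap⁺ (λ x → map (x ,_) (elems (fb x)))
    (Any.map (λ { refl → ∈-map⁺ (a ,_) (complete (fb a) b) }) (complete fa a)) }

⊎-finite : {A B : Set} → Finite A → Finite B → Finite (A ⊎ B)
⊎-finite fa fb = finite (map inj₁ (elems fa) ++ map inj₂ (elems fb)) λ
  { (inj₁ a) → ∈-++⁺ˡ (∈-map⁺ inj₁ (complete fa a))
  ; (inj₂ b) → ∈-++⁺ʳ (map inj₁ (elems fa)) (∈-map⁺ inj₂ (complete fb b)) }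

allBits : ∀ n → List (Vec Bool n)
allBits zero    = V.[] ∷ []
allBits (suc n) = map (false V.∷_) (allBits n) ++ map (true V.∷_) (allBits n)

allBits-complete : ∀ {n} (v : Vec Bool n) → v ∈ allBits n
allBits-complete V.[] = here refl
allBits-complete (false V.∷ v) = ∈-++⁺ˡ (∈-map⁺ (false V.∷_) (allBits-complete v))
allBits-complete {suc n} (true V.∷ v) = ∈-++⁺ʳ (map (false V.∷_) (allBits n)) (∈-map⁺ (true V.∷_) (allBits-complete v))

nth : {A : Set} → A → List A → ℕ → A
nth d []       _       = d
nth d (x ∷ xs) zero    = x
nth d (x ∷ xs) (suc n) = nth d xs n

-- Tape symbols carry K mark tracks: register j holds the position of the unique cell marked on track j.
-- The extra Boolean singles out the leftmost input cell.
module Machine (K : ℕ) where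

  Sym : Set
  Sym = Fin 6 × Bool × Vec Bool K

  blankSym : Sym
  blankSym = F.zero , false , V.replicate K false

  Tape : Set
  Tape = List Sym × Sym × List Sym

  writeT : Sym → Tape → Tape
  writeT w (ls , _ , rs) = ls , w , rs

  moveT : Move → Tape → Tape
  moveT Move.L ([] , a , rs)     = [] , blankSym , a ∷ rs
  moveT Move.L (l ∷ ls , a , rs) = ls , l , a ∷ rs
  moveT Move.R (ls , a , [])     = a ∷ ls , blankSym , []
  moveT Move.R (ls , a , r ∷ rs) = a ∷ ls , r , rs
  moveT Move.S t = t

  cur : Tape → Sym
  cur (_ , a , _) = a

  -- The index type is the set of exits. A continuation may depend on the exit value, so branching
  -- on a symbol that was read is a `bind`; the value ranges over a finite type because it is kept
  -- in the control state.
  data Frag : Set → Set₁ where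
    act  : ∀ {E} → (Sym → E × Sym × Move) → Frag E
    bind : ∀ {D E} → Finite D → Frag D → (D → Frag E) → Frag E
    loop : ∀ {E} → Frag (Maybe E) → Frag E

  relink : {A B C : Set} → (A → B) → A × C → B × C
  relink f (a , c) = f a , c

  bindTo : {Q D : Set} {R : D → Set} {E : Set} → (∀ d → R d) → Q ⊎ D → (Q ⊎ Σ D R) ⊎ E
  bindTo en (inj₁ q) = inj₁ (inj₁ q)
  bindTo en (inj₂ d) = inj₁ (inj₂ (d , en d))

  bindTo₂ : {Q D : Set} {R : D → Set} {E : Set} (d : D) → R d ⊎ E → (Q ⊎ Σ D R) ⊎ E
  bindTo₂ d (inj₁ q) = inj₁ (inj₂ (d , q))
  bindTo₂ d (inj₂ x) = inj₂ x

  loopTo : {Q E : Set} → Q → Q ⊎ Maybe E → Q ⊎ E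
  loopTo en (inj₁ q)        = inj₁ q
  loopTo en (inj₂ nothing)  = inj₁ en
  loopTo en (inj₂ (just x)) = inj₂ x

  Q : ∀ {E} → Frag E → Set
  Q (act _)            = ⊤
  Q (bind {D} _ p₁ p₂) = Q p₁ ⊎ Σ D (λ d → Q (p₂ d))
  Q (loop p₁)          = Q p₁

  finQ : ∀ {E} (F : Frag E) → Finite (Q F)
  finQ (act _)         = ⊤-finite
  finQ (bind fd p₁ p₂) = ⊎-finite (finQ p₁) (Σ-finite fd λ d → finQ (p₂ d))
  finQ (loop p₁)       = finQ p₁

  entry : ∀ {E} (F : Frag E) → Q F
  entry (act _)        = tt
  entry (bind _ p₁ _)  = inj₁ (entry p₁)
  entry (loop p₁)      = entry p₁

  trans′ : ∀ {E} (F : Frag E) → Q F → Sym → (Q F ⊎ E) × Sym × Move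
  trans′ (act f) _ a = inj₂ (proj₁ (f a)) , proj₂ (f a)
  trans′ (bind _ p₁ p₂) (inj₁ q) a = relink (bindTo λ d → entry (p₂ d)) (trans′ p₁ q a)
  trans′ (bind _ p₁ p₂) (inj₂ (d , q)) a = relink (bindTo₂ d) (trans′ (p₂ d) q a)
  trans′ (loop p₁) q a = relink (loopTo (entry p₁)) (trans′ p₁ q a)

  -- The last step of a run still writes and moves, and inside a larger fragment that same step
  -- enters the successor. Hence the lengths of consecutive runs simply add.
  data Runs {E : Set} (F : Frag E) : Q F → Tape → ℕ → E → Tape → Set where
    done : ∀ {q t x w mv} → trans′ F q (cur t) ≡ (inj₂ x , w , mv) → Runs F q t 1 x (moveT mv (writeT w t))
    more : ∀ {q t q′ w mv n x t′} → trans′ F q (cur t) ≡ (inj₁ q′ , w , mv) →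
           Runs F q′ (moveT mv (writeT w t)) n x t′ → Runs F q t (suc n) x t′

  run-bind₂ : ∀ {D E} {fd : Finite D} {p₁ : Frag D} {p₂ : D → Frag E} {d q t n x t′} →
              Runs (p₂ d) q t n x t′ → Runs (bind fd p₁ p₂) (inj₂ (d , q)) t n x t′
  run-bind₂ {d = d} (done eq) = done (cong (relink (bindTo₂ d)) eq)
  run-bind₂ {d = d} (more eq r) = more (cong (relink (bindTo₂ d)) eq) (run-bind₂ r)

  run-bind : ∀ {D E} {fd : Finite D} {p₁ : Frag D} {p₂ : D → Frag E} {d q t n t₁ k x t₂} →
             Runs p₁ q t n d t₁ → Runs (p₂ d) (entry (p₂ d)) t₁ k x t₂ →
             Runs (bind fd p₁ p₂) (inj₁ q) t (n + k) x t₂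
  run-bind {p₂ = p₂} (done eq) r′ = more (cong (relink (bindTo λ d → entry (p₂ d))) eq) (run-bind₂ r′)
  run-bind {p₂ = p₂} (more eq r) r′ = more (cong (relink (bindTo λ d → entry (p₂ d))) eq) (run-bind r r′)

  run-exit : ∀ {E} {p₁ : Frag (Maybe E)} {q t n x t′} → Runs p₁ q t n (just x) t′ → Runs (loop p₁) q t n x t′
  run-exit {p₁ = p₁} (done eq) = done (cong (relink (loopTo (entry p₁))) eq)
  run-exit {p₁ = p₁} (more eq r) = more (cong (relink (loopTo (entry p₁))) eq) (run-exit r)

  run-again : ∀ {E} {p₁ : Frag (Maybe E)} {q t n t₁ k x t₂} → Runs p₁ q t n nothing t₁ →
              Runs (loop p₁) (entry p₁) t₁ k x t₂ → Runs (loop p₁) q t (n + k) x t₂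
  run-again {p₁ = p₁} (done eq) r′ = more (cong (relink (loopTo (entry p₁))) eq) r′
  run-again {p₁ = p₁} (more eq r) r′ = more (cong (relink (loopTo (entry p₁))) eq) (run-again r r′)

  Sym-finite : Finite Sym
  Sym-finite = Σ-finite (Fin-finite 6) λ _ → Σ-finite Bool-finite λ _ → finite (allBits K) allBits-complete

  allSyms : List Sym
  allSyms = elems Sym-finite

  plain : Fin 6 → Sym
  plain b = b , false , V.replicate K false

  -- The blank and the five input symbols come first, at the codes that `blank` and `initial`
  -- prescribe, so that decoding them computes. Their second occurrence in `allSyms` does no harm,
  -- since codes are only ever compared after decoding.
  syms : List Sym
  syms = plain (# 0) ∷ plain (# 1) ∷ plain (# 2) ∷ plain (# 3) ∷ plain (# 4) ∷ plain (# 5) ∷ allSyms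

  syms-complete : ∀ a → a ∈ syms
  syms-complete a = there (there (there (there (there (there (complete Sym-finite a))))))

  dec : Fin (length syms) → Sym
  dec = lookup syms

  code : Sym → Fin (length syms)
  code a = index (syms-complete a)

  dec-code : ∀ a → dec (code a) ≡ a
  dec-code a = sym (lookup-index (syms-complete a))

  module _ (F : Frag Bool) where
    private
      qs = elems (finQ F)
      dq : Fin (length qs) → Q F
      dq = lookup qs
      cq : Q F → Fin (length qs)
      cq q = index (complete (finQ F) q)
      dq-cq : ∀ q → dq (cq q) ≡ q
      dq-cq q = sym (lookup-index (complete (finQ F) q))

    codeOut : (Q F ⊎ Bool) × Sym × Move → (Fin (length qs) ⊎ Bool) × Fin (length syms) × Move
    codeOut (inj₁ q , w , mv) = inj₁ (cq q) , code w , mv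
    codeOut (inj₂ b , w , mv) = inj₂ b , code w , mv

    toTM : TM
    toTM = record { extra = length allSyms ; states = length qs ; start = cq (entry F)
                  ; δ = λ q a → codeOut (trans′ F (dq q) (dec a)) }

    decT : List (Fin (length syms)) × Fin (length syms) × List (Fin (length syms)) → Tape
    decT (ls , a , rs) = map dec ls , dec a , map dec rs

    -- Symbols may have several codes, so a coded configuration is known only up to decoding. The
    -- induction therefore quantifies over every coded configuration that decodes to the given one.
    sim : ∀ {q t n x t′} → Runs F q t n x t′ → ∀ qc T → dq qc ≡ q → decT T ≡ t → ∀ k → n ≤ k →
          runFrom toTM k (qc , T) ≡ just x
    sim (done eq) qc (ls , a , rs) refl refl (suc k) _ rewrite eq = refl
    sim {n = suc n} (more {w = w} {Move.L} eq r) qc ([] , a , rs) refl refl (suc k) (s≤s le) rewrite eq =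
      sim r _ _ (dq-cq _) (cong (λ z → [] , blankSym , z ∷ map dec rs) (dec-code w)) k le
    sim {n = suc n} (more {w = w} {Move.L} eq r) qc (l ∷ ls , a , rs) refl refl (suc k) (s≤s le) rewrite eq =
      sim r _ _ (dq-cq _) (cong (λ z → map dec ls , dec l , z ∷ map dec rs) (dec-code w)) k le
    sim {n = suc n} (more {w = w} {Move.R} eq r) qc (ls , a , []) refl refl (suc k) (s≤s le) rewrite eq =
      sim r _ _ (dq-cq _) (cong (λ z → z ∷ map dec ls , blankSym , []) (dec-code w)) k le
    sim {n = suc n} (more {w = w} {Move.R} eq r) qc (ls , a , x ∷ rs) refl refl (suc k) (s≤s le) rewrite eq =
      sim r _ _ (dq-cq _) (cong (λ z → z ∷ map dec ls , dec x , map dec rs) (dec-code w)) k le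
    sim {n = suc n} (more {w = w} {Move.S} eq r) qc (ls , a , rs) refl refl (suc k) (s≤s le) rewrite eq =
      sim r _ _ (dq-cq _) (cong (λ z → map dec ls , z , map dec rs) (dec-code w)) k le

  initT : List (Fin 5) → Tape
  initT []       = [] , blankSym , []
  initT (x ∷ xs) = [] , plain (F.suc x) , map (plain ∘ F.suc) xs

  dec-input : ∀ (x : Fin 5) → dec (F.suc (x ↑ˡ length allSyms)) ≡ plain (F.suc x)
  dec-input F.zero = refl
  dec-input (F.suc F.zero) = refl
  dec-input (F.suc (F.suc F.zero)) = refl
  dec-input (F.suc (F.suc (F.suc F.zero))) = refl
  dec-input (F.suc (F.suc (F.suc (F.suc F.zero)))) = refl

  toTM-run : ∀ (F : Frag Bool) {x n b t′} → Runs F (entry F) (initT x) n b t′ → ∀ k → n ≤ k → run (toTM F) k x ≡ just b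
  toTM-run F {[]} r k le = sim F r _ _ (sym (lookup-index (complete (finQ F) (entry F)))) refl k le
  toTM-run F {x ∷ xs} r k le = sim F r _ _ (sym (lookup-index (complete (finQ F) (entry F))))
    (cong₂ (λ a b → [] , a , b) (dec-input x)
      (trans (sym (LP.map-∘ xs)) (LP.map-cong dec-input xs))) k le

-- Register files and their marks on the tape

≡ᵇ-refl : ∀ n → (n ≡ᵇ n) ≡ true
≡ᵇ-refl zero    = refl
≡ᵇ-refl (suc n) = ≡ᵇ-refl n

≡ᵇ-≢ : ∀ {a b} → a ≢ b → (a ≡ᵇ b) ≡ false
≡ᵇ-≢ {zero}  {zero}  ne = ⊥-elim (ne refl)
≡ᵇ-≢ {zero}  {suc b} ne = refl
≡ᵇ-≢ {suc a} {zero}  ne = refl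
≡ᵇ-≢ {suc a} {suc b} ne = ≡ᵇ-≢ {a} {b} (ne ∘ cong suc)

≡ᵇ-sound : ∀ a b → (a ≡ᵇ b) ≡ true → a ≡ b
≡ᵇ-sound zero    zero    _  = refl
≡ᵇ-sound (suc a) (suc b) eq = cong suc (≡ᵇ-sound a b eq)

infixl 9 _[_↦_]
opaque
  _[_↦_] : {A : Set} → (ℕ → A) → ℕ → A → ℕ → A
  (f [ j ↦ v ]) i = if i ≡ᵇ j then v else f i

opaque
  unfolding _[_↦_]

  upd-here : {A : Set} (f : ℕ → A) (j : ℕ) (v : A) → (f [ j ↦ v ]) j ≡ v
  upd-here f j v rewrite ≡ᵇ-refl j = refl

  upd-there : {A : Set} (f : ℕ → A) {i j : ℕ} (v : A) → i ≢ j → (f [ j ↦ v ]) i ≡ f i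
  upd-there f v ne rewrite ≡ᵇ-≢ ne = refl

  upd-cong : {A : Set} {f g : ℕ → A} {j : ℕ} {u v : A} → (∀ i → f i ≡ g i) → u ≡ v → ∀ i → (f [ j ↦ u ]) i ≡ (g [ j ↦ v ]) i
  upd-cong {j = j} eq refl i with i ≡ᵇ j
  ... | true  = refl
  ... | false = eq i

  upd-shadow : {A : Set} (f : ℕ → A) {j : ℕ} {u v : A} → ∀ i → (f [ j ↦ u ] [ j ↦ v ]) i ≡ (f [ j ↦ v ]) i
  upd-shadow f {j} i with i ≡ᵇ j
  ... | true  = refl
  ... | false = refl

  upd-shadow₃ : {A : Set} (f : ℕ → A) {x z r : ℕ} {a b c a′ b′ c′ : A} → ∀ i →
    (f [ x ↦ a ] [ z ↦ b ] [ r ↦ c ] [ x ↦ a′ ] [ z ↦ b′ ] [ r ↦ c′ ]) i ≡ (f [ x ↦ a′ ] [ z ↦ b′ ] [ r ↦ c′ ]) i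
  upd-shadow₃ f {x} {z} {r} i with i ≡ᵇ r | i ≡ᵇ z | i ≡ᵇ x
  ... | true  | _     | _     = refl
  ... | false | true  | _     = refl
  ... | false | false | true  = refl
  ... | false | false | false = refl

  upd-comm : {A : Set} (f : ℕ → A) {j k : ℕ} {u v : A} → j ≢ k → ∀ i → (f [ j ↦ u ] [ k ↦ v ]) i ≡ (f [ k ↦ v ] [ j ↦ u ]) i
  upd-comm f {j} {k} ne i with i ≟ j | i ≟ k
  ... | yes refl | yes refl = ⊥-elim (ne refl)
  ... | yes refl | no ne₁ rewrite ≡ᵇ-≢ ne₁ | ≡ᵇ-refl j = refl
  ... | no ne₁ | yes refl rewrite ≡ᵇ-≢ ne₁ | ≡ᵇ-refl k = refl
  ... | no ne₁ | no ne₂ rewrite ≡ᵇ-≢ ne₁ | ≡ᵇ-≢ ne₂ = refl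

  upd-≤ : ∀ {f : ℕ → ℕ} {n j v} → (∀ i → f i ≤ n) → v ≤ n → ∀ i → (f [ j ↦ v ]) i ≤ n
  upd-≤ {j = j} le lv i with i ≡ᵇ j
  ... | true  = lv
  ... | false = le i

upd-id : {A : Set} (f : ℕ → A) {j : ℕ} {v : A} → f j ≡ v → ∀ i → (f [ j ↦ v ]) i ≡ f i
upd-id f {j} eq i with i ≟ j
... | yes refl = trans (upd-here f i _) (sym eq)
... | no ne = upd-there f _ ne

getMark : ∀ {k} → ℕ → Vec Bool k → Bool
getMark _       V.[]      = false
getMark zero    (b V.∷ v) = b
getMark (suc j) (b V.∷ v) = getMark j v

setMark : ∀ {k} → ℕ → Bool → Vec Bool k → Vec Bool k
setMark _       c V.[]      = V.[]
setMark zero    c (b V.∷ v) = c V.∷ v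
setMark (suc j) c (b V.∷ v) = b V.∷ setMark j c v

marks : (ℕ → ℕ) → ∀ k → ℕ → Vec Bool k
marks ρ zero    q = V.[]
marks ρ (suc k) q = (q ≡ᵇ ρ 0) V.∷ marks (ρ ∘ suc) k q

getMark-marks : ∀ ρ {k j} q → j < k → getMark j (marks ρ k q) ≡ (q ≡ᵇ ρ j)
getMark-marks ρ {suc k} {zero}  q _        = refl
getMark-marks ρ {suc k} {suc j} q (s≤s lt) = getMark-marks (ρ ∘ suc) q lt

marks-cong : ∀ {ρ ρ′} k q → (∀ i → (q ≡ᵇ ρ i) ≡ (q ≡ᵇ ρ′ i)) → marks ρ k q ≡ marks ρ′ k q
marks-cong zero    q eq = refl
marks-cong (suc k) q eq = cong₂ V._∷_ (eq 0) (marks-cong k q (eq ∘ suc))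

setMark-marks : ∀ {ρ ρ′} k j b q → (q ≡ᵇ ρ′ j) ≡ b → (∀ i → i ≢ j → (q ≡ᵇ ρ i) ≡ (q ≡ᵇ ρ′ i)) →
                setMark j b (marks ρ k q) ≡ marks ρ′ k q
setMark-marks zero    j       b q e₁ e₂ = refl
setMark-marks (suc k) zero    b q e₁ e₂ = cong₂ V._∷_ (sym e₁) (marks-cong k q λ i → e₂ (suc i) λ ())
setMark-marks (suc k) (suc j) b q e₁ e₂ =
  cong₂ V._∷_ (e₂ 0 λ ()) (setMark-marks k j b q e₁ λ i ne → e₂ (suc i) (ne ∘ ℕP.suc-injective))

-- Elementary register operations with timed specifications

module Ops (K : ℕ) where
  open Machine K

  ret : ∀ {E} → E → Frag E
  ret x = act λ a → x , a , Move.S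

  infixr 5 _⨟_
  _⨟_ : ∀ {E} → Frag ⊤ → Frag E → Frag E
  a ⨟ b = bind ⊤-finite a λ _ → b

  markOf : ℕ → Sym → Bool
  markOf j (_ , _ , v) = getMark j v

  homeOf : Sym → Bool
  homeOf (_ , b , _) = b

  withMark : ℕ → Bool → Sym → Sym
  withMark j b (x , hm , v) = x , hm , setMark j b v

  scanR : ℕ → Frag ⊤
  scanR j = loop (act λ a → if markOf j a then (just tt , a , Move.S) else (nothing , a , Move.R))

  scanHome : ∀ {E} → E → Frag E
  scanHome x = loop (act λ a → if homeOf a then (just x , a , Move.S) else (nothing , a , Move.L))

  -- Both scan right for the mark, shift it by one cell and return to the home cell. If the mark is
  -- already at home, `dcr` leaves it there, which is truncated subtraction.
  inc dcr : ℕ → Frag ⊤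
  inc j = scanR j ⨟ act (λ a → tt , withMark j false a , Move.R) ⨟ act (λ a → tt , withMark j true a , Move.S) ⨟ scanHome tt
  dcr j = scanR j ⨟ act (λ a → if homeOf a then (tt , a , Move.S) else (tt , withMark j false a , Move.L))
          ⨟ act (λ a → tt , withMark j true a , Move.S) ⨟ scanHome tt

  readAt : ℕ → Frag (Fin 6)
  readAt j = scanR j ⨟ bind (Fin-finite 6) (act λ a → proj₁ a , a , Move.S) scanHome

  -- Between operations the head rests on the home cell, which is position 0, so the scanned symbol
  -- already tells whether the register is zero.
  isZero : ℕ → Frag Bool
  isZero j = act λ a → markOf j a , a , Move.S

  forDown : ℕ → Frag ⊤ → Frag ⊤
  forDown j body = loop (bind Bool-finite (isZero j) λ z → if z then ret (just tt) else (dcr j ⨟ body ⨟ ret nothing))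

  Left : ℕ → (ℕ → Sym) → List Sym → Set
  Left zero    f _        = ⊤
  Left (suc i) f []       = ⊥
  Left (suc i) f (l ∷ ls) = (l ≡ f i) × Left i f ls

  -- The idealised tape is a total function on positions, so a register may point beyond the stored
  -- cells: the right-hand list is read with the blank as default.
  At : ℕ → (ℕ → Sym) → Tape → Set
  At i f (ls , a , rs) = Left i f ls × (a ≡ f i) × (∀ n → nth blankSym rs n ≡ f (suc i + n))

  Left-cong : ∀ i {f g ls} → (∀ q → q < i → f q ≡ g q) → Left i f ls → Left i g ls
  Left-cong zero eq _ = tt
  Left-cong (suc i) {ls = l ∷ ls} eq (e₁ , e₂) = trans e₁ (eq i ℕP.≤-refl) , Left-cong i (λ q lt → eq q (ℕP.m<n⇒m<1+n lt)) e₂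

  At-cong : ∀ {i f g t} → (∀ q → f q ≡ g q) → At i f t → At i g t
  At-cong {i} eq (e₁ , e₂ , e₃) = Left-cong i (λ q _ → eq q) e₁ , trans e₂ (eq i) , λ n → trans (e₃ n) (eq _)

  At-cur : ∀ {i f t} → At i f t → cur t ≡ f i
  At-cur (_ , eq , _) = eq

  At-write : ∀ {i f t} w → At i f t → At i (f [ i ↦ w ]) (writeT w t)
  At-write {i} {f} w (e₁ , e₂ , e₃) =
    Left-cong i (λ q lt → sym (upd-there f w (ℕP.<⇒≢ lt))) e₁ , sym (upd-here f i w) ,
    λ n → trans (e₃ n) (sym (upd-there f w (λ eq → ℕP.m≢1+m+n i (sym eq))))

  At-R : ∀ {i f t} → At i f t → At (suc i) f (moveT Move.R t)
  At-R {i} {f} {_ , _ , []} (e₁ , e₂ , e₃) = (e₂ , e₁) , trans (e₃ 0) (cong f (ℕP.+-identityʳ (suc i))) , λ n → trans (e₃ (suc n)) (cong f (ℕP.+-suc (suc i) n))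
  At-R {i} {f} {_ , _ , r ∷ rs} (e₁ , e₂ , e₃) = (e₂ , e₁) , trans (e₃ 0) (cong f (ℕP.+-identityʳ (suc i))) , λ n → trans (e₃ (suc n)) (cong f (ℕP.+-suc (suc i) n))

  At-L : ∀ {i f t} → At (suc i) f t → At i f (moveT Move.L t)
  At-L {i} {f} {l ∷ ls , _ , rs} ((e₀ , e₁) , e₂ , e₃) = e₁ , e₀ , λ
    { zero → trans e₂ (cong f (sym (ℕP.+-identityʳ (suc i)))) ; (suc n) → trans (e₃ n) (cong f (sym (ℕP.+-suc (suc i) n))) }

  scanR-run : ∀ {j} k {i f t} → At i f t → (∀ q → q < k → markOf j (f (i + q)) ≡ false) → markOf j (f (i + k)) ≡ true →
              ∃ λ t′ → Runs (scanR j) tt t (suc k) tt t′ × At (i + k) f t′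
  scanR-run {j} zero {i} {f} {t} at un mk = _ , done eq , subst (λ z → At z f t) (sym (ℕP.+-identityʳ i)) at
    where eq : trans′ (scanR j) tt (cur t) ≡ (inj₂ tt , cur t , Move.S)
          eq rewrite At-cur {i} {f} {t} at | trans (cong (markOf j ∘ f) (sym (ℕP.+-identityʳ i)) ) mk = refl
  scanR-run {j} (suc k) {i} {f} {t} at un mk =
    let (t′ , r , at′) = scanR-run k {suc i} {f} {moveT Move.R t} (At-R {i} {f} {t} at)
                           (λ q lt → trans (cong (markOf j ∘ f) (sym (ℕP.+-suc i q))) (un (suc q) (s≤s lt)))
                           (trans (cong (markOf j ∘ f) (sym (ℕP.+-suc i k))) mk)
    in t′ , more eq r , subst (λ z → At z f t′) (sym (ℕP.+-suc i k)) at′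
    where eq : trans′ (scanR j) tt (cur t) ≡ (inj₁ tt , cur t , Move.R)
          eq rewrite At-cur {i} {f} {t} at | trans (cong (markOf j ∘ f) (sym (ℕP.+-identityʳ i))) (un 0 (s≤s z≤n)) = refl

  scanHome-run : ∀ {E} {x : E} i {f t} → At i f t → (∀ q → homeOf (f q) ≡ (q ≡ᵇ 0)) →
                 ∃ λ t′ → Runs (scanHome x) tt t (suc i) x t′ × At 0 f t′
  scanHome-run {x = x} zero {f} {t} at hm = _ , done eq , at
    where eq : trans′ (scanHome x) tt (cur t) ≡ (inj₂ x , cur t , Move.S)
          eq rewrite At-cur {0} {f} {t} at | hm 0 = refl
  scanHome-run {x = x} (suc i) {f} {t} at hm =
    let (t′ , r , at′) = scanHome-run i {f} {moveT Move.L t} (At-L {i} {f} {t} at) hm in t′ , more eq r , at′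
    where eq : trans′ (scanHome x) tt (cur t) ≡ (inj₁ tt , cur t , Move.L)
          eq rewrite At-cur {suc i} {f} {t} at | hm (suc i) = refl

  module Spec (inp : ℕ → Fin 6) where

    cell : (ℕ → ℕ) → ℕ → Sym
    cell ρ q = inp q , (q ≡ᵇ 0) , marks ρ K q

    -- A Hoare triple on register files with a time bound. The head is on the home cell at both ends
    -- and the tape is arbitrary among those representing the registers, so triples compose without
    -- mention of tapes.
    record Does {E : Set} (F : Frag E) (ρ : ℕ → ℕ) (x : E) (ρ′ : ℕ → ℕ) (b : ℕ) : Set where
      field
        from : ∀ t → At 0 (cell ρ) t → ∃ λ t′ → ∃ λ n → Runs F (entry F) t n x t′ × At 0 (cell ρ′) t′ × n ≤ b
    open Does public

    cell-cong : ∀ {ρ ρ′} → (∀ i → ρ i ≡ ρ′ i) → ∀ q → cell ρ q ≡ cell ρ′ q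
    cell-cong eq q = cong (λ z → inp q , (q ≡ᵇ 0) , z) (marks-cong K q λ i → cong (q ≡ᵇ_) (eq i))

    Does-cong : ∀ {E} {F : Frag E} {ρ ρ₁ x ρ′ ρ₁′ b b′} → (∀ i → ρ₁ i ≡ ρ i) → (∀ i → ρ′ i ≡ ρ₁′ i) → b ≤ b′ →
                Does F ρ x ρ′ b → Does F ρ₁ x ρ₁′ b′
    Does-cong eq₁ eq₂ le d .from t at =
      let (t′ , n , r , at′ , le′) = from d t (At-cong {t = t} (cell-cong eq₁) at)
      in t′ , n , r , At-cong {t = t′} (cell-cong eq₂) at′ , ℕP.≤-trans le′ le

    Does-bind : ∀ {D E} {fd : Finite D} {p₁ : Frag D} {p₂ : D → Frag E} {ρ d ρ₁ x ρ₂ b₁ b₂} →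
                Does p₁ ρ d ρ₁ b₁ → Does (p₂ d) ρ₁ x ρ₂ b₂ → Does (bind fd p₁ p₂) ρ x ρ₂ (b₁ + b₂)
    Does-bind d₁ d₂ .from t at =
      let (t₁ , n₁ , r₁ , at₁ , le₁) = from d₁ t at
          (t₂ , n₂ , r₂ , at₂ , le₂) = from d₂ t₁ at₁
      in t₂ , n₁ + n₂ , run-bind r₁ r₂ , at₂ , ℕP.+-mono-≤ le₁ le₂

    Does-act : ∀ {E} {g : Sym → E} {ρ x} → g (cell ρ 0) ≡ x → Does (act λ a → g a , a , Move.S) ρ x ρ 1
    Does-act {g = g} {ρ} {x} eq .from t at = t , 1 , done {w = cur t} {mv = Move.S} (cong (λ z → inj₂ z , cur t , Move.S) (trans (cong g (At-cur {0} {cell ρ} {t} at)) eq)) , at , ℕP.≤-refl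

    Does-ret : ∀ {E} {x : E} {ρ} → Does (ret x) ρ x ρ 1
    Does-ret {x = x} = Does-act {g = λ _ → x} refl

    Does-isZero : ∀ {j ρ b} → j < K → (0 ≡ᵇ ρ j) ≡ b → Does (isZero j) ρ b ρ 1
    Does-isZero {ρ = ρ} lt eq = Does-act (trans (getMark-marks ρ 0 lt) eq)

    scanTo : ∀ {j} ρ {t} → j < K → At 0 (cell ρ) t → ∃ λ t′ → Runs (scanR j) tt t (suc (ρ j)) tt t′ × At (ρ j) (cell ρ) t′
    scanTo {j} ρ lt at = scanR-run (ρ j) at
      (λ q l → trans (getMark-marks ρ q lt) (≡ᵇ-≢ (ℕP.<⇒≢ l))) (trans (getMark-marks ρ (ρ j) lt) (≡ᵇ-refl (ρ j)))

    marks-off : ∀ {ρ j v q} → q ≢ ρ j → q ≢ v → ∀ i → (q ≡ᵇ ρ i) ≡ (q ≡ᵇ (ρ [ j ↦ v ]) i)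
    marks-off {ρ} {j} {v} {q} ne₁ ne₂ i with i ≟ j
    ... | yes refl = trans (≡ᵇ-≢ ne₁) (sym (trans (cong (q ≡ᵇ_) (upd-here ρ i v)) (≡ᵇ-≢ ne₂)))
    ... | no ne = sym (cong (q ≡ᵇ_) (upd-there ρ v ne))

    moved : ∀ ρ j v q → v ≢ ρ j →
            ((cell ρ [ ρ j ↦ withMark j false (cell ρ (ρ j)) ]) [ v ↦ withMark j true (cell ρ v) ]) q ≡ cell (ρ [ j ↦ v ]) q
    moved ρ j v q ne with q ≟ v
    ... | yes refl = trans (upd-here _ q _) (cong (λ z → inp q , (q ≡ᵇ 0) , z) (setMark-marks K j true q
            (trans (cong (q ≡ᵇ_) (upd-here ρ j q)) (≡ᵇ-refl q)) λ i ne′ → cong (q ≡ᵇ_) (sym (upd-there ρ q ne′))))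
    ... | no q≢v with q ≟ ρ j
    ...   | yes refl = trans (upd-there _ _ q≢v) (trans (upd-here _ q _) (cong (λ z → inp q , (q ≡ᵇ 0) , z) (setMark-marks K j false q
            (trans (cong (q ≡ᵇ_) (upd-here ρ j v)) (≡ᵇ-≢ q≢v)) λ i ne′ → cong (q ≡ᵇ_) (sym (upd-there ρ v ne′)))))
    ...   | no q≢ρj = trans (upd-there _ _ q≢v) (trans (upd-there _ _ q≢ρj) (cong (λ z → inp q , (q ≡ᵇ 0) , z) (marks-cong K q (marks-off q≢ρj q≢v))))

    Does-inc : ∀ {j ρ} → j < K → Does (inc j) ρ tt (ρ [ j ↦ suc (ρ j) ]) (2 * ρ j + 5)
    Does-inc {j} {ρ} lt .from t at =
      let (t₁ , r₁ , at₁) = scanTo ρ lt at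
          f = cell ρ
          w₁ = withMark j false (cur t₁)
          t₂ = moveT Move.R (writeT w₁ t₁)
          f₁ = f [ ρ j ↦ w₁ ]
          at₂ = At-R {ρ j} {f₁} {writeT w₁ t₁} (At-write {ρ j} {f} {t₁} w₁ at₁)
          w₂ = withMark j true (cur t₂)
          t₃ = writeT w₂ t₂
          ne : suc (ρ j) ≢ ρ j
          ne = ℕP.1+n≢n
          cu : cur t₂ ≡ cell ρ (suc (ρ j))
          cu = trans (At-cur {suc (ρ j)} {f₁} {t₂} at₂) (upd-there f w₁ ne)
          at₃ = At-cong {suc (ρ j)} {t = t₃} (λ q → trans (cong₂ (λ a b → ((f [ ρ j ↦ withMark j false a ]) [ suc (ρ j) ↦ withMark j true b ]) q)
                                               (At-cur {ρ j} {f} {t₁} at₁) cu) (moved ρ j (suc (ρ j)) q ne))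
                  (At-write {suc (ρ j)} {f₁} {t₂} w₂ at₂)
          (t₄ , r₄ , at₄) = scanHome-run (suc (ρ j)) {t = t₃} at₃ (λ q → refl)
      in t₄ , _ , run-bind r₁ (run-bind (done refl) (run-bind (done refl) r₄)) , at₄ , ℕP.≤-reflexive (arith (ρ j))
      where arith : ∀ n → suc n + (1 + (1 + suc (suc n))) ≡ 2 * n + 5
            arith = ℕS.solve-∀

    Does-dcr : ∀ {j ρ} → j < K → Does (dcr j) ρ tt (ρ [ j ↦ ρ j ∸ 1 ]) (2 * ρ j + 5)
    Does-dcr {j} {ρ} lt .from t at with ρ j in eqρ
    ... | zero =
      let (t₁ , r₁ , at₁) = scanTo ρ lt at
          at₁′ = subst (λ z → At z (cell ρ) t₁) eqρ at₁
          cu = At-cur {0} {cell ρ} {t₁} at₁′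
          w₂ = withMark j true (cur t₁)
          t₃ = writeT w₂ t₁
          at₃ = At-cong {0} {t = t₃} (λ q → fin q cu) (At-write {0} {cell ρ} {t₁} w₂ at₁′)
          (t₄ , r₄ , at₄) = scanHome-run 0 {cell (ρ [ j ↦ 0 ])} {t₃} at₃ (λ q → refl)
      in t₄ , _ , run-bind r₁ (run-bind (done (cong (λ a → inj₂ (proj₁ (br a)) , proj₂ (br a)) cu)) (run-bind (done (cong (λ a → inj₂ tt , withMark j true a , Move.S) (sym cu))) r₄)) , at₄ , le
      where
      br : Sym → ⊤ × Sym × Move
      br a = if homeOf a then (tt , a , Move.S) else (tt , withMark j false a , Move.L)
      le : suc (ρ j) + 3 ≤ 5
      le rewrite eqρ = ℕP.n≤1+n 4
      fin : ∀ q {a} → a ≡ cell ρ 0 → (cell ρ [ 0 ↦ withMark j true a ]) q ≡ cell (ρ [ j ↦ 0 ]) q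
      fin zero refl = trans (upd-here (cell ρ) 0 _) (cong (λ z → inp 0 , true , z) (setMark-marks K j true 0 (trans (cong (0 ≡ᵇ_) (upd-here ρ j 0)) refl) λ i ne → cong (0 ≡ᵇ_) (sym (upd-there ρ 0 ne))))
      fin (suc q) refl = trans (upd-there (cell ρ) _ λ ()) (cong (λ z → inp (suc q) , false , z) (marks-cong K (suc q) (marks-off (λ eq → ℕP.1+n≢0 (trans eq eqρ)) λ ())))
    ... | suc k =
      let (t₁ , r₁ , at₁) = scanTo ρ lt at
          f = cell ρ
          at₁′ = subst (λ z → At z f t₁) eqρ at₁
          cu₁ = At-cur {suc k} {f} {t₁} at₁′
          w₁ = withMark j false (cell ρ (suc k))
          t₂ = moveT Move.L (writeT w₁ t₁)
          f₁ = f [ suc k ↦ w₁ ]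
          at₂ = At-L {k} {f₁} {writeT w₁ t₁} (At-write {suc k} {f} {t₁} w₁ at₁′)
          w₂ = withMark j true (cur t₂)
          t₃ = writeT w₂ t₂
          cu : cur t₂ ≡ cell ρ k
          cu = trans (At-cur {k} {f₁} {t₂} at₂) (upd-there f w₁ (λ eq → ℕP.1+n≢n (sym eq)))
          at₃ = At-cong {k} {t = t₃} (λ q → trans (cong₂ (λ a b → ((f [ a ↦ withMark j false (cell ρ a) ]) [ k ↦ withMark j true b ]) q)
                                               (sym eqρ) cu) (moved ρ j k q (λ eq → ℕP.1+n≢n (sym (trans eq eqρ)))))
                  (At-write {k} {f₁} {t₂} w₂ at₂)
          (t₄ , r₄ , at₄) = scanHome-run k {t = t₃} at₃ (λ q → refl)
      in t₄ , _ , run-bind r₁ (run-bind (done (cong (λ a → inj₂ (proj₁ (br a)) , proj₂ (br a)) cu₁)) (run-bind (done refl) r₄)) , at₄ , le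
      where
      br : Sym → ⊤ × Sym × Move
      br a = if homeOf a then (tt , a , Move.S) else (tt , withMark j false a , Move.L)
      arith : ∀ n → suc (suc n) + (1 + (1 + suc n)) + 2 ≡ 2 * suc n + 5
      arith = ℕS.solve-∀
      le : suc (ρ j) + (1 + (1 + suc k)) ≤ 2 * suc k + 5
      le rewrite eqρ = ℕP.≤-trans (ℕP.m≤m+n _ 2) (ℕP.≤-reflexive (arith k))

    Does-read : ∀ {j ρ} → j < K → Does (readAt j) ρ (inp (ρ j)) ρ (2 * ρ j + 5)
    Does-read {j} {ρ} lt .from t at =
      let (t₁ , r₁ , at₁) = scanTo ρ lt at
          (t₂ , r₂ , at₂) = scanHome-run {x = inp (ρ j)} (ρ j) {t = t₁} at₁ (λ q → refl)
      in t₂ , _ , run-bind r₁ (run-bind (done {w = cur t₁} {mv = Move.S} (cong (λ a → inj₂ (proj₁ a) , cur t₁ , Move.S) (At-cur {ρ j} {cell ρ} {t₁} at₁))) r₂) , at₂ ,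
         ℕP.≤-trans (ℕP.m≤m+n _ 2) (ℕP.≤-reflexive (arith (ρ j)))
      where arith : ∀ n → suc n + (1 + suc n) + 2 ≡ 2 * n + 5
            arith = ℕS.solve-∀

    -- The invariant `I k` is the register file when the counter reads k; the body starts with the
    -- counter already lowered. A round costs 1 for the test, 2V + 5 for the decrement, `tb` for the
    -- body and 1 for `ret nothing`; leaving the loop costs 2.
    Does-forDown : ∀ {j body tb V} (I : ℕ → ℕ → ℕ) v → j < K → v ≤ V → (∀ k → I k j ≡ k) →
                   (∀ k → k < v → Does body (I (suc k) [ j ↦ k ]) tt (I k) tb) →
                   Does (forDown j body) (I v) tt (I 0) (v * (2 * V + 7 + tb) + 2)
    Does-forDown I zero lt le hj hb .from t at =
      let (t₁ , n , r , at₁ , le₁) = from (Does-bind {fd = Bool-finite} (Does-isZero {ρ = I 0} lt (cong (0 ≡ᵇ_) (hj 0))) (Does-ret {ρ = I 0})) t at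
      in t₁ , n , run-exit r , at₁ , le₁
    Does-forDown {j} {body} {tb} {V} I (suc v) lt le hj hb .from t at =
      let (t₁ , n , r , at₁ , le₁) = from (Does-bind {fd = Bool-finite} (Does-isZero {ρ = I (suc v)} lt (cong (0 ≡ᵇ_) (hj (suc v))))
             (Does-bind {fd = ⊤-finite} (Does-cong {F = dcr j} (λ _ → refl) (λ i → cong (λ z → (I (suc v) [ j ↦ z ∸ 1 ]) i) (hj (suc v)))
                                           (ℕP.+-monoˡ-≤ 5 (ℕP.*-monoʳ-≤ 2 (ℕP.≤-trans (ℕP.≤-reflexive (hj (suc v))) le))) (Does-dcr lt))
               (Does-bind {fd = ⊤-finite} (hb v ℕP.≤-refl) Does-ret))) t at
          (t₂ , n₂ , r₂ , at₂ , le₂) = from (Does-forDown I v lt (ℕP.≤-trans (ℕP.n≤1+n v) le) hj (λ k l → hb k (ℕP.m<n⇒m<1+n l))) t₁ at₁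
      in t₂ , n + n₂ , run-again r r₂ , at₂ , ℕP.≤-trans (ℕP.+-mono-≤ le₁ le₂) (ℕP.≤-reflexive (arith v V tb))
      where arith : ∀ v V tb → (1 + (2 * V + 5 + (tb + 1))) + (v * (2 * V + 7 + tb) + 2) ≡ suc v * (2 * V + 7 + tb) + 2
            arith = ℕS.solve-∀

-- Polynomial bounds: closed under composition, because a sum expression is evaluated in an environment holding
-- values that are themselves only polynomially bounded.
infixl 6 _:+_
infixl 7 _:*_
infixr 8 _:∘_
data PB : Set where
  :X    : PB
  :C    : ℕ → PB
  _:+_ _:*_ _:∘_ : PB → PB → PB

⟦_⟧ᵇ : PB → ℕ → ℕ
⟦ :X ⟧ᵇ      n = n
⟦ :C k ⟧ᵇ    n = k
⟦ a :+ b ⟧ᵇ n = ⟦ a ⟧ᵇ n + ⟦ b ⟧ᵇ n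
⟦ a :* b ⟧ᵇ n = ⟦ a ⟧ᵇ n * ⟦ b ⟧ᵇ n
⟦ a :∘ b ⟧ᵇ n = ⟦ a ⟧ᵇ (⟦ b ⟧ᵇ n)

-- Exponents to the base n + 2. A constant uses k ≤ 2^k; a sum spends one further factor n + 2 ≥ 2;
-- a composition spends two, so that the inner bound plus 2 is again at most a power of n + 2.
deg : PB → ℕ
deg :X        = 1
deg (:C k)    = k
deg (a :+ b) = deg a + deg b + 1
deg (a :* b) = deg a + deg b
deg (a :∘ b) = (deg b + 2) * deg a

pow-mono : ∀ n {i j} → i ≤ j → timeBound i n ≤ timeBound j n
pow-mono n le rewrite ℕP.+-comm n 2 = ℕP.^-monoʳ-≤ (2 + n) le

1≤pow : ∀ n i → 1 ≤ timeBound i n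
1≤pow n i = pow-mono n (z≤n {i})

n≤2^n : ∀ k n → k ≤ timeBound k n
n≤2^n zero    n = z≤n
n≤2^n (suc k) n = begin
  suc k                                  ≤⟨ ℕP.+-mono-≤ (1≤pow n k) (n≤2^n k n) ⟩
  timeBound k n + timeBound k n          ≡⟨ cong (timeBound k n +_) (sym (ℕP.+-identityʳ _)) ⟩
  2 * timeBound k n                      ≤⟨ ℕP.*-monoˡ-≤ (timeBound k n) (ℕP.m≤n+m 2 n) ⟩
  (n + 2) * timeBound k n                ∎
  where open ℕP.≤-Reasoning

PB-pow : ∀ b n → ⟦ b ⟧ᵇ n ≤ timeBound (deg b) n
PB-pow :X n = ℕP.≤-trans (ℕP.m≤m+n n 2) (ℕP.≤-reflexive (sym (ℕP.*-identityʳ _)))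
PB-pow (:C k) n = n≤2^n k n
PB-pow (a :+ b) n = begin
  ⟦ a ⟧ᵇ n + ⟦ b ⟧ᵇ n ≤⟨ ℕP.+-mono-≤ (ℕP.≤-trans (PB-pow a n) (pow-mono n (ℕP.m≤m+n (deg a) (deg b)))) (ℕP.≤-trans (PB-pow b n) (pow-mono n (ℕP.m≤n+m (deg b) (deg a)))) ⟩
  t + t               ≡⟨ cong (t +_) (sym (ℕP.+-identityʳ _)) ⟩
  2 * t               ≤⟨ ℕP.*-monoˡ-≤ t (ℕP.m≤n+m 2 n) ⟩
  timeBound (suc (deg a + deg b)) n ≡⟨ cong (λ z → timeBound z n) (ℕP.+-comm 1 (deg a + deg b)) ⟩
  timeBound (deg a + deg b + 1) n ∎
  where open ℕP.≤-Reasoning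
        t = timeBound (deg a + deg b) n
PB-pow (a :* b) n = ℕP.≤-trans (ℕP.*-mono-≤ (PB-pow a n) (PB-pow b n)) (ℕP.≤-reflexive (sym (ℕP.^-distribˡ-+-* (n + 2) (deg a) (deg b))))
PB-pow (a :∘ b) n = begin
  ⟦ a ⟧ᵇ (⟦ b ⟧ᵇ n)                     ≤⟨ PB-pow a _ ⟩
  (⟦ b ⟧ᵇ n + 2) ^ deg a                ≤⟨ ℕP.^-monoˡ-≤ (deg a) (ℕP.+-monoˡ-≤ 2 (PB-pow b n)) ⟩
  (u + 2) ^ deg a                       ≤⟨ ℕP.^-monoˡ-≤ (deg a) le ⟩
  (timeBound (deg b + 2) n) ^ deg a     ≡⟨ ℕP.^-*-assoc (n + 2) (deg b + 2) (deg a) ⟩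
  timeBound ((deg b + 2) * deg a) n     ∎
  where
  open ℕP.≤-Reasoning
  u = timeBound (deg b) n
  arith : ∀ u → u + (u + (u + (u + 0))) ≡ u * 4
  arith = ℕS.solve-∀
  le : u + 2 ≤ timeBound (deg b + 2) n
  le = begin
    u + 2             ≤⟨ ℕP.+-monoʳ-≤ u (ℕP.+-mono-≤ (1≤pow n (deg b)) (ℕP.+-mono-≤ (1≤pow n (deg b)) z≤n)) ⟩
    u + (u + (u + (u + 0))) ≡⟨ arith u ⟩
    u * 4             ≤⟨ ℕP.*-monoʳ-≤ u (ℕP.*-mono-≤ (ℕP.m≤n+m 2 n) (ℕP.≤-trans (ℕP.m≤n+m 2 n) (ℕP.≤-reflexive (sym (ℕP.*-identityʳ (n + 2)))))) ⟩
    u * timeBound 2 n ≡⟨ sym (ℕP.^-distribˡ-+-* (n + 2) (deg b) 2) ⟩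
    timeBound (deg b + 2) n ∎

-- Bounded-sum expressions and their resource bounds

sumTo : ℕ → (ℕ → ℕ) → ℕ
sumTo zero    f = 0
sumTo (suc n) f = f 0 + sumTo n (f ∘ suc)

sumTo-cong : ∀ n {f g : ℕ → ℕ} → (∀ i → i < n → f i ≡ g i) → sumTo n f ≡ sumTo n g
sumTo-cong zero    eq = refl
sumTo-cong (suc n) eq = cong₂ _+_ (eq 0 (s≤s z≤n)) (sumTo-cong n λ i lt → eq (suc i) (s≤s lt))

sumTo-≤ : ∀ n {f} b → (∀ i → i < n → f i ≤ b) → sumTo n f ≤ n * b
sumTo-≤ zero    b le = z≤n
sumTo-≤ (suc n) b le = ℕP.+-mono-≤ (le 0 (s≤s z≤n)) (sumTo-≤ n b λ i lt → le (suc i) (s≤s lt))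

infixl 6 _⊹_ _⊸_
-- Bounded sums together with truncated subtraction give products, comparisons and bounded
-- quantifiers, while values and running times stay polynomial in the largest environment entry.
data Expr : ℕ → Set where
  var : ∀ {k} → Fin k → Expr k
  𝟙 : ∀ {k} → Expr k
  _⊹_ _⊸_ : ∀ {k} → Expr k → Expr k → Expr k
  sumE : ∀ {k} → Expr k → Expr (suc k) → Expr k
  symE : ∀ {k} → Fin 6 → Expr k → Expr k

symTest : Fin 6 → Fin 6 → ℕ
symTest c x = if toℕ c ≡ᵇ toℕ x then 1 else 0

eval : (ℕ → Fin 6) → ∀ {k} → Expr k → Vec ℕ k → ℕ
eval inp (var i)    env = V.lookup env i
eval inp 𝟙        env = 1
eval inp (a ⊹ b)    env = eval inp a env + eval inp b env
eval inp (a ⊸ b)    env = eval inp a env ∸ eval inp b env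
eval inp (sumE a b) env = sumTo (eval inp a env) (λ i → eval inp b (i V.∷ env))
eval inp (symE c a) env = symTest c (inp (eval inp a env))

-- A supply of scratch registers that suffices for the compiled code. Adding the depths of the
-- operands instead of taking the maximum only enlarges it.
depth : ∀ {k} → Expr k → ℕ
depth (var _)    = 1
depth 𝟙        = 0
depth (a ⊹ b)    = depth a + depth b
depth (a ⊸ b)    = 1 + (depth a + depth b)
depth (sumE a b) = 1 + (depth a + depth b)
depth (symE _ a) = 1 + depth a

-- Every bound is a function of a common bound n on the registers at the start. The second operand
-- of a sum runs after the target register has grown, so its time is composed with `:X :+ valB a`; a
-- loop body also sees the index, and a target that may already hold the whole sum.
valB timeB : ∀ {k} → Expr k → PB
valB (var _)    = :X
valB 𝟙        = :C 1
valB (a ⊹ b)    = valB a :+ valB b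
valB (a ⊸ b)    = valB a
valB (sumE a b) = valB a :* (valB b :∘ (:X :+ valB a))
valB (symE _ _) = :C 1

opB : PB → PB
opB v = :C 2 :* v :+ :C 5

downB : PB → PB → PB
downB v b = v :* (:C 2 :* v :+ :C 7 :+ b) :+ :C 2

timeB (var _)    = downB :X (opB :X :+ opB (:X :+ :X)) :+ downB :X (opB :X)
timeB 𝟙        = opB :X
timeB (a ⊹ b)    = timeB a :+ timeB b :∘ (:X :+ valB a)
timeB (a ⊸ b)    = timeB a :+ (timeB b :∘ (:X :+ valB a) :+ downB (valB a) (opB (:X :+ valB a)))
timeB (sumE a b) = timeB a :+ downB (valB a) (timeB b :∘ (:X :+ valB a :+ valB (sumE a b)))
timeB (symE _ a) = timeB a :+ (opB (valB a) :+ opB :X :+ downB (valB a) (:C 1))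

module _ (inp : ℕ → Fin 6) where
  eval-≤ : ∀ {k} (e : Expr k) env n → (∀ i → V.lookup env i ≤ n) → eval inp e env ≤ ⟦ valB e ⟧ᵇ n
  eval-≤ (var i) env n le = le i
  eval-≤ 𝟙 env n le = ℕP.≤-refl
  eval-≤ (a ⊹ b) env n le = ℕP.+-mono-≤ (eval-≤ a env n le) (eval-≤ b env n le)
  eval-≤ (a ⊸ b) env n le = ℕP.≤-trans (ℕP.m∸n≤m _ (eval inp b env)) (eval-≤ a env n le)
  eval-≤ (sumE a b) env n le = ℕP.≤-trans
    (sumTo-≤ (eval inp a env) (⟦ valB b ⟧ᵇ (n + ⟦ valB a ⟧ᵇ n)) λ i lt → eval-≤ b (i V.∷ env) _ λ
      { F.zero → ℕP.≤-trans (ℕP.<⇒≤ lt) (ℕP.≤-trans (eval-≤ a env n le) (ℕP.m≤n+m _ n))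
      ; (F.suc j) → ℕP.≤-trans (le j) (ℕP.m≤m+n n _) })
    (ℕP.*-monoˡ-≤ _ (eval-≤ a env n le))
  eval-≤ (symE c a) env n le with toℕ c ≡ᵇ toℕ (inp (eval inp a env))
  ... | true  = ℕP.≤-refl
  ... | false = z≤n

-- Addition and truncated subtraction are treated alike because both are iterations of a single step
-- (`op-op`), which is what the loop invariants rest on.
op : Bool → ℕ → ℕ → ℕ
op true  x n = x + n
op false x n = x ∸ n

op-0 : ∀ a x → op a x 0 ≡ x
op-0 true  x = ℕP.+-identityʳ x
op-0 false x = refl

op-op : ∀ a x i j → op a (op a x i) j ≡ op a x (i + j)
op-op true  x i j = ℕP.+-assoc x i j
op-op false x i j = ℕP.∸-+-assoc x i j

op-≤ : ∀ a x i → op a x i ≤ x + i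
op-≤ true  x i = ℕP.≤-refl
op-≤ false x i = ℕP.≤-trans (ℕP.m∸n≤m x i) (ℕP.m≤m+n x i)

map-upd : ∀ {k} (f : ℕ → ℕ) {j v} (η : Vec ℕ k) → (∀ i → V.lookup η i ≢ j) → V.map (f [ j ↦ v ]) η ≡ V.map f η
map-upd f V.[] ne = refl
map-upd f (x V.∷ η) ne = cong₂ V._∷_ (upd-there f _ (ne F.zero)) (map-upd f η (ne ∘ F.suc))

-- Loops count downwards: when the counter reads k, the terms with indices k, ..., v - 1 have been
-- accumulated.
tailSum : ℕ → (ℕ → ℕ) → ℕ → ℕ
tailSum v f k = sumTo (v ∸ k) (λ i → f (k + i))

tailSum-step : ∀ {v} f {k} → k < v → tailSum v f (suc k) + f k ≡ tailSum v f k
tailSum-step {v} f {k} lt rewrite ℕP.+-∸-assoc 1 lt =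
  trans (ℕP.+-comm _ (f k)) (cong₂ _+_ (cong f (sym (ℕP.+-identityʳ k))) (sumTo-cong (v ∸ suc k) λ i _ → cong f (sym (ℕP.+-suc k i))))

tailSum-≤ : ∀ v f b k → (∀ i → i < v → f i ≤ b) → tailSum v f k ≤ v * b
tailSum-≤ v f b k le = ℕP.≤-trans (sumTo-≤ (v ∸ k) b λ i lt → le (k + i) (lt′ i lt)) (ℕP.*-monoˡ-≤ b (ℕP.m∸n≤m v k))
  where lt′ : ∀ i → i < v ∸ k → k + i < v
        lt′ i lt with k ≤? v
        ... | yes le′ = ℕP.<-≤-trans (ℕP.+-monoʳ-< k lt) (ℕP.≤-reflexive (ℕP.m+[n∸m]≡n le′))
        ... | no nle rewrite ℕP.m≤n⇒m∸n≡0 (ℕP.<⇒≤ (ℕP.≰⇒> nle)) = ⊥-elim (ℕP.n≮0 lt)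

-- Compilation of expressions into register programs

module Compile (K : ℕ) where
  open Machine K
  open Ops K

  stepR : Bool → ℕ → Frag ⊤
  stepR true  r = inc r
  stepR false r = dcr r

  -- Performs the increment (or truncated decrement) of register r as often as the value of the
  -- expression says; registers from z on are scratch, zero before and after.
  comp : ∀ {k} → Expr k → Vec ℕ k → Bool → ℕ → ℕ → Frag ⊤
  comp (var i)    η a r z = forDown (V.lookup η i) (inc z ⨟ stepR a r) ⨟ forDown z (inc (V.lookup η i))
  comp 𝟙        η a r z = stepR a r
  comp (x ⊹ y)    η a r z = comp x η a r z ⨟ comp y η a r z
  comp (x ⊸ y)    η a r z = comp x η true z (suc z) ⨟ comp y η false z (suc z) ⨟ forDown z (stepR a r)
  comp (sumE x y) η a r z = comp x η true z (suc z) ⨟ forDown z (comp y (z V.∷ η) a r (suc z))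
  comp (symE c x) η a r z = comp x η true z (suc z) ⨟
    bind (Fin-finite 6) (readAt z) (λ d → (if toℕ c ≡ᵇ toℕ d then stepR a r else ret tt) ⨟ forDown z (ret tt))

  module Correct (inp : ℕ → Fin 6) where
    open Spec inp

    Does-step : ∀ {r ρ n} a → r < K → ρ r ≤ n → Does (stepR a r) ρ tt (ρ [ r ↦ op a (ρ r) 1 ]) (2 * n + 5)
    Does-step {r} {ρ} true  lt le = Does-cong (λ _ → refl) (upd-cong (λ _ → refl) (ℕP.+-comm 1 (ρ r))) (ℕP.+-monoˡ-≤ 5 (ℕP.*-monoʳ-≤ 2 le)) (Does-inc lt)
    Does-step {r} {ρ} false lt le = Does-cong (λ _ → refl) (λ _ → refl) (ℕP.+-monoˡ-≤ 5 (ℕP.*-monoʳ-≤ 2 le)) (Does-dcr lt)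

    infixr 5 _then_
    _then_ : ∀ {E} {p₁ : Frag ⊤} {p₂ : Frag E} {ρ ρ₁ x ρ₂ b₁ b₂} → Does p₁ ρ tt ρ₁ b₁ → Does p₂ ρ₁ x ρ₂ b₂ → Does (p₁ ⨟ p₂) ρ x ρ₂ (b₁ + b₂)
    d₁ then d₂ = Does-bind d₁ d₂

    -- The target r lies below the scratch area and is not the register of a variable, so it may
    -- change while the environment is still being read.
    Ready : ∀ {k} → Vec ℕ k → ℕ → ℕ → (ℕ → ℕ) → ℕ → Set
    Ready η r z ρ n = r < z × (∀ i → V.lookup η i < z × V.lookup η i ≢ r) × (∀ j → z ≤ j → ρ j ≡ 0) × (∀ j → ρ j ≤ n)

    loop-step : ∀ {r z ρ n V} a v → r < z → z < K → ρ r ≤ n → v ≤ V → ρ z ≡ v →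
                Does (forDown z (stepR a r)) ρ tt (ρ [ z ↦ 0 ] [ r ↦ op a (ρ r) v ]) (V * (2 * V + 7 + (2 * (n + V) + 5)) + 2)
    loop-step {r} {z} {ρ} {n} {V} a v r<z z<K le v≤V ρz = Does-cong start (λ _ → refl) (ℕP.+-monoˡ-≤ 2 (ℕP.*-monoˡ-≤ _ v≤V))
      (Does-forDown I v z<K v≤V (λ k → trans (upd-there (ρ [ z ↦ k ]) _ z≢r) (upd-here ρ z k)) body)
      where
      z≢r = λ eq → ℕP.<⇒≢ r<z (sym eq)
      I : ℕ → ℕ → ℕ
      I k = ρ [ z ↦ k ] [ r ↦ op a (ρ r) (v ∸ k) ]
      start : ∀ i → ρ i ≡ I v i
      start i = sym (trans (upd-cong (upd-id ρ ρz) (trans (cong (op a (ρ r)) (ℕP.n∸n≡0 v)) (op-0 a (ρ r))) i) (upd-id ρ refl i))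
      body : ∀ k → k < v → Does (stepR a r) (I (suc k) [ z ↦ k ]) tt (I k) (2 * (n + V) + 5)
      body k k<v = Does-cong (λ _ → refl) (λ i → trans (upd-cong {f = I (suc k) [ z ↦ k ]} (λ i → upd-comm (ρ [ z ↦ suc k ]) (ℕP.<⇒≢ r<z) i) refl i)
                                            (trans (upd-shadow (ρ [ z ↦ suc k ] [ z ↦ k ]) i) (upd-cong (upd-shadow ρ) val i))) ℕP.≤-refl
                     (Does-step a (ℕP.<-trans r<z z<K) rb)
        where
        cr : (I (suc k) [ z ↦ k ]) r ≡ op a (ρ r) (v ∸ suc k)
        cr = trans (upd-there (I (suc k)) k (ℕP.<⇒≢ r<z)) (upd-here _ r _)
        rb : (I (suc k) [ z ↦ k ]) r ≤ n + V
        rb = ℕP.≤-trans (ℕP.≤-reflexive cr) (ℕP.≤-trans (op-≤ a _ _) (ℕP.+-mono-≤ le (ℕP.≤-trans (ℕP.m∸n≤m v (suc k)) v≤V)))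
        val : op a ((I (suc k) [ z ↦ k ]) r) 1 ≡ op a (ρ r) (v ∸ k)
        val = trans (cong (λ x → op a x 1) cr) (trans (op-op a (ρ r) (v ∸ suc k) 1) (cong (op a (ρ r)) (trans (ℕP.+-comm _ 1) (sym (ℕP.+-∸-assoc 1 k<v)))))

    comp-correct : ∀ {k} (e : Expr k) (η : Vec ℕ k) a r z ρ n → z + depth e ≤ K → Ready η r z ρ n →
                   Does (comp e η a r z) ρ tt (ρ [ r ↦ op a (ρ r) (eval inp e (V.map ρ η)) ]) (⟦ timeB e ⟧ᵇ n)

    -- With the zero register z as target, adding a value is assigning it; the scratch area that
    -- remains starts at z + 1.
    comp-fresh : ∀ {k} (e : Expr k) (η : Vec ℕ k) r z ρ n → suc z + depth e ≤ K → Ready η r z ρ n →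
                 Does (comp e η true z (suc z)) ρ tt (ρ [ z ↦ eval inp e (V.map ρ η) ]) (⟦ timeB e ⟧ᵇ n)
    comp-fresh e η r z ρ n dep (r<z , hη , hz , le) =
      Does-cong (λ _ → refl) (upd-cong (λ _ → refl) (cong (_+ eval inp e (V.map ρ η)) (hz z ℕP.≤-refl))) ℕP.≤-refl
        (comp-correct e η true z (suc z) ρ n dep
          (ℕP.≤-refl , (λ i → ℕP.m<n⇒m<1+n (proj₁ (hη i)) , ℕP.<⇒≢ (proj₁ (hη i))) , (λ j l → hz j (ℕP.<⇒≤ l)) , le))

    env-≤ : ∀ {k} (ρ : ℕ → ℕ) (η : Vec ℕ k) {n} → (∀ j → ρ j ≤ n) → ∀ i → V.lookup (V.map ρ η) i ≤ n
    env-≤ ρ η le i = ℕP.≤-trans (ℕP.≤-reflexive (VP.lookup-map i ρ η)) (le _)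

    comp-correct (var i) η a r z ρ n dep (r<z , hη , hz , le) =
      Does-cong (λ _ → refl) final ℕP.≤-refl (d₁ then d₂)
      where
      x = V.lookup η i
      v = ρ x
      x<z = proj₁ (hη i)
      x≢r = proj₂ (hη i)
      x≢z = ℕP.<⇒≢ x<z
      r≢z = ℕP.<⇒≢ r<z
      z<K : z < K
      z<K = ℕP.≤-trans (ℕP.≤-reflexive (ℕP.+-comm 1 z)) dep
      -- Reading a register by counting it down destroys it. The first loop moves x into z while
      -- acting on r, the second moves z back into x.
      I₁ I₂ : ℕ → ℕ → ℕ
      I₁ k = ρ [ x ↦ k ] [ z ↦ v ∸ k ] [ r ↦ op a (ρ r) (v ∸ k) ]
      I₂ k = ρ [ r ↦ op a (ρ r) v ] [ x ↦ v ∸ k ] [ z ↦ k ]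
      body₁ : ∀ k → k < v → Does (inc z ⨟ stepR a r) (I₁ (suc k) [ x ↦ k ]) tt (I₁ k) (2 * n + 5 + (2 * (n + n) + 5))
      body₁ k k<v = Does-cong (λ _ → refl) post ℕP.≤-refl
          (Does-cong (λ _ → refl) (λ _ → refl) (ℕP.+-monoˡ-≤ 5 (ℕP.*-monoʳ-≤ 2 zb)) (Does-inc z<K) then Does-step a (ℕP.<-trans r<z z<K) rb)
        where
        pre = I₁ (suc k) [ x ↦ k ]
        preZ : pre z ≡ v ∸ suc k
        preZ = trans (upd-there (I₁ (suc k)) k (x≢z ∘ sym)) (trans (upd-there (ρ [ x ↦ suc k ] [ z ↦ v ∸ suc k ]) _ (r≢z ∘ sym)) (upd-here _ z _))
        preR : (pre [ z ↦ suc (pre z) ]) r ≡ op a (ρ r) (v ∸ suc k)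
        preR = trans (upd-there pre _ r≢z) (trans (upd-there (I₁ (suc k)) k (x≢r ∘ sym)) (upd-here _ r _))
        zb : pre z ≤ n
        zb = ℕP.≤-trans (ℕP.≤-reflexive preZ) (ℕP.≤-trans (ℕP.m∸n≤m v (suc k)) (le x))
        rb : (pre [ z ↦ suc (pre z) ]) r ≤ n + n
        rb = ℕP.≤-trans (ℕP.≤-reflexive preR) (ℕP.≤-trans (op-≤ a _ _) (ℕP.+-mono-≤ (le r) (ℕP.≤-trans (ℕP.m∸n≤m v (suc k)) (le x))))
        sv : suc (v ∸ suc k) ≡ v ∸ k
        sv = sym (ℕP.+-∸-assoc 1 k<v)
        valR : op a ((pre [ z ↦ suc (pre z) ]) r) 1 ≡ op a (ρ r) (v ∸ k)
        valR = trans (cong (λ y → op a y 1) preR) (trans (op-op a (ρ r) (v ∸ suc k) 1) (cong (op a (ρ r)) (trans (ℕP.+-comm _ 1) sv)))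
        valZ : suc (pre z) ≡ v ∸ k
        valZ = trans (cong suc preZ) sv
        post : ∀ j → (pre [ z ↦ suc (pre z) ] [ r ↦ op a ((pre [ z ↦ suc (pre z) ]) r) 1 ]) j ≡ I₁ k j
        post j rewrite valR | valZ = upd-shadow₃ ρ j
      body₂ : ∀ k → k < v → Does (inc x) (I₂ (suc k) [ z ↦ k ]) tt (I₂ k) (2 * n + 5)
      body₂ k k<v = Does-cong (λ _ → refl) post (ℕP.+-monoˡ-≤ 5 (ℕP.*-monoʳ-≤ 2 xb)) (Does-inc (ℕP.<-trans x<z z<K))
        where
        pre = I₂ (suc k) [ z ↦ k ]
        preX : pre x ≡ v ∸ suc k
        preX = trans (upd-there (I₂ (suc k)) k x≢z) (trans (upd-there (ρ [ r ↦ _ ] [ x ↦ v ∸ suc k ]) _ x≢z) (upd-here _ x _))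
        xb : pre x ≤ n
        xb = ℕP.≤-trans (ℕP.≤-reflexive preX) (ℕP.≤-trans (ℕP.m∸n≤m v (suc k)) (le x))
        post : ∀ j → (pre [ x ↦ suc (pre x) ]) j ≡ I₂ k j
        post j = trans (upd-comm (I₂ (suc k)) (x≢z ∘ sym) j)
          (trans (upd-cong {f = I₂ (suc k) [ x ↦ suc (pre x) ]} (upd-comm _ (x≢z ∘ sym)) refl j)
          (trans (upd-shadow (ρ [ r ↦ _ ] [ x ↦ v ∸ suc k ] [ x ↦ suc (pre x) ]) j)
            (upd-cong (λ j → trans (upd-shadow (ρ [ r ↦ _ ]) j) (upd-cong (λ _ → refl) (trans (cong suc preX) (sym (ℕP.+-∸-assoc 1 k<v))) j)) refl j)))
      d₁ : Does (forDown x (inc z ⨟ stepR a r)) ρ tt (I₂ v) _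
      d₁ = Does-cong start mid (ℕP.+-monoˡ-≤ 2 (ℕP.*-monoˡ-≤ _ (le x)))
             (Does-forDown I₁ v (ℕP.<-trans x<z z<K) (le x)
               (λ k → trans (upd-there (ρ [ x ↦ k ] [ z ↦ v ∸ k ]) _ x≢r) (trans (upd-there (ρ [ x ↦ k ]) _ x≢z) (upd-here ρ x k))) body₁)
        where
        start : ∀ j → ρ j ≡ I₁ v j
        start j rewrite ℕP.n∸n≡0 v | op-0 a (ρ r) = sym (trans (upd-id (ρ [ x ↦ v ] [ z ↦ 0 ]) (trans (upd-there (ρ [ x ↦ v ]) _ r≢z) (upd-there ρ _ (x≢r ∘ sym))) j)
                       (trans (upd-id (ρ [ x ↦ v ]) (trans (upd-there ρ _ (x≢z ∘ sym)) (hz z ℕP.≤-refl)) j) (upd-id ρ refl j)))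
        mid : ∀ j → I₁ 0 j ≡ I₂ v j
        mid j rewrite ℕP.n∸n≡0 v = trans (upd-comm (ρ [ x ↦ 0 ]) (r≢z ∘ sym) j) (upd-cong (upd-comm ρ x≢r) refl j)
      d₂ : Does (forDown z (inc x)) (I₂ v) tt (I₂ 0) _
      d₂ = Does-cong (λ _ → refl) (λ _ → refl) (ℕP.+-monoˡ-≤ 2 (ℕP.*-monoˡ-≤ _ (le x)))
             (Does-forDown I₂ v z<K (le x) (λ k → upd-here _ z k) body₂)
      final : ∀ j → I₂ 0 j ≡ (ρ [ r ↦ op a (ρ r) (V.lookup (V.map ρ η) i) ]) j
      final j rewrite VP.lookup-map i ρ η =
        trans (upd-id (ρ [ r ↦ op a (ρ r) v ] [ x ↦ v ]) (trans (upd-there (ρ [ r ↦ _ ]) _ (x≢z ∘ sym)) (trans (upd-there ρ _ (r≢z ∘ sym)) (hz z ℕP.≤-refl))) j)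
              (upd-id (ρ [ r ↦ op a (ρ r) v ]) (upd-there ρ _ x≢r) j)
    comp-correct 𝟙 η a r z ρ n dep (r<z , hη , hz , le) = Does-step a (ℕP.<-≤-trans r<z (ℕP.≤-trans (ℕP.m≤m+n z 0) dep)) (le r)
    comp-correct (e₁ ⊹ e₂) η a r z ρ n dep (r<z , hη , hz , le) =
      Does-cong (λ _ → refl) post ℕP.≤-refl
        (comp-correct e₁ η a r z ρ n (ℕP.≤-trans (ℕP.+-monoʳ-≤ z (ℕP.m≤m+n (depth e₁) (depth e₂))) dep) (r<z , hη , hz , le) then
         comp-correct e₂ η a r z ρ₁ (n + ⟦ valB e₁ ⟧ᵇ n) (ℕP.≤-trans (ℕP.+-monoʳ-≤ z (ℕP.m≤n+m (depth e₂) (depth e₁))) dep)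
           (r<z , hη , (λ j l → trans (upd-there ρ _ (λ eq → ℕP.<⇒≢ (ℕP.<-≤-trans r<z l) (sym eq))) (hz j l)) ,
            upd-≤ (λ i → ℕP.≤-trans (le i) (ℕP.m≤m+n n _)) (ℕP.≤-trans (op-≤ a (ρ r) v₁) (ℕP.+-mono-≤ (le r) (eval-≤ inp e₁ _ n (env-≤ ρ η le))))))
      where
      v₁ = eval inp e₁ (V.map ρ η)
      ρ₁ = ρ [ r ↦ op a (ρ r) v₁ ]
      post : ∀ j → (ρ₁ [ r ↦ op a (ρ₁ r) (eval inp e₂ (V.map ρ₁ η)) ]) j ≡ (ρ [ r ↦ op a (ρ r) (v₁ + eval inp e₂ (V.map ρ η)) ]) j
      post j = trans (upd-shadow ρ j) (upd-cong (λ _ → refl)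
        (trans (cong₂ (λ x y → op a x (eval inp e₂ y)) (upd-here ρ r _) (map-upd ρ η (proj₂ ∘ hη))) (op-op a (ρ r) v₁ _)) j)
    comp-correct (e₁ ⊸ e₂) η a r z ρ n dep rd@(r<z , hη , hz , le) =
      Does-cong (λ _ → refl) post ℕP.≤-refl
        (comp-fresh e₁ η r z ρ n (ℕP.≤-trans (ℕP.≤-trans (ℕP.+-monoʳ-≤ (suc z) (ℕP.m≤m+n (depth e₁) (depth e₂))) (ℕP.≤-reflexive (sym (ℕP.+-suc z _)))) dep) rd then
         Does-cong (λ _ → refl) post₂ ℕP.≤-refl (comp-correct e₂ η false z (suc z) ρ₁ (n + V₁)
           (ℕP.≤-trans (ℕP.≤-trans (ℕP.+-monoʳ-≤ (suc z) (ℕP.m≤n+m (depth e₂) (depth e₁))) (ℕP.≤-reflexive (sym (ℕP.+-suc z _)))) dep)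
           (ℕP.≤-refl , (λ i → ℕP.m<n⇒m<1+n (proj₁ (hη i)) , ℕP.<⇒≢ (proj₁ (hη i))) ,
            (λ j l → trans (upd-there ρ _ (λ eq → ℕP.<⇒≢ l (sym eq))) (hz j (ℕP.<⇒≤ l))) ,
            upd-≤ (λ i → ℕP.≤-trans (le i) (ℕP.m≤m+n n _)) (ℕP.≤-trans v₁≤ (ℕP.m≤n+m V₁ n)))) then
         loop-step {ρ = ρ₂} {n} {V₁} a (v₁ ∸ v₂) r<z z<K ρ₂≤ (ℕP.≤-trans (ℕP.m∸n≤m v₁ v₂) v₁≤) (upd-here ρ z _))
      where
      v₁ = eval inp e₁ (V.map ρ η)
      v₂ = eval inp e₂ (V.map ρ η)
      V₁ = ⟦ valB e₁ ⟧ᵇ n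
      v₁≤ : v₁ ≤ V₁
      v₁≤ = eval-≤ inp e₁ _ n (env-≤ ρ η le)
      ρ₁ = ρ [ z ↦ v₁ ]
      -- The difference is truncated inside the scratch register before it acts on r; acting on r
      -- with the two operands separately would truncate at the wrong place.
      ρ₂ = ρ [ z ↦ v₁ ∸ v₂ ]
      z<K : z < K
      z<K = ℕP.≤-trans (ℕP.≤-trans (ℕP.≤-reflexive (ℕP.+-comm 1 z)) (ℕP.+-monoʳ-≤ z (s≤s z≤n))) dep
      ρ₂≤ : ρ₂ r ≤ n
      ρ₂≤ = ℕP.≤-trans (ℕP.≤-reflexive (upd-there ρ _ (ℕP.<⇒≢ r<z))) (le r)
      post₂ : ∀ j → (ρ₁ [ z ↦ ρ₁ z ∸ eval inp e₂ (V.map ρ₁ η) ]) j ≡ ρ₂ j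
      post₂ j = trans (upd-shadow ρ j) (upd-cong (λ _ → refl) (cong₂ (λ x y → x ∸ eval inp e₂ y) (upd-here ρ z v₁) (map-upd ρ η λ i → ℕP.<⇒≢ (proj₁ (hη i)))) j)
      post : ∀ j → (ρ₂ [ z ↦ 0 ] [ r ↦ op a (ρ₂ r) (v₁ ∸ v₂) ]) j ≡ (ρ [ r ↦ op a (ρ r) (v₁ ∸ v₂) ]) j
      post = upd-cong (λ j → trans (upd-shadow ρ j) (upd-id ρ (hz z ℕP.≤-refl) j)) (cong (λ x → op a x (v₁ ∸ v₂)) (upd-there ρ _ (ℕP.<⇒≢ r<z)))
    comp-correct (sumE e₁ e₂) η a r z ρ n dep rd@(r<z , hη , hz , le) =
      Does-cong (λ _ → refl) post ℕP.≤-refl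
        (comp-fresh e₁ η r z ρ n (ℕP.≤-trans (ℕP.≤-trans (ℕP.+-monoʳ-≤ (suc z) (ℕP.m≤m+n (depth e₁) (depth e₂))) (ℕP.≤-reflexive (sym (ℕP.+-suc z _)))) dep) rd then
         Does-cong start (λ _ → refl) (ℕP.+-monoˡ-≤ 2 (ℕP.*-monoˡ-≤ _ v≤))
           (Does-forDown I v z<K v≤ (λ k → trans (upd-there (ρ [ z ↦ k ]) _ z≢r) (upd-here ρ z k)) body))
      where
      v = eval inp e₁ (V.map ρ η)
      f : ℕ → ℕ
      f i = eval inp e₂ (i V.∷ V.map ρ η)
      V₁ = ⟦ valB e₁ ⟧ᵇ n
      V₂ = ⟦ valB e₂ ⟧ᵇ (n + V₁)
      S₁ = V₁ * V₂
      v≤ : v ≤ V₁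
      v≤ = eval-≤ inp e₁ _ n (env-≤ ρ η le)
      r≢z = ℕP.<⇒≢ r<z
      z≢r = r≢z ∘ sym
      z<K : z < K
      z<K = ℕP.≤-trans (ℕP.≤-trans (ℕP.≤-reflexive (ℕP.+-comm 1 z)) (ℕP.+-monoʳ-≤ z (s≤s z≤n))) dep
      I : ℕ → ℕ → ℕ
      I k = ρ [ z ↦ k ] [ r ↦ op a (ρ r) (tailSum v f k) ]
      f≤ : ∀ i → i < v → f i ≤ V₂
      f≤ i lt = eval-≤ inp e₂ _ _ λ { F.zero → ℕP.≤-trans (ℕP.<⇒≤ lt) (ℕP.≤-trans v≤ (ℕP.m≤n+m V₁ n))
                                    ; (F.suc j) → ℕP.≤-trans (env-≤ ρ η le j) (ℕP.m≤m+n n V₁) }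
      ts≤ : ∀ k → tailSum v f k ≤ S₁
      ts≤ k = ℕP.≤-trans (tailSum-≤ v f V₂ k f≤) (ℕP.*-monoˡ-≤ V₂ v≤)
      start : ∀ i → (ρ [ z ↦ v ]) i ≡ I v i
      start i = sym (upd-id (ρ [ z ↦ v ]) (trans (upd-there ρ _ r≢z) (sym (trans (cong (λ q → op a (ρ r) (sumTo q (λ i → f (v + i)))) (ℕP.n∸n≡0 v)) (op-0 a (ρ r))))) i)
      post : ∀ j → I 0 j ≡ (ρ [ r ↦ op a (ρ r) (sumTo v f) ]) j
      post = upd-cong (upd-id ρ (hz z ℕP.≤-refl)) refl
      body : ∀ k → k < v → Does (comp e₂ (z V.∷ η) a r (suc z)) (I (suc k) [ z ↦ k ]) tt (I k) (⟦ timeB e₂ ⟧ᵇ (n + V₁ + S₁))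
      body k k<v = Does-cong (λ _ → refl)
          (λ i → trans (upd-cong {f = pre} (λ i → upd-comm (ρ [ z ↦ suc k ]) r≢z i) refl i)
                       (trans (upd-shadow (ρ [ z ↦ suc k ] [ z ↦ k ]) i) (upd-cong (upd-shadow ρ) val i))) ℕP.≤-refl
          (comp-correct e₂ (z V.∷ η) a r (suc z) pre (n + V₁ + S₁)
            (ℕP.≤-trans (ℕP.≤-trans (ℕP.+-monoʳ-≤ (suc z) (ℕP.m≤n+m (depth e₂) (depth e₁))) (ℕP.≤-reflexive (sym (ℕP.+-suc z _)))) dep)
            (ℕP.m<n⇒m<1+n r<z , (λ { F.zero → ℕP.≤-refl , z≢r ; (F.suc i) → ℕP.m<n⇒m<1+n (proj₁ (hη i)) , proj₂ (hη i) }) ,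
             (λ j l → trans (upd-there (I (suc k)) k (λ eq → ℕP.<⇒≢ l (sym eq))) (trans (upd-there (ρ [ z ↦ suc k ]) _ (λ eq → ℕP.<⇒≢ (ℕP.<-trans r<z l) (sym eq)))
                        (trans (upd-there ρ _ (λ eq → ℕP.<⇒≢ l (sym eq))) (hz j (ℕP.<⇒≤ l))))) ,
             upd-≤ (upd-≤ (upd-≤ (λ j → ℕP.≤-trans (le j) (ℕP.≤-trans (ℕP.m≤m+n n V₁) (ℕP.m≤m+n _ S₁)))
                       (ℕP.≤-trans k<v (ℕP.≤-trans v≤ (ℕP.≤-trans (ℕP.m≤n+m V₁ n) (ℕP.m≤m+n _ S₁)))))
                     (ℕP.≤-trans (op-≤ a (ρ r) _) (ℕP.+-mono-≤ (ℕP.≤-trans (le r) (ℕP.m≤m+n n V₁)) (ts≤ (suc k)))))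
                   (ℕP.≤-trans (ℕP.<⇒≤ k<v) (ℕP.≤-trans v≤ (ℕP.≤-trans (ℕP.m≤n+m V₁ n) (ℕP.m≤m+n _ S₁))))))
        where
        pre = I (suc k) [ z ↦ k ]
        cr : pre r ≡ op a (ρ r) (tailSum v f (suc k))
        cr = trans (upd-there (I (suc k)) k r≢z) (upd-here _ r _)
        η≢z = λ i → ℕP.<⇒≢ (proj₁ (hη i))
        ev : V.map pre (z V.∷ η) ≡ k V.∷ V.map ρ η
        ev = cong₂ V._∷_ (upd-here _ z k) (trans (map-upd (I (suc k)) η η≢z) (trans (map-upd (ρ [ z ↦ suc k ]) η (proj₂ ∘ hη)) (map-upd ρ η η≢z)))
        val : op a (pre r) (eval inp e₂ (V.map pre (z V.∷ η))) ≡ op a (ρ r) (tailSum v f k)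
        val = trans (cong₂ (λ x y → op a x (eval inp e₂ y)) cr ev) (trans (op-op a (ρ r) _ (f k)) (cong (op a (ρ r)) (tailSum-step f k<v)))
    comp-correct (symE c e₁) η a r z ρ n dep rd@(r<z , hη , hz , le) =
      Does-cong (λ _ → refl) post (ℕP.+-monoʳ-≤ (⟦ timeB e₁ ⟧ᵇ n) (ℕP.≤-reflexive (sym (ℕP.+-assoc (2 * V₁ + 5) (2 * n + 5) _))))
        (comp-fresh e₁ η r z ρ n (ℕP.≤-trans (ℕP.≤-reflexive (sym (ℕP.+-suc z _))) dep) rd then
         Does-bind (Does-cong (λ _ → refl) (λ _ → refl) (ℕP.+-monoˡ-≤ 5 (ℕP.*-monoʳ-≤ 2 (ℕP.≤-trans (ℕP.≤-reflexive (upd-here ρ z v)) v≤))) (Does-read z<K))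
           (branch then clear))
      where
      v = eval inp e₁ (V.map ρ η)
      V₁ = ⟦ valB e₁ ⟧ᵇ n
      v≤ : v ≤ V₁
      v≤ = eval-≤ inp e₁ _ n (env-≤ ρ η le)
      r≢z = ℕP.<⇒≢ r<z
      z<K : z < K
      z<K = ℕP.≤-trans (ℕP.≤-trans (ℕP.≤-reflexive (ℕP.+-comm 1 z)) (ℕP.+-monoʳ-≤ z (s≤s z≤n))) dep
      ρ₁ = ρ [ z ↦ v ]
      ρ₂ = ρ₁ [ r ↦ op a (ρ₁ r) (symTest c (inp (ρ₁ z))) ]
      branch : Does (if toℕ c ≡ᵇ toℕ (inp (ρ₁ z)) then stepR a r else ret tt) ρ₁ tt ρ₂ (2 * n + 5)
      branch with toℕ c ≡ᵇ toℕ (inp (ρ₁ z))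
      ... | true  = Does-step a (ℕP.<-trans r<z z<K) (ℕP.≤-trans (ℕP.≤-reflexive (upd-there ρ _ r≢z)) (le r))
      ... | false = Does-cong (λ _ → refl) (λ j → sym (upd-id ρ₁ (sym (op-0 a (ρ₁ r))) j)) (ℕP.≤-trans (s≤s z≤n) (ℕP.m≤n+m 5 (2 * n))) Does-ret
      clear : Does (forDown z (ret tt)) ρ₂ tt (ρ₂ [ z ↦ 0 ]) (V₁ * (2 * V₁ + 7 + 1) + 2)
      clear = Does-cong (λ j → sym (upd-id ρ₂ (trans (upd-there ρ₁ _ (r≢z ∘ sym)) (upd-here ρ z v)) j)) (λ _ → refl) (ℕP.+-monoˡ-≤ 2 (ℕP.*-monoˡ-≤ _ v≤))
        (Does-forDown (λ k → ρ₂ [ z ↦ k ]) v z<K v≤ (λ k → upd-here ρ₂ z k) λ k _ → Does-cong (λ _ → refl) (upd-shadow ρ₂) ℕP.≤-refl Does-ret)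
      post : ∀ j → (ρ₂ [ z ↦ 0 ]) j ≡ (ρ [ r ↦ op a (ρ r) (symTest c (inp v)) ]) j
      post j = trans (upd-comm ρ₁ r≢z j) (upd-cong (λ j → trans (upd-shadow ρ j) (upd-id ρ (hz z ℕP.≤-refl) j))
                 (cong₂ (λ x y → op a x (symTest c (inp y))) (upd-there ρ _ r≢z) (upd-here ρ z v)) j)

-- From an expression to a polynomial-time decider

inputAt : List (Fin 5) → ℕ → Fin 6
inputAt x = nth F.zero (map F.suc x)

isPos : ℕ → Bool
isPos zero    = false
isPos (suc _) = true

accepts-run : ∀ M c x b → run M (timeBound c (length x)) x ≡ just b → acceptsᵇ M c x ≡ b
accepts-run M c x b eq with run M (timeBound c (length x)) x
accepts-run M c x true  refl | _ = refl
accepts-run M c x false refl | _ = refl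

-- Register 0 will hold the input length, the one variable of the expression; register 1 receives
-- the value; the scratch area starts at 2, whence the number of tracks.
module Decider (ex : Expr 1) where
  K : ℕ
  K = 2 + depth ex
  open Machine K
  open Ops K
  open Compile K

  -- Setting all marks in the first cell makes every register zero, and the flag makes this cell the
  -- home cell.
  start : Frag ⊤
  start = act λ a → tt , (proj₁ a , true , V.replicate K true) , Move.S

  -- Input symbols have nonzero tape codes, so the first blank that register 0 meets lies at the
  -- input length.
  lenLoop : Frag ⊤
  lenLoop = loop (bind (Fin-finite 6) (readAt 0) λ c → if toℕ c ≡ᵇ 0 then ret (just tt) else (inc 0 ⨟ ret nothing))

  prog : Frag Bool
  prog = start ⨟ lenLoop ⨟ comp ex (0 V.∷ V.[]) true 1 2 ⨟ bind Bool-finite (isZero 1) (ret ∘ not)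

  bound : PB
  -- One step for `start`; n rounds of a read, an increment and a `ret`; a last read with its `ret`;
  -- the expression; the final test with its `ret`.
  bound = :C 1 :+ ((:X :* (:C 2 :* :X :+ :C 5 :+ (:C 2 :* :X :+ :C 5 :+ :C 1)) :+ (:C 2 :* :X :+ :C 6)) :+ (timeB ex :+ :C 2))

  module _ (x : List (Fin 5)) where
    n = length x
    inp = inputAt x
    open Spec inp
    open Correct inp

    inp-in : ∀ {y : List (Fin 5)} {q} → q < length y → (toℕ (inputAt y q) ≡ᵇ 0) ≡ false
    inp-in {_ ∷ _} {zero}  _        = refl
    inp-in {_ ∷ y} {suc q} (s≤s lt) = inp-in {y} lt

    inp-end : ∀ (y : List (Fin 5)) → (toℕ (inputAt y (length y)) ≡ᵇ 0) ≡ true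
    inp-end []      = refl
    inp-end (_ ∷ y) = inp-end y

    regs : ℕ → ℕ → ℕ
    regs i zero    = i
    regs i (suc _) = 0

    nth-map : ∀ {A B : Set} (f : A → B) d ys q → nth (f d) (map f ys) q ≡ f (nth d ys q)
    nth-map f d []       q       = refl
    nth-map f d (y ∷ ys) zero    = refl
    nth-map f d (y ∷ ys) (suc q) = nth-map f d ys q

    marks-0 : ∀ k → marks (λ _ → 0) k 0 ≡ V.replicate k true
    marks-0 zero    = refl
    marks-0 (suc k) = cong (true V.∷_) (marks-0 k)

    marks-suc : ∀ k q → marks (λ _ → 0) k (suc q) ≡ V.replicate k false
    marks-suc zero    q = refl
    marks-suc (suc k) q = cong (false V.∷_) (marks-suc k q)

    init-at : ∀ y → At 0 (plain ∘ inputAt y) (initT y)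
    init-at []      = tt , refl , λ _ → refl
    init-at (_ ∷ y) = tt , refl , λ q → trans (cong (λ z → nth (plain F.zero) z q) (LP.map-∘ y)) (nth-map plain F.zero (map F.suc y) q)

    start-run : ∃ λ t → Runs start tt (initT x) 1 tt t × At 0 (cell (regs 0)) t
    start-run = _ , done refl , At-cong {t = writeT w (initT x)} eq (At-write {0} {plain ∘ inp} {initT x} w (init-at x))
      where
      w : Sym
      w = proj₁ (cur (initT x)) , true , V.replicate K true
      eq : ∀ q → ((plain ∘ inp) [ 0 ↦ w ]) q ≡ cell (regs 0) q
      eq zero = trans (upd-here (plain ∘ inp) 0 w) $ cong₂ (λ a b → a , true , b) (cong proj₁ (At-cur {0} {plain ∘ inp} {initT x} (init-at x)))
                  (sym (trans (marks-cong {regs 0} {λ _ → 0} K 0 λ { zero → refl ; (suc i) → refl }) (marks-0 K)))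
      eq (suc q) = trans (upd-there (plain ∘ inp) w λ ()) $ cong (λ b → inp (suc q) , false , b) (sym (trans (marks-cong {regs 0} {λ _ → 0} K (suc q) λ { zero → refl ; (suc i) → refl }) (marks-suc K q)))

    Does-len : ∀ d i → d + i ≡ n → Does lenLoop (regs i) tt (regs n) (d * (2 * n + 5 + (2 * n + 5 + 1)) + (2 * n + 6))
    Does-len zero i refl .from t at =
      let (t₁ , k , r , at₁ , le) = from (Does-bind {fd = Fin-finite 6} (Does-read {ρ = regs n} (s≤s z≤n)) stop) t at
      in t₁ , k , run-exit r , at₁ , ℕP.≤-trans le (ℕP.≤-reflexive (ℕP.+-assoc (2 * n) 5 1))
      where
      stop : Does (if toℕ (inp n) ≡ᵇ 0 then ret (just tt) else (inc 0 ⨟ ret nothing)) (regs n) (just tt) (regs n) 1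
      stop rewrite inp-end x = Does-ret
    Does-len (suc d) i eq .from t at =
      let (t₁ , k , r , at₁ , le) = from (Does-bind {fd = Fin-finite 6} (Does-read {ρ = regs i} (s≤s z≤n)) go) t at
          (t₂ , k₂ , r₂ , at₂ , le₂) = from (Does-len d (suc i) (trans (ℕP.+-suc d i) eq)) t₁ at₁
      in t₂ , k + k₂ , run-again r r₂ , at₂ , ℕP.≤-trans (ℕP.+-mono-≤ (ℕP.≤-trans le (ℕP.+-monoˡ-≤ _ c≤)) le₂)
            (ℕP.≤-reflexive (sym (ℕP.+-assoc (2 * n + 5 + (2 * n + 5 + 1)) (d * (2 * n + 5 + (2 * n + 5 + 1))) _)))
      where
      i<n : i < n
      i<n = subst (i <_) eq (s≤s (ℕP.m≤n+m i d))
      c≤ : 2 * i + 5 ≤ 2 * n + 5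
      c≤ = ℕP.+-monoˡ-≤ 5 (ℕP.*-monoʳ-≤ 2 (ℕP.<⇒≤ i<n))
      go : Does (if toℕ (inp i) ≡ᵇ 0 then ret (just tt) else (inc 0 ⨟ ret nothing)) (regs i) nothing (regs (suc i)) (2 * n + 5 + 1)
      go rewrite inp-in {x} i<n = Does-cong {ρ = regs i} {ρ₁ = regs i} {ρ₁′ = regs (suc i)} (λ _ → refl) (λ { zero → upd-here (regs i) 0 (suc i) ; (suc j) → upd-there (regs i) (suc i) λ () }) c≤ (Does-inc {ρ = regs i} (s≤s z≤n)) then Does-ret

    result : ℕ
    result = eval inp ex (n V.∷ V.[])

    Does-rest : Does (lenLoop ⨟ comp ex (0 V.∷ V.[]) true 1 2 ⨟ bind Bool-finite (isZero 1) (ret ∘ not)) (regs 0) (isPos result)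
                     (regs n [ 1 ↦ result ]) _
    Does-rest = Does-len n 0 (ℕP.+-identityʳ n) then
      comp-correct ex (0 V.∷ V.[]) true 1 2 (regs n) n ℕP.≤-refl
        (s≤s (s≤s z≤n) , (λ { F.zero → s≤s z≤n , λ () }) , (λ { (suc j) _ → refl }) , λ { zero → ℕP.≤-refl ; (suc _) → z≤n }) then
      Does-bind (Does-isZero {b = 0 ≡ᵇ result} (s≤s (s≤s z≤n)) (cong (0 ≡ᵇ_) (upd-here (regs n) 1 result))) (subst (λ b → Does (ret b) (regs n [ 1 ↦ result ]) (isPos result) (regs n [ 1 ↦ result ]) 1) (eq result) Does-ret)
      where eq : ∀ k → isPos k ≡ not (0 ≡ᵇ k)
            eq zero    = refl
            eq (suc _) = refl

    halts : ∃ λ t → ∃ λ k → Runs prog (entry prog) (initT x) k (isPos result) t × k ≤ ⟦ bound ⟧ᵇ n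
    halts = let (t₁ , r₁ , at₁) = start-run
                (t₂ , k , r₂ , _ , le) = from Does-rest t₁ at₁
            in t₂ , 1 + k , run-bind r₁ r₂ , s≤s le

  machine : TM
  machine = toTM prog

  machine-run : ∀ c → deg bound ≤ c → ∀ x → run machine (timeBound c (length x)) x ≡ just (isPos (result x))
  machine-run c le x = let (t , k , r , le′) = halts x in
    toTM-run prog {x} r _ (ℕP.≤-trans le′ (ℕP.≤-trans (PB-pow bound (length x)) (pow-mono (length x) le)))

  machine-polytime : ∀ c → deg bound ≤ c → PolyTimeDecider machine c
  machine-polytime c le x = _ , machine-run c le x

  machine-accepts : ∀ c → deg bound ≤ c → ∀ x → acceptsᵇ machine c x ≡ isPos (result x)
  machine-accepts c le x = accepts-run machine c x _ (machine-run c le x)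

-- Finite integer sums

-- Opaque so that unification sees the summand instead of an unfolded sum.
opaque
  ∑ : {A : Set} → List A → (A → ℤ) → ℤ
  ∑ []       f = pos 0
  ∑ (x ∷ xs) f = f x +ᶻ ∑ xs f

ι : Bool → ℤ
ι true  = pos 1
ι false = pos 0

ι-∧ : ∀ a b → ι (a ∧ b) ≡ ι a *ᶻ ι b
ι-∧ true  b = sym (ℤP.*-identityˡ (ι b))
ι-∧ false b = sym (ℤP.*-zeroˡ (ι b))

ι-∧* : ∀ a b x → ι (a ∧ b) *ᶻ x ≡ ι a *ᶻ (ι b *ᶻ x)
ι-∧* a b x = trans (cong (_*ᶻ x) (ι-∧ a b)) (ℤP.*-assoc (ι a) (ι b) x)

ι-cong : ∀ b {x y} → (b ≡ true → x ≡ y) → ι b *ᶻ x ≡ ι b *ᶻ y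
ι-cong true  eq = cong (pos 1 *ᶻ_) (eq refl)
ι-cong false eq = refl

ι-true : ∀ {b} x → b ≡ true → ι b *ᶻ x ≡ x
ι-true x refl = ℤP.*-identityˡ x

ι-false : ∀ {b} x → b ≡ false → ι b *ᶻ x ≡ pos 0
ι-false x refl = refl

ι-comm : ∀ a b x → ι a *ᶻ (ι b *ᶻ x) ≡ ι b *ᶻ (ι a *ᶻ x)
ι-comm a b x = lem (ι a) (ι b) x
  where lem : ∀ a b x → a *ᶻ (b *ᶻ x) ≡ b *ᶻ (a *ᶻ x)
        lem = ℤS.solve-∀

bool-iff : ∀ {a b : Bool} → (a ≡ true → b ≡ true) → (b ≡ true → a ≡ true) → a ≡ b
bool-iff {true}  {true}  _ _ = refl
bool-iff {true}  {false} f _ = sym (f refl)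
bool-iff {false} {true}  _ g = g refl
bool-iff {false} {false} _ _ = refl

bool-not : ∀ {a : Bool} → ¬ (a ≡ true) → a ≡ false
bool-not {true}  na = ⊥-elim (na refl)
bool-not {false} _  = refl

∧-true : ∀ {a b : Bool} → (a ∧ b) ≡ true → (a ≡ true) × (b ≡ true)
∧-true {true} {true} _ = refl , refl

∧-intro : ∀ {a b : Bool} → a ≡ true → b ≡ true → (a ∧ b) ≡ true
∧-intro refl refl = refl

≤ᵇ-true : ∀ {i j} → i ≤ j → (i ≤ᵇ j) ≡ true
≤ᵇ-true {zero}          _ = refl
≤ᵇ-true {suc i} {suc j} (s≤s le) = lem i j le
  where lem : ∀ i j → i ≤ j → (i <ᵇ suc j) ≡ true
        lem zero    j       _        = refl
        lem (suc i) (suc j) (s≤s le) = lem i j le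

<ᵇ-true : ∀ {i j} → i < j → (i <ᵇ j) ≡ true
<ᵇ-true {i} {j} lt = ≤ᵇ-true {suc i} {j} lt

<ᵇ-sound : ∀ i j → (i <ᵇ j) ≡ true → i < j
<ᵇ-sound zero    (suc j) _  = s≤s z≤n
<ᵇ-sound (suc i) (suc j) eq = s≤s (<ᵇ-sound i j eq)

≤ᵇ-sound : ∀ i j → (i ≤ᵇ j) ≡ true → i ≤ j
≤ᵇ-sound zero    j _  = z≤n
≤ᵇ-sound (suc i) j eq = <ᵇ-sound i j eq

≤ᵇ-false : ∀ {i j} → j < i → (i ≤ᵇ j) ≡ false
≤ᵇ-false {i} {j} lt = bool-not λ eq → ℕP.<⇒≱ lt (≤ᵇ-sound i j eq)

<ᵇ-false : ∀ {i j} → j ≤ i → (i <ᵇ j) ≡ false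
<ᵇ-false {i} {j} le = bool-not λ eq → ℕP.<⇒≱ (<ᵇ-sound i j eq) le

≤ᵇ-suc : ∀ i j → (suc i ≤ᵇ suc j) ≡ (i ≤ᵇ j)
≤ᵇ-suc i j = bool-iff (λ eq → ≤ᵇ-true (ℕP.≤-pred (≤ᵇ-sound (suc i) (suc j) eq))) (λ eq → ≤ᵇ-true (s≤s (≤ᵇ-sound i j eq)))

≡ᵇ-sym : ∀ i j → (i ≡ᵇ j) ≡ (j ≡ᵇ i)
≡ᵇ-sym zero    zero    = refl
≡ᵇ-sym zero    (suc j) = refl
≡ᵇ-sym (suc i) zero    = refl
≡ᵇ-sym (suc i) (suc j) = ≡ᵇ-sym i j

module _ {A : Set} where
  opaque
    unfolding ∑
    ∑-[] : ∀ (f : A → ℤ) → ∑ [] f ≡ pos 0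
    ∑-[] f = refl

    ∑-∷ : ∀ x (xs : List A) f → ∑ (x ∷ xs) f ≡ f x +ᶻ ∑ xs f
    ∑-∷ x xs f = refl

    ∑-cong : ∀ (xs : List A) {f g} → (∀ x → f x ≡ g x) → ∑ xs f ≡ ∑ xs g
    ∑-cong []       eq = refl
    ∑-cong (x ∷ xs) eq = cong₂ _+ᶻ_ (eq x) (∑-cong xs eq)

    ∑-cong∈ : ∀ (xs : List A) {f g} → (∀ x → x ∈ xs → f x ≡ g x) → ∑ xs f ≡ ∑ xs g
    ∑-cong∈ []       eq = refl
    ∑-cong∈ (x ∷ xs) eq = cong₂ _+ᶻ_ (eq x (here refl)) (∑-cong∈ xs λ y y∈ → eq y (there y∈))

    ∑-zero : ∀ (xs : List A) {f} → (∀ x → f x ≡ pos 0) → ∑ xs f ≡ pos 0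
    ∑-zero []       eq = refl
    ∑-zero (x ∷ xs) eq = cong₂ _+ᶻ_ (eq x) (∑-zero xs eq)

    ∑-zero∈ : ∀ (xs : List A) {f} → (∀ x → x ∈ xs → f x ≡ pos 0) → ∑ xs f ≡ pos 0
    ∑-zero∈ xs eq = trans (∑-cong∈ xs eq) (∑-zero xs λ _ → refl)

    ∑-++ : ∀ (xs ys : List A) f → ∑ (xs ++ ys) f ≡ ∑ xs f +ᶻ ∑ ys f
    ∑-++ []       ys f = sym (ℤP.+-identityˡ _)
    ∑-++ (x ∷ xs) ys f = trans (cong (f x +ᶻ_) (∑-++ xs ys f)) (sym (ℤP.+-assoc (f x) _ _))

    ∑-filter : ∀ p (xs : List A) (f : A → ℤ) → ∑ (filterᵇ p xs) f ≡ ∑ xs (λ x → ι (p x) *ᶻ f x)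
    ∑-filter p []       f = refl
    ∑-filter p (x ∷ xs) f with p x
    ... | true  = cong₂ _+ᶻ_ (sym (ℤP.*-identityˡ (f x))) (∑-filter p xs f)
    ... | false = trans (∑-filter p xs f) (sym (ℤP.+-identityˡ _))

    ∑-+ : ∀ (xs : List A) (f g : A → ℤ) → ∑ xs (λ x → f x +ᶻ g x) ≡ ∑ xs f +ᶻ ∑ xs g
    ∑-+ []       f g = refl
    ∑-+ (x ∷ xs) f g = trans (cong ((f x +ᶻ g x) +ᶻ_) (∑-+ xs f g)) (lem (f x) (g x) (∑ xs f) (∑ xs g))
      where lem : ∀ a b c d → (a +ᶻ b) +ᶻ (c +ᶻ d) ≡ (a +ᶻ c) +ᶻ (b +ᶻ d)
            lem = ℤS.solve-∀

    ∑-* : ∀ (xs : List A) c (f : A → ℤ) → ∑ xs (λ x → c *ᶻ f x) ≡ c *ᶻ ∑ xs f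
    ∑-* []       c f = sym (ℤP.*-zeroʳ c)
    ∑-* (x ∷ xs) c f = trans (cong (c *ᶻ f x +ᶻ_) (∑-* xs c f)) (sym (ℤP.*-distribˡ-+ c (f x) _))

    ∑-neg : ∀ (xs : List A) (f : A → ℤ) → ∑ xs (λ x → -ᶻ f x) ≡ -ᶻ ∑ xs f
    ∑-neg []       f = refl
    ∑-neg (x ∷ xs) f = trans (cong (-ᶻ f x +ᶻ_) (∑-neg xs f)) (sym (ℤP.neg-distrib-+ (f x) _))

  ∑-[]-eq : ∀ (f g : A → ℤ) → ∑ [] f ≡ ∑ [] g
  ∑-[]-eq f g = trans (∑-[] f) (sym (∑-[] g))

  ∑-≡ : ∀ {xs ys : List A} → xs ≡ ys → ∀ (f : A → ℤ) → ∑ xs f ≡ ∑ ys f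
  ∑-≡ refl f = refl

  ∑-one : ∀ x (f : A → ℤ) → ∑ (x ∷ []) f ≡ f x
  ∑-one x f = trans (∑-∷ x [] f) (trans (cong (f x +ᶻ_) (∑-[] f)) (ℤP.+-identityʳ (f x)))

  ∑-minus : ∀ (xs : List A) (f g : A → ℤ) → ∑ xs (λ x → f x -ᶻ g x) ≡ ∑ xs f -ᶻ ∑ xs g
  ∑-minus xs f g = trans (∑-+ xs f (λ x → -ᶻ g x)) (cong (∑ xs f +ᶻ_) (∑-neg xs g))

module _ {A B : Set} where
  opaque
    unfolding ∑
    ∑-map : ∀ (g : A → B) xs f → ∑ (map g xs) f ≡ ∑ xs (f ∘ g)
    ∑-map g []       f = refl
    ∑-map g (x ∷ xs) f = cong (f (g x) +ᶻ_) (∑-map g xs f)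

    ∑-concatMap : ∀ (g : A → List B) xs f → ∑ (concatMap g xs) f ≡ ∑ xs (λ x → ∑ (g x) f)
    ∑-concatMap g []       f = refl
    ∑-concatMap g (x ∷ xs) f = trans (∑-++ (g x) (concatMap g xs) f) (cong (∑ (g x) f +ᶻ_) (∑-concatMap g xs f))

    ∑-swap : ∀ (xs : List A) (ys : List B) (f : A → B → ℤ) → ∑ xs (λ x → ∑ ys (f x)) ≡ ∑ ys (λ y → ∑ xs (λ x → f x y))
    ∑-swap []       ys f = sym (∑-zero ys λ _ → refl)
    ∑-swap (x ∷ xs) ys f = trans (cong (∑ ys (f x) +ᶻ_) (∑-swap xs ys f)) (sym (∑-+ ys (f x) _))

opaque
  unfolding ∑
  length-filter : {A : Set} (p : A → Bool) (xs : List A) → pos (length (filterᵇ p xs)) ≡ ∑ xs (λ x → ι (p x))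
  length-filter p []       = refl
  length-filter p (x ∷ xs) with p x
  ... | true  = cong (pos 1 +ᶻ_) (length-filter p xs)
  ... | false = trans (length-filter p xs) (sym (ℤP.+-identityˡ _))

  ∑-applyUpTo : ∀ (g : ℕ → ℕ) n f → ∑ (applyUpTo g n) f ≡ ∑ (upTo n) (f ∘ g)
  ∑-applyUpTo g n f = lem g id n f
    where lem : ∀ (g k : ℕ → ℕ) n f → ∑ (applyUpTo (g ∘ k) n) f ≡ ∑ (applyUpTo k n) (f ∘ g)
          lem g k zero    f = refl
          lem g k (suc n) f = cong (f (g (k 0)) +ᶻ_) (lem g (k ∘ suc) n f)

  ∑-upTo-suc : ∀ n f → ∑ (upTo (suc n)) f ≡ f 0 +ᶻ ∑ (upTo n) (f ∘ suc)
  ∑-upTo-suc n f = cong (f 0 +ᶻ_) (∑-applyUpTo suc n f)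

∑-upTo-cong : ∀ n {f g} → (∀ i → i < n → f i ≡ g i) → ∑ (upTo n) f ≡ ∑ (upTo n) g
∑-upTo-cong zero            eq = ∑-[]-eq _ _
∑-upTo-cong (suc n) {f} {g} eq = trans (∑-upTo-suc n f) (trans
  (cong₂ _+ᶻ_ (eq 0 (s≤s z≤n)) (∑-upTo-cong n λ i lt → eq (suc i) (s≤s lt))) (sym (∑-upTo-suc n g)))

∑-upTo-zero : ∀ n {f} → (∀ i → i < n → f i ≡ pos 0) → ∑ (upTo n) f ≡ pos 0
∑-upTo-zero n eq = trans (∑-upTo-cong n eq) (∑-zero (upTo n) λ _ → refl)

∑-upTo-+ : ∀ a b f → ∑ (upTo (a + b)) f ≡ ∑ (upTo a) f +ᶻ ∑ (upTo b) (f ∘ (a +_))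
∑-upTo-+ zero    b f = sym (trans (cong (_+ᶻ ∑ (upTo b) f) (∑-[] f)) (ℤP.+-identityˡ _))
∑-upTo-+ (suc a) b f = trans (∑-upTo-suc (a + b) f) (trans (cong (f 0 +ᶻ_) (∑-upTo-+ a b (f ∘ suc)))
  (trans (sym (ℤP.+-assoc (f 0) _ _)) (cong (_+ᶻ ∑ (upTo b) (f ∘ (suc a +_))) (sym (∑-upTo-suc a f)))))

∑-upTo-last : ∀ n f → ∑ (upTo (suc n)) f ≡ ∑ (upTo n) f +ᶻ f n
∑-upTo-last n f = trans (cong (λ z → ∑ (upTo z) f) (ℕP.+-comm 1 n)) (trans (∑-upTo-+ n 1 f)
  (cong (∑ (upTo n) f +ᶻ_) (trans (∑-one 0 _) (cong f (ℕP.+-identityʳ n)))))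

∑-upTo-rev : ∀ n f → ∑ (upTo n) f ≡ ∑ (upTo n) (λ i → f (n ∸ suc i))
∑-upTo-rev zero    f = ∑-[]-eq _ _
∑-upTo-rev (suc n) f = trans (∑-upTo-last n f) (trans (ℤP.+-comm _ (f n))
  (trans (cong (f n +ᶻ_) (∑-upTo-rev n f)) (sym (∑-upTo-suc n _))))

∑-upTo-delta : ∀ n j (f : ℕ → ℤ) → ∑ (upTo n) (λ i → ι (j ≡ᵇ i) *ᶻ f i) ≡ ι (j <ᵇ n) *ᶻ f j
∑-upTo-delta zero    j       f = ∑-[] _
∑-upTo-delta (suc n) zero    f = trans (∑-upTo-suc n _) (trans (cong (pos 1 *ᶻ f 0 +ᶻ_) (∑-zero (upTo n) λ _ → refl)) (ℤP.+-identityʳ _))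
∑-upTo-delta (suc n) (suc j) f = trans (∑-upTo-suc n _) (trans (ℤP.+-identityˡ _) (∑-upTo-delta n j (f ∘ suc)))

∑-upTo-restrict : ∀ {b hi} (f : ℕ → ℤ) → hi ≤ b → ∑ (upTo (suc b)) (λ i → ι (i ≤ᵇ hi) *ᶻ f i) ≡ ∑ (upTo (suc hi)) f
∑-upTo-restrict {b} {hi} f le = trans (cong (λ z → ∑ (upTo (suc z)) (λ i → ι (i ≤ᵇ hi) *ᶻ f i)) (sym (ℕP.m+[n∸m]≡n le)))
  (trans (∑-upTo-+ (suc hi) (b ∸ hi) _) (trans (cong₂ _+ᶻ_
    (∑-upTo-cong (suc hi) λ i lt → ι-true (f i) (≤ᵇ-true (ℕP.≤-pred lt)))
    (∑-zero (upTo (b ∸ hi)) λ i → ι-false (f (suc hi + i)) (≤ᵇ-false (s≤s (ℕP.m≤m+n hi i))))) (ℤP.+-identityʳ _)))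

between : ℕ → ℕ → ℕ → Bool
between lo hi i = (lo ≤ᵇ i) ∧ (i ≤ᵇ hi)

-- The substitution i ↦ lo + hi - i traverses the same interval backwards; for lo > hi both sums are
-- empty. It is the elementary move of the Bender-Knuth argument below.
∑-reflect : ∀ {b} lo hi (f : ℕ → ℤ) → hi ≤ b → ∑ (upTo (suc b)) (λ i → ι (between lo hi i) *ᶻ f i) ≡
            ∑ (upTo (suc b)) (λ i → ι (between lo hi i) *ᶻ f (lo + hi ∸ i))
∑-reflect {b} lo hi f le with lo ≤? hi
... | no nle = ∑-cong (upTo (suc b)) λ i → ι-cong (between lo hi i) λ eq →
        ⊥-elim (nle (ℕP.≤-trans (≤ᵇ-sound lo i (proj₁ (∧-true eq))) (≤ᵇ-sound i hi (proj₂ (∧-true {lo ≤ᵇ i} eq)))))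
... | yes lo≤hi = trans (red f) (trans (∑-upTo-rev (suc d) _) (trans (∑-upTo-cong (suc d) λ i lt → cong f (ar i (ℕP.≤-pred lt))) (sym (red _))))
  where
  d = hi ∸ lo
  hi≡ : lo + d ≡ hi
  hi≡ = ℕP.m+[n∸m]≡n lo≤hi
  ar : ∀ i → i ≤ d → lo + (d ∸ i) ≡ lo + hi ∸ (lo + i)
  ar i le′ = trans (sym (ℕP.+-∸-assoc lo le′)) (trans (cong (_∸ i) hi≡) (sym (ℕP.[m+n]∸[m+o]≡n∸o lo hi i)))
  red : ∀ g → ∑ (upTo (suc b)) (λ i → ι (between lo hi i) *ᶻ g i) ≡ ∑ (upTo (suc d)) (λ i → g (lo + i))
  red g = trans (∑-cong (upTo (suc b)) λ i → trans (ι-∧* (lo ≤ᵇ i) (i ≤ᵇ hi) (g i)) (ι-comm (lo ≤ᵇ i) (i ≤ᵇ hi) (g i)))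
    (trans (∑-upTo-restrict (λ i → ι (lo ≤ᵇ i) *ᶻ g i) le)
    (trans (cong (λ z → ∑ (upTo z) (λ i → ι (lo ≤ᵇ i) *ᶻ g i)) (trans (cong suc (sym hi≡)) (sym (ℕP.+-suc lo d))))
    (trans (∑-upTo-+ lo (suc d) _)
    (trans (cong₂ _+ᶻ_ (∑-upTo-zero lo λ i lt → ι-false (g i) (≤ᵇ-false lt)) (∑-cong (upTo (suc d)) λ i → ι-true (g (lo + i)) (≤ᵇ-true (ℕP.m≤m+n lo i))))
      (ℤP.+-identityˡ _)))))

-- Sums over words

words : {A : Set} → List A → ℕ → List (List A)
words xs zero    = [] ∷ []
words xs (suc n) = concatMap (λ x → map (x ∷_) (words xs n)) xs

allLists≡words : ∀ n b → allLists n b ≡ words (upTo (suc b)) n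
allLists≡words zero    b = refl
allLists≡words (suc n) b = cong (λ z → concatMap (λ x → map (x ∷_) z) (upTo (suc b))) (allLists≡words n b)

module _ {A : Set} where
  ∑-words-0 : ∀ (xs : List A) f → ∑ (words xs 0) f ≡ f []
  ∑-words-0 xs f = ∑-one [] f

  ∑-words-suc : ∀ (xs : List A) n f → ∑ (words xs (suc n)) f ≡ ∑ xs (λ x → ∑ (words xs n) (λ w → f (x ∷ w)))
  ∑-words-suc xs n f = trans (∑-concatMap _ xs f) (∑-cong xs λ x → ∑-map (x ∷_) (words xs n) f)

  ∑-words-+ : ∀ (xs : List A) a b f → ∑ (words xs (a + b)) f ≡ ∑ (words xs a) (λ u → ∑ (words xs b) (λ v → f (u ++ v)))
  ∑-words-+ xs zero    b f = sym (∑-words-0 xs _)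
  ∑-words-+ xs (suc a) b f = trans (∑-words-suc xs (a + b) f) (trans (∑-cong xs λ x → ∑-words-+ xs a b (λ w → f (x ∷ w)))
    (sym (∑-words-suc xs a _)))

  ∑-words-cong : ∀ (xs : List A) n {f g} → (∀ w → All (_∈ xs) w → length w ≡ n → f w ≡ g w) → ∑ (words xs n) f ≡ ∑ (words xs n) g
  ∑-words-cong xs zero    eq = trans (∑-one [] _) (trans (eq [] [] refl) (sym (∑-one [] _)))
  ∑-words-cong xs (suc n) eq = trans (∑-words-suc xs n _) (trans
    (∑-cong∈ xs λ x x∈ → ∑-words-cong xs n λ w al len → eq (x ∷ w) (x∈ ∷ al) (cong suc len)) (sym (∑-words-suc xs n _)))

∈-upTo : ∀ {n i} → i ∈ upTo n → i < n
∈-upTo i∈ = lem id _ i∈ (λ j lt → lt)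
  where
  lem : ∀ {N i} (g : ℕ → ℕ) n → i ∈ applyUpTo g n → (∀ j → j < n → g j < N) → i < N
  lem g (suc n) (here refl) h = h 0 (s≤s z≤n)
  lem g (suc n) (there i∈) h = lem (g ∘ suc) n i∈ (λ j lt → h (suc j) (s≤s lt))

∑-letters-cong : ∀ N n {f g} → (∀ w → All (_< N) w → length w ≡ n → f w ≡ g w) → ∑ (words (upTo N) n) f ≡ ∑ (words (upTo N) n) g
∑-letters-cong N n eq = ∑-words-cong (upTo N) n λ w al len → eq w (mapAll al) len
  where mapAll : ∀ {w} → All (_∈ upTo N) w → All (_< N) w
        mapAll []       = []
        mapAll (x ∷ al) = ∈-upTo x ∷ mapAll al

eqL : List ℕ → List ℕ → Bool
eqL []       []       = true
eqL []       (_ ∷ _)  = false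
eqL (_ ∷ _)  []       = false
eqL (x ∷ xs) (y ∷ ys) = (x ≡ᵇ y) ∧ eqL xs ys

eqL-refl : ∀ xs → eqL xs xs ≡ true
eqL-refl []       = refl
eqL-refl (x ∷ xs) = ∧-intro (≡ᵇ-refl x) (eqL-refl xs)

eqL-sound : ∀ xs ys → eqL xs ys ≡ true → xs ≡ ys
eqL-sound []       []       _  = refl
eqL-sound (x ∷ xs) (y ∷ ys) eq = let (a , b) = ∧-true {x ≡ᵇ y} eq in cong₂ _∷_ (≡ᵇ-sound x y a) (eqL-sound xs ys b)

∑-words-delta : ∀ N v (f : List ℕ → ℤ) → All (_< N) v → ∑ (words (upTo N) (length v)) (λ w → ι (eqL v w) *ᶻ f w) ≡ f v
∑-words-delta N []      f _ = trans (∑-words-0 (upTo N) _) (ℤP.*-identityˡ (f []))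
∑-words-delta N (x ∷ v) f (lt ∷ al) = trans (∑-words-suc (upTo N) (length v) _)
  (trans (∑-cong (upTo N) λ y → trans (∑-cong (words (upTo N) (length v)) λ w → ι-∧* (x ≡ᵇ y) (eqL v w) (f (y ∷ w)))
            (trans (∑-* (words (upTo N) (length v)) (ι (x ≡ᵇ y)) _) (cong (ι (x ≡ᵇ y) *ᶻ_) (∑-words-delta N v (λ w → f (y ∷ w)) al))))
  (trans (∑-upTo-delta N x (λ y → f (y ∷ v))) (ι-true _ (<ᵇ-true lt))))

-- Schur coefficient extraction: Φ λ X is the coefficient of x^λ in ∏_{i<j} (1 - x_j / x_i) · X, where X is given
-- by its coefficients; E expands the factors with i = 0.
infixl 9 _▸_
_▸_ : ∀ {n} → (ℤ → Vec ℤ (suc n) → ℤ) → ℤ → ℤ → Vec ℤ n → ℤ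
(K ▸ b) l μ = K l (b V.∷ μ)

E : ∀ {n} → ℤ → Vec ℤ n → (ℤ → Vec ℤ n → ℤ) → ℤ
E l V.[]      K = K l V.[]
E l (b V.∷ v) K = E l v (K ▸ b) -ᶻ E (l +ᶻ pos 1) v (K ▸ (b -ᶻ pos 1))

Φ : ∀ {n} → Vec ℤ n → (Vec ℤ n → ℤ) → ℤ
Φ V.[] X = X V.[]
Φ {suc n} (l V.∷ v) X = E l v (λ l′ μ → Φ {n} μ (λ β → X (l′ V.∷ β)))

-- The arguments at which `E l v` evaluates its continuation. A factor 1 - x_j/x_0 either leaves the
-- exponent alone or moves one unit from the entry of x_j to l.
data Reach : ∀ {n} → ℤ → Vec ℤ n → ℤ → Vec ℤ n → Set where
  stop : ∀ {l} → Reach l V.[] l V.[]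
  keep : ∀ {n l b l′} {v μ : Vec ℤ n} → Reach l v l′ μ → Reach l (b V.∷ v) l′ (b V.∷ μ)
  lower : ∀ {n l b l′} {v μ : Vec ℤ n} → Reach (l +ᶻ pos 1) v l′ μ → Reach l (b V.∷ v) l′ ((b -ᶻ pos 1) V.∷ μ)

E-cong↓ : ∀ {n l} (v : Vec ℤ n) {K K′} → (∀ l′ μ → Reach l v l′ μ → K l′ μ ≡ K′ l′ μ) → E l v K ≡ E l v K′
E-cong↓ V.[]      eq = eq _ _ stop
E-cong↓ (b V.∷ v) eq = cong₂ _-ᶻ_ (E-cong↓ v λ l′ μ r → eq l′ _ (keep r)) (E-cong↓ v λ l′ μ r → eq l′ _ (lower r))

E-cong : ∀ {n l} (v : Vec ℤ n) {K K′} → (∀ l′ μ → K l′ μ ≡ K′ l′ μ) → E l v K ≡ E l v K′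
E-cong v eq = E-cong↓ v λ l′ μ _ → eq l′ μ

E-scale : ∀ {n} {l} (v : Vec ℤ n) c K → E l v (λ l′ μ → c *ᶻ K l′ μ) ≡ c *ᶻ E l v K
E-scale V.[]      c K = refl
E-scale {l = l} (b V.∷ v) c K = trans (cong₂ _-ᶻ_ (E-scale v c (K ▸ b)) (E-scale v c (K ▸ (b -ᶻ pos 1)))) (lem c (E l v (K ▸ b)) (E (l +ᶻ pos 1) v (K ▸ (b -ᶻ pos 1))))
  where lem : ∀ c x y → c *ᶻ x -ᶻ c *ᶻ y ≡ c *ᶻ (x -ᶻ y)
        lem = ℤS.solve-∀

E-+ : ∀ {n l} (v : Vec ℤ n) K K′ → E l v (λ l′ μ → K l′ μ +ᶻ K′ l′ μ) ≡ E l v K +ᶻ E l v K′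
E-+ V.[]      K K′ = refl
E-+ {l = l} (b V.∷ v) K K′ = trans (cong₂ _-ᶻ_ (E-+ v (K ▸ b) (K′ ▸ b)) (E-+ v (K ▸ (b -ᶻ pos 1)) (K′ ▸ (b -ᶻ pos 1))))
  (lem (E l v (K ▸ b)) (E l v (K′ ▸ b)) (E (l +ᶻ pos 1) v (K ▸ (b -ᶻ pos 1))) (E (l +ᶻ pos 1) v (K′ ▸ (b -ᶻ pos 1))))
  where lem : ∀ x y z w → (x +ᶻ y) -ᶻ (z +ᶻ w) ≡ (x -ᶻ z) +ᶻ (y -ᶻ w)
        lem = ℤS.solve-∀

E-minus : ∀ {n l} (v : Vec ℤ n) K K′ → E l v (λ l′ μ → K l′ μ -ᶻ K′ l′ μ) ≡ E l v K -ᶻ E l v K′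
E-minus V.[]      K K′ = refl
E-minus {l = l} (b V.∷ v) K K′ = trans (cong₂ _-ᶻ_ (E-minus v (K ▸ b) (K′ ▸ b)) (E-minus v (K ▸ (b -ᶻ pos 1)) (K′ ▸ (b -ᶻ pos 1))))
  (lem (E l v (K ▸ b)) (E l v (K′ ▸ b)) (E (l +ᶻ pos 1) v (K ▸ (b -ᶻ pos 1))) (E (l +ᶻ pos 1) v (K′ ▸ (b -ᶻ pos 1))))
  where lem : ∀ x y z w → (x -ᶻ y) -ᶻ (z -ᶻ w) ≡ (x -ᶻ z) -ᶻ (y -ᶻ w)
        lem = ℤS.solve-∀

E-neg : ∀ {n l} (v : Vec ℤ n) K → E l v (λ l′ μ → -ᶻ K l′ μ) ≡ -ᶻ E l v K
E-neg V.[]      K = refl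
E-neg {l = l} (b V.∷ v) K = trans (cong₂ _-ᶻ_ (E-neg v (K ▸ b)) (E-neg v (K ▸ (b -ᶻ pos 1)))) (lem (E l v (K ▸ b)) (E (l +ᶻ pos 1) v (K ▸ (b -ᶻ pos 1))))
  where lem : ∀ x y → (-ᶻ x) -ᶻ (-ᶻ y) ≡ -ᶻ (x -ᶻ y)
        lem = ℤS.solve-∀

E-0 : ∀ {n l} (v : Vec ℤ n) → E l v (λ _ _ → pos 0) ≡ pos 0
E-0 V.[]      = refl
E-0 (b V.∷ v) = cong₂ _-ᶻ_ (E-0 v) (E-0 v)

E-zero↓ : ∀ {n l} (v : Vec ℤ n) {K} → (∀ l′ μ → Reach l v l′ μ → K l′ μ ≡ pos 0) → E l v K ≡ pos 0
E-zero↓ v eq = trans (E-cong↓ v eq) (E-0 v)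

E-∑ : ∀ {A : Set} {n l} (v : Vec ℤ n) (xs : List A) (K : A → ℤ → Vec ℤ n → ℤ) →
      E l v (λ l′ μ → ∑ xs (λ x → K x l′ μ)) ≡ ∑ xs (λ x → E l v (K x))
E-∑ v []       K = trans (trans (E-cong v λ _ _ → ∑-[] _) (E-0 v)) (sym (∑-[] _))
E-∑ v (x ∷ xs) K = trans (E-cong v λ _ _ → ∑-∷ x xs _) (trans (E-+ v _ _) (trans (cong (E _ v (K x) +ᶻ_) (E-∑ v xs K)) (sym (∑-∷ x xs _))))

Φ-cong : ∀ {n} (v : Vec ℤ n) {X Y} → (∀ β → X β ≡ Y β) → Φ v X ≡ Φ v Y
Φ-cong V.[] eq = eq V.[]
Φ-cong {suc n} (l V.∷ v) eq = E-cong v λ l′ μ → Φ-cong {n} μ λ β → eq (l′ V.∷ β)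

Φ-scale : ∀ {n} (v : Vec ℤ n) c X → Φ v (λ β → c *ᶻ X β) ≡ c *ᶻ Φ v X
Φ-scale V.[] c X = refl
Φ-scale {suc n} (l V.∷ v) c X = trans (E-cong v λ l′ μ → Φ-scale {n} μ c _) (E-scale v c _)

Φ-∑ : ∀ {A : Set} {n} (v : Vec ℤ n) (xs : List A) (X : A → Vec ℤ n → ℤ) → Φ v (λ β → ∑ xs (λ x → X x β)) ≡ ∑ xs (λ x → Φ v (X x))
Φ-∑ V.[] xs X = refl
Φ-∑ {n = suc n} (l V.∷ v) xs X = trans (E-cong v λ l′ μ → Φ-∑ {n = n} μ xs _) (E-∑ v xs _)

Φ-minus : ∀ {n} (v : Vec ℤ n) X Y → Φ v (λ β → X β -ᶻ Y β) ≡ Φ v X -ᶻ Φ v Y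
Φ-minus V.[] X Y = refl
Φ-minus {suc n} (l V.∷ v) X Y = trans (E-cong v λ l′ μ → Φ-minus {n} μ _ _) (E-minus v _ _)

swapV : {A : Set} {n : ℕ} → ℕ → Vec A n → Vec A n
swapV zero    (a V.∷ b V.∷ v) = b V.∷ a V.∷ v
swapV (suc k) (a V.∷ v)       = a V.∷ swapV k v
swapV _       v               = v

-- The dot action v ↦ s(v + ρ) - ρ of a simple transposition s, with ρ = (n - 1, ..., 1, 0).
dotSwap : ∀ {n} → ℕ → Vec ℤ n → Vec ℤ n
dotSwap zero    (a V.∷ b V.∷ v) = (b -ᶻ pos 1) V.∷ (a +ᶻ pos 1) V.∷ v
dotSwap (suc k) (a V.∷ v)       = a V.∷ dotSwap k v
dotSwap _       v               = v

SymZ : ∀ {n} → (Vec ℤ n → ℤ) → Set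
SymZ X = ∀ k v → X (swapV k v) ≡ X v

private
  +1-1 : ∀ a → (a +ᶻ pos 1) -ᶻ pos 1 ≡ a
  +1-1 = ℤS.solve-∀
  -1+1 : ∀ a → (a -ᶻ pos 1) +ᶻ pos 1 ≡ a
  -1+1 = ℤS.solve-∀

-- The two entries involved can be lowered in four ways. Lowering is compatible with the dot action
-- except that the two mixed cases change places, and every term takes a sign from the continuation.
E-dotSwap : ∀ {n l} k (v : Vec ℤ n) K → suc k < n → (∀ l′ μ → K l′ (dotSwap k μ) ≡ -ᶻ K l′ μ) →
            E l (dotSwap k v) K ≡ -ᶻ E l v K
E-dotSwap {l = l} zero (a V.∷ b V.∷ v) K _ anti = trans
  (cong₂ _-ᶻ_ (cong₂ _-ᶻ_ (tr l a b (b -ᶻ pos 1) (a +ᶻ pos 1) refl refl)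
                          (tr (l +ᶻ pos 1) (a -ᶻ pos 1) b (b -ᶻ pos 1) ((a +ᶻ pos 1) -ᶻ pos 1) refl (trans (+1-1 a) (sym (-1+1 a)))))
              (cong₂ _-ᶻ_ (tr (l +ᶻ pos 1) a (b -ᶻ pos 1) ((b -ᶻ pos 1) -ᶻ pos 1) (a +ᶻ pos 1) refl refl)
                          (tr ((l +ᶻ pos 1) +ᶻ pos 1) (a -ᶻ pos 1) (b -ᶻ pos 1) ((b -ᶻ pos 1) -ᶻ pos 1) ((a +ᶻ pos 1) -ᶻ pos 1) refl (trans (+1-1 a) (sym (-1+1 a))))))
  (lem (T l a b) (T (l +ᶻ pos 1) (a -ᶻ pos 1) b) (T (l +ᶻ pos 1) a (b -ᶻ pos 1)) (T ((l +ᶻ pos 1) +ᶻ pos 1) (a -ᶻ pos 1) (b -ᶻ pos 1)))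
  where
  T : ℤ → ℤ → ℤ → ℤ
  T l a b = E l v (λ l′ μ → K l′ (a V.∷ b V.∷ μ))
  tr : ∀ l a b a′ b′ → a′ ≡ b -ᶻ pos 1 → b′ ≡ a +ᶻ pos 1 → T l a′ b′ ≡ -ᶻ T l a b
  tr l a b _ _ refl refl = trans (E-cong v λ l′ μ → anti l′ (a V.∷ b V.∷ μ)) (E-neg v _)
  lem : ∀ x y z w → ((-ᶻ x) -ᶻ (-ᶻ y)) -ᶻ ((-ᶻ z) -ᶻ (-ᶻ w)) ≡ -ᶻ ((x -ᶻ z) -ᶻ (y -ᶻ w))
  lem = ℤS.solve-∀
E-dotSwap {l = l} (suc k) (a V.∷ v) K (s≤s lt) anti = trans
  (cong₂ _-ᶻ_ (E-dotSwap k v (K ▸ a) lt λ l′ μ → anti l′ (a V.∷ μ)) (E-dotSwap k v (K ▸ (a -ᶻ pos 1)) lt λ l′ μ → anti l′ ((a -ᶻ pos 1) V.∷ μ)))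
  (lem (E l v (K ▸ a)) (E (l +ᶻ pos 1) v (K ▸ (a -ᶻ pos 1))))
  where lem : ∀ x y → (-ᶻ x) -ᶻ (-ᶻ y) ≡ -ᶻ (x -ᶻ y)
        lem = ℤS.solve-∀
E-dotSwap {n = suc zero} zero (a V.∷ V.[]) K (s≤s ()) anti

-- An entry is lowered for neither, one or both of the two front variables, and the resulting
-- exponents do not depend on which front variable is treated first.
E-comm : ∀ {n} a b (v : Vec ℤ n) (G : ℤ → ℤ → Vec ℤ n → ℤ) →
         E a v (λ a′ μ → E b μ (λ b′ θ → G a′ b′ θ)) ≡ E b v (λ b′ μ → E a μ (λ a′ θ → G a′ b′ θ))
E-comm a b V.[]      G = refl
E-comm {suc n} a b (c V.∷ v) G = trans (cong₂ _-ᶻ_ (E-minus v (M a b c) (M a (b +ᶻ pos 1) c₁)) (E-minus v (M a b c₁) (M a (b +ᶻ pos 1) c₂)))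
  (trans (lem (T a b c) (T a (b +ᶻ pos 1) c₁) (T (a +ᶻ pos 1) b c₁) (T (a +ᶻ pos 1) (b +ᶻ pos 1) c₂))
  (trans (cong₂ _-ᶻ_ (cong₂ _-ᶻ_ (E-comm a b v _) (E-comm (a +ᶻ pos 1) b v _)) (cong₂ _-ᶻ_ (E-comm a (b +ᶻ pos 1) v _) (E-comm (a +ᶻ pos 1) (b +ᶻ pos 1) v _)))
  (sym (cong₂ _-ᶻ_ (E-minus v (M′ a c) (M′ (a +ᶻ pos 1) c₁)) (E-minus v (M′ a c₁) (M′ (a +ᶻ pos 1) c₂))))))
  where
  c₁ = c -ᶻ pos 1
  c₂ = c₁ -ᶻ pos 1
  M : ℤ → ℤ → ℤ → ℤ → Vec ℤ n → ℤ
  M a b c a′ μ = E b μ (λ b′ θ → G a′ b′ (c V.∷ θ))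
  M′ : ℤ → ℤ → ℤ → Vec ℤ n → ℤ
  M′ a c b′ μ = E a μ (λ a′ θ → G a′ b′ (c V.∷ θ))
  T : ℤ → ℤ → ℤ → ℤ
  T a b c = E a v (M a b c)
  lem : ∀ x y z w → (x -ᶻ y) -ᶻ (z -ᶻ w) ≡ (x -ᶻ z) -ᶻ (y -ᶻ w)
  lem = ℤS.solve-∀

-- For the first two entries, all factors but 1 - x_1/x_0 give an expression `T a b`, symmetric
-- because the two operators `E` commute and X is symmetric. The last factor turns it into `T a b`
-- minus `T` at (a + 1, b - 1), and the dot action exchanges these two terms. For later entries the
-- sign passes through `E`.
Φ-dotSwap : ∀ {n} k (v : Vec ℤ n) X → suc k < n → SymZ X → Φ (dotSwap k v) X ≡ -ᶻ Φ v X
Φ-dotSwap {suc (suc n)} zero (a V.∷ b V.∷ v) X _ sy = begin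
  T (b -ᶻ pos 1) (a +ᶻ pos 1) -ᶻ T ((b -ᶻ pos 1) +ᶻ pos 1) ((a +ᶻ pos 1) -ᶻ pos 1)
    ≡⟨ cong₂ (λ x y → T (b -ᶻ pos 1) (a +ᶻ pos 1) -ᶻ T x y) (-1+1 b) (+1-1 a) ⟩
  T (b -ᶻ pos 1) (a +ᶻ pos 1) -ᶻ T b a
    ≡⟨ cong₂ _-ᶻ_ (Tsym (b -ᶻ pos 1) (a +ᶻ pos 1)) (Tsym b a) ⟩
  T (a +ᶻ pos 1) (b -ᶻ pos 1) -ᶻ T a b
    ≡⟨ lem (T (a +ᶻ pos 1) (b -ᶻ pos 1)) (T a b) ⟩
  -ᶻ (T a b -ᶻ T (a +ᶻ pos 1) (b -ᶻ pos 1)) ∎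
  where
  open ≡-Reasoning
  T : ℤ → ℤ → ℤ
  T a b = E a v (λ a′ μ → E b μ (λ b′ θ → Φ θ (λ β → X (a′ V.∷ b′ V.∷ β))))
  Tsym : ∀ a b → T a b ≡ T b a
  Tsym a b = trans (E-comm a b v _) (E-cong v λ b′ μ → E-cong μ λ a′ θ → Φ-cong θ λ β → sy 0 (b′ V.∷ a′ V.∷ β))
  lem : ∀ x y → x -ᶻ y ≡ -ᶻ (y -ᶻ x)
  lem = ℤS.solve-∀
Φ-dotSwap {suc n} (suc k) (a V.∷ v) X (s≤s lt) sy =
  E-dotSwap k v _ lt λ l′ μ → Φ-dotSwap {n} k μ _ lt λ j β → sy (suc j) (l′ V.∷ β)
Φ-dotSwap {suc zero} zero (a V.∷ V.[]) X (s≤s ()) sy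

Φ-fixed : ∀ {n} k (v : Vec ℤ n) X → suc k < n → SymZ X → dotSwap k v ≡ v → Φ v X ≡ pos 0
Φ-fixed k v X lt sy fx = x≡-x _ (trans (cong (λ z → Φ z X) (sym fx)) (Φ-dotSwap k v X lt sy))
  where x≡-x : ∀ x → x ≡ -ᶻ x → x ≡ pos 0
        x≡-x (pos zero)    _  = refl
        x≡-x (pos (suc n)) ()
        x≡-x (negsuc n)    ()

-- `wtZ v` is Σ i·v_i with positions counted from 0. Each factor of the product moves units towards
-- the front, so it preserves `sumZ` and does not raise `wtZ`: this makes the functional triangular.
sumZ wtZ : ∀ {n} → Vec ℤ n → ℤ
sumZ V.[]      = pos 0
sumZ (b V.∷ v) = b +ᶻ sumZ v
wtZ V.[]      = pos 0
wtZ (b V.∷ v) = sumZ v +ᶻ wtZ v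

Reach-sum : ∀ {n l l′} {v μ : Vec ℤ n} → Reach l v l′ μ → l′ +ᶻ sumZ μ ≡ l +ᶻ sumZ v
Reach-sum stop = refl
Reach-sum {l = l} {l′} {b V.∷ v} {_ V.∷ μ} (keep r) = trans (lem l′ b (sumZ μ)) (trans (cong (b +ᶻ_) (Reach-sum r)) (sym (lem l b (sumZ v))))
  where lem : ∀ l b z → l +ᶻ (b +ᶻ z) ≡ b +ᶻ (l +ᶻ z)
        lem = ℤS.solve-∀
Reach-sum {l = l} {l′} {b V.∷ v} {_ V.∷ μ} (lower r) = trans (lem l′ b (sumZ μ)) (trans (cong ((b -ᶻ pos 1) +ᶻ_) (Reach-sum r)) (lem₂ l b (sumZ v)))
  where lem : ∀ l b z → l +ᶻ ((b -ᶻ pos 1) +ᶻ z) ≡ (b -ᶻ pos 1) +ᶻ (l +ᶻ z)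
        lem = ℤS.solve-∀
        lem₂ : ∀ l b z → (b -ᶻ pos 1) +ᶻ ((l +ᶻ pos 1) +ᶻ z) ≡ l +ᶻ (b +ᶻ z)
        lem₂ = ℤS.solve-∀

l<l+1 : ∀ l → l I.< l +ᶻ pos 1
l<l+1 l = subst₂ I._<_ (ℤP.+-identityʳ l) refl (ℤP.+-monoʳ-< l (I.+<+ (s≤s z≤n)))

Reach-≤ : ∀ {n l l′} {v μ : Vec ℤ n} → Reach l v l′ μ → l I.≤ l′
Reach-≤ stop     = ℤP.≤-refl
Reach-≤ (keep r) = Reach-≤ r
Reach-≤ {l = l} (lower r) = ℤP.≤-trans (ℤP.<⇒≤ (l<l+1 l)) (Reach-≤ r)

tot-≤ : ∀ {a a′ x y} → a′ +ᶻ x ≡ a +ᶻ y → a I.≤ a′ → x I.≤ y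
tot-≤ {a} {a′} {x} {y} eq le = ℤP.≮⇒≥ λ lt → ℤP.<-irrefl (sym eq) (ℤP.+-mono-≤-< le lt)

tot-< : ∀ {a a′ x y} → a′ +ᶻ x ≡ a +ᶻ y → a I.< a′ → x I.< y
tot-< {a} {a′} {x} {y} eq lt = ℤP.≰⇒> λ le → ℤP.<-irrefl (sym eq) (ℤP.+-mono-<-≤ lt le)

Reach-wt : ∀ {n l l′} {v μ : Vec ℤ n} → Reach l v l′ μ → wtZ μ I.≤ wtZ v
Reach-wt stop     = ℤP.≤-refl
Reach-wt (keep r) = ℤP.+-mono-≤ (tot-≤ (Reach-sum r) (Reach-≤ r)) (Reach-wt r)
Reach-wt (lower r) = ℤP.+-mono-≤ (tot-≤ (Reach-sum r) (Reach-≤ r)) (Reach-wt r)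

-- Only the choice of 1 from every factor leaves l unchanged; every other choice raises it, and
-- there the continuation vanishes.
E-lead : ∀ {n l} (v : Vec ℤ n) K → (∀ l′ μ → Reach l v l′ μ → l I.< l′ → K l′ μ ≡ pos 0) → E l v K ≡ K l v
E-lead V.[]      K z = refl
E-lead {l = l} (b V.∷ v) K z = trans (cong₂ _-ᶻ_ (E-lead v _ λ l′ μ r lt → z l′ _ (keep r) lt)
  (E-zero↓ v λ l′ μ r → z l′ _ (lower r) (ℤP.<-≤-trans (l<l+1 l) (Reach-≤ r)))) (ℤP.+-identityʳ _)

Φ-zero : ∀ {n} (v : Vec ℤ n) X → (∀ γ → sumZ γ ≡ sumZ v → wtZ γ I.≤ wtZ v → X γ ≡ pos 0) → Φ v X ≡ pos 0
Φ-zero V.[] X z = z V.[] refl ℤP.≤-refl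
Φ-zero {suc n} (l V.∷ v) X z = E-zero↓ v λ l′ μ r → Φ-zero {n} μ _ λ γ sm wt →
  z (l′ V.∷ γ) (trans (cong (l′ +ᶻ_) sm) (Reach-sum r))
    (ℤP.+-mono-≤ (ℤP.≤-trans (ℤP.≤-reflexive sm) (tot-≤ (Reach-sum r) (Reach-≤ r))) (ℤP.≤-trans wt (Reach-wt r)))

-- Apart from `X v`, only coefficients at exponents of the same total and strictly smaller weight
-- enter.
Φ-lead : ∀ {n} (v : Vec ℤ n) X → (∀ γ → sumZ γ ≡ sumZ v → wtZ γ I.< wtZ v → X γ ≡ pos 0) → Φ v X ≡ X v
Φ-lead V.[] X z = refl
Φ-lead {suc n} (l V.∷ v) X z = trans
  (E-lead v _ λ l′ μ r lt → Φ-zero {n} μ _ λ γ sm wt →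
    z (l′ V.∷ γ) (trans (cong (l′ +ᶻ_) sm) (Reach-sum r))
      (ℤP.+-mono-<-≤ (ℤP.≤-<-trans (ℤP.≤-reflexive sm) (tot-< (Reach-sum r) lt)) (ℤP.≤-trans wt (Reach-wt r))))
  (Φ-lead {n} v _ λ γ sm wt → z (l V.∷ γ) (cong (l +ᶻ_) sm) (ℤP.+-mono-≤-< (ℤP.≤-reflexive sm) wt))

-- Branching and symmetry of Schur polynomials

hd : List ℕ → ℕ
hd []      = 0
hd (k ∷ _) = k

-- κ/μ is a horizontal strip. Here μ is written with as many entries as κ, so it may end in zeros;
-- the row below the last counts as 0.
il : List ℕ → List ℕ → Bool
il []      []      = true
il (k ∷ κ) (j ∷ μ) = (hd κ ≤ᵇ j) ∧ ((j ≤ᵇ k) ∧ il κ μ)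
il _       _       = false

allZ : List ℕ → Bool
allZ []      = true
allZ (k ∷ κ) = (k ≡ᵇ 0) ∧ allZ κ

il-size : ∀ κ μ → il κ μ ≡ true → size μ ≤ size κ
il-size []      []      _  = z≤n
il-size (k ∷ κ) (j ∷ μ) eq = let (_ , b) = ∧-true {hd κ ≤ᵇ j} eq ; (c , d) = ∧-true {j ≤ᵇ k} b in
  ℕP.+-mono-≤ (≤ᵇ-sound j k c) (il-size κ μ d)

swapL : {A : Set} → ℕ → List A → List A
swapL zero    (a ∷ b ∷ v) = b ∷ a ∷ v
swapL (suc k) (a ∷ v)     = a ∷ swapL k v
swapL _       v           = v

Sym : {A : Set} → List (List A) → Set
Sym M = ∀ k f → ∑ M (λ v → f (swapL k v)) ≡ ∑ M f

actL : {A : Set} → List ℕ → List A → List A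
actL []       v = v
actL (k ∷ ks) v = actL ks (swapL k v)

actL-++ : {A : Set} (ks js : List ℕ) (v : List A) → actL (ks ++ js) v ≡ actL js (actL ks v)
actL-++ []       js v = refl
actL-++ (k ∷ ks) js v = actL-++ ks js (swapL k v)

actL-suc : {A : Set} (ks : List ℕ) (x : A) (v : List A) → actL (map suc ks) (x ∷ v) ≡ x ∷ actL ks v
actL-suc []       x v = refl
actL-suc (k ∷ ks) x v = actL-suc ks x (swapL k v)

actL-rot : {A : Set} (x : A) (v : List A) → actL (upTo (length v)) (x ∷ v) ≡ v ∷ʳ x
actL-rot x []      = refl
actL-rot x (y ∷ v) = trans (cong (λ z → actL z (y ∷ x ∷ v)) (sym (LP.map-upTo suc (length v))))
  (trans (actL-suc (upTo (length v)) y (x ∷ v)) (cong (y ∷_) (actL-rot x v)))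

revSwaps : ℕ → List ℕ
revSwaps zero    = []
revSwaps (suc n) = map suc (revSwaps n) ++ upTo n

actL-length : {A : Set} (ks : List ℕ) (v : List A) → length (actL ks v) ≡ length v
actL-length []       v = refl
actL-length (k ∷ ks) v = trans (actL-length ks (swapL k v)) (swapL-length k v)
  where
  swapL-length : ∀ {A : Set} k (v : List A) → length (swapL k v) ≡ length v
  swapL-length zero    []          = refl
  swapL-length zero    (_ ∷ [])    = refl
  swapL-length zero    (_ ∷ _ ∷ _) = refl
  swapL-length (suc k) []          = refl
  swapL-length (suc k) (x ∷ v)     = cong suc (swapL-length k v)

actL-rev : {A : Set} (v : List A) → actL (revSwaps (length v)) v ≡ reverse v
actL-rev []      = refl
actL-rev (x ∷ v) = trans (actL-++ (map suc (revSwaps n)) (upTo n) (x ∷ v))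
  (trans (cong (actL (upTo n)) (actL-suc (revSwaps n) x v))
  (trans (cong (λ z → actL (upTo z) (x ∷ actL (revSwaps n) v)) (sym (actL-length (revSwaps n) v)))
  (trans (actL-rot x (actL (revSwaps n) v)) (trans (cong (_∷ʳ x) (actL-rev v)) (sym (LP.unfold-reverse x v))))))
  where n = length v

∑-actL : ∀ {A : Set} (M : List (List A)) → Sym M → ∀ ks f → ∑ M (λ v → f (actL ks v)) ≡ ∑ M f
∑-actL M sy []       f = refl
∑-actL M sy (k ∷ ks) f = trans (sy k (λ v → f (actL ks v))) (∑-actL M sy ks f)

-- Reversal is a product of adjacent transpositions, spelt out in `revSwaps`. It is needed because
-- Gelfand-Tsetlin patterns produce the exponents from the largest variable downwards.
∑-reverse : ∀ {A : Set} (M : List (List A)) n → Sym M → (∀ v → v ∈ M → length v ≡ n) → ∀ f → ∑ M (λ v → f (reverse v)) ≡ ∑ M f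
∑-reverse M n sy len f = trans (∑-cong∈ M λ v v∈ → cong f (trans (sym (actL-rev v)) (cong (λ z → actL (revSwaps z) v) (len v v∈))))
  (∑-actL M sy (revSwaps n) f)

module GT (B : ℕ) where

  Box : ℕ → List (List ℕ)
  Box n = words (upTo (suc B)) n

  Bdd : List ℕ → Set
  Bdd = All (_< suc B)

  Box-cong : ∀ n {f g} → (∀ w → Bdd w → length w ≡ n → f w ≡ g w) → ∑ (Box n) f ≡ ∑ (Box n) g
  Box-cong n eq = ∑-letters-cong (suc B) n eq

  -- Exponent vectors of the Schur polynomial of κ, largest variable first (Gelfand–Tsetlin patterns).
  RL : ℕ → List ℕ → List (List ℕ)
  RL zero    κ = if allZ κ then [] ∷ [] else []
  RL (suc N) κ = concatMap (λ μ → map ((size κ ∸ size μ) ∷_) (RL N μ)) (filterᵇ (il κ) (Box (length κ)))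

  ∑-RL-0 : ∀ κ f → ∑ (RL 0 κ) f ≡ ι (allZ κ) *ᶻ f []
  ∑-RL-0 κ f with allZ κ
  ... | true  = trans (∑-one [] f) (sym (ℤP.*-identityˡ (f [])))
  ... | false = ∑-[] f

  ∑-RL-suc : ∀ N κ f → ∑ (RL (suc N) κ) f ≡
    ∑ (Box (length κ)) (λ μ → ι (il κ μ) *ᶻ ∑ (RL N μ) (λ β → f ((size κ ∸ size μ) ∷ β)))
  ∑-RL-suc N κ f = trans (∑-concatMap _ (filterᵇ (il κ) (Box (length κ))) f) (trans (∑-filter (il κ) (Box (length κ)) _)
    (∑-cong (Box (length κ)) λ μ → cong (ι (il κ μ) *ᶻ_) (∑-map _ (RL N μ) f)))

  -- Two-step branching κ ⊇ μ ⊇ η; reflecting each entry of μ in its interval exchanges the first two exponents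
  -- (Bender–Knuth), which gives the symmetry of RL.
  mid : ℕ → List ℕ → List ℕ → (ℤ → ℤ) → ℤ
  mid c κ η F = ∑ (Box (length κ)) (λ μ → ι (hd μ ≤ᵇ c) *ᶻ (ι (il κ μ) *ᶻ (ι (il μ η) *ᶻ F (pos (size μ)))))

  -- The sum of both ends of all intervals in which the entries of μ move. The lower end max(κ₂, η₁)
  -- of one interval and the upper end min(κ₂, η₁) of the next add up to κ₂ + η₁, so only the first
  -- upper end min(κ₁, c) stays visible.
  total : ℕ → List ℕ → List ℕ → ℕ
  total c []      η = size η
  total c (k ∷ κ) η = (k ⊓ c) + size κ + size η

  mid-cong : ∀ c κ η {F G} → (∀ z → F z ≡ G z) → mid c κ η F ≡ mid c κ η G
  mid-cong c κ η eq = ∑-cong (Box (length κ)) λ μ → cong (λ z → ι (hd μ ≤ᵇ c) *ᶻ (ι (il κ μ) *ᶻ (ι (il μ η) *ᶻ z))) (eq _)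

  le-max : ∀ a b c → ((a ⊔ b) ≤ᵇ c) ≡ ((a ≤ᵇ c) ∧ (b ≤ᵇ c))
  le-max a b c = bool-iff (λ eq → let le = ≤ᵇ-sound (a ⊔ b) c eq in ∧-intro (≤ᵇ-true (ℕP.m⊔n≤o⇒m≤o a b le)) (≤ᵇ-true (ℕP.m⊔n≤o⇒n≤o a b le)))
    (λ eq → let (x , y) = ∧-true {a ≤ᵇ c} eq in ≤ᵇ-true (ℕP.⊔-lub (≤ᵇ-sound a c x) (≤ᵇ-sound b c y)))

  le-min : ∀ a b c → (c ≤ᵇ (a ⊓ b)) ≡ ((c ≤ᵇ a) ∧ (c ≤ᵇ b))
  le-min a b c = bool-iff (λ eq → let le = ≤ᵇ-sound c (a ⊓ b) eq in ∧-intro (≤ᵇ-true (ℕP.≤-trans le (ℕP.m⊓n≤m a b))) (≤ᵇ-true (ℕP.≤-trans le (ℕP.m⊓n≤n a b))))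
    (λ eq → let (x , y) = ∧-true {c ≤ᵇ a} eq in ≤ᵇ-true (ℕP.⊓-glb (≤ᵇ-sound c a x) (≤ᵇ-sound c b y)))

  -- The first entry of μ ranges from max(κ₂, η₁) to min(κ₁, c). The condition that the second entry
  -- be at most η₁ is taken over by the parameter c of the remaining sum, so the entries vary
  -- independently.
  mid-suc : ∀ c k κ e₁ η F → mid c (k ∷ κ) (e₁ ∷ η) F ≡
    ∑ (upTo (suc B)) (λ j → ι (between (hd κ ⊔ e₁) (k ⊓ c) j) *ᶻ mid e₁ κ η (λ z → F (pos j +ᶻ z)))
  mid-suc c k κ e₁ η F = trans (∑-words-suc (upTo (suc B)) (length κ) _) (∑-cong (upTo (suc B)) λ j →
    trans (∑-cong (Box (length κ)) λ μ → step j μ) (∑-* (Box (length κ)) (ι (between (hd κ ⊔ e₁) (k ⊓ c) j)) _))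
    where
    ring : ∀ a b c d x y z w f → a *ᶻ ((b *ᶻ (c *ᶻ d)) *ᶻ ((x *ᶻ (y *ᶻ z)) *ᶻ f)) ≡ ((b *ᶻ y) *ᶻ (c *ᶻ a)) *ᶻ (x *ᶻ (d *ᶻ (z *ᶻ f)))
    ring = ℤS.solve-∀
    i3 : ∀ a b c → ι (a ∧ (b ∧ c)) ≡ ι a *ᶻ (ι b *ᶻ ι c)
    i3 a b c = trans (ι-∧ a (b ∧ c)) (cong (ι a *ᶻ_) (ι-∧ b c))
    step : ∀ j μ → ι (j ≤ᵇ c) *ᶻ (ι (il (k ∷ κ) (j ∷ μ)) *ᶻ (ι (il (j ∷ μ) (e₁ ∷ η)) *ᶻ F (pos (j + size μ)))) ≡
           ι (between (hd κ ⊔ e₁) (k ⊓ c) j) *ᶻ (ι (hd μ ≤ᵇ e₁) *ᶻ (ι (il κ μ) *ᶻ (ι (il μ η) *ᶻ F (pos j +ᶻ pos (size μ)))))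
    step j μ = trans (cong₂ (λ x y → ι (j ≤ᵇ c) *ᶻ (x *ᶻ (y *ᶻ F (pos (j + size μ))))) (i3 (hd κ ≤ᵇ j) (j ≤ᵇ k) (il κ μ)) (i3 (hd μ ≤ᵇ e₁) (e₁ ≤ᵇ j) (il μ η)))
      (trans (ring (ι (j ≤ᵇ c)) (ι (hd κ ≤ᵇ j)) (ι (j ≤ᵇ k)) (ι (il κ μ)) (ι (hd μ ≤ᵇ e₁)) (ι (e₁ ≤ᵇ j)) (ι (il μ η)) (pos 0) (F (pos (j + size μ))))
        (cong (_*ᶻ (ι (hd μ ≤ᵇ e₁) *ᶻ (ι (il κ μ) *ᶻ (ι (il μ η) *ᶻ F (pos (j + size μ))))))
          (sym (trans (ι-∧ ((hd κ ⊔ e₁) ≤ᵇ j) (j ≤ᵇ (k ⊓ c))) (cong₂ _*ᶻ_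
            (trans (cong ι (le-max (hd κ) e₁ j)) (ι-∧ (hd κ ≤ᵇ j) (e₁ ≤ᵇ j))) (trans (cong ι (le-min k c j)) (ι-∧ (j ≤ᵇ k) (j ≤ᵇ c))))))))

  -- Reflect the first entry in its interval and the others by induction, with F translated by the
  -- first entry; the reflection constants add up to `total`.
  mid-reflect : ∀ c κ η F → Bdd κ → length η ≡ length κ → mid c κ η F ≡ mid c κ η (λ z → F (pos (total c κ η) -ᶻ z))
  mid-reflect c [] [] F bd len = mid-cong₀
    where mid-cong₀ : mid c [] [] F ≡ mid c [] [] (λ z → F (pos 0 -ᶻ z))
          mid-cong₀ = trans (∑-one [] _) (sym (∑-one [] _))
  mid-reflect c (k ∷ κ) (e₁ ∷ η) F (k<B ∷ bd) len = trans (mid-suc c k κ e₁ η F)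
    (trans (∑-reflect lo hi (λ j → mid e₁ κ η (λ z → F (pos j +ᶻ z))) (ℕP.≤-trans (ℕP.m⊓n≤m k c) (ℕP.≤-pred k<B)))
    (trans (∑-cong (upTo (suc B)) λ j → ι-cong (between lo hi j) λ eq → step j (≤ᵇ-sound j hi (proj₂ (∧-true {lo ≤ᵇ j} eq))))
    (sym (mid-suc c k κ e₁ η (λ z → F (pos (total c (k ∷ κ) (e₁ ∷ η)) -ᶻ z))))))
    where
    lo = hd κ ⊔ e₁
    hi = k ⊓ c
    ma : ∀ a b → (a ⊔ b) + (a ⊓ b) ≡ a + b
    ma a b with ℕP.≤-total a b
    ... | inj₁ le = trans (cong₂ _+_ (ℕP.m≤n⇒m⊔n≡n le) (ℕP.m≤n⇒m⊓n≡m le)) (ℕP.+-comm b a)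
    ... | inj₂ le = cong₂ _+_ (ℕP.m≥n⇒m⊔n≡m le) (ℕP.m≥n⇒m⊓n≡n le)
    tot : lo + hi + total e₁ κ η ≡ total c (k ∷ κ) (e₁ ∷ η)
    tot = go κ
      where
      ar1 : ∀ a b c → a + b + c ≡ b + 0 + (a + c)
      ar1 = ℕS.solve-∀
      ar2 : ∀ a b c d f → a + b + (c + d + f) ≡ b + (a + c + d) + f
      ar2 = ℕS.solve-∀
      ar3 : ∀ b k₂ g d f → b + (k₂ + g + d) + f ≡ b + (k₂ + d) + (g + f)
      ar3 = ℕS.solve-∀
      go : ∀ κ → (hd κ ⊔ e₁) + hi + total e₁ κ η ≡ hi + size κ + (e₁ + size η)
      go []       = ar1 e₁ hi (size η)
      go (k₂ ∷ κ) = trans (ar2 (k₂ ⊔ e₁) hi (k₂ ⊓ e₁) (size κ) (size η)) (trans (cong (λ z → hi + (z + size κ) + size η) (ma k₂ e₁)) (ar3 hi k₂ e₁ (size κ) (size η)))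
    zring : ∀ a j t z → (a -ᶻ j) +ᶻ (t -ᶻ z) ≡ (a +ᶻ t) -ᶻ (j +ᶻ z)
    zring = ℤS.solve-∀
    step : ∀ j → j ≤ hi → mid e₁ κ η (λ z → F (pos (lo + hi ∸ j) +ᶻ z)) ≡ mid e₁ κ η (λ z → F (pos (total c (k ∷ κ) (e₁ ∷ η)) -ᶻ (pos j +ᶻ z)))
    step j le = trans (mid-reflect e₁ κ η (λ z → F (pos (lo + hi ∸ j) +ᶻ z)) bd (ℕP.suc-injective len)) (mid-cong e₁ κ η λ z → cong F
      (trans (cong (_+ᶻ (pos (total e₁ κ η) -ᶻ z)) (sym (trans (ℤP.m-n≡m⊖n (lo + hi) j) (ℤP.⊖-≥ (ℕP.≤-trans le (ℕP.m≤n+m hi lo))))))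
      (trans (zring (pos (lo + hi)) (pos j) (pos (total e₁ κ η)) z) (cong (λ y → pos y -ᶻ (pos j +ᶻ z)) tot))))

  -- When c bounds all of κ, `total` is |κ| + |η|, so reflection sends |μ| to |κ| + |η| - |μ|. This
  -- exchanges |κ| - |μ| and |μ| - |η|, the exponents of the two variables removed.
  two-step : ∀ κ (g : ℕ → ℕ → List ℕ → ℤ) → Bdd κ →
    ∑ (Box (length κ)) (λ μ → ι (il κ μ) *ᶻ ∑ (Box (length κ)) (λ η → ι (il μ η) *ᶻ g (size κ ∸ size μ) (size μ ∸ size η) η)) ≡
    ∑ (Box (length κ)) (λ μ → ι (il κ μ) *ᶻ ∑ (Box (length κ)) (λ η → ι (il μ η) *ᶻ g (size μ ∸ size η) (size κ ∸ size μ) η))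
  two-step κ g bd = trans (toMid g) (trans (∑-words-cong (upTo (suc B)) n λ η _ len →
      trans (mid-reflect B κ η (Fn g η) bd len) (mid-cong B κ η λ z → cong₂ (λ x y → g I.∣ x ∣ I.∣ y ∣ η) (r₁ z η) (r₂ z η)))
    (sym (toMid (λ a b → g b a))))
    where
    n = length κ
    Fn : (ℕ → ℕ → List ℕ → ℤ) → List ℕ → ℤ → ℤ
    Fn g η z = g I.∣ pos (size κ) -ᶻ z ∣ I.∣ z -ᶻ pos (size η) ∣ η
    totB : ∀ κ η → Bdd κ → total B κ η ≡ size κ + size η
    totB []      η _        = refl
    totB (k ∷ κ) η (lt ∷ _) = cong (λ z → z + size κ + size η) (ℕP.m≤n⇒m⊓n≡m (ℕP.≤-pred lt))
    z₁ : ∀ a b z → a -ᶻ ((a +ᶻ b) -ᶻ z) ≡ z -ᶻ b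
    z₁ = ℤS.solve-∀
    z₂ : ∀ a b z → ((a +ᶻ b) -ᶻ z) -ᶻ b ≡ a -ᶻ z
    z₂ = ℤS.solve-∀
    T : List ℕ → ℕ
    T η = total B κ η
    r₁ : ∀ z η → pos (size κ) -ᶻ (pos (T η) -ᶻ z) ≡ z -ᶻ pos (size η)
    r₁ z η = trans (cong (λ t → pos (size κ) -ᶻ (pos t -ᶻ z)) (totB κ η bd)) (z₁ (pos (size κ)) (pos (size η)) z)
    r₂ : ∀ z η → (pos (T η) -ᶻ z) -ᶻ pos (size η) ≡ pos (size κ) -ᶻ z
    r₂ z η = trans (cong (λ t → (pos t -ᶻ z) -ᶻ pos (size η)) (totB κ η bd)) (z₂ (pos (size κ)) (pos (size η)) z)
    abs∸ : ∀ a b → b ≤ a → a ∸ b ≡ I.∣ pos a -ᶻ pos b ∣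
    abs∸ a b le = sym (trans (cong I.∣_∣ (ℤP.m-n≡m⊖n a b)) (cong I.∣_∣ (ℤP.⊖-≥ le)))
    hdB : ∀ {μ} → Bdd μ → (hd μ ≤ᵇ B) ≡ true
    hdB []       = refl
    hdB (lt ∷ _) = ≤ᵇ-true (ℕP.≤-pred lt)
    toMid : ∀ g → ∑ (Box n) (λ μ → ι (il κ μ) *ᶻ ∑ (Box n) (λ η → ι (il μ η) *ᶻ g (size κ ∸ size μ) (size μ ∸ size η) η)) ≡
                  ∑ (Box n) (λ η → mid B κ η (Fn g η))
    toMid g = trans (Box-cong n λ μ bμ _ → trans (sym (∑-* (Box n) (ι (il κ μ)) _)) (∑-cong (Box n) λ η →
        trans (ι-cong (il κ μ) λ e₁ → ι-cong (il μ η) λ e₂ → cong₂ (λ x y → g x y η) (abs∸ _ _ (il-size κ μ e₁)) (abs∸ _ _ (il-size μ η e₂)))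
              (sym (ι-true _ (hdB bμ)))))
      (∑-swap (Box n) (Box n) _)

  RL-sym : ∀ N κ → Bdd κ → Sym (RL N κ)
  RL-sym zero κ bd k f = trans (∑-RL-0 κ _) (trans (cong (λ z → ι (allZ κ) *ᶻ f z) (sw k)) (sym (∑-RL-0 κ f)))
    where sw : ∀ k → swapL {ℕ} k [] ≡ []
          sw zero    = refl
          sw (suc k) = refl
  RL-sym (suc zero) κ bd zero f = trans (∑-RL-suc 0 κ _) (trans (∑-cong (Box (length κ)) λ μ → cong (ι (il κ μ) *ᶻ_)
    (trans (∑-RL-0 μ _) (sym (∑-RL-0 μ _)))) (sym (∑-RL-suc 0 κ f)))
  RL-sym (suc (suc N)) κ bd zero f = trans (expand (λ v → f (swapL 0 v))) (trans (two-step κ (λ a b η → ∑ (RL N η) (λ β → f (b ∷ a ∷ β))) bd)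
    (sym (expand f)))
    where
    expand : ∀ f → ∑ (RL (suc (suc N)) κ) f ≡ ∑ (Box (length κ)) (λ μ → ι (il κ μ) *ᶻ ∑ (Box (length κ)) (λ η → ι (il μ η) *ᶻ
               ∑ (RL N η) (λ β → f ((size κ ∸ size μ) ∷ (size μ ∸ size η) ∷ β))))
    expand f = trans (∑-RL-suc (suc N) κ f) (Box-cong (length κ) λ μ _ len → cong (ι (il κ μ) *ᶻ_)
      (trans (∑-RL-suc N μ _) (cong (λ z → ∑ (Box z) (λ η → ι (il μ η) *ᶻ ∑ (RL N η) (λ β → f ((size κ ∸ size μ) ∷ (size μ ∸ size η) ∷ β)))) len)))
  RL-sym (suc N) κ bd (suc k) f = trans (∑-RL-suc N κ _) (trans (Box-cong (length κ) λ μ bμ _ → cong (ι (il κ μ) *ᶻ_)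
    (RL-sym N μ bμ k (λ v → f ((size κ ∸ size μ) ∷ v)))) (sym (∑-RL-suc N κ f)))

-- Semistandard tableaux by removal of their largest entry

∑-onlyTop : ∀ N k (f : List ℕ → ℤ) →
  ∑ (words (upTo (suc N)) k) (λ w → ι (weaklyIncᵇ (N ∷ w)) *ᶻ f w) ≡ f (replicate k N)
∑-onlyTop N zero    f = trans (∑-words-0 (upTo (suc N)) _) (ℤP.*-identityˡ (f []))
∑-onlyTop N (suc k) f = trans (∑-words-suc (upTo (suc N)) k _) (trans (∑-upTo-last N _) (trans (cong₂ _+ᶻ_
    (∑-upTo-zero N λ x lt → ∑-zero (words (upTo (suc N)) k) λ w → trans (ι-∧* (N ≤ᵇ x) (weaklyIncᵇ (x ∷ w)) (f (x ∷ w))) (ι-false _ (≤ᵇ-false lt)))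
    (trans (∑-cong (words (upTo (suc N)) k) λ w → trans (ι-∧* (N ≤ᵇ N) (weaklyIncᵇ (N ∷ w)) (f (N ∷ w))) (ι-true _ (≤ᵇ-true (ℕP.≤-refl {N}))))
      (∑-onlyTop N k (λ w → f (N ∷ w)))))
  (ℤP.+-identityˡ _)))

-- In a weakly increasing word all occurrences of the largest letter N stand at the end, so the word
-- is its part below N together with the length j of that part.
∑-splitTop : ∀ N k (f : List ℕ → ℤ) → ∑ (words (upTo (suc N)) k) (λ w → ι (weaklyIncᵇ w) *ᶻ f w) ≡
  ∑ (upTo (suc k)) (λ j → ∑ (words (upTo N) j) (λ v → ι (weaklyIncᵇ v) *ᶻ f (v ++ replicate (k ∸ j) N)))
∑-splitTop N zero f = trans (∑-words-0 (upTo (suc N)) _) (sym (trans (∑-one 0 _) (∑-words-0 (upTo N) _)))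
∑-splitTop N (suc k) f = trans (∑-words-suc (upTo (suc N)) k _) (trans (∑-upTo-last N _) (trans (ℤP.+-comm low top) (sym
  (trans (∑-upTo-suc (suc k) _) (cong₂ _+ᶻ_ zeroPart sucPart)))))
  where
  low top : ℤ
  low = ∑ (upTo N) (λ x → ∑ (words (upTo (suc N)) k) (λ w → ι (weaklyIncᵇ (x ∷ w)) *ᶻ f (x ∷ w)))
  top = ∑ (words (upTo (suc N)) k) (λ w → ι (weaklyIncᵇ (N ∷ w)) *ᶻ f (N ∷ w))
  zeroPart : ∑ (words (upTo N) 0) (λ v → ι (weaklyIncᵇ v) *ᶻ f (v ++ replicate (suc k) N)) ≡
             ∑ (words (upTo (suc N)) k) (λ w → ι (weaklyIncᵇ (N ∷ w)) *ᶻ f (N ∷ w))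
  zeroPart = trans (∑-words-0 (upTo N) _) (trans (ℤP.*-identityˡ _) (sym (∑-onlyTop N k (λ w → f (N ∷ w)))))
  head≤ : ℕ → List ℕ → Bool
  head≤ x []      = true
  head≤ x (y ∷ _) = x ≤ᵇ y
  winc-∷ : ∀ x w → weaklyIncᵇ (x ∷ w) ≡ (weaklyIncᵇ w ∧ head≤ x w)
  winc-∷ x []      = refl
  winc-∷ x (y ∷ w) = bool-iff (λ eq → let (a , b) = ∧-true {x ≤ᵇ y} eq in ∧-intro b a) (λ eq → let (a , b) = ∧-true {weaklyIncᵇ (y ∷ w)} eq in ∧-intro b a)
  head-rep : ∀ x v j → x < N → head≤ x (v ++ replicate j N) ≡ head≤ x v
  head-rep x []      zero    lt = refl
  head-rep x []      (suc j) lt = ≤ᵇ-true (ℕP.<⇒≤ lt)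
  head-rep x (y ∷ v) j       lt = refl
  inner : ∀ x → x < N → ∑ (words (upTo (suc N)) k) (λ w → ι (weaklyIncᵇ (x ∷ w)) *ᶻ f (x ∷ w)) ≡
          ∑ (upTo (suc k)) (λ j → ∑ (words (upTo N) j) (λ v → ι (weaklyIncᵇ (x ∷ v)) *ᶻ f (x ∷ v ++ replicate (k ∸ j) N)))
  inner x lt = trans (∑-cong (words (upTo (suc N)) k) λ w → trans (cong (λ b → ι b *ᶻ f (x ∷ w)) (winc-∷ x w)) (ι-∧* (weaklyIncᵇ w) (head≤ x w) (f (x ∷ w))))
    (trans (∑-splitTop N k (λ w → ι (head≤ x w) *ᶻ f (x ∷ w)))
      (∑-cong (upTo (suc k)) λ j → ∑-cong (words (upTo N) j) λ v →
        trans (cong (λ b → ι (weaklyIncᵇ v) *ᶻ (ι b *ᶻ f (x ∷ v ++ replicate (k ∸ j) N))) (head-rep x v (k ∸ j) lt))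
          (trans (sym (ι-∧* (weaklyIncᵇ v) (head≤ x v) _)) (cong (λ b → ι b *ᶻ f (x ∷ v ++ replicate (k ∸ j) N)) (sym (winc-∷ x v))))))
  sucPart : ∑ (upTo (suc k)) (λ j → ∑ (words (upTo N) (suc j)) (λ v → ι (weaklyIncᵇ v) *ᶻ f (v ++ replicate (k ∸ j) N))) ≡
            ∑ (upTo N) (λ x → ∑ (words (upTo (suc N)) k) (λ w → ι (weaklyIncᵇ (x ∷ w)) *ᶻ f (x ∷ w)))
  sucPart = trans (∑-cong (upTo (suc k)) λ j → ∑-words-suc (upTo N) j _) (trans (∑-swap (upTo (suc k)) (upTo N) _)
    (∑-upTo-cong N λ x lt → sym (inner x lt)))

-- Rows are generated top to bottom; c is the column condition imposed by the previous row.
SR : ℕ → (List ℕ → Bool) → List ℕ → (List (List ℕ) → ℤ) → ℤ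
SR N c []      f = f []
SR N c (k ∷ κ) f = ∑ (words (upTo N) k) (λ r → ι (weaklyIncᵇ r) *ᶻ (ι (c r) *ᶻ SR N (colStrictᵇ r) κ (λ T → f (r ∷ T))))

data Fits (N : ℕ) : List ℕ → List (List ℕ) → Set where
  []  : Fits N [] []
  _∷_ : ∀ {k κ r T} → All (_< N) r × length r ≡ k → Fits N κ T → Fits N (k ∷ κ) (r ∷ T)

SR-cong : ∀ N c κ {f g} → (∀ T → Fits N κ T → f T ≡ g T) → SR N c κ f ≡ SR N c κ g
SR-cong N c []      eq = eq [] []
SR-cong N c (k ∷ κ) eq = ∑-letters-cong N k λ r al len → cong (λ z → ι (weaklyIncᵇ r) *ᶻ (ι (c r) *ᶻ z))
  (SR-cong N (colStrictᵇ r) κ λ T ft → eq (r ∷ T) ((al , len) ∷ ft))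

-- Nothing may stand below an entry N, so the lower row, its own entries N included, has to fit
-- under the entries of the upper row that are less than N. There a lower entry N is automatically
-- larger.
colStrict-glue : ∀ N u v a b → All (_< N) u → All (_< N) v →
  colStrictᵇ (u ++ replicate a N) (v ++ replicate b N) ≡ ((length v + b ≤ᵇ length u) ∧ colStrictᵇ u v)
colStrict-glue N [] [] a zero _ _ = lem (replicate a N)
  where lem : ∀ xs → colStrictᵇ xs [] ≡ true
        lem []      = refl
        lem (_ ∷ _) = refl
colStrict-glue N [] [] zero (suc b) _ _ = refl
colStrict-glue N [] [] (suc a) (suc b) _ _ = cong (_∧ colStrictᵇ (replicate a N) (replicate b N)) (<ᵇ-false (ℕP.≤-refl {N}))
colStrict-glue N [] (y ∷ v) zero b _ _ = refl
colStrict-glue N [] (y ∷ v) (suc a) b _ (lt ∷ _) = cong (_∧ colStrictᵇ (replicate a N) (v ++ replicate b N)) (<ᵇ-false (ℕP.<⇒≤ lt))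
colStrict-glue N (x ∷ u) [] a zero _ _ = refl
colStrict-glue N (x ∷ u) [] a (suc b) (lt ∷ al) _ = trans (cong (_∧ colStrictᵇ (u ++ replicate a N) (replicate b N)) (<ᵇ-true lt))
  (trans (colStrict-glue N u [] a b al []) (cong₂ _∧_ (sym (≤ᵇ-suc b (length u))) (lem u)))
  where lem : ∀ u → colStrictᵇ u [] ≡ colStrictᵇ (x ∷ u) []
        lem []      = refl
        lem (_ ∷ _) = refl
colStrict-glue N (x ∷ u) (y ∷ v) a b (lx ∷ al) (ly ∷ al′) = trans (cong ((x <ᵇ y) ∧_) (colStrict-glue N u v a b al al′))
  (trans (lem (x <ᵇ y) (length v + b ≤ᵇ length u) (colStrictᵇ u v)) (cong (_∧ ((x <ᵇ y) ∧ colStrictᵇ u v)) (sym (≤ᵇ-suc (length v + b) (length u)))))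
  where lem : ∀ a b c → (a ∧ (b ∧ c)) ≡ (b ∧ (a ∧ c))
        lem true  b     c = refl
        lem false true  c = refl
        lem false false c = refl

glue : ℕ → List ℕ → List (List ℕ) → List (List ℕ)
glue N (k ∷ κ) (v ∷ T) = (v ++ replicate (k ∸ length v) N) ∷ glue N κ T
glue N _       _       = []

cont : ℕ → List ℕ → List ℕ
cont N w = map (λ i → countℕ i w) (upTo N)

module SSYT (B : ℕ) where
  open GT B

  -- Deleting the entries N from a tableau of shape κ leaves one whose shape μ interlaces κ. The
  -- number q of smaller entries in the row above bounds the length of the next row; the induction
  -- carries it so that each row supplies the bound for the next. For the first row the bound is B.
  SR-peel : ∀ N c c₀ q κ f → (∀ v b → All (_< N) v → length v + b ≤ B → c (v ++ replicate b N) ≡ ((length v + b ≤ᵇ q) ∧ c₀ v)) → Bdd κ →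
    SR (suc N) c κ f ≡ ∑ (Box (length κ)) (λ μ → ι ((hd κ ≤ᵇ q) ∧ il κ μ) *ᶻ SR N c₀ μ (λ T → f (glue N κ T)))
  SR-peel N c c₀ q [] f hyp bd = sym (trans (∑-words-0 (upTo (suc B)) _) (ℤP.*-identityˡ (f [])))
  SR-peel N c c₀ q (k ∷ κ) f hyp (k<B ∷ bd) = trans (∑-splitTop N k _) (trans (∑-upTo-cong (suc k) λ j lt → ∑-letters-cong N j λ v al len → left j (ℕP.≤-pred lt) v al len)
    (sym (trans (∑-words-suc (upTo (suc B)) (length κ) _) (trans (∑-cong (upTo (suc B)) right) (∑-upTo-restrict _ (ℕP.≤-pred k<B))))))
    where
    W : ℕ → List (List ℕ)
    W = words (upTo N)
    X : ℕ → List ℕ → List ℕ → ℤ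
    X j v μ = SR N (colStrictᵇ v) μ (λ T → f ((v ++ replicate (k ∸ j) N) ∷ glue N κ T))
    Y : ℕ → List ℕ → List ℕ → ℤ
    Y j v μ = ι (weaklyIncᵇ v) *ᶻ (ι (k ≤ᵇ q) *ᶻ (ι (c₀ v) *ᶻ (ι ((hd κ ≤ᵇ j) ∧ il κ μ) *ᶻ X j v μ)))
    left : ∀ j → j ≤ k → ∀ v → All (_< N) v → length v ≡ j →
      ι (weaklyIncᵇ v) *ᶻ (ι (c (v ++ replicate (k ∸ j) N)) *ᶻ SR (suc N) (colStrictᵇ (v ++ replicate (k ∸ j) N)) κ (λ T → f ((v ++ replicate (k ∸ j) N) ∷ T)))
      ≡ ∑ (Box (length κ)) (λ μ → Y j v μ)
    left j le v al refl = trans (cong₂ (λ x y → ι (weaklyIncᵇ v) *ᶻ (x *ᶻ y))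
        (trans (cong ι (trans (hyp v (k ∸ j) al (ℕP.≤-trans (ℕP.≤-reflexive jk) (ℕP.≤-pred k<B))) (cong (λ z → (z ≤ᵇ q) ∧ c₀ v) jk))) (ι-∧ (k ≤ᵇ q) (c₀ v)))
        (SR-peel N _ (colStrictᵇ v) j κ _ (λ v′ b al′ _ → colStrict-glue N v v′ (k ∸ j) b al al′) bd))
      (trans (cong (ι (weaklyIncᵇ v) *ᶻ_) (trans (ℤP.*-assoc (ι (k ≤ᵇ q)) (ι (c₀ v)) _) (cong (ι (k ≤ᵇ q) *ᶻ_) (sym (∑-* Bx (ι (c₀ v)) _)))))
      (trans (cong (ι (weaklyIncᵇ v) *ᶻ_) (sym (∑-* Bx (ι (k ≤ᵇ q)) _))) (sym (∑-* Bx (ι (weaklyIncᵇ v)) _))))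
      where Bx = Box (length κ)
            jk : j + (k ∸ j) ≡ k
            jk = ℕP.m+[n∸m]≡n le
    ring : ∀ kq hj jk ik w c x → (kq *ᶻ (hj *ᶻ (jk *ᶻ ik))) *ᶻ (w *ᶻ (c *ᶻ x)) ≡ jk *ᶻ (w *ᶻ (kq *ᶻ (c *ᶻ ((hj *ᶻ ik) *ᶻ x))))
    ring = ℤS.solve-∀
    right : ∀ j → ∑ (Box (length κ)) (λ μ → ι ((k ≤ᵇ q) ∧ il (k ∷ κ) (j ∷ μ)) *ᶻ SR N c₀ (j ∷ μ) (λ T → f (glue N (k ∷ κ) T))) ≡
                  ι (j ≤ᵇ k) *ᶻ ∑ (W j) (λ v → ∑ (Box (length κ)) (λ μ → Y j v μ))
    right j = trans (∑-cong Bx λ μ → trans (sym (∑-* (W j) (ι ((k ≤ᵇ q) ∧ il (k ∷ κ) (j ∷ μ))) _)) (∑-letters-cong N j λ v al len →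
        trans (cong₂ (λ x y → x *ᶻ (ι (weaklyIncᵇ v) *ᶻ (ι (c₀ v) *ᶻ y))) (i4 (k ≤ᵇ q) (hd κ ≤ᵇ j) (j ≤ᵇ k) (il κ μ)) (SR-cong N (colStrictᵇ v) μ λ T _ → cong (λ z → f ((v ++ replicate (k ∸ z) N) ∷ glue N κ T)) len))
          (trans (ring (ι (k ≤ᵇ q)) (ι (hd κ ≤ᵇ j)) (ι (j ≤ᵇ k)) (ι (il κ μ)) (ι (weaklyIncᵇ v)) (ι (c₀ v)) (X j v μ))
            (cong (λ z → ι (j ≤ᵇ k) *ᶻ (ι (weaklyIncᵇ v) *ᶻ (ι (k ≤ᵇ q) *ᶻ (ι (c₀ v) *ᶻ (z *ᶻ X j v μ))))) (sym (ι-∧ (hd κ ≤ᵇ j) (il κ μ)))))))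
      (trans (∑-swap Bx (W j) _) (trans (∑-cong (W j) λ v → ∑-* Bx (ι (j ≤ᵇ k)) _) (∑-* (W j) (ι (j ≤ᵇ k)) _)))
      where
      Bx = Box (length κ)
      i4 : ∀ a b c d → ι (a ∧ (b ∧ (c ∧ d))) ≡ ι a *ᶻ (ι b *ᶻ (ι c *ᶻ ι d))
      i4 a b c d = trans (ι-∧ a _) (cong (ι a *ᶻ_) (trans (ι-∧ b _) (cong (ι b *ᶻ_) (ι-∧ c d))))

  SR-0 : ∀ c κ (F : List (List ℕ) → ℤ) z → c [] ≡ true → (∀ T → F T ≡ z) → SR 0 c κ F ≡ ι (allZ κ) *ᶻ z
  SR-0 c []          F z ok eq = trans (eq []) (sym (ℤP.*-identityˡ z))
  SR-0 c (zero ∷ κ)  F z ok eq = trans (∑-words-0 [] _) (trans (ℤP.*-identityˡ _) (trans (ι-true _ ok) (SR-0 (colStrictᵇ []) κ _ z refl (λ T → eq ([] ∷ T)))))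
  SR-0 c (suc k ∷ κ) F z ok eq = ∑-[] _

countℕ-++ : ∀ i u v → countℕ i (u ++ v) ≡ countℕ i u + countℕ i v
countℕ-++ i []      v = refl
countℕ-++ i (x ∷ u) v with i ≡ᵇ x
... | true  = cong suc (countℕ-++ i u v)
... | false = countℕ-++ i u v

countℕ-rep : ∀ i a N → countℕ i (replicate a N) ≡ (if i ≡ᵇ N then a else 0)
countℕ-rep i zero    N with i ≡ᵇ N
... | true  = refl
... | false = refl
countℕ-rep i (suc a) N with i ≡ᵇ N in eq
... | true  = cong suc (trans (countℕ-rep i a N) (cong (λ b → if b then a else 0) eq))
... | false = trans (countℕ-rep i a N) (cong (λ b → if b then a else 0) eq)

countℕ-none : ∀ i v → All (_< i) v → countℕ i v ≡ 0
countℕ-none i []      []        = refl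
countℕ-none i (x ∷ v) (lt ∷ al) rewrite ≡ᵇ-≢ {i} {x} (λ eq → ℕP.<⇒≢ lt (sym eq)) = countℕ-none i v al

upTo-∷ʳ : ∀ n → upTo (suc n) ≡ upTo n ∷ʳ n
upTo-∷ʳ n = trans (sym (LP.applyUpTo-∷ʳ id n)) refl

map-upTo-cong : ∀ {A : Set} n {f g : ℕ → A} → (∀ i → i < n → f i ≡ g i) → map f (upTo n) ≡ map g (upTo n)
map-upTo-cong n eq = lem n id λ i lt → eq i lt
  where lem : ∀ {A : Set} {f g : ℕ → A} n h → (∀ i → i < n → f (h i) ≡ g (h i)) → map f (applyUpTo h n) ≡ map g (applyUpTo h n)
        lem zero    h eq = refl
        lem (suc n) h eq = cong₂ _∷_ (eq 0 (s≤s z≤n)) (lem n (h ∘ suc) λ i lt → eq (suc i) (s≤s lt))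

glue-low : ∀ N i κ μ T → i < N → il κ μ ≡ true → Fits N μ T → countℕ i (concat (glue N κ T)) ≡ countℕ i (concat T)
glue-low N i [] [] [] lt eq [] = refl
glue-low N i (k ∷ κ) (j ∷ μ) (v ∷ T) lt eq ((al , len) ∷ ft) = trans (countℕ-++ i (v ++ replicate (k ∸ length v) N) _)
  (trans (cong₂ _+_ (trans (countℕ-++ i v _) (trans (cong (countℕ i v +_) (trans (countℕ-rep i (k ∸ length v) N) (cong (λ b → if b then k ∸ length v else 0) (≡ᵇ-≢ (ℕP.<⇒≢ lt))))) (ℕP.+-identityʳ _)))
    (glue-low N i κ μ T lt (proj₂ (∧-true {j ≤ᵇ k} (proj₂ (∧-true {hd κ ≤ᵇ j} eq)))) ft)) (sym (countℕ-++ i v (concat T))))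

glue-top : ∀ N κ μ T → il κ μ ≡ true → Fits N μ T → countℕ N (concat (glue N κ T)) + size μ ≡ size κ
glue-top N [] [] [] eq [] = refl
glue-top N (k ∷ κ) (_ ∷ μ) (v ∷ T) eq ((al , refl) ∷ ft) = begin
  countℕ N ((v ++ replicate (k ∸ j) N) ++ concat (glue N κ T)) + (j + size μ)
    ≡⟨ cong (_+ (j + size μ)) (trans (countℕ-++ N (v ++ replicate (k ∸ j) N) _) (cong (_+ c) (countℕ-++ N v _))) ⟩
  countℕ N v + countℕ N (replicate (k ∸ j) N) + c + (j + size μ)
    ≡⟨ cong₂ (λ x y → x + y + c + (j + size μ)) (countℕ-none N v al) (trans (countℕ-rep N (k ∸ j) N) (cong (λ b → if b then k ∸ j else 0) (≡ᵇ-refl N))) ⟩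
  (k ∸ j) + c + (j + size μ) ≡⟨ ar (k ∸ j) c j (size μ) ⟩
  ((k ∸ j) + j) + (c + size μ) ≡⟨ cong₂ _+_ (ℕP.m∸n+n≡m (≤ᵇ-sound j k (proj₁ (∧-true {j ≤ᵇ k} e₂)))) (glue-top N κ μ T (proj₂ (∧-true {j ≤ᵇ k} e₂)) ft) ⟩
  k + size κ ∎
  where
  open ≡-Reasoning
  j = length v
  c = countℕ N (concat (glue N κ T))
  e₂ = proj₂ (∧-true {hd κ ≤ᵇ j} eq)
  ar : ∀ a c j z → a + c + (j + z) ≡ (a + j) + (c + z)
  ar = ℕS.solve-∀

glue-cont : ∀ N κ μ T → il κ μ ≡ true → Fits N μ T → cont (suc N) (concat (glue N κ T)) ≡ cont N (concat T) ∷ʳ (size κ ∸ size μ)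
glue-cont N κ μ T eq ft = trans (cong (map g) (upTo-∷ʳ N)) (trans (LP.map-++ g (upTo N) (N ∷ []))
  (cong₂ _∷ʳ_ (map-upTo-cong N λ i lt → glue-low N i κ μ T lt eq ft)
    (trans (sym (ℕP.m+n∸n≡m (g N) (size μ))) (cong (_∸ size μ) (glue-top N κ μ T eq ft)))))
  where g : ℕ → ℕ
        g i = countℕ i (concat (glue N κ T))

-- The conjuncts of `isSSYTᵇ` regrouped row by row, in the order in which `SR` generates the rows.
chk : ℕ → (List ℕ → Bool) → List (List ℕ) → Bool
chk N c []      = true
chk N c (r ∷ T) = (weaklyIncᵇ r ∧ c r) ∧ (all (_<ᵇ N) r ∧ chk N (colStrictᵇ r) T)

chk-∷ : ∀ N c r T → chk N c (r ∷ T) ≡ (all weaklyIncᵇ (r ∷ T) ∧ ((c r ∧ colsStrictᵇ (r ∷ T)) ∧ all (all (_<ᵇ N)) (r ∷ T)))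
chk-∷ N c r [] = lem (weaklyIncᵇ r) (c r) (all (_<ᵇ N) r)
  where lem : ∀ a b l → ((a ∧ b) ∧ (l ∧ true)) ≡ ((a ∧ true) ∧ ((b ∧ true) ∧ (l ∧ true)))
        lem true  true  l = refl
        lem true  false l = refl
        lem false b     l = refl
chk-∷ N c r (r′ ∷ T) = trans (cong (λ z → (weaklyIncᵇ r ∧ c r) ∧ (all (_<ᵇ N) r ∧ z)) (chk-∷ N (colStrictᵇ r) r′ T))
  (lem (weaklyIncᵇ r) (c r) (all (_<ᵇ N) r) (all weaklyIncᵇ (r′ ∷ T)) (colStrictᵇ r r′ ∧ colsStrictᵇ (r′ ∷ T)) (all (all (_<ᵇ N)) (r′ ∷ T)))
  where lem : ∀ a b l A S L → ((a ∧ b) ∧ (l ∧ (A ∧ (S ∧ L)))) ≡ ((a ∧ A) ∧ ((b ∧ S) ∧ (l ∧ L)))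
        lem false b     l     A     S     L = refl
        lem true  false l     true  S     L = refl
        lem true  false l     false S     L = refl
        lem true  true  true  A     S     L = refl
        lem true  true  false true  true  L = refl
        lem true  true  false true  false L = refl
        lem true  true  false false S     L = refl

isSSYT-chk : ∀ N T → isSSYTᵇ N T ≡ chk N (const true) T
isSSYT-chk N []      = refl
isSSYT-chk N (r ∷ T) = sym (chk-∷ N (const true) r T)

∑-fillings-∷ : ∀ N k κ f → ∑ (fillings N (k ∷ κ)) f ≡ ∑ (words (upTo (suc (N ∸ 1))) k) (λ r → ∑ (fillings N κ) (λ T → f (r ∷ T)))
∑-fillings-∷ N k κ f = trans (∑-concatMap _ (allLists k (N ∸ 1)) f) (trans (cong (λ z → ∑ z (λ r → ∑ (map (r ∷_) (fillings N κ)) f)) (allLists≡words k (N ∸ 1)))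
  (∑-cong (words (upTo (suc (N ∸ 1))) k) λ r → ∑-map (r ∷_) (fillings N κ) f))

all-true : ∀ N w → All (_< N) w → all (_<ᵇ N) w ≡ true
all-true N []      []        = refl
all-true N (x ∷ w) (lt ∷ al) = ∧-intro (<ᵇ-true lt) (all-true N w al)

-- For N = 0, `fillings` still offers the letter 0; since every row is nonempty, the test that
-- entries are below N rejects all such fillings. For N > 0 the letters offered are exactly those
-- below N.
∑-fillings : ∀ N c κ (g : List (List ℕ) → ℤ) → All (1 ≤_) κ → ∑ (fillings N κ) (λ T → ι (chk N c T) *ᶻ g T) ≡ SR N c κ g
∑-fillings N       c []          g _        = trans (∑-one [] _) (ℤP.*-identityˡ (g []))
∑-fillings zero    c (suc k ∷ κ) g (_ ∷ _)  = trans (∑-fillings-∷ 0 (suc k) κ _) (trans (∑-words-suc (upTo 1) k _)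
  (trans (∑-zero (upTo 1) λ x → ∑-zero (words (upTo 1) k) λ w → ∑-zero (fillings 0 κ) λ T → ι-false (g ((x ∷ w) ∷ T)) (lem (weaklyIncᵇ (x ∷ w) ∧ c (x ∷ w)))) (sym (∑-[] _))))
  where lem : ∀ b → (b ∧ false) ≡ false
        lem true  = refl
        lem false = refl
∑-fillings (suc N) c (k ∷ κ)     g (_ ∷ al) = trans (∑-fillings-∷ (suc N) k κ _) (∑-letters-cong (suc N) k λ r alr _ →
  trans (∑-cong (fillings (suc N) κ) λ T → trans (cong (λ z → ι ((weaklyIncᵇ r ∧ c r) ∧ (z ∧ chk (suc N) (colStrictᵇ r) T)) *ᶻ g (r ∷ T)) (all-true (suc N) r alr))
      (trans (ι-∧* (weaklyIncᵇ r ∧ c r) (chk (suc N) (colStrictᵇ r) T) (g (r ∷ T))) (ι-∧* (weaklyIncᵇ r) (c r) _)))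
    (trans (∑-* (fillings (suc N) κ) (ι (weaklyIncᵇ r)) _) (cong (ι (weaklyIncᵇ r) *ᶻ_) (trans (∑-* (fillings (suc N) κ) (ι (c r)) _)
      (cong (ι (c r) *ᶻ_) (∑-fillings (suc N) (colStrictᵇ r) κ (λ T → g (r ∷ T)) al))))))

toList-tabulate : ∀ {A : Set} N (g : ℕ → A) → V.toList (V.tabulate {n = N} (λ i → g (toℕ i))) ≡ map g (upTo N)
toList-tabulate zero    g = refl
toList-tabulate (suc N) g = cong (g 0 ∷_) (trans (toList-tabulate N (g ∘ suc)) (trans (LP.map-∘ (upTo N)) (cong (map g) (LP.map-upTo suc N))))

∑-schur-SR : ∀ N κ (f : List ℕ → ℤ) → All (1 ≤_) κ → ∑ (map V.toList (schur N κ)) f ≡ SR N (const true) κ (λ T → f (cont N (concat T)))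
∑-schur-SR N κ f al = trans (∑-map V.toList (schur N κ) f) (trans (∑-map (content N) (filterᵇ (isSSYTᵇ N) (fillings N κ)) _)
  (trans (∑-filter (isSSYTᵇ N) (fillings N κ) _) (trans (∑-cong (fillings N κ) λ T → cong₂ (λ b x → ι b *ᶻ f x) (isSSYT-chk N T) (toList-tabulate N (λ i → countℕ i (concat T))))
    (∑-fillings N (const true) κ _ al))))

module Schur (B : ℕ) where
  open GT B
  open SSYT B

  RL-length : ∀ N κ v → v ∈ RL N κ → length v ≡ N
  RL-length zero κ v v∈ with allZ κ
  RL-length zero κ v (here refl) | true = refl
  RL-length (suc N) κ v v∈ with Any.satisfied (∈-concatMap⁻ (λ μ → map ((size κ ∸ size μ) ∷_) (RL N μ)) {xs = filterᵇ (il κ) (Box (length κ))} v∈)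
  ... | μ , v∈μ with ∈-map⁻ ((size κ ∸ size μ) ∷_) v∈μ
  ...   | β , β∈ , refl = cong suc (RL-length N μ β β∈)

  -- Removing the largest entry appends its multiplicity at the end of the content, whereas `RL`
  -- puts it in front; hence the reversal.
  SR-RL : ∀ N κ (f : List ℕ → ℤ) → Bdd κ → SR N (const true) κ (λ T → f (cont N (concat T))) ≡ ∑ (RL N κ) (λ β → f (reverse β))
  SR-RL zero    κ f bd = trans (SR-0 (const true) κ _ (f []) refl λ _ → refl) (sym (∑-RL-0 κ _))
  SR-RL (suc N) κ f bd = trans (SR-peel N (const true) (const true) B κ _ (λ v b _ le → sym (∧-intro (≤ᵇ-true le) refl)) bd)
    (trans (Box-cong (length κ) λ μ bμ _ → trans (cong (λ z → ι z *ᶻ SR N (const true) μ (λ T → f (cont (suc N) (concat (glue N κ T))))) (hdB bd))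
        (ι-cong (il κ μ) λ eq → trans (SR-cong N (const true) μ λ T ft → cong f (glue-cont N κ μ T eq ft))
          (trans (SR-RL N μ (λ w → f (w ∷ʳ (size κ ∸ size μ))) bμ) (∑-cong (RL N μ) λ β → cong f (sym (LP.unfold-reverse (size κ ∸ size μ) β))))))
      (sym (∑-RL-suc N κ _)))
    where hdB : ∀ {κ b} → Bdd κ → ((hd κ ≤ᵇ B) ∧ b) ≡ b
          hdB []       = refl
          hdB (lt ∷ _) = cong (_∧ _) (≤ᵇ-true (ℕP.≤-pred lt))

  ∑-schur : ∀ N κ (f : List ℕ → ℤ) → All (1 ≤_) κ → Bdd κ → ∑ (map V.toList (schur N κ)) f ≡ ∑ (RL N κ) f
  ∑-schur N κ f al bd = trans (∑-schur-SR N κ f al) (trans (SR-RL N κ f bd) (∑-reverse (RL N κ) N (RL-sym N κ bd) (RL-length N κ) f))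

-- The extraction functional on Schur polynomials

eqzn : ℤ → ℕ → Bool
eqzn (pos a)    k = a ≡ᵇ k
eqzn (negsuc _) k = false

eqzn-sound : ∀ z k → eqzn z k ≡ true → z ≡ pos k
eqzn-sound (pos a) k eq = cong pos (≡ᵇ-sound a k eq)

eqZ : ∀ {n} → Vec ℤ n → List ℕ → Bool
eqZ V.[]      []      = true
eqZ (b V.∷ v) (k ∷ γ) = eqzn b k ∧ eqZ v γ
eqZ _         _       = false

eqZ-sum : ∀ {n} (v : Vec ℤ n) γ → eqZ v γ ≡ true → sumZ v ≡ pos (size γ)
eqZ-sum V.[]      []      eq = refl
eqZ-sum (b V.∷ v) (k ∷ γ) eq = let (a , c) = ∧-true {eqzn b k} eq in cong₂ _+ᶻ_ (eqzn-sound b k a) (eqZ-sum v γ c)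

eqZ-pos : ∀ {n} (v : Vec ℕ n) γ → eqZ (V.map pos v) γ ≡ eqL (V.toList v) γ
eqZ-pos V.[]      []      = refl
eqZ-pos V.[]      (_ ∷ _) = refl
eqZ-pos (_ V.∷ _) []      = refl
eqZ-pos (a V.∷ v) (k ∷ γ) = cong ((a ≡ᵇ k) ∧_) (eqZ-pos v γ)

coefV : ∀ {n} → List (List ℕ) → Vec ℤ n → ℤ
coefV M v = ∑ M (λ γ → ι (eqZ v γ))

eqZ-swap : ∀ {n} k (v : Vec ℤ n) γ → eqZ (swapV k v) (swapL k γ) ≡ eqZ v γ
eqZ-swap zero    V.[]                []          = refl
eqZ-swap zero    V.[]                (_ ∷ [])    = refl
eqZ-swap zero    V.[]                (_ ∷ _ ∷ _) = refl
eqZ-swap zero    (a V.∷ V.[])        []          = refl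
eqZ-swap zero    (a V.∷ V.[])        (_ ∷ [])    = refl
eqZ-swap zero    (a V.∷ V.[])        (x ∷ y ∷ _) = trans (lem (eqzn a y)) (sym (lem (eqzn a x)))
  where lem : ∀ b → (b ∧ false) ≡ false
        lem true  = refl
        lem false = refl
eqZ-swap zero    (a V.∷ b V.∷ v)     []          = refl
eqZ-swap zero    (a V.∷ b V.∷ v)     (x ∷ [])    = trans (lem (eqzn b x)) (sym (lem (eqzn a x)))
  where lem : ∀ b → (b ∧ false) ≡ false
        lem true  = refl
        lem false = refl
eqZ-swap zero    (a V.∷ b V.∷ v)     (x ∷ y ∷ γ) = lem (eqzn b y) (eqzn a x) (eqZ v γ)
  where lem : ∀ a b c → (a ∧ (b ∧ c)) ≡ (b ∧ (a ∧ c))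
        lem true  b     c = refl
        lem false true  c = refl
        lem false false c = refl
eqZ-swap (suc k) V.[]                []          = refl
eqZ-swap (suc k) V.[]                (_ ∷ _)     = refl
eqZ-swap (suc k) (a V.∷ v)           []          = refl
eqZ-swap (suc k) (a V.∷ v)           (x ∷ γ)     = cong (eqzn a x ∧_) (eqZ-swap k v γ)

coefV-sym : ∀ {n} (M : List (List ℕ)) → Sym M → SymZ {n} (coefV M)
coefV-sym M sy k v = trans (sym (sy k _)) (∑-cong M λ γ → cong ι (eqZ-swap k v γ))

WD : List ℕ → Set
WD []      = ⊤
WD (k ∷ κ) = hd κ ≤ k × WD κ

hdV : ∀ {n} → Vec ℕ n → ℕ
hdV V.[]      = 0
hdV (a V.∷ _) = a

WDV : ∀ {n} → Vec ℕ n → Set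
WDV V.[]      = ⊤
WDV (a V.∷ v) = hdV v ≤ a × WDV v

LastNeg : ∀ {n} → Vec ℤ n → Set
LastNeg V.[]              = ⊥
LastNeg (a V.∷ V.[])      = ∃ λ j → a ≡ negsuc j
LastNeg (a V.∷ (b V.∷ v)) = LastNeg (b V.∷ v)

LastNeg-reach : ∀ {n l l′} {v μ : Vec ℤ n} → Reach l v l′ μ → LastNeg v → LastNeg μ
LastNeg-reach (keep stop) ln = ln
LastNeg-reach (lower stop) (j , refl) = _ , refl
LastNeg-reach (keep r@(keep _)) ln = LastNeg-reach r ln
LastNeg-reach (keep r@(lower _)) ln = LastNeg-reach r ln
LastNeg-reach (lower r@(keep _)) ln = LastNeg-reach r ln
LastNeg-reach (lower r@(lower _)) ln = LastNeg-reach r ln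

-- Units only move forward, so the last exponent never increases and a negative one stays negative.
Φ-neg : ∀ {n} (v : Vec ℤ n) X → LastNeg v → (∀ β → LastNeg β → X β ≡ pos 0) → Φ v X ≡ pos 0
Φ-neg (a V.∷ V.[]) X ln z = z (a V.∷ V.[]) ln
Φ-neg {suc (suc n)} (a V.∷ v@(_ V.∷ _)) X ln z = E-zero↓ v λ l′ μ r → Φ-neg {suc n} μ (λ β → X (l′ V.∷ β)) (LastNeg-reach r ln) λ { (b V.∷ β) lb → z (l′ V.∷ b V.∷ β) lb }

-- The fixed points of the dot action of the k-th adjacent transposition: the next entry exceeds
-- this one by exactly 1.
Asc : ∀ {n} → ℕ → Vec ℤ n → Set
Asc zero    (a V.∷ b V.∷ v) = b ≡ a +ᶻ pos 1
Asc (suc k) (a V.∷ v)       = Asc k v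
Asc _       _               = ⊥

Asc-fixed : ∀ {n} k (v : Vec ℤ n) → Asc k v → (suc k < n) × (dotSwap k v ≡ v)
Asc-fixed zero    (a V.∷ _ V.∷ v) refl = s≤s (s≤s z≤n) , cong (λ z → z V.∷ (a +ᶻ pos 1) V.∷ v) (lem a)
  where lem : ∀ a → (a +ᶻ pos 1) -ᶻ pos 1 ≡ a
        lem = ℤS.solve-∀
Asc-fixed (suc k) (a V.∷ v)       as   = let (lt , eq) = Asc-fixed k v as in s≤s lt , cong (a V.∷_) eq

Asc-WD : ∀ {n} k (v : Vec ℤ n) γ → Asc k v → WD γ → eqZ v γ ≡ false
Asc-WD zero    (a V.∷ _ V.∷ v) []          refl wd = refl
Asc-WD zero    (a V.∷ _ V.∷ v) (x ∷ [])    refl wd = lem (eqzn a x)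
  where lem : ∀ b → (b ∧ false) ≡ false
        lem true  = refl
        lem false = refl
Asc-WD zero    (a V.∷ _ V.∷ v) (x ∷ y ∷ γ) refl (le , _) = bool-not λ eq →
  let (e₁ , e₂) = ∧-true {eqzn a x} eq ; (e₃ , _) = ∧-true {eqzn (a +ᶻ pos 1) y} e₂
      xy = trans (cong (_+ᶻ pos 1) (sym (eqzn-sound a x e₁))) (eqzn-sound (a +ᶻ pos 1) y e₃)
  in ℕP.<⇒≱ (ℕP.≤-reflexive (trans (ℕP.+-comm 1 x) (ℤP.+-injective xy))) le
Asc-WD (suc k) (a V.∷ v)       []          as   wd = refl
Asc-WD (suc k) (a V.∷ v)       (x ∷ γ)     as   (_ , wd) = trans (cong (eqzn a x ∧_) (Asc-WD k v γ as wd)) (lem (eqzn a x))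
  where lem : ∀ b → (b ∧ false) ≡ false
        lem true  = refl
        lem false = refl

-- In the first two cases the functional vanishes, by antisymmetry or because no monomial has a
-- negative exponent; the third keeps the induction among partitions.
data Class {n} (λ′ : Vec ℕ n) (θ : Vec ℤ n) : Set where
  asc  : ∀ k → Asc k θ → Class λ′ θ
  neg  : LastNeg θ → Class λ′ θ
  good : (θ′ : Vec ℕ n) → WDV θ′ → hdV θ′ ≤ hdV λ′ → θ ≡ V.map pos θ′ → Class λ′ θ

-- Each entry of a partition is lowered by at most 1. Monotonicity fails only where the first of two
-- equal neighbours is lowered and the second is not, which creates an ascent by 1; negativity
-- arises only when a last entry 0 is lowered. The bound on the first entry is what the comparison
-- with the entry in front uses.
classify : ∀ {n} (λ′ : Vec ℕ n) {l l′ θ} → WDV λ′ → Reach l (V.map pos λ′) l′ θ → Class λ′ θ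
classify V.[] wd stop = good V.[] tt z≤n refl
classify (a V.∷ λ′) (le , wd) (keep r) with classify λ′ wd r
... | asc k as = asc (suc k) as
... | neg ln = neg (lift λ′ r ln)
  where lift : ∀ {n} (λ′ : Vec ℕ n) {l l′ θ b} → Reach l (V.map pos λ′) l′ θ → LastNeg θ → LastNeg (b V.∷ θ)
        lift (_ V.∷ _) {θ = _ V.∷ _} _ ln = ln
... | good θ′ wd′ le′ refl = good (a V.∷ θ′) (ℕP.≤-trans le′ le , wd′) ℕP.≤-refl refl
classify (a V.∷ λ′) (le , wd) (lower r) with classify λ′ wd r
... | asc k as = asc (suc k) as
... | neg ln = neg (lift λ′ r ln)
  where lift : ∀ {n} (λ′ : Vec ℕ n) {l l′ θ b} → Reach l (V.map pos λ′) l′ θ → LastNeg θ → LastNeg (b V.∷ θ)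
        lift (_ V.∷ _) {θ = _ V.∷ _} _ ln = ln
classify (zero V.∷ V.[]) (le , wd) (lower r) | good V.[] wd′ le′ refl = neg (0 , refl)
classify (zero V.∷ (b V.∷ λ′)) (le , wd) (lower r) | good (t V.∷ θ′) wd′ le′ refl with ℕP.n≤0⇒n≡0 (ℕP.≤-trans le′ le)
... | refl = asc 0 refl
classify (suc a V.∷ λ′) (le , wd) (lower r) | good θ′ wd′ le′ refl with hdV θ′ ≤? a
... | yes l = good (a V.∷ θ′) (l , wd′) (ℕP.n≤1+n a) refl
classify (suc a V.∷ λ′) (le , wd) (lower r) | good V.[] wd′ le′ refl | no nl = ⊥-elim (nl z≤n)
classify (suc a V.∷ λ′) (le , wd) (lower r) | good (t V.∷ θ′) wd′ le′ refl | no nl =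
  asc 0 (cong pos (trans (ℕP.≤-antisym (ℕP.≤-trans le′ le) (ℕP.≰⇒> nl)) (ℕP.+-comm 1 a)))

-- Interlacing of consecutive rows of a triangular Gelfand-Tsetlin pattern: unlike in `il`, the
-- lower row is one entry shorter.
ild : List ℕ → List ℕ → Bool
ild (k ∷ [])     []      = true
ild (k ∷ k₂ ∷ κ) (j ∷ μ) = (k₂ ≤ᵇ j) ∧ ((j ≤ᵇ k) ∧ ild (k₂ ∷ κ) μ)
ild _            _       = false

ild-parts : ∀ {k₂ j k b} → ((k₂ ≤ᵇ j) ∧ ((j ≤ᵇ k) ∧ b)) ≡ true → (k₂ ≤ j) × (j ≤ k) × (b ≡ true)
ild-parts {k₂} {j} {k} eq = let (x , y) = ∧-true {k₂ ≤ᵇ j} eq ; (z , w) = ∧-true {j ≤ᵇ k} y in ≤ᵇ-sound k₂ j x , ≤ᵇ-sound j k z , w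

ild-WD : ∀ κ μ → ild κ μ ≡ true → WD μ × (hd μ ≤ hd κ)
ild-WD (k ∷ [])     []      _  = tt , z≤n
ild-WD (k ∷ k₂ ∷ κ) (j ∷ μ) eq = let (a , b , c) = ild-parts {k₂} {j} {k} eq ; (wd , le) = ild-WD (k₂ ∷ κ) μ c in (ℕP.≤-trans le a , wd) , b

ild-size : ∀ κ μ → ild κ μ ≡ true → size μ ≤ size κ
ild-size (k ∷ [])     []      _  = z≤n
ild-size (k ∷ k₂ ∷ κ) (j ∷ μ) eq = let (a , b , c) = ild-parts {k₂} {j} {k} eq in ℕP.+-mono-≤ b (ild-size (k₂ ∷ κ) μ c)

lastD : ℕ → List ℕ → ℕ
lastD k []      = k
lastD k (j ∷ κ) = lastD j κ

il-snoc : ∀ k κ u j → length u ≡ length κ → il (k ∷ κ) (u ++ j ∷ []) ≡ (ild (k ∷ κ) u ∧ (j ≤ᵇ lastD k κ))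
il-snoc k []       []      j len with j ≤ᵇ k
... | true  = refl
... | false = refl
il-snoc k (k₂ ∷ κ) (x ∷ u) j len = trans (cong (λ z → (k₂ ≤ᵇ x) ∧ ((x ≤ᵇ k) ∧ z)) (il-snoc k₂ κ u j (ℕP.suc-injective len)))
  (lem (k₂ ≤ᵇ x) (x ≤ᵇ k) (ild (k₂ ∷ κ) u) _)
  where lem : ∀ a b c d → (a ∧ (b ∧ (c ∧ d))) ≡ ((a ∧ (b ∧ c)) ∧ d)
        lem true  true  c d = refl
        lem true  false c d = refl
        lem false b     c d = refl

il-pad : ∀ κ u j → length u ≡ length κ → il (κ ++ 0 ∷ []) (u ++ j ∷ []) ≡ (il κ u ∧ (j ≤ᵇ 0))
il-pad []      []      zero    len = refl
il-pad []      []      (suc j) len = refl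
il-pad (k ∷ κ) (x ∷ u) j       len = trans (cong₂ (λ y z → (y ≤ᵇ x) ∧ ((x ≤ᵇ k) ∧ z)) (hd-pad κ) (il-pad κ u j (ℕP.suc-injective len))) (lem (hd κ ≤ᵇ x) (x ≤ᵇ k) (il κ u) _)
  where lem : ∀ a b c d → (a ∧ (b ∧ (c ∧ d))) ≡ ((a ∧ (b ∧ c)) ∧ d)
        lem true  true  c d = refl
        lem true  false c d = refl
        lem false b     c d = refl
        hd-pad : ∀ κ → hd (κ ++ 0 ∷ []) ≡ hd κ
        hd-pad []      = refl
        hd-pad (_ ∷ _) = refl

size-snoc : ∀ κ j → size (κ ++ j ∷ []) ≡ size κ + j
size-snoc []      j = ℕP.+-identityʳ j
size-snoc (k ∷ κ) j = trans (cong (k +_) (size-snoc κ j)) (sym (ℕP.+-assoc k (size κ) j))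

PosPrefix : ℕ → List ℕ → Set
PosPrefix zero    κ       = ⊤
PosPrefix (suc n) []      = ⊥
PosPrefix (suc n) (k ∷ κ) = 1 ≤ k × PosPrefix n κ

PosPrefix-il : ∀ n κ μ → il κ μ ≡ true → PosPrefix (suc n) κ → PosPrefix n μ
PosPrefix-il zero    κ            μ       eq pp            = tt
PosPrefix-il (suc n) (k ∷ k₂ ∷ κ) (j ∷ μ) eq (_ , p₂ , pp) =
  let (a , b) = ∧-true {k₂ ≤ᵇ j} eq in ℕP.≤-trans p₂ (≤ᵇ-sound k₂ j a) , PosPrefix-il n (k₂ ∷ κ) μ (proj₂ (∧-true {j ≤ᵇ k} b)) (p₂ , pp)

module Main (B : ℕ) where
  open GT B

  Box-≡ : ∀ {n n′} → n ≡ n′ → ∀ (f : List ℕ → ℤ) → ∑ (Box n) f ≡ ∑ (Box n′) f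
  Box-≡ refl f = refl

  -- By interlacing, a branching step loses at most one positive part, and with no variables left
  -- all parts have to be zero.
  RL-vanish : ∀ N κ f → PosPrefix (suc N) κ → ∑ (RL N κ) f ≡ pos 0
  RL-vanish zero (suc k ∷ κ) f (_ , _) = ∑-[] f
  RL-vanish (suc N) κ f pp = trans (∑-RL-suc N κ f) (∑-zero (Box (length κ)) λ μ →
    trans (ι-cong (il κ μ) λ eq → RL-vanish N μ _ (PosPrefix-il (suc N) κ μ eq pp)) (ℤP.*-zeroʳ (ι (il κ μ))))

  ∑-Box-snoc : ∀ n f → ∑ (Box (n + 1)) f ≡ ∑ (Box n) (λ u → ∑ (upTo (suc B)) (λ j → f (u ++ j ∷ [])))
  ∑-Box-snoc n f = trans (∑-words-+ (upTo (suc B)) n 1 f) (∑-cong (Box n) λ u → trans (∑-words-suc (upTo (suc B)) 0 _) (∑-cong (upTo (suc B)) λ j → ∑-words-0 (upTo (suc B)) _))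

  RL-pad : ∀ N κ f → ∑ (RL N (κ ++ 0 ∷ [])) f ≡ ∑ (RL N κ) f
  RL-pad zero κ f = trans (∑-RL-0 (κ ++ 0 ∷ []) f) (trans (cong (λ b → ι b *ᶻ f []) (az κ)) (sym (∑-RL-0 κ f)))
    where az : ∀ κ → allZ (κ ++ 0 ∷ []) ≡ allZ κ
          az []      = refl
          az (k ∷ κ) = cong ((k ≡ᵇ 0) ∧_) (az κ)
  RL-pad (suc N) κ f = trans (∑-RL-suc N (κ ++ 0 ∷ []) f) (trans (Box-≡ (LP.length-++ κ) _)
    (trans (∑-Box-snoc (length κ) _) (trans (Box-cong (length κ) λ u _ len →
        trans (∑-cong (upTo (suc B)) λ j → trans (cong (λ b → ι b *ᶻ g u j) (il-pad κ u j len)) (trans (ι-∧* (il κ u) (j ≤ᵇ 0) (g u j)) (ι-comm (il κ u) (j ≤ᵇ 0) (g u j))))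
          (trans (∑-upTo-restrict {B} {0} (λ j → ι (il κ u) *ᶻ g u j) z≤n) (trans (∑-one 0 _) (cong (ι (il κ u) *ᶻ_) (gz u)))))
      (sym (∑-RL-suc N κ f)))))
    where
    g : List ℕ → ℕ → ℤ
    g u j = ∑ (RL N (u ++ j ∷ [])) (λ β → f ((size (κ ++ 0 ∷ []) ∸ size (u ++ j ∷ [])) ∷ β))
    gz : ∀ u → g u 0 ≡ ∑ (RL N u) (λ β → f ((size κ ∸ size u) ∷ β))
    gz u = trans (RL-pad N u _) (∑-cong (RL N u) λ β → cong₂ (λ x y → f ((x ∸ y) ∷ β)) (trans (size-snoc κ 0) (ℕP.+-identityʳ _)) (trans (size-snoc u 0) (ℕP.+-identityʳ _)))

  -- Coefficients of the Schur polynomial in as many variables as κ has entries, counted by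
  -- triangular patterns. The formula makes sense at all integer exponents, where `Φ` needs it.
  Kd : ∀ {n} → Vec ℤ n → List ℕ → ℤ
  Kd V.[] κ = pos 1
  Kd {suc n} (b V.∷ β) κ = ∑ (Box n) (λ μ → ι (ild κ μ) *ᶻ (ι (eqzn b (size κ ∸ size μ)) *ᶻ Kd β μ))

  coef-RL-suc : ∀ {n} b (β : Vec ℤ n) κ → coefV (RL (suc n) κ) (b V.∷ β) ≡
    ∑ (Box (length κ)) (λ μ → ι (il κ μ) *ᶻ (ι (eqzn b (size κ ∸ size μ)) *ᶻ coefV (RL n μ) β))
  coef-RL-suc {n} b β κ = trans (∑-RL-suc n κ _) (∑-cong (Box (length κ)) λ μ → cong (ι (il κ μ) *ᶻ_)
    (trans (∑-cong (RL n μ) λ γ → ι-∧ (eqzn b (size κ ∸ size μ)) (eqZ β γ)) (∑-* (RL n μ) (ι (eqzn b (size κ ∸ size μ))) _)))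

  last-pos : ∀ k κ → WD (k ∷ κ) → 1 ≤ lastD k κ → PosPrefix (suc (length κ)) (k ∷ κ)
  last-pos k []       wd         le = le , tt
  last-pos k (k₂ ∷ κ) (l , wd)   le = let pp = last-pos k₂ κ wd le in ℕP.≤-trans (proj₁ pp) l , pp

  ild-pos : ∀ κ u → ild κ u ≡ true → PosPrefix (length κ) κ → ∀ j → PosPrefix (suc (length u)) (u ++ suc j ∷ [])
  ild-pos (k ∷ [])     []      eq pp      j = s≤s z≤n , tt
  ild-pos (k ∷ k₂ ∷ κ) (x ∷ u) eq (_ , pp) j = let (a , b , c) = ild-parts {k₂} {x} {k} eq in
    ℕP.≤-trans (proj₁ pp) a , ild-pos (k₂ ∷ κ) u c pp j

  -- With as many variables as rows, the last entry of μ must be 0. A positive one forces the last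
  -- part of κ, hence all parts of κ and of μ, to be positive, and then μ has more positive parts
  -- than there are variables left.
  RL-Kd : ∀ {n} (β : Vec ℤ n) κ → length κ ≡ n → WD κ → Bdd κ → coefV (RL n κ) β ≡ Kd β κ
  RL-Kd V.[] [] refl wd bd = ∑-one [] _
  RL-Kd {suc n} (b V.∷ β) (k ∷ κ) len wd (k<B ∷ bd) = trans (coef-RL-suc b β (k ∷ κ)) (trans (Box-≡ (trans len (ℕP.+-comm 1 n)) _)
    (trans (∑-Box-snoc n _) (Box-cong n λ u bu lu → per u bu lu)))
    where
    lenκ : length κ ≡ n
    lenκ = ℕP.suc-injective len
    per : ∀ u → Bdd u → length u ≡ n →
      ∑ (upTo (suc B)) (λ j → ι (il (k ∷ κ) (u ++ j ∷ [])) *ᶻ (ι (eqzn b (size (k ∷ κ) ∸ size (u ++ j ∷ []))) *ᶻ coefV (RL n (u ++ j ∷ [])) β)) ≡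
      ι (ild (k ∷ κ) u) *ᶻ (ι (eqzn b (size (k ∷ κ) ∸ size u)) *ᶻ Kd β u)
    per u bu lu = trans (∑-cong (upTo (suc B)) λ j → trans (cong (λ z → ι z *ᶻ g j) (il-snoc k κ u j (trans lu (sym lenκ)))) (ι-∧* (ild (k ∷ κ) u) (j ≤ᵇ lastD k κ) (g j)))
      (trans (∑-* (upTo (suc B)) (ι (ild (k ∷ κ) u)) _) (ι-cong (ild (k ∷ κ) u) λ eq →
        trans (∑-upTo-suc B _) (trans (cong₂ _+ᶻ_ (trans (ℤP.*-identityˡ (g 0)) (g0 eq))
          (∑-zero (upTo B) λ j → trans (ι-cong (suc j ≤ᵇ lastD k κ) λ e₂ → gs eq j (ℕP.≤-trans (s≤s z≤n) (≤ᵇ-sound (suc j) (lastD k κ) e₂))) (ℤP.*-zeroʳ (ι (suc j ≤ᵇ lastD k κ)))))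
          (ℤP.+-identityʳ _))))
      where
      g : ℕ → ℤ
      g j = ι (eqzn b (size (k ∷ κ) ∸ size (u ++ j ∷ []))) *ᶻ coefV (RL n (u ++ j ∷ [])) β
      g0 : ild (k ∷ κ) u ≡ true → g 0 ≡ ι (eqzn b (size (k ∷ κ) ∸ size u)) *ᶻ Kd β u
      g0 eq = cong₂ (λ x y → ι (eqzn b (size (k ∷ κ) ∸ x)) *ᶻ y) (trans (size-snoc u 0) (ℕP.+-identityʳ _))
        (trans (RL-pad n u _) (RL-Kd β u lu (proj₁ (ild-WD (k ∷ κ) u eq)) bu))
      gs : ild (k ∷ κ) u ≡ true → ∀ j → 1 ≤ lastD k κ → g (suc j) ≡ pos 0
      gs eq j le = trans (cong (ι (eqzn b (size (k ∷ κ) ∸ size (u ++ suc j ∷ []))) *ᶻ_)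
        (RL-vanish n (u ++ suc j ∷ []) _ (subst (λ z → PosPrefix (suc z) (u ++ suc j ∷ [])) lu (ild-pos (k ∷ κ) u eq (last-pos k κ wd le) j))))
        (ℤP.*-zeroʳ (ι (eqzn b (size (k ∷ κ) ∸ size (u ++ suc j ∷ [])))))

  Kd-sym : ∀ {n} κ → length κ ≡ n → WD κ → Bdd κ → SymZ {n} (λ β → Kd β κ)
  Kd-sym {n} κ len wd bd k v = trans (sym (RL-Kd (swapV k v) κ len wd bd)) (trans (coefV-sym (RL n κ) (RL-sym n κ bd) k v) (RL-Kd v κ len wd bd))

  Kd-neg : ∀ {n} (β : Vec ℤ n) κ → LastNeg β → Kd β κ ≡ pos 0
  Kd-neg (_ V.∷ V.[]) κ (j , refl) = ∑-zero (Box 0) λ μ → ℤP.*-zeroʳ (ι (ild κ μ))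
  Kd-neg {suc (suc n)} (b V.∷ β@(_ V.∷ _)) κ ln = ∑-zero (Box (suc n)) λ μ → trans (cong (λ z → ι (ild κ μ) *ᶻ (ι (eqzn b (size κ ∸ size μ)) *ᶻ z)) (Kd-neg β μ ln))
    (trans (cong (ι (ild κ μ) *ᶻ_) (ℤP.*-zeroʳ (ι (eqzn b (size κ ∸ size μ))))) (ℤP.*-zeroʳ (ι (ild κ μ))))

  -- The indicator that the integer vector μ interlaces κ, written as a sum so that it vanishes at
  -- vectors with negative entries. It is what remains of the pattern sum once the induction
  -- hypothesis has been applied to the shorter rows.
  HK : ∀ {n} → List ℕ → Vec ℤ n → ℤ
  HK {n} κ μ = ∑ (Box n) (λ u → ι (ild κ u) *ᶻ ι (eqZ μ u))

  χ : ℕ → ℕ → ℤ → ℤ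
  χ k k₂ b = ∑ (upTo (suc B)) (λ j → ι (between k₂ k j) *ᶻ ι (eqzn b j))

  HK-suc : ∀ {n} k k₂ κ b (μ : Vec ℤ n) → HK (k ∷ k₂ ∷ κ) (b V.∷ μ) ≡ χ k k₂ b *ᶻ HK (k₂ ∷ κ) μ
  HK-suc {n} k k₂ κ b μ = trans (∑-words-suc (upTo (suc B)) n _) (trans (∑-cong (upTo (suc B)) λ j →
      trans (∑-cong (Box n) λ u → trans (cong₂ _*ᶻ_ (trans (ι-∧ (k₂ ≤ᵇ j) ((j ≤ᵇ k) ∧ ild (k₂ ∷ κ) u)) (cong (ι (k₂ ≤ᵇ j) *ᶻ_) (ι-∧ (j ≤ᵇ k) (ild (k₂ ∷ κ) u)))) (ι-∧ (eqzn b j) (eqZ μ u)))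
               (ring (ι (k₂ ≤ᵇ j)) (ι (j ≤ᵇ k)) (ι (ild (k₂ ∷ κ) u)) (ι (eqzn b j)) (ι (eqZ μ u))))
        (trans (∑-* (Box n) ((ι (k₂ ≤ᵇ j) *ᶻ ι (j ≤ᵇ k)) *ᶻ ι (eqzn b j)) _)
          (trans (ℤP.*-comm ((ι (k₂ ≤ᵇ j) *ᶻ ι (j ≤ᵇ k)) *ᶻ ι (eqzn b j)) (HK (k₂ ∷ κ) μ))
            (cong (λ z → HK (k₂ ∷ κ) μ *ᶻ (z *ᶻ ι (eqzn b j))) (sym (ι-∧ (k₂ ≤ᵇ j) (j ≤ᵇ k)))))))
    (trans (∑-* (upTo (suc B)) (HK (k₂ ∷ κ) μ) _) (ℤP.*-comm (HK (k₂ ∷ κ) μ) (χ k k₂ b))))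
    where
    ring : ∀ a b c d f → (a *ᶻ (b *ᶻ c)) *ᶻ (d *ᶻ f) ≡ ((a *ᶻ b) *ᶻ d) *ᶻ (c *ᶻ f)
    ring = ℤS.solve-∀

  χ-pos : ∀ k k₂ j → k ≤ B → χ k k₂ (pos j) ≡ ι (between k₂ k j)
  χ-pos k k₂ j le = trans (∑-cong (upTo (suc B)) λ i → ℤP.*-comm (ι (between k₂ k i)) (ι (j ≡ᵇ i))) (trans (∑-upTo-delta (suc B) j (λ i → ι (between k₂ k i))) (lem (between k₂ k j) refl))
    where lem : ∀ b → between k₂ k j ≡ b → ι (j <ᵇ suc B) *ᶻ ι b ≡ ι b
          lem true  eq = ι-true (pos 1) (<ᵇ-true (s≤s (ℕP.≤-trans (≤ᵇ-sound j k (proj₂ (∧-true {k₂ ≤ᵇ j} eq))) le)))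
          lem false eq = ℤP.*-zeroʳ (ι (j <ᵇ suc B))

  -- The indicator of the interval from k₂ to k jumps up at k₂ and down at k + 1.
  χ-diff : ∀ k k₂ j → k ≤ B → k₂ ≤ k → χ k k₂ (pos j) -ᶻ χ k k₂ (pos j -ᶻ pos 1) ≡ ι (j ≡ᵇ k₂) -ᶻ ι (j ≡ᵇ suc k)
  χ-diff k k₂ zero le kk = trans (cong₂ _-ᶻ_ (χ-pos k k₂ 0 le) (∑-zero (upTo (suc B)) λ i → ℤP.*-zeroʳ (ι (between k₂ k i)))) (cong (λ z → ι z -ᶻ pos 0) (lem k₂))
    where lem : ∀ k₂ → between k₂ k 0 ≡ (0 ≡ᵇ k₂)
          lem zero    = refl
          lem (suc _) = refl
  χ-diff k k₂ (suc j) le kk = trans (cong₂ _-ᶻ_ (χ-pos k k₂ (suc j) le) (χ-pos k k₂ j le)) (lem (ℕP.<-cmp (suc j) k₂) (ℕP.<-cmp j k))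
    where
    open import Relation.Binary.Definitions using (Tri; tri<; tri≈; tri>)
    bt : ∀ {i} → k₂ ≤ i → i ≤ k → between k₂ k i ≡ true
    bt a b = ∧-intro (≤ᵇ-true a) (≤ᵇ-true b)
    bl : ∀ {i} → i < k₂ → between k₂ k i ≡ false
    bl a = cong (_∧ _) (≤ᵇ-false a)
    bh : ∀ {i} → k < i → between k₂ k i ≡ false
    bh {i} a = bool-not λ eq → ℕP.<⇒≱ a (≤ᵇ-sound i k (proj₂ (∧-true {k₂ ≤ᵇ i} eq)))
    lem : Tri (suc j < k₂) (suc j ≡ k₂) (k₂ < suc j) → Tri (j < k) (j ≡ k) (k < j) →
          ι (between k₂ k (suc j)) -ᶻ ι (between k₂ k j) ≡ ι (suc j ≡ᵇ k₂) -ᶻ ι (j ≡ᵇ k)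
    lem (tri< a ne _) _ rewrite bl a | bl (ℕP.<-trans (ℕP.n<1+n j) a) | ≡ᵇ-≢ ne | ≡ᵇ-≢ {j} {k} (λ eq → ℕP.<⇒≱ (ℕP.<-trans (ℕP.n<1+n j) a) (ℕP.≤-trans kk (ℕP.≤-reflexive (sym eq)))) = refl
    lem (tri≈ _ refl _) _ rewrite bt {suc j} ℕP.≤-refl kk | bl {j} ℕP.≤-refl | ≡ᵇ-refl j | ≡ᵇ-≢ {j} {k} (λ eq → ℕP.<⇒≢ kk eq) = refl
    lem (tri> _ ne c) (tri< a ne′ _) rewrite bt {suc j} (ℕP.<⇒≤ c) a | bt {j} (ℕP.≤-pred c) (ℕP.<⇒≤ a) | ≡ᵇ-≢ ne | ≡ᵇ-≢ ne′ = refl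
    lem (tri> _ ne c) (tri≈ _ refl _) rewrite bh {suc j} ℕP.≤-refl | bt {j} (ℕP.≤-pred c) ℕP.≤-refl | ≡ᵇ-≢ ne | ≡ᵇ-refl j = refl
    lem (tri> _ ne c) (tri> _ ne′ d) rewrite bh {suc j} (ℕP.<-trans d (ℕP.n<1+n j)) | bh {j} d | ≡ᵇ-≢ ne | ≡ᵇ-≢ ne′ = refl

  Jv : ∀ {n} → List ℕ → Vec ℕ n → ℤ
  Jv (k ∷ k₂ ∷ κ) (j V.∷ v) = (ι (j ≡ᵇ k₂) -ᶻ ι (j ≡ᵇ suc k)) *ᶻ Jv (k₂ ∷ κ) v
  Jv _ _ = pos 1

  -- The interlacing indicator is a product of interval indicators, one for each entry, and `E`
  -- takes a backward difference in each entry; `Jv` is the resulting product of jumps.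
  E-HK : ∀ {n} l k κ (v : Vec ℕ n) → length κ ≡ n → WD (k ∷ κ) → Bdd (k ∷ κ) → E l (V.map pos v) (λ _ μ → HK (k ∷ κ) μ) ≡ Jv (k ∷ κ) v
  E-HK l k []       V.[]      len wd bd = ∑-one [] _
  E-HK l k (k₂ ∷ κ) (j V.∷ v) len (kk , wd) (k<B ∷ bd) = begin
    E l v′ (λ _ μ → HK (k ∷ k₂ ∷ κ) (pos j V.∷ μ)) -ᶻ E (l +ᶻ pos 1) v′ (λ _ μ → HK (k ∷ k₂ ∷ κ) ((pos j -ᶻ pos 1) V.∷ μ))
      ≡⟨ cong₂ _-ᶻ_ (part l (pos j)) (part (l +ᶻ pos 1) (pos j -ᶻ pos 1)) ⟩
    χ k k₂ (pos j) *ᶻ J -ᶻ χ k k₂ (pos j -ᶻ pos 1) *ᶻ J ≡⟨ ring (χ k k₂ (pos j)) (χ k k₂ (pos j -ᶻ pos 1)) J ⟩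
    (χ k k₂ (pos j) -ᶻ χ k k₂ (pos j -ᶻ pos 1)) *ᶻ J ≡⟨ cong (_*ᶻ J) (χ-diff k k₂ j (ℕP.≤-pred k<B) kk) ⟩
    (ι (j ≡ᵇ k₂) -ᶻ ι (j ≡ᵇ suc k)) *ᶻ J ∎
    where
    open ≡-Reasoning
    v′ = V.map pos v
    J = Jv (k₂ ∷ κ) v
    ring : ∀ a b c → a *ᶻ c -ᶻ b *ᶻ c ≡ (a -ᶻ b) *ᶻ c
    ring = ℤS.solve-∀
    part : ∀ l b → E l v′ (λ _ μ → HK (k ∷ k₂ ∷ κ) (b V.∷ μ)) ≡ χ k k₂ b *ᶻ J
    part l b = trans (E-cong v′ λ _ μ → HK-suc k k₂ κ b μ) (trans (E-scale v′ (χ k k₂ b) _) (cong (χ k k₂ b *ᶻ_) (E-HK l k₂ κ v (ℕP.suc-injective len) wd bd)))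

  Jv-low : ∀ {n} k κ (v : Vec ℕ n) → length κ ≡ n → WDV v → hdV v ≤ k → Jv (k ∷ κ) v ≡ ι (eqL (V.toList v) κ)
  Jv-low k []       V.[]      len wd le = refl
  Jv-low k (k₂ ∷ κ) (j V.∷ v) len (jj , wd) le =
    trans (cong (λ z → (ι (j ≡ᵇ k₂) -ᶻ ι z) *ᶻ Jv (k₂ ∷ κ) v) (≡ᵇ-≢ {j} {suc k} (ℕP.<⇒≢ (s≤s le))))
    (trans (cong (_*ᶻ Jv (k₂ ∷ κ) v) (ℤP.+-identityʳ (ι (j ≡ᵇ k₂))))
    (trans (ι-cong (j ≡ᵇ k₂) λ eq → Jv-low k₂ κ v (ℕP.suc-injective len) wd (ℕP.≤-trans jj (ℕP.≤-reflexive (≡ᵇ-sound j k₂ eq)))) (sym (ι-∧ (j ≡ᵇ k₂) _))))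

  -- Where the product does not vanish, every entry of v is the next part of κ or exceeds the
  -- present part by 1; either way it is at least the next part.
  Jv-size : ∀ {n} k κ (v : Vec ℕ n) → length κ ≡ n → WD (k ∷ κ) → (Jv (k ∷ κ) v ≡ pos 0) ⊎ (size κ ≤ size (V.toList v))
  Jv-size k []       V.[]      len wd = inj₂ z≤n
  Jv-size k (k₂ ∷ κ) (j V.∷ v) len (kk , wd) with Jv-size k₂ κ v (ℕP.suc-injective len) wd
  ... | inj₁ z = inj₁ (trans (cong ((ι (j ≡ᵇ k₂) -ᶻ ι (j ≡ᵇ suc k)) *ᶻ_) z) (ℤP.*-zeroʳ (ι (j ≡ᵇ k₂) -ᶻ ι (j ≡ᵇ suc k))))
  ... | inj₂ le with j ≟ k₂ | j ≟ suc k
  ...   | yes refl | _ = inj₂ (ℕP.+-monoʳ-≤ j le)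
  ...   | no _ | yes refl = inj₂ (ℕP.+-mono-≤ (ℕP.≤-trans kk (ℕP.n≤1+n k)) le)
  ...   | no n₁ | no n₂ = inj₁ (cong₂ (λ x y → (ι x -ᶻ ι y) *ᶻ Jv (k₂ ∷ κ) v) (≡ᵇ-≢ n₁) (≡ᵇ-≢ n₂))

  -- If the first entry of v is at most k, then `Jv` forces v = κ, and equal totals force l = k.
  -- Otherwise l > k, while a nonvanishing `Jv` gives |v| ≥ |κ|, so the totals cannot agree.
  finish : ∀ {n} l k κ (v : Vec ℕ n) → length κ ≡ n → WD (k ∷ κ) → WDV (l V.∷ v) →
           ι (l + size (V.toList v) ≡ᵇ k + size κ) *ᶻ Jv (k ∷ κ) v ≡ ι ((l ≡ᵇ k) ∧ eqL (V.toList v) κ)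
  finish l k κ v len wd (ll , wdv) with hdV v ≤? k
  ... | yes le = trans (cong (ι (l + size (V.toList v) ≡ᵇ k + size κ) *ᶻ_) (Jv-low k κ v len wdv le))
      (trans (sym (ι-∧ (l + size (V.toList v) ≡ᵇ k + size κ) (eqL (V.toList v) κ))) (cong ι (bool-iff
        (λ eq → let (a , b) = ∧-true {l + size (V.toList v) ≡ᵇ k + size κ} eq in ∧-intro (trans (cong (_≡ᵇ k) (canc (eqL-sound (V.toList v) κ b) (≡ᵇ-sound _ _ a))) (≡ᵇ-refl k)) b)
        (λ eq → let (a , b) = ∧-true {l ≡ᵇ k} eq in ∧-intro (trans (cong₂ (λ x y → (x + size y) ≡ᵇ (k + size κ)) (≡ᵇ-sound l k a) (eqL-sound (V.toList v) κ b)) (≡ᵇ-refl (k + size κ))) b))))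
    where canc : ∀ {xs} → xs ≡ κ → l + size xs ≡ k + size κ → l ≡ k
          canc refl eq = ℕP.+-cancelʳ-≡ (size κ) l k eq
  ... | no nle with Jv-size k κ v len wd
  ...   | inj₁ z = trans (cong (ι (l + size (V.toList v) ≡ᵇ k + size κ) *ᶻ_) z) (trans (ℤP.*-zeroʳ (ι (l + size (V.toList v) ≡ᵇ k + size κ))) (cong (λ b → ι (b ∧ eqL (V.toList v) κ)) (sym lk)))
    where lk : (l ≡ᵇ k) ≡ false
          lk = ≡ᵇ-≢ {l} {k} λ eq → nle (ℕP.≤-trans ll (ℕP.≤-reflexive eq))
  ...   | inj₂ sz = trans (ι-false _ (≡ᵇ-≢ (λ eq → ℕP.<⇒≢ (ℕP.+-mono-<-≤ (ℕP.<-≤-trans (ℕP.≰⇒> nle) ll) sz) (sym eq)))) (cong (λ b → ι (b ∧ eqL (V.toList v) κ)) (sym lk))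
    where lk : (l ≡ᵇ k) ≡ false
          lk = ≡ᵇ-≢ {l} {k} λ eq → nle (ℕP.≤-trans ll (ℕP.≤-reflexive eq))

  sumZ-pos : ∀ {n} (v : Vec ℕ n) → sumZ (V.map pos v) ≡ pos (size (V.toList v))
  sumZ-pos V.[]      = refl
  sumZ-pos (a V.∷ v) = cong (pos a +ᶻ_) (sumZ-pos v)

  -- Split off the first variable: by induction the functional on the shorter patterns is a
  -- Kronecker delta at every exponent that `E` reaches, and what is left is `E` of the interlacing
  -- indicator.
  Φ-Kd : ∀ n (v : Vec ℕ n) κ → length κ ≡ n → WDV v → WD κ → Bdd κ → Φ (V.map pos v) (λ β → Kd β κ) ≡ ι (eqL (V.toList v) κ)
  -- Carries the evaluation from partitions to every exponent reached from one. At fixed points of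
  -- the dot action and at negative last entries both sides are 0.
  Φ-near : ∀ n (v : Vec ℕ n) κ {l l′ θ} → Reach l (V.map pos v) l′ θ → length κ ≡ n → WDV v → WD κ → Bdd κ → Φ θ (λ β → Kd β κ) ≡ ι (eqZ θ κ)

  Φ-near n v κ {θ = θ} r len wdv wd bd with classify v wdv r
  ... | asc k as = let (lt , fx) = Asc-fixed k θ as in
          trans (Φ-fixed k θ _ lt (Kd-sym κ len wd bd) fx) (sym (cong ι (Asc-WD k θ κ as wd)))
  ... | neg ln = trans (Φ-neg θ _ ln λ β lb → Kd-neg β κ lb) (sym (cong ι (ln-eq θ κ ln)))
    where ln-eq : ∀ {n} (θ : Vec ℤ n) κ → LastNeg θ → eqZ θ κ ≡ false
          ln-eq (_ V.∷ V.[]) [] _ = refl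
          ln-eq (_ V.∷ V.[]) (_ ∷ _) (j , refl) = refl
          ln-eq (b V.∷ (c V.∷ θ)) [] ln = refl
          ln-eq (b V.∷ (c V.∷ θ)) (x ∷ κ) ln = trans (cong (eqzn b x ∧_) (ln-eq (c V.∷ θ) κ ln)) (lem (eqzn b x))
            where lem : ∀ b → (b ∧ false) ≡ false
                  lem true  = refl
                  lem false = refl
  ... | good θ′ wd′ _ refl = trans (Φ-Kd n θ′ κ len wd′ wd bd) (cong ι (sym (eqZ-pos θ′ κ)))

  Φ-Kd zero V.[] [] len wdv wd bd = refl
  Φ-Kd (suc n) (l V.∷ v) (k ∷ κ) len wdv wd bd = begin
    E (pos l) v′ (λ l′ μ → Φ μ (λ β → ∑ (Box n) (λ u → ι (ild K u) *ᶻ (ι (eqzn l′ (size K ∸ size u)) *ᶻ Kd β u))))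
      ≡⟨ E-cong v′ (λ l′ μ → trans (Φ-∑ μ (Box n) _) (∑-cong (Box n) λ u → trans (Φ-scale μ (ι (ild K u)) _) (cong (ι (ild K u) *ᶻ_) (Φ-scale μ (ι (eqzn l′ (size K ∸ size u))) _)))) ⟩
    E (pos l) v′ (λ l′ μ → ∑ (Box n) (λ u → ι (ild K u) *ᶻ (ι (eqzn l′ (size K ∸ size u)) *ᶻ Φ μ (λ β → Kd β u))))
      ≡⟨ E-cong↓ v′ (λ l′ μ r → trans (Box-cong n λ u bu lu → trans (ι-cong (ild K u) λ eq → per r u bu lu eq) (ι-left (ild K u) (ι tot) (ι (eqZ μ u)))) (∑-* (Box n) (ι tot) _)) ⟩
    E (pos l) v′ (λ l′ μ → ι tot *ᶻ HK K μ)
      ≡⟨ E-scale v′ (ι tot) _ ⟩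
    ι tot *ᶻ E (pos l) v′ (λ l′ μ → HK K μ)
      ≡⟨ cong (ι tot *ᶻ_) (E-HK (pos l) k κ v (ℕP.suc-injective len) wd bd) ⟩
    ι tot *ᶻ Jv K v
      ≡⟨ finish l k κ v (ℕP.suc-injective len) wd wdv ⟩
    ι ((l ≡ᵇ k) ∧ eqL (V.toList v) κ) ∎
    where
    open ≡-Reasoning
    v′ = V.map pos v
    K = k ∷ κ
    tot : Bool
    -- Moving units preserves the total degree. So where μ = u, the condition on l′ says only that
    -- the degrees agree; it does not depend on the terms chosen in `E` and can be taken out of it.
    tot = l + size (V.toList v) ≡ᵇ k + size κ
    ι-left : ∀ a t x → ι a *ᶻ (t *ᶻ x) ≡ t *ᶻ (ι a *ᶻ x)
    ι-left a t x = lem (ι a) t x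
      where lem : ∀ a b x → a *ᶻ (b *ᶻ x) ≡ b *ᶻ (a *ᶻ x)
            lem = ℤS.solve-∀
    per : ∀ {l′ μ} → Reach (pos l) v′ l′ μ → ∀ u → Bdd u → length u ≡ n → ild K u ≡ true →
          ι (eqzn l′ (size K ∸ size u)) *ᶻ Φ μ (λ β → Kd β u) ≡ ι tot *ᶻ ι (eqZ μ u)
    per {l′} {μ} r u bu lu eq = trans (cong (ι (eqzn l′ (size K ∸ size u)) *ᶻ_) (Φ-near n v u r lu (proj₂ wdv) (proj₁ (ild-WD K u eq)) bu))
      (trans (ℤP.*-comm (ι (eqzn l′ (size K ∸ size u))) (ι (eqZ μ u))) (trans (ι-cong (eqZ μ u) λ e₁ → cong ι (same e₁)) (ℤP.*-comm (ι (eqZ μ u)) (ι tot))))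
      where
      su : size u ≤ size K
      su = ild-size K u eq
      tsum : eqZ μ u ≡ true → l′ +ᶻ pos (size u) ≡ pos (l + size (V.toList v))
      tsum e₁ = trans (cong (l′ +ᶻ_) (sym (eqZ-sum μ u e₁))) (trans (Reach-sum r) (cong (pos l +ᶻ_) (sumZ-pos v)))
      same : eqZ μ u ≡ true → eqzn l′ (size K ∸ size u) ≡ tot
      same e₁ = bool-iff
        (λ e₂ → trans (cong (_≡ᵇ (k + size κ)) (ℤP.+-injective (trans (sym (tsum e₁)) (trans (cong (_+ᶻ pos (size u)) (eqzn-sound l′ _ e₂)) (cong pos (ℕP.m∸n+n≡m su)))))) (≡ᵇ-refl (k + size κ)))
        (λ e₂ → trans (cong (λ z → eqzn z (size K ∸ size u)) (canc l′ (trans (tsum e₁) (cong pos (trans (≡ᵇ-sound _ _ e₂) (sym (ℕP.m∸n+n≡m su))))))) (≡ᵇ-refl (size K ∸ size u)))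
        where
        canc : ∀ z → z +ᶻ pos (size u) ≡ pos (size K ∸ size u + size u) → z ≡ pos (size K ∸ size u)
        canc z h = trans (lem z (pos (size u))) (trans (cong (_-ᶻ pos (size u)) h) (sym (lem (pos (size K ∸ size u)) (pos (size u)))))
          where lem : ∀ a b → a ≡ (a +ᶻ b) -ᶻ b
                lem = ℤS.solve-∀

-- Schur expansions

partition-pos : ∀ κ → IsPartition κ → All (1 ≤_) κ
partition-pos κ pt = go κ (proj₂ (∧-true {weaklyDecᵇ κ} pt))
  where go : ∀ κ → all (1 ≤ᵇ_) κ ≡ true → All (1 ≤_) κ
        go []      _  = []
        go (k ∷ κ) eq = let (a , b) = ∧-true {1 ≤ᵇ k} eq in ≤ᵇ-sound 1 k a ∷ go κ b

partition-WD : ∀ κ → IsPartition κ → WD κ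
partition-WD κ pt = go κ (proj₁ (∧-true {weaklyDecᵇ κ} pt))
  where go : ∀ κ → weaklyDecᵇ κ ≡ true → WD κ
        go []           _  = tt
        go (k ∷ [])     _  = z≤n , tt
        go (k ∷ k₂ ∷ κ) eq = let (a , b) = ∧-true {k₂ ≤ᵇ k} eq in ≤ᵇ-sound k₂ k a , go (k₂ ∷ κ) b

WD-partition : ∀ κ → WD κ → All (1 ≤_) κ → IsPartition κ
WD-partition κ wd al = ∧-intro (go κ wd) (go₂ κ al)
  where go : ∀ κ → WD κ → weaklyDecᵇ κ ≡ true
        go []           _        = refl
        go (k ∷ [])     _        = refl
        go (k ∷ k₂ ∷ κ) (l , wd) = ∧-intro (≤ᵇ-true l) (go (k₂ ∷ κ) wd)
        go₂ : ∀ κ → All (1 ≤_) κ → all (1 ≤ᵇ_) κ ≡ true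
        go₂ []      []       = refl
        go₂ (k ∷ κ) (l ∷ al) = ∧-intro (≤ᵇ-true l) (go₂ κ al)

parts-≤-size : ∀ κ {d} → size κ ≤ d → All (_< suc d) κ
parts-≤-size []      le = []
parts-≤-size (k ∷ κ) le = s≤s (ℕP.≤-trans (ℕP.m≤m+n k (size κ)) le) ∷ parts-≤-size κ (ℕP.≤-trans (ℕP.m≤n+m (size κ) k) le)

length-≤-size : ∀ κ → All (1 ≤_) κ → length κ ≤ size κ
length-≤-size []      []       = z≤n
length-≤-size (k ∷ κ) (l ∷ al) = ℕP.+-mono-≤ l (length-≤-size κ al)

eqL-length : ∀ u v → eqL u v ≡ true → length u ≡ length v
eqL-length u v eq = cong length (eqL-sound u v eq)

isPartOf : ℕ → List ℕ → Bool
isPartOf d la = isPartitionᵇ la ∧ (size la ≡ᵇ d)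

smallLists : ℕ → List (List ℕ)
smallLists d = concatMap (λ l → allLists l d) (upTo (suc d))

∑-parts-cong : ∀ d {f g : List ℕ → ℤ} → (∀ κ → IsPartition κ → size κ ≡ d → f κ ≡ g κ) → ∑ (partitionsOf d) f ≡ ∑ (partitionsOf d) g
∑-parts-cong d {f} {g} eq = trans (∑-filter (isPartOf d) (smallLists d) f) (trans (∑-cong (smallLists d) λ κ → ι-cong (isPartOf d κ) λ ok →
  let (a , b) = ∧-true {isPartitionᵇ κ} ok in eq κ a (≡ᵇ-sound (size κ) d b)) (sym (∑-filter (isPartOf d) (smallLists d) g)))

∑-parts-delta : ∀ d κ (f : List ℕ → ℤ) → IsPartition κ → size κ ≡ d → ∑ (partitionsOf d) (λ μ → f μ *ᶻ ι (eqL κ μ)) ≡ f κ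
∑-parts-delta d κ f pt sz = trans (∑-filter P (smallLists d) _) (trans (∑-concatMap (λ l → allLists l d) (upTo (suc d)) _)
  (trans (∑-cong (upTo (suc d)) λ l → trans (cong (λ z → ∑ z (λ μ → ι (P μ) *ᶻ (f μ *ᶻ ι (eqL κ μ)))) (allLists≡words l d)) (per l))
  (trans (∑-upTo-delta (suc d) (length κ) (λ _ → f κ)) (ι-true (f κ) (<ᵇ-true (s≤s (ℕP.≤-trans (length-≤-size κ (partition-pos κ pt)) (ℕP.≤-reflexive sz))))))))
  where
  P : List ℕ → Bool
  P = isPartOf d
  ring : ∀ a b c → a *ᶻ (b *ᶻ c) ≡ c *ᶻ (a *ᶻ b)
  ring = ℤS.solve-∀
  per : ∀ l → ∑ (words (upTo (suc d)) l) (λ μ → ι (P μ) *ᶻ (f μ *ᶻ ι (eqL κ μ))) ≡ ι (length κ ≡ᵇ l) *ᶻ f κ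
  per l with length κ ≟ l
  ... | yes refl = trans (∑-cong (words (upTo (suc d)) l) λ μ → ring (ι (P μ)) (f μ) (ι (eqL κ μ)))
          (trans (∑-words-delta (suc d) κ (λ μ → ι (P μ) *ᶻ f μ) (parts-≤-size κ (ℕP.≤-reflexive sz)))
          (trans (ι-true (f κ) (∧-intro pt (trans (cong (_≡ᵇ d) sz) (≡ᵇ-refl d)))) (sym (ι-true (f κ) (≡ᵇ-refl (length κ))))))
  ... | no ne = trans (∑-words-cong (upTo (suc d)) l {g = λ _ → pos 0} λ μ _ len → trans (cong (λ b → ι (P μ) *ᶻ (f μ *ᶻ ι b)) (bool-not λ eq → ne (trans (eqL-length κ μ eq) len)))
            (trans (cong (ι (P μ) *ᶻ_) (ℤP.*-zeroʳ (f μ))) (ℤP.*-zeroʳ (ι (P μ)))))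
          (trans (∑-zero (words (upTo (suc d)) l) λ _ → refl) (sym (ι-false (f κ) (≡ᵇ-≢ ne))))

zvec : (κ : List ℕ) → Vec ℤ (length κ)
zvec κ = V.map pos (V.fromList κ)

fromList-WD : ∀ κ → WD κ → WDV (V.fromList κ)
fromList-WD []           wd       = tt
fromList-WD (k ∷ [])     wd       = z≤n , tt
fromList-WD (k ∷ k₂ ∷ κ) (l , wd) = l , fromList-WD (k₂ ∷ κ) wd

Φ-0 : ∀ {n} (v : Vec ℤ n) X → (∀ β → X β ≡ pos 0) → Φ v X ≡ pos 0
Φ-0 v X z = Φ-zero v X λ γ _ _ → z γ

hz : List ℕ → Bool
hz []      = false
hz (c ∷ _) = 0 ≡ᵇ c

tl : List ℕ → List ℕ
tl []      = []
tl (_ ∷ γ) = γ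

-- Setting the first variable to zero gives the polynomial in one variable fewer. Together with
-- symmetry this makes a sequence of polynomials one symmetric function.
Stab : (ℕ → List (List ℕ)) → Set
Stab M = ∀ N g → ∑ (M (suc N)) (λ β → ι (hz β) *ᶻ g (tl β)) ≡ ∑ (M N) g

eqL-0 : ∀ α γ → ι (eqL (0 ∷ α) γ) ≡ ι (hz γ) *ᶻ ι (eqL α (tl γ))
eqL-0 α []      = refl
eqL-0 α (c ∷ γ) = ι-∧ (0 ≡ᵇ c) (eqL α γ)

coefL : List (List ℕ) → List ℕ → ℤ
coefL M α = ∑ M (λ γ → ι (eqL α γ))

coefL-pos : ∀ {n} M (v : Vec ℕ n) → coefV M (V.map pos v) ≡ coefL M (V.toList v)
coefL-pos M v = ∑-cong M λ γ → cong ι (eqZ-pos v γ)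

eqL-swap : ∀ k u v → eqL (swapL k u) (swapL k v) ≡ eqL u v
eqL-swap k u v = bool-iff
  (λ eq → trans (cong (eqL u) (sym (inj k u v (eqL-sound _ _ eq)))) (eqL-refl u))
  (λ eq → trans (cong (λ z → eqL (swapL k u) (swapL k z)) (sym (eqL-sound u v eq))) (eqL-refl (swapL k u)))
  where
  invol : ∀ k (u : List ℕ) → swapL k (swapL k u) ≡ u
  invol zero    []          = refl
  invol zero    (_ ∷ [])    = refl
  invol zero    (_ ∷ _ ∷ _) = refl
  invol (suc k) []          = refl
  invol (suc k) (x ∷ u)     = cong (x ∷_) (invol k u)
  inj : ∀ k u v → swapL k u ≡ swapL k v → u ≡ v
  inj k u v eq = trans (sym (invol k u)) (trans (cong (swapL k) eq) (invol k v))

coefL-swap : ∀ M → Sym M → ∀ k α → coefL M (swapL k α) ≡ coefL M α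
coefL-swap M sy k α = trans (sym (sy k _)) (∑-cong M λ γ → cong ι (eqL-swap k α γ))

module _ (B : ℕ) where
  open GT B
  open Main B
  open Schur B

  il-same : ∀ κ μ → il κ μ ≡ true → size κ ≤ size μ → κ ≡ μ
  il-same []      []      _  _  = refl
  il-same (k ∷ κ) (j ∷ μ) eq le =
    let e₂ = proj₂ (∧-true {hd κ ≤ᵇ j} eq) ; j≤k = ≤ᵇ-sound j k (proj₁ (∧-true {j ≤ᵇ k} e₂)) ; e₃ = proj₂ (∧-true {j ≤ᵇ k} e₂)
        sz = il-size κ μ e₃
        k≤j : k ≤ j
        k≤j = ℕP.+-cancelʳ-≤ (size μ) k j (ℕP.≤-trans (ℕP.+-monoʳ-≤ k sz) le)
        jk = ℕP.≤-antisym k≤j j≤k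
    in cong₂ _∷_ jk (il-same κ μ e₃ (ℕP.+-cancelˡ-≤ k (size κ) (size μ) (ℕP.≤-trans le (ℕP.≤-reflexive (cong (_+ size μ) (sym jk))))))

  il-refl : ∀ κ → WD κ → il κ κ ≡ true
  il-refl []      _        = refl
  il-refl (k ∷ κ) (l , wd) = ∧-intro (≤ᵇ-true l) (∧-intro (≤ᵇ-true (ℕP.≤-refl {k})) (il-refl κ wd))

  -- Exponent 0 for the variable split off means |μ| = |κ|, and interlacing then forces μ = κ.
  RL-stab : ∀ κ → WD κ → Bdd κ → Stab (λ N → RL N κ)
  RL-stab κ wd bd N g = trans (∑-RL-suc N κ _) (trans (∑-cong (Box (length κ)) λ μ →
      trans (cong (ι (il κ μ) *ᶻ_) (∑-* (RL N μ) (ι (0 ≡ᵇ (size κ ∸ size μ))) g))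
        (trans (sym (ι-∧* (il κ μ) (0 ≡ᵇ (size κ ∸ size μ)) _)) (cong (λ b → ι b *ᶻ ∑ (RL N μ) g) (same μ))))
    (∑-words-delta (suc B) κ (λ μ → ∑ (RL N μ) g) bd))
    where
    same : ∀ μ → (il κ μ ∧ (0 ≡ᵇ (size κ ∸ size μ))) ≡ eqL κ μ
    same μ = bool-iff
      (λ eq → let (a , b) = ∧-true {il κ μ} eq in trans (cong (eqL κ) (sym (il-same κ μ a (ℕP.m∸n≡0⇒m≤n (sym (≡ᵇ-sound 0 (size κ ∸ size μ) b)))))) (eqL-refl κ))
      (λ eq → subst (λ z → (il κ z ∧ (0 ≡ᵇ (size κ ∸ size z))) ≡ true) (eqL-sound κ μ eq) (∧-intro (il-refl κ wd) (cong (0 ≡ᵇ_) (ℕP.n∸n≡0 (size κ)))))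

  RL-size : ∀ N κ v → v ∈ RL N κ → size v ≡ size κ
  RL-size zero κ v v∈ with allZ κ in eq
  RL-size zero κ v (here refl) | true = az κ eq
    where az : ∀ κ → allZ κ ≡ true → 0 ≡ size κ
          az []         _  = refl
          az (zero ∷ κ) eq = az κ eq
  RL-size (suc N) κ v v∈ with Any.satisfied (∈-aux v∈)
    where
    ∈-aux : v ∈ RL (suc N) κ → Any.Any (λ μ → (il κ μ ≡ true) × (v ∈ map ((size κ ∸ size μ) ∷_) (RL N μ))) (Box (length κ))
    ∈-aux v∈ = keepIl (Box (length κ)) (∈-concatMap⁻ (λ μ → map ((size κ ∸ size μ) ∷_) (RL N μ)) {xs = filterᵇ (il κ) (Box (length κ))} v∈)
      where
      keepIl : ∀ xs → Any.Any (λ μ → v ∈ map ((size κ ∸ size μ) ∷_) (RL N μ)) (filterᵇ (il κ) xs) →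
               Any.Any (λ μ → (il κ μ ≡ true) × (v ∈ map ((size κ ∸ size μ) ∷_) (RL N μ))) xs
      keepIl (x ∷ xs) an with il κ x in eq
      keepIl (x ∷ xs) (here px)  | true  = here (eq , px)
      keepIl (x ∷ xs) (there an) | true  = there (keepIl xs an)
      keepIl (x ∷ xs) an         | false = there (keepIl xs an)
  ... | μ , ilt , v∈μ with ∈-map⁻ ((size κ ∸ size μ) ∷_) v∈μ
  ...   | β , β∈ , refl = trans (cong ((size κ ∸ size μ) +_) (RL-size N μ β β∈)) (ℕP.m∸n+n≡m (il-size κ μ ilt))

  pad : ℕ → List ℕ → List ℕ
  pad zero    κ = κ
  pad (suc j) κ = pad j (κ ++ 0 ∷ [])

  RL-pads : ∀ j N κ f → ∑ (RL N (pad j κ)) f ≡ ∑ (RL N κ) f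
  RL-pads zero    N κ f = refl
  RL-pads (suc j) N κ f = trans (RL-pads j N (κ ++ 0 ∷ []) f) (RL-pad N κ f)

  pad-WD : ∀ j κ → WD κ → WD (pad j κ)
  pad-WD zero    κ wd = wd
  pad-WD (suc j) κ wd = pad-WD j (κ ++ 0 ∷ []) (sn κ wd)
    where sn : ∀ κ → WD κ → WD (κ ++ 0 ∷ [])
          sn []           _        = z≤n , tt
          sn (k ∷ [])     _        = z≤n , z≤n , tt
          sn (k ∷ k₂ ∷ κ) (l , wd) = l , sn (k₂ ∷ κ) wd

  pad-Bdd : ∀ j κ → Bdd κ → Bdd (pad j κ)
  pad-Bdd zero    κ bd = bd
  pad-Bdd (suc j) κ bd = pad-Bdd j (κ ++ 0 ∷ []) (sn κ bd)
    where sn : ∀ κ → Bdd κ → Bdd (κ ++ 0 ∷ [])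
          sn []      []        = s≤s z≤n ∷ []
          sn (k ∷ κ) (l ∷ bd) = l ∷ sn κ bd

  pad-length : ∀ j κ → length (pad j κ) ≡ j + length κ
  pad-length zero    κ = refl
  pad-length (suc j) κ = trans (pad-length j (κ ++ 0 ∷ [])) (trans (cong (j +_) (trans (LP.length-++ κ) (ℕP.+-comm (length κ) 1))) (ℕP.+-suc j (length κ)))

  -- The evaluation by patterns needs exactly ℓ(λ′) rows. A shorter κ is padded with zeros, which a
  -- partition with positive parts cannot equal; a longer κ has the zero polynomial.
  Φ-schur : ∀ λ′ κ → WD λ′ → All (1 ≤_) λ′ → WD κ → All (1 ≤_) κ → Bdd κ →
            Φ (zvec λ′) (coefV (RL (length λ′) κ)) ≡ ι (eqL λ′ κ)
  Φ-schur λ′ κ wdλ posλ wdκ posκ bd with length κ ≤? length λ′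
  ... | yes le = trans (Φ-cong (zvec λ′) λ β → trans (sym (RL-pads j n κ _)) (RL-Kd β (pad j κ) lenp (pad-WD j κ wdκ) (pad-Bdd j κ bd)))
      (trans (Φ-Kd n (V.fromList λ′) (pad j κ) lenp (fromList-WD λ′ wdλ) (pad-WD j κ wdκ) (pad-Bdd j κ bd))
        (trans (cong (λ z → ι (eqL z (pad j κ))) (VP.toList∘fromList λ′)) (cong ι (unpad j κ lenp))))
    where
    n = length λ′
    j = n ∸ length κ
    lenp : length (pad j κ) ≡ n
    lenp = trans (pad-length j κ) (ℕP.m∸n+n≡m le)
    nozero : ∀ (u : List ℕ) κ → All (1 ≤_) u → eqL u (κ ++ 0 ∷ []) ≡ false
    nozero []          []      _  = refl
    nozero (suc x ∷ u) []      _  = refl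
    nozero []          (_ ∷ _) _  = refl
    nozero (x ∷ u)     (k ∷ κ) (_ ∷ al) = trans (cong ((x ≡ᵇ k) ∧_) (nozero u κ al)) (lem (x ≡ᵇ k))
      where lem : ∀ b → (b ∧ false) ≡ false
            lem true  = refl
            lem false = refl
    padEnd : ∀ j κ → ∃ λ κ′ → pad j (κ ++ 0 ∷ []) ≡ κ′ ++ 0 ∷ []
    padEnd zero    κ = κ , refl
    padEnd (suc j) κ = padEnd j (κ ++ 0 ∷ [])
    unpad : ∀ j κ → length (pad j κ) ≡ n → eqL λ′ (pad j κ) ≡ eqL λ′ κ
    unpad zero    κ len = refl
    unpad (suc j) κ len = trans (trans (cong (eqL λ′) (proj₂ (padEnd j κ))) (nozero λ′ (proj₁ (padEnd j κ)) posλ))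
      (sym (bool-not λ eq → ℕP.m≢1+n+m (length κ) (trans (sym (eqL-length λ′ κ eq)) (trans (sym len) (pad-length (suc j) κ)))))
  ... | no nle = trans (Φ-0 (zvec λ′) _ λ β → RL-vanish (length λ′) κ _ (pp (length λ′) κ (ℕP.≰⇒> nle) posκ))
      (sym (cong ι (bool-not λ eq → nle (ℕP.≤-reflexive (sym (eqL-length λ′ κ eq))))))
    where pp : ∀ n κ → n < length κ → All (1 ≤_) κ → PosPrefix (suc n) κ
          pp zero    (k ∷ κ) lt       (l ∷ _)  = l , tt
          pp (suc n) (k ∷ κ) (s≤s lt) (l ∷ al) = l , pp n κ lt al

wtL : List ℕ → ℕ
wtL []      = 0
wtL (a ∷ v) = size v + wtL v

-- Exchanging an ascending pair moves the larger entry forward, so sorting strictly lowers the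
-- weight used in the induction below.
ascent : ∀ α → WD α ⊎ ∃ λ k → (wtL (swapL k α) < wtL α) × (size (swapL k α) ≡ size α)
ascent [] = inj₁ tt
ascent (a ∷ []) = inj₁ (z≤n , tt)
ascent (a ∷ b ∷ v) with ascent (b ∷ v) | b ≤? a
... | _ | no nle = inj₂ (0 , ℕP.+-monoˡ-< (size v + wtL v) (ℕP.+-monoˡ-< (size v) (ℕP.≰⇒> nle)) , ar b a (size v))
  where ar : ∀ b a x → b + (a + x) ≡ a + (b + x)
        ar = ℕS.solve-∀
... | inj₁ wd | yes le = inj₁ (le , wd)
... | inj₂ (k , lt , sz) | yes le = inj₂ (suc k , ℕP.+-mono-≤-< (ℕP.≤-reflexive sz) lt , cong (a +_) sz)

wtZ-pos : ∀ {n} (v : Vec ℕ n) → wtZ (V.map pos v) ≡ pos (wtL (V.toList v))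
wtZ-pos V.[]      = refl
wtZ-pos (a V.∷ v) = cong₂ _+ᶻ_ (Main.sumZ-pos 0 v) (wtZ-pos v)

natural? : ∀ {n} (γ : Vec ℤ n) → (∃ λ γ′ → γ ≡ V.map pos γ′) ⊎ (∀ κ → eqZ γ κ ≡ false)
natural? V.[] = inj₁ (V.[] , refl)
natural? (negsuc _ V.∷ γ) = inj₂ λ { [] → refl ; (_ ∷ _) → refl }
natural? (pos a V.∷ γ) with natural? γ
... | inj₁ (γ′ , refl) = inj₁ (a V.∷ γ′ , refl)
... | inj₂ ng = inj₂ λ { [] → refl ; (k ∷ κ) → trans (cong ((a ≡ᵇ k) ∧_) (ng κ)) (lem (a ≡ᵇ k)) }
  where lem : ∀ b → (b ∧ false) ≡ false
        lem true  = refl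
        lem false = refl

record Family (d : ℕ) : Set where
  field
    mono      : ℕ → List (List ℕ)
    mono-sym  : ∀ N → Sym (mono N)
    mono-stab : Stab mono
    mono-size : ∀ N v → v ∈ mono N → size v ≡ d

module Expansion {d : ℕ} (Fm : Family d) where
  open Family Fm
  open GT d using (RL; RL-sym)

  schurCoef : List ℕ → ℤ
  schurCoef κ = Φ (zvec κ) (coefV (mono (length κ)))

  -- The error of the proposed expansion, at integer exponents; `x` is the same at natural
  -- exponents, with the number of variables read off from the length.
  Xv : ∀ {n} → Vec ℤ n → ℤ
  Xv {n} v = coefV (mono n) v -ᶻ ∑ (partitionsOf d) (λ κ → schurCoef κ *ᶻ coefV (RL n κ) v)

  x : List ℕ → ℤ
  x α = coefL (mono (length α)) α -ᶻ ∑ (partitionsOf d) (λ κ → schurCoef κ *ᶻ coefL (RL (length α) κ) α)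

  Xv-pos : ∀ {n} (v : Vec ℕ n) → Xv (V.map pos v) ≡ x (V.toList v)
  Xv-pos {n} v = trans (cong₂ _-ᶻ_ (coefL-pos (mono n) v) (∑-cong (partitionsOf d) λ κ → cong (schurCoef κ *ᶻ_) (coefL-pos (RL n κ) v)))
    (cong (λ z → coefL (mono z) (V.toList v) -ᶻ ∑ (partitionsOf d) (λ κ → schurCoef κ *ᶻ coefL (RL z κ) (V.toList v))) (sym (VP.length-toList v)))

  bdd : ∀ κ → size κ ≡ d → All (_< suc d) κ
  bdd κ sz = parts-≤-size κ (ℕP.≤-reflexive sz)

  x-swap : ∀ k α → x (swapL k α) ≡ x α
  x-swap k α = trans (cong (λ z → coefL (mono z) (swapL k α) -ᶻ ∑ (partitionsOf d) (λ κ → schurCoef κ *ᶻ coefL (RL z κ) (swapL k α))) (actL-length (k ∷ []) α))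
    (cong₂ _-ᶻ_ (coefL-swap (mono (length α)) (mono-sym (length α)) k α)
      (∑-parts-cong d λ κ pt sz → cong (schurCoef κ *ᶻ_) (coefL-swap (RL (length α) κ) (RL-sym (length α) κ (bdd κ sz)) k α)))

  coefL-0 : ∀ M → Stab M → ∀ α → coefL (M (suc (length α))) (0 ∷ α) ≡ coefL (M (length α)) α
  coefL-0 M st α = trans (∑-cong (M (suc (length α))) λ γ → eqL-0 α γ) (st (length α) _)

  x-0 : ∀ α → x (0 ∷ α) ≡ x α
  x-0 α = cong₂ _-ᶻ_ (coefL-0 mono mono-stab α) (∑-parts-cong d λ κ pt sz → cong (schurCoef κ *ᶻ_)
    (coefL-0 (λ N → RL N κ) (RL-stab d κ (partition-WD κ pt) (bdd κ sz)) α))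

  x-snoc : ∀ α → x (α ∷ʳ 0) ≡ x α
  x-snoc α = trans (cong x (sym (actL-rot 0 α))) (trans (act (upTo (length α)) (0 ∷ α)) (x-0 α))
    where act : ∀ ks v → x (actL ks v) ≡ x v
          act []       v = refl
          act (k ∷ ks) v = trans (act ks (swapL k v)) (x-swap k v)

  x-size : ∀ α → size α ≢ d → x α ≡ pos 0
  x-size α ne = cong₂ _-ᶻ_ (z (mono (length α)) (mono-size (length α)))
    (trans (∑-parts-cong d {g = λ _ → pos 0} λ κ pt sz → trans (cong (schurCoef κ *ᶻ_) (z (RL (length α) κ) λ v v∈ → trans (RL-size d (length α) κ v v∈) sz)) (ℤP.*-zeroʳ (schurCoef κ)))
      (∑-zero (partitionsOf d) λ _ → refl))
    where z : ∀ M → (∀ v → v ∈ M → size v ≡ d) → coefL M α ≡ pos 0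
          z M h = ∑-zero∈ M λ v v∈ → cong ι (bool-not λ eq → ne (trans (cong size (eqL-sound α v eq)) (h v v∈)))

  Φ-Xv : ∀ λ′ → IsPartition λ′ → size λ′ ≡ d → Φ (zvec λ′) Xv ≡ pos 0
  Φ-Xv λ′ pt sz = trans (Φ-minus (zvec λ′) _ _) (trans (cong (λ z → schurCoef λ′ -ᶻ z) (trans (Φ-∑ (zvec λ′) (partitionsOf d) _)
      (trans (∑-parts-cong d λ κ ptκ szκ → trans (Φ-scale (zvec λ′) (schurCoef κ) _) (cong (schurCoef κ *ᶻ_)
               (Φ-schur d λ′ κ (partition-WD λ′ pt) (partition-pos λ′ pt) (partition-WD κ ptκ) (partition-pos κ ptκ) (bdd κ szκ))))
        (∑-parts-delta d λ′ schurCoef pt sz))))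
    (ℤP.+-inverseʳ (schurCoef λ′)))

  snoc-WD : ∀ α z → WD (α ∷ʳ z) → WD α
  snoc-WD []           z _        = tt
  snoc-WD (a ∷ [])     z _        = z≤n , tt
  snoc-WD (a ∷ b ∷ α)  z (l , wd) = l , snoc-WD (b ∷ α) z wd

  snoc-pos : ∀ α z → WD (α ∷ʳ suc z) → All (1 ≤_) (α ∷ʳ suc z)
  snoc-pos []          z _        = s≤s z≤n ∷ []
  snoc-pos (a ∷ [])    z (l , _)  = ℕP.≤-trans (s≤s z≤n) l ∷ s≤s z≤n ∷ []
  snoc-pos (a ∷ b ∷ α) z (l , wd) with snoc-pos (b ∷ α) z wd
  ... | lb ∷ al = ℕP.≤-trans lb l ∷ lb ∷ al

  wt-snoc : ∀ α → wtL (α ∷ʳ 0) ≡ wtL α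
  wt-snoc []      = refl
  wt-snoc (a ∷ α) = cong₂ _+_ (trans (size-snoc α 0) (ℕP.+-identityʳ _)) (wt-snoc α)

  strip : ∀ n α → length α ≡ n → WD α → ∃ λ λ′ → WD λ′ × All (1 ≤_) λ′ × (x α ≡ x λ′) × (wtL λ′ ≡ wtL α) × (size λ′ ≡ size α)
  strip n α len wd with initLast α
  strip n .[] len wd | [] = [] , tt , [] , refl , refl , refl
  strip n .(α ∷ʳ suc z) len wd | α ∷ʳ′ suc z = α ∷ʳ suc z , wd , snoc-pos α z wd , refl , refl , refl
  strip zero .(α ∷ʳ 0) len wd | α ∷ʳ′ zero = ⊥-elim (ℕP.1+n≢0 (trans (ℕP.+-comm 1 (length α)) (trans (sym (LP.length-++ α)) len)))
  strip (suc n) .(α ∷ʳ 0) len wd | α ∷ʳ′ zero with strip n α (ℕP.suc-injective (trans (ℕP.+-comm 1 (length α)) (trans (sym (LP.length-++ α)) len))) (snoc-WD α 0 wd)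
  ... | λ′ , w , al , ex , ew , es = λ′ , w , al , trans (x-snoc α) ex , trans ew (sym (wt-snoc α)) , trans es (sym (trans (size-snoc α 0) (ℕP.+-identityʳ _)))

  -- Induction on the weight. Sort α by exchanges that lower the weight, then drop trailing zeros by
  -- stability. At the resulting partition of size d the functional of the error is 0; its terms
  -- other than the coefficient sought have smaller weight and vanish by induction. In other sizes
  -- the error is 0 by degree.
  x-zero : ∀ α → x α ≡ pos 0
  x-zero α = go (wtL α) (ℕI.<-wellFounded (wtL α)) α refl
    where
    go : ∀ w → WF.Acc _<_ w → ∀ α → wtL α ≡ w → x α ≡ pos 0
    go w (WF.acc rs) α refl with ascent α
    ... | inj₂ (k , lt , _) = trans (sym (x-swap k α)) (go (wtL (swapL k α)) (rs lt) (swapL k α) refl)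
    ... | inj₁ wd with strip (length α) α refl wd
    ...   | λ′ , wdλ , posλ , ex , ew , _ with size λ′ ≟ d
    ...     | no ne = trans ex (x-size λ′ ne)
    ...     | yes sz = trans ex (trans (sym (trans (Xv-pos (V.fromList λ′)) (cong x (VP.toList∘fromList λ′))))
                (trans (sym (Φ-lead (zvec λ′) Xv lead)) (Φ-Xv λ′ (WD-partition λ′ wdλ posλ) sz)))
      where
      lead : ∀ γ → sumZ γ ≡ sumZ (zvec λ′) → wtZ γ I.< wtZ (zvec λ′) → Xv γ ≡ pos 0
      lead γ _ lt with natural? γ
      ... | inj₂ ng = cong₂ _-ᶻ_ (∑-zero (mono (length λ′)) λ κ → cong ι (ng κ))
              (∑-zero (partitionsOf d) λ κ → trans (cong (schurCoef κ *ᶻ_) (∑-zero (RL (length λ′) κ) λ μ → cong ι (ng μ))) (ℤP.*-zeroʳ (schurCoef κ)))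
      ... | inj₁ (γ′ , refl) = trans (Xv-pos γ′) (go (wtL (V.toList γ′)) (rs (ℕP.<-≤-trans lt′ (ℕP.≤-reflexive ew))) (V.toList γ′) refl)
        where lt′ : wtL (V.toList γ′) < wtL λ′
              lt′ = ℤP.drop‿+<+ (subst₂ I._<_ (wtZ-pos γ′) (trans (wtZ-pos (V.fromList λ′)) (cong (pos ∘ wtL) (VP.toList∘fromList λ′))) lt)

  expansion : ∀ α → coefL (mono (length α)) α ≡ ∑ (partitionsOf d) (λ κ → schurCoef κ *ᶻ coefL (map V.toList (schur (length α) κ)) α)
  expansion α = trans (zero-diff _ _ (x-zero α)) (∑-parts-cong d λ κ pt sz → cong (schurCoef κ *ᶻ_) (sym (Schur.∑-schur d (length α) κ _ (partition-pos κ pt) (bdd κ sz))))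
    where zero-diff : ∀ a b → a -ᶻ b ≡ pos 0 → a ≡ b
          zero-diff a b = ℤP.i-j≡0⇒i≡j a b

  schurCoef-size : ∀ κ → size κ ≢ d → schurCoef κ ≡ pos 0
  schurCoef-size κ ne = Φ-zero (zvec κ) _ λ γ sm _ → ∑-zero∈ (mono (length κ)) λ v v∈ → cong ι (bool-not λ eq →
    ne (ℤP.+-injective (trans (sym (trans (Main.sumZ-pos 0 (V.fromList κ)) (cong (pos ∘ size) (VP.toList∘fromList κ)))) (trans (sym sm) (trans (eqZ-sum γ v eq) (cong pos (mono-size (length κ) v v∈)))))))

  -- The functional is linear and sends the Schur functions to Kronecker deltas, so at λ′ it
  -- isolates `c λ′`. Exponents with a negative entry have coefficient 0 on both sides, so the
  -- equations at natural exponents suffice.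
  unique : ∀ (c : List ℕ → ℤ) → (∀ α → coefL (mono (length α)) α ≡ ∑ (partitionsOf d) (λ κ → c κ *ᶻ coefL (map V.toList (schur (length α) κ)) α)) →
           ∀ λ′ → IsPartition λ′ → size λ′ ≡ d → c λ′ ≡ schurCoef λ′
  unique c ex λ′ pt sz = sym (trans (Φ-cong (zvec λ′) coef) (trans (Φ-∑ (zvec λ′) (partitionsOf d) _)
    (trans (∑-parts-cong d λ κ ptκ szκ → trans (Φ-scale (zvec λ′) (c κ) _) (cong (c κ *ᶻ_)
               (Φ-schur d λ′ κ (partition-WD λ′ pt) (partition-pos λ′ pt) (partition-WD κ ptκ) (partition-pos κ ptκ) (bdd κ szκ))))
        (∑-parts-delta d λ′ c pt sz))))
    where
    n = length λ′
    coef : ∀ (β : Vec ℤ n) → coefV (mono n) β ≡ ∑ (partitionsOf d) (λ κ → c κ *ᶻ coefV (RL n κ) β)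
    coef β with natural? β
    ... | inj₂ ng = trans (∑-zero (mono n) λ v → cong ι (ng v)) (sym (∑-zero (partitionsOf d) λ κ → trans (cong (c κ *ᶻ_) (∑-zero (RL n κ) λ v → cong ι (ng v))) (ℤP.*-zeroʳ (c κ))))
    ... | inj₁ (β′ , refl) = trans (coefL-pos (mono n) β′) (trans (cong (λ z → coefL (mono z) (V.toList β′)) (sym (VP.length-toList β′))) (trans (ex (V.toList β′))
          (∑-parts-cong d λ κ ptκ szκ → cong (c κ *ᶻ_) (trans (Schur.∑-schur d (length (V.toList β′)) κ _ (partition-pos κ ptκ) (bdd κ szκ))
            (trans (cong (λ z → coefL (RL z κ) (V.toList β′)) (VP.length-toList β′)) (sym (coefL-pos (RL n κ) β′)))))))

-- Plethysm of families

-- Multisets of exponent vectors are compared through all their weighted sums.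
_≋_ : {A : Set} → List A → List A → Set
xs ≋ ys = ∀ f → ∑ xs f ≡ ∑ ys f

∑-swapL : {A : Set} (k : ℕ) (xs : List A) → swapL k xs ≋ xs
∑-swapL zero    []          f = refl
∑-swapL zero    (_ ∷ [])    f = refl
∑-swapL zero    (a ∷ b ∷ v) f = trans (∑-∷ b (a ∷ v) f) (trans (cong (f b +ᶻ_) (∑-∷ a v f)) (trans (lem (f b) (f a) (∑ v f)) (sym (trans (∑-∷ a (b ∷ v) f) (cong (f a +ᶻ_) (∑-∷ b v f))))))
  where lem : ∀ x y z → x +ᶻ (y +ᶻ z) ≡ y +ᶻ (x +ᶻ z)
        lem = ℤS.solve-∀
∑-swapL (suc k) []          f = refl
∑-swapL (suc k) (a ∷ v)     f = trans (∑-∷ a (swapL k v) f) (trans (cong (f a +ᶻ_) (∑-swapL k v f)) (sym (∑-∷ a v f)))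

actL-≋ : {A : Set} (ks : List ℕ) (xs : List A) → actL ks xs ≋ xs
actL-≋ []       xs f = refl
actL-≋ (k ∷ ks) xs f = trans (actL-≋ ks (swapL k xs) f) (∑-swapL k xs f)

module _ {A : Set} (eq? : A → A → Bool) (eq?-refl : ∀ a → eq? a a ≡ true) (eq?-sound : ∀ a b → eq? a b ≡ true → a ≡ b) where

  bring : ∀ y (xs : List A) → ∑ xs (λ x → ι (eq? y x)) ≢ pos 0 → ∃ λ ks → ∃ λ xs′ → actL ks xs ≡ y ∷ xs′
  bring y [] ne = ⊥-elim (ne (∑-[] _))
  bring y (x ∷ xs) ne with eq? y x in eq
  ... | true = [] , xs , cong (_∷ xs) (sym (eq?-sound y x eq))
  ... | false = let (ks , xs′ , h) = bring y xs (λ z → ne (trans (∑-∷ x xs _) (trans (cong₂ _+ᶻ_ (cong ι eq) z) refl))) in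
        map suc ks ++ 0 ∷ [] , x ∷ xs′ , trans (actL-++ (map suc ks) (0 ∷ []) (x ∷ xs)) (cong (swapL 0) (trans (actL-suc ks x xs) (cong (x ∷_) h)))

  ∑-ι-nonneg : ∀ y (xs : List A) → ∃ λ n → ∑ xs (λ x → ι (eq? y x)) ≡ pos n
  ∑-ι-nonneg y [] = 0 , ∑-[] _
  ∑-ι-nonneg y (x ∷ xs) with eq? y x in eq | ∑-ι-nonneg y xs
  ... | true  | n , h = suc n , trans (∑-∷ x xs _) (cong₂ _+ᶻ_ (cong ι eq) h)
  ... | false | n , h = n , trans (∑-∷ x xs _) (cong₂ _+ᶻ_ (cong ι eq) h)

  -- Taking for the weight the indicator of the first element of ys shows that it occurs in xs;
  -- swaps bring it to the front, and cancelling it reduces the length. Explicit transpositions are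
  -- wanted because symmetry of f is stated for them.
  ≋-actL : ∀ (xs ys : List A) → xs ≋ ys → ∃ λ ks → actL ks xs ≡ ys
  ≋-actL [] [] h = [] , refl
  ≋-actL (x ∷ xs) [] h = ⊥-elim (contra (trans (sym (trans (∑-∷ x xs _) (cong₂ _+ᶻ_ (cong ι (eq?-refl x)) (proj₂ (∑-ι-nonneg x xs))))) (trans (h (λ z → ι (eq? x z))) (∑-[] _))))
    where contra : ∀ {n} → pos (suc n) ≡ pos 0 → ⊥
          contra ()
  ≋-actL xs (y ∷ ys) h =
    let (n , cnt) = ∑-ι-nonneg y ys
        (ks , xs′ , e₁) = bring y xs λ z → contra (trans (sym (trans (h (λ z → ι (eq? y z))) (trans (∑-∷ y ys _) (cong₂ _+ᶻ_ (cong ι (eq?-refl y)) cnt)))) z)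
        (js , e₂) = ≋-actL xs′ ys λ f → cancel (f y) (trans (sym (∑-∷ y xs′ f)) (trans (cong (λ z → ∑ z f) (sym e₁)) (trans (actL-≋ ks xs f) (trans (h f) (∑-∷ y ys f)))))
    in ks ++ map suc js , trans (actL-++ ks (map suc js) xs) (trans (cong (actL (map suc js)) e₁) (trans (actL-suc js y xs′) (cong (y ∷_) e₂)))
    where
    contra : ∀ {n} → pos (suc n) ≡ pos 0 → ⊥
    contra ()
    cancel : ∀ a {x y} → a +ᶻ x ≡ a +ᶻ y → x ≡ y
    cancel a {x} {y} eq = trans (sym (lem a x)) (trans (cong (λ z → z -ᶻ a) eq) (lem a y))
      where lem : ∀ a x → (a +ᶻ x) -ᶻ a ≡ x
            lem = ℤS.solve-∀

eqVec-refl : ∀ {N} (v : Vec ℕ N) → eqVecᵇ v v ≡ true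
eqVec-refl V.[]      = refl
eqVec-refl (a V.∷ v) = ∧-intro (≡ᵇ-refl a) (eqVec-refl v)

eqVec-sound : ∀ {N} (u v : Vec ℕ N) → eqVecᵇ u v ≡ true → u ≡ v
eqVec-sound V.[]      V.[]      _  = refl
eqVec-sound (a V.∷ u) (b V.∷ v) eq = let (x , y) = ∧-true {a ≡ᵇ b} eq in cong₂ V._∷_ (≡ᵇ-sound a b x) (eqVec-sound u v y)

SymV : ∀ {N} → Monos N → Set
SymV {N} M = ∀ k → map (swapV k) M ≋ M

hzV : ∀ {N} → Vec ℕ (suc N) → Bool
hzV (a V.∷ _) = 0 ≡ᵇ a

StabV : (∀ N → Monos N) → Set
StabV M = ∀ N (g : Vec ℕ N → ℤ) → ∑ (M (suc N)) (λ v → ι (hzV v) *ᶻ g (V.tail v)) ≡ ∑ (M N) g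

record VFamily (d : ℕ) : Set where
  field
    vmono      : ∀ N → Monos N
    vmono-sym  : ∀ N → SymV (vmono N)
    vmono-stab : StabV vmono
    vmono-size : ∀ N v → v ∈ vmono N → sumV v ≡ d

toList-swap : ∀ {A : Set} {N} k (v : Vec A N) → V.toList (swapV k v) ≡ swapL k (V.toList v)
toList-swap zero    V.[]            = refl
toList-swap zero    (_ V.∷ V.[])    = refl
toList-swap zero    (_ V.∷ _ V.∷ _) = refl
toList-swap (suc k) V.[]            = refl
toList-swap (suc k) (a V.∷ v)       = cong (a ∷_) (toList-swap k v)

toFamily : ∀ {d} → VFamily d → Family d
toFamily Fm = record
  { mono = λ N → map V.toList (vmono N)
  ; mono-sym = λ N k f → trans (∑-map V.toList (vmono N) _) (trans (∑-cong (vmono N) λ v → cong f (sym (toList-swap k v)))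
      (trans (sym (∑-map (swapV k) (vmono N) _)) (trans (vmono-sym N k _) (sym (∑-map V.toList (vmono N) f)))))
  ; mono-stab = λ N g → trans (∑-map V.toList (vmono (suc N)) _) (trans (∑-cong (vmono (suc N)) λ { (a V.∷ v) → refl })
      (trans (vmono-stab N (g ∘ V.toList)) (sym (∑-map V.toList (vmono N) g))))
  ; mono-size = λ N v v∈ → let (u , u∈ , eq) = ∈-map⁻ V.toList v∈ in trans (cong size eq) (vmono-size N u u∈) }
  where open VFamily Fm

addV : ∀ {N} → Vec ℕ N → Vec ℕ N → Vec ℕ N
addV = V.zipWith _+_

zeroV : ∀ N → Vec ℕ N
zeroV N = V.replicate N 0

swapV-zero : ∀ {N} k → swapV k (zeroV N) ≡ zeroV N
swapV-zero {zero}        zero    = refl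
swapV-zero {suc zero}    zero    = refl
swapV-zero {suc (suc N)} zero    = refl
swapV-zero {zero}        (suc k) = refl
swapV-zero {suc N}       (suc k) = cong (0 V.∷_) (swapV-zero k)

swapV-add : ∀ {N} k (u v : Vec ℕ N) → swapV k (addV u v) ≡ addV (swapV k u) (swapV k v)
swapV-add zero    V.[]            V.[]            = refl
swapV-add zero    (_ V.∷ V.[])    (_ V.∷ V.[])    = refl
swapV-add zero    (_ V.∷ _ V.∷ _) (_ V.∷ _ V.∷ _) = refl
swapV-add (suc k) V.[]            V.[]            = refl
swapV-add (suc k) (a V.∷ u)       (b V.∷ v)       = cong ((a + b) V.∷_) (swapV-add k u v)

swapV-map : ∀ {N} k (g : ℕ → ℕ) (v : Vec ℕ N) → swapV k (V.map g v) ≡ V.map g (swapV k v)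
swapV-map zero    g V.[]            = refl
swapV-map zero    g (_ V.∷ V.[])    = refl
swapV-map zero    g (_ V.∷ _ V.∷ _) = refl
swapV-map (suc k) g V.[]            = refl
swapV-map (suc k) g (a V.∷ v)       = cong (g a V.∷_) (swapV-map k g v)

sumV-add : ∀ {N} (u v : Vec ℕ N) → sumV (addV u v) ≡ sumV u + sumV v
sumV-add V.[]      V.[]      = refl
sumV-add (a V.∷ u) (b V.∷ v) = trans (cong ((a + b) +_) (sumV-add u v)) (lem a b (sumV u) (sumV v))
  where lem : ∀ a b c d → (a + b) + (c + d) ≡ (a + c) + (b + d)
        lem = ℕS.solve-∀

sumV-scale : ∀ {N} c (v : Vec ℕ N) → sumV (V.map (c *_) v) ≡ c * sumV v
sumV-scale c V.[]      = sym (ℕP.*-zeroʳ c)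
sumV-scale c (a V.∷ v) = trans (cong (c * a +_) (sumV-scale c v)) (sym (ℕP.*-distribˡ-+ c a (sumV v)))

sumV-zero : ∀ N → sumV (zeroV N) ≡ 0
sumV-zero zero    = refl
sumV-zero (suc N) = sumV-zero N

-- The exponent of the monomial that y^β becomes when y_j is replaced by the j-th monomial of the
-- list.
subL : ∀ {N} → List (Vec ℕ N) → List ℕ → Vec ℕ N
subL {N} (τ ∷ τs) (b ∷ β) = addV (V.map (b *_) τ) (subL τs β)
subL {N} _        _       = zeroV N

addV-left : ∀ {N} (u v w : Vec ℕ N) → addV u (addV v w) ≡ addV v (addV u w)
addV-left V.[]      V.[]      V.[]      = refl
addV-left (a V.∷ u) (b V.∷ v) (c V.∷ w) = cong₂ V._∷_ (lem a b c) (addV-left u v w)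
  where lem : ∀ a b c → a + (b + c) ≡ b + (a + c)
        lem = ℕS.solve-∀

subL-swap : ∀ {N} k (τs : List (Vec ℕ N)) β → length τs ≡ length β → subL (swapL k τs) (swapL k β) ≡ subL τs β
subL-swap zero    []           []           len = refl
subL-swap zero    (_ ∷ [])     (_ ∷ [])     len = refl
subL-swap zero    (σ ∷ τ ∷ τs) (a ∷ b ∷ β)  len = addV-left (V.map (b *_) τ) (V.map (a *_) σ) (subL τs β)
subL-swap (suc k) []           []           len = refl
subL-swap (suc k) (τ ∷ τs)     (b ∷ β)      len = cong (addV (V.map (b *_) τ)) (subL-swap k τs β (ℕP.suc-injective len))

subL-swapV : ∀ {N} k (τs : List (Vec ℕ N)) β → subL (map (swapV k) τs) β ≡ swapV k (subL τs β)
subL-swapV k []       β       = sym (swapV-zero k)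
subL-swapV k (τ ∷ τs) []      = sym (swapV-zero k)
subL-swapV k (τ ∷ τs) (b ∷ β) = trans (cong₂ addV (sym (swapV-map k (b *_) τ)) (subL-swapV k τs β)) (sym (swapV-add k _ _))

subL-tail : ∀ {N} (τs : List (Vec ℕ (suc N))) β → V.tail (subL τs β) ≡ subL (map V.tail τs) β
subL-tail []               β       = refl
subL-tail (τ ∷ τs)         []      = refl
subL-tail ((a V.∷ τ) ∷ τs) (b ∷ β) with subL τs β | subL-tail τs β
... | c V.∷ w | refl = refl

hzV-add : ∀ {N} (u v : Vec ℕ (suc N)) → hzV (addV u v) ≡ (hzV u ∧ hzV v)
hzV-add (zero  V.∷ _) (b V.∷ _) = refl
hzV-add (suc a V.∷ _) (b V.∷ _) = refl

module Plethysm {d : ℕ} (Fm : VFamily d) where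
  open VFamily Fm

  PL : ∀ {N} → ℕ → List (Vec ℕ N) → (Vec ℕ N → ℤ) → ℤ
  PL M τs f = ∑ (vmono M) (λ β → f (subL τs (V.toList β)))

  pl : ∀ {N} → List (Vec ℕ N) → Monos N
  pl τs = map (λ β → subL τs (V.toList β)) (vmono (length τs))

  PL-swap : ∀ {N} k (τs : List (Vec ℕ N)) f → PL (length τs) (swapL k τs) f ≡ PL (length τs) τs f
  PL-swap k τs f = trans (sym (vmono-sym (length τs) k _)) (trans (∑-map (swapV k) (vmono (length τs)) _)
    (∑-cong (vmono (length τs)) λ β → cong f (trans (cong (subL (swapL k τs)) (toList-swap k β)) (subL-swap k τs (V.toList β) (sym (VP.length-toList β))))))

  PL-act : ∀ {N} ks (τs : List (Vec ℕ N)) f → PL (length (actL ks τs)) (actL ks τs) f ≡ PL (length τs) τs f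
  PL-act []       τs f = refl
  PL-act (k ∷ ks) τs f = trans (PL-act ks (swapL k τs) f) (trans (cong (λ z → PL z (swapL k τs) f) (actL-length (k ∷ []) τs)) (PL-swap k τs f))

  -- Permuting the monomials to be substituted is permuting the variables of f, and f is symmetric.
  -- Hence the monomials of g may be listed in any convenient order.
  PL-≋ : ∀ {N} {τs σs : List (Vec ℕ N)} → τs ≋ σs → ∀ f → PL (length τs) τs f ≡ PL (length σs) σs f
  PL-≋ {τs = τs} {σs} h f with ≋-actL eqVecᵇ eqVec-refl eqVec-sound τs σs h
  ... | ks , refl = sym (PL-act ks τs f)

  pl-sym : ∀ {N} (τs : List (Vec ℕ N)) → SymV τs → SymV (pl τs)
  pl-sym τs sy k f = trans (∑-map (swapV k) (pl τs) f) (trans (∑-map _ (vmono (length τs)) _)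
    (trans (∑-cong (vmono (length τs)) λ β → cong f (sym (subL-swapV k τs (V.toList β))))
    (trans (cong (λ z → PL z (map (swapV k) τs) f) (sym (LP.length-map (swapV k) τs)))
    (trans (PL-≋ (sy k) f) (sym (∑-map _ (vmono (length τs)) f))))))

  pl-size : ∀ {N} (τs : List (Vec ℕ N)) n → (∀ τ → τ ∈ τs → sumV τ ≡ n) → ∀ v → v ∈ pl τs → sumV v ≡ d * n
  pl-size τs n hn v v∈ with ∈-map⁻ _ v∈
  ... | β , β∈ , refl = trans (go τs (V.toList β) (sym (VP.length-toList β)) hn) (cong (_* n) (vmono-size (length τs) β β∈))
    where go : ∀ {N} (τs : List (Vec ℕ N)) β → length τs ≡ length β → (∀ τ → τ ∈ τs → sumV τ ≡ n) → sumV (subL τs β) ≡ size β * n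
          go {N} []       []      len hn = sumV-zero N
          go     (τ ∷ τs) (b ∷ β) len hn = trans (sumV-add (V.map (b *_) τ) (subL τs β)) (trans (cong₂ _+_ (trans (sumV-scale b τ) (cong (b *_) (hn τ (here refl))))
            (go τs β (ℕP.suc-injective len) λ σ σ∈ → hn σ (there σ∈))) (sym (ℕP.*-distribʳ-+ n b (size β))))

  RS : ∀ {N} → (Vec ℕ N → ℤ) → Vec ℕ (suc N) → ℤ
  RS g v = ι (hzV v) *ᶻ g (V.tail v)

  -- A monomial containing the first variable becomes 0 with it, so the outer variable it replaces
  -- is set to zero; stability of f then removes that variable.
  PL-bad : ∀ {N} (bs : List (Vec ℕ (suc N))) (τs : List (Vec ℕ (suc N))) g → All (λ τ → hzV τ ≡ false) bs →
           PL (length (bs ++ τs)) (bs ++ τs) (RS g) ≡ PL (length τs) τs (RS g)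
  PL-bad []       τs g []       = refl
  PL-bad ((suc a V.∷ σ) ∷ bs) τs g (_ ∷ al) = trans (∑-cong (vmono (suc M)) drop-β) (trans (vmono-stab M (λ β → RS g (subL (bs ++ τs) (V.toList β)))) (PL-bad bs τs g al))
    where
    M = length (bs ++ τs)
    drop-β : ∀ (β : Vec ℕ (suc M)) → RS g (subL ((suc a V.∷ σ) ∷ (bs ++ τs)) (V.toList β)) ≡ ι (hzV β) *ᶻ RS g (subL (bs ++ τs) (V.toList (V.tail β)))
    drop-β (zero  V.∷ β) = trans (cong (RS g) (zeroAdd (suc a V.∷ σ) (subL (bs ++ τs) (V.toList β)))) (sym (ℤP.*-identityˡ _))
      where zeroAdd : ∀ {N} (τ w : Vec ℕ N) → addV (V.map (0 *_) τ) w ≡ w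
            zeroAdd V.[]      V.[]      = refl
            zeroAdd (x V.∷ τ) (y V.∷ w) = cong (y V.∷_) (zeroAdd τ w)
    drop-β (suc b V.∷ β) = ι-false _ (hzV-add (V.map (suc b *_) (suc a V.∷ σ)) (subL (bs ++ τs) (V.toList β)))

  PL-good : ∀ {N} M (τs : List (Vec ℕ (suc N))) g → All (λ τ → hzV τ ≡ true) τs → PL M τs (RS g) ≡ PL M (map V.tail τs) g
  PL-good M τs g al = ∑-cong (vmono M) λ β → trans (ι-true _ (gd τs (V.toList β) al)) (cong g (subL-tail τs (V.toList β)))
    where gd : ∀ {N} (τs : List (Vec ℕ (suc N))) β → All (λ τ → hzV τ ≡ true) τs → hzV (subL τs β) ≡ true
          gd []                  β       _        = refl
          gd (τ ∷ τs)            []      _        = refl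
          gd ((zero V.∷ τ) ∷ τs) (b ∷ β) (_ ∷ al) = trans (hzV-add (V.map (b *_) (0 V.∷ τ)) (subL τs β)) (∧-intro (cong (0 ≡ᵇ_) (ℕP.*-zeroʳ b)) (gd τs β al))

  filter-all : ∀ {A : Set} (q : A → Bool) xs → All (λ y → q y ≡ true) (filterᵇ q xs)
  filter-all q []       = []
  filter-all q (y ∷ xs) with q y in eq
  ... | true  = eq ∷ filter-all q xs
  ... | false = filter-all q xs

  -- Separate the monomials that contain the first variable from the others. The former drop out by
  -- stability of f; the latter, with that variable deleted, are the monomials of g in N variables
  -- by stability of g.
  pl-stab : ∀ {N} (τs : List (Vec ℕ (suc N))) (σs : List (Vec ℕ N)) → (∀ g → ∑ τs (RS g) ≡ ∑ σs g) → ∀ g → ∑ (pl τs) (RS g) ≡ ∑ (pl σs) g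
  pl-stab {N} τs σs st g = trans (∑-map _ (vmono (length τs)) _) (trans (PL-≋ split (RS g))
    (trans (PL-bad bs gs g (notAll τs)) (trans (PL-good (length gs) gs g (filter-all hzV τs))
    (trans (cong (λ z → PL z (map V.tail gs) g) (sym (LP.length-map V.tail gs)))
    (trans (PL-≋ gsσ g) (sym (∑-map _ (vmono (length σs)) g)))))))
    where
    bs = filterᵇ (not ∘ hzV) τs
    gs = filterᵇ hzV τs
    notAll : ∀ xs → All (λ (τ : Vec ℕ (suc N)) → hzV τ ≡ false) (filterᵇ (not ∘ hzV) xs)
    notAll [] = []
    notAll (y ∷ xs) with hzV y in eq
    ... | true  = notAll xs
    ... | false = eq ∷ notAll xs
    split : τs ≋ (bs ++ gs)
    split f = sym (trans (∑-++ bs gs f) (trans (cong₂ _+ᶻ_ (∑-filter (not ∘ hzV) τs f) (∑-filter hzV τs f))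
      (trans (sym (∑-+ τs _ _)) (∑-cong τs λ τ → one (hzV τ) (f τ)))))
      where one : ∀ b x → ι (not b) *ᶻ x +ᶻ ι b *ᶻ x ≡ x
            one true  x = trans (ℤP.+-identityˡ _) (ℤP.*-identityˡ x)
            one false x = trans (ℤP.+-identityʳ _) (ℤP.*-identityˡ x)
    gsσ : map V.tail gs ≋ σs
    gsσ f = trans (∑-map V.tail gs f) (trans (∑-filter hzV τs _) (st f))

plethysmFamily : ∀ {d d′} → VFamily d → VFamily d′ → VFamily (d * d′)
plethysmFamily Fm Gm = record
  { vmono = λ N → pl (VFamily.vmono Gm N)
  ; vmono-sym = λ N → pl-sym (VFamily.vmono Gm N) (VFamily.vmono-sym Gm N)
  ; vmono-stab = λ N → pl-stab (VFamily.vmono Gm (suc N)) (VFamily.vmono Gm N) (VFamily.vmono-stab Gm N)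
  ; vmono-size = λ N → pl-size (VFamily.vmono Gm N) _ (VFamily.vmono-size Gm N) }
  where open Plethysm Fm

-- The five bases as stable symmetric families

∑-allVecs-suc : ∀ N b (f : Vec ℕ (suc N) → ℤ) → ∑ (allVecs (suc N) b) f ≡ ∑ (upTo (suc b)) (λ x → ∑ (allVecs N b) (λ v → f (x V.∷ v)))
∑-allVecs-suc N b f = trans (∑-concatMap _ (upTo (suc b)) f) (∑-cong (upTo (suc b)) λ x → ∑-map (x V.∷_) (allVecs N b) f)

allVecs-sym : ∀ N b k (f : Vec ℕ N → ℤ) → ∑ (allVecs N b) (λ v → f (swapV k v)) ≡ ∑ (allVecs N b) f
allVecs-sym zero b zero f = ∑-cong (allVecs 0 b) λ { V.[] → refl }
allVecs-sym (suc zero) b zero f = ∑-cong (allVecs 1 b) λ { (_ V.∷ V.[]) → refl }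
allVecs-sym (suc (suc N)) b zero f = trans (two (λ v → f (swapV 0 v))) (trans (∑-swap (upTo (suc b)) (upTo (suc b)) _) (sym (two f)))
  where two : ∀ (f : Vec ℕ (suc (suc N)) → ℤ) → ∑ (allVecs (suc (suc N)) b) f ≡ ∑ (upTo (suc b)) (λ x → ∑ (upTo (suc b)) (λ y → ∑ (allVecs N b) (λ v → f (x V.∷ y V.∷ v))))
        two f = trans (∑-allVecs-suc (suc N) b f) (∑-cong (upTo (suc b)) λ x → ∑-allVecs-suc N b _)
allVecs-sym zero b (suc k) f = ∑-cong (allVecs 0 b) λ { V.[] → refl }
allVecs-sym (suc N) b (suc k) f = trans (∑-allVecs-suc N b _) (trans (∑-cong (upTo (suc b)) λ x → allVecs-sym N b k (λ v → f (x V.∷ v))) (sym (∑-allVecs-suc N b f)))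

∈-filterᵇ : {A : Set} (q : A → Bool) (xs : List A) {y : A} → y ∈ filterᵇ q xs → q y ≡ true
∈-filterᵇ q (x ∷ xs) y∈ with q x in eq
∈-filterᵇ q (x ∷ xs) (here refl) | true  = eq
∈-filterᵇ q (x ∷ xs) (there y∈)  | true  = ∈-filterᵇ q xs y∈
∈-filterᵇ q (x ∷ xs) y∈          | false = ∈-filterᵇ q xs y∈

-- Covers h_k, e_k and the monomial functions: multiplicity-free sums of the exponents in a box that
-- satisfy a symmetric condition indifferent to zero entries.
boxFamily : ∀ {d} b (P : ∀ {N} → Vec ℕ N → Bool) → (∀ {N} k (v : Vec ℕ N) → P (swapV k v) ≡ P v) → (∀ {N} (v : Vec ℕ N) → P (0 V.∷ v) ≡ P v) →
            (∀ {N} (v : Vec ℕ N) → P v ≡ true → sumV v ≡ d) → VFamily d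
boxFamily b P Psym Pstab Psize = record
  { vmono = λ N → filterᵇ P (allVecs N b)
  ; vmono-sym = λ N k f → trans (∑-map (swapV k) (filterᵇ P (allVecs N b)) f) (trans (∑-filter P (allVecs N b) _)
      (trans (∑-cong (allVecs N b) λ v → cong (λ z → ι z *ᶻ f (swapV k v)) (sym (Psym k v))) (trans (allVecs-sym N b k (λ v → ι (P v) *ᶻ f v)) (sym (∑-filter P (allVecs N b) f)))))
  ; vmono-stab = λ N g → trans (∑-filter P (allVecs (suc N) b) _) (trans (∑-allVecs-suc N b _) (trans (∑-upTo-suc b _)
      (trans (cong₂ _+ᶻ_ (∑-cong (allVecs N b) λ v → cong₂ _*ᶻ_ (cong ι (Pstab v)) (ℤP.*-identityˡ (g v)))
               (∑-zero (upTo b) λ x → ∑-zero (allVecs N b) λ v → ℤP.*-zeroʳ (ι (P (suc x V.∷ v)))))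
        (trans (ℤP.+-identityʳ _) (sym (∑-filter P (allVecs N b) g))))))
  ; vmono-size = λ N v v∈ → Psize v (∈-filterᵇ P (allVecs N b) v∈) }

sumV-swap : ∀ {N} k (v : Vec ℕ N) → sumV (swapV k v) ≡ sumV v
sumV-swap zero    V.[]            = refl
sumV-swap zero    (_ V.∷ V.[])    = refl
sumV-swap zero    (a V.∷ b V.∷ v) = lem b a (sumV v)
  where lem : ∀ b a x → b + (a + x) ≡ a + (b + x)
        lem = ℕS.solve-∀
sumV-swap (suc k) V.[]            = refl
sumV-swap (suc k) (a V.∷ v)       = cong (a +_) (sumV-swap k v)

countV-swap : ∀ {N} i k (v : Vec ℕ N) → countℕ i (V.toList (swapV k v)) ≡ countℕ i (V.toList v)
countV-swap i zero    V.[]            = refl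
countV-swap i zero    (_ V.∷ V.[])    = refl
countV-swap i zero    (a V.∷ b V.∷ v) with i ≡ᵇ a in ea | i ≡ᵇ b in eb
... | true  | true  rewrite ea | eb = refl
... | true  | false rewrite ea | eb = refl
... | false | true  rewrite ea | eb = refl
... | false | false rewrite ea | eb = refl
countV-swap i (suc k) V.[]            = refl
countV-swap i (suc k) (a V.∷ v)       with i ≡ᵇ a
... | true  = cong suc (countV-swap i k v)
... | false = countV-swap i k v

all-cong : ∀ {A : Set} {f g : A → Bool} (xs : List A) → (∀ x → f x ≡ g x) → all f xs ≡ all g xs
all-cong []       eq = refl
all-cong (x ∷ xs) eq = cong₂ _∧_ (eq x) (all-cong xs eq)

all-map : ∀ {A B : Set} (f : B → Bool) (g : A → B) xs → all f (map g xs) ≡ all (f ∘ g) xs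
all-map f g []       = refl
all-map f g (x ∷ xs) = cong (f (g x) ∧_) (all-map f g xs)

hkFamily ekFamily : ∀ k → VFamily k
hkFamily k = boxFamily k (λ v → sumV v ≡ᵇ k) (λ j v → cong (_≡ᵇ k) (sumV-swap j v)) (λ v → refl) (λ v eq → ≡ᵇ-sound (sumV v) k eq)
ekFamily k = boxFamily 1 (λ v → sumV v ≡ᵇ k) (λ j v → cong (_≡ᵇ k) (sumV-swap j v)) (λ v → refl) (λ v eq → ≡ᵇ-sound (sumV v) k eq)

hasType : List ℕ → ∀ {N} → Vec ℕ N → Bool
hasType la α = (sumV α ≡ᵇ size la) ∧ all (λ v → countℕ v (V.toList α) ≡ᵇ countℕ v la) (map suc (upTo (size la)))

monomialFamily : ∀ la → VFamily (size la)
monomialFamily la = boxFamily (size la) (hasType la)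
  (λ k v → cong₂ _∧_ (cong (_≡ᵇ size la) (sumV-swap k v)) (all-cong (map suc (upTo (size la))) λ i → cong (_≡ᵇ countℕ i la) (countV-swap i k v)))
  (λ v → cong ((sumV v ≡ᵇ size la) ∧_) (trans (all-map _ suc (upTo (size la))) (sym (all-map _ suc (upTo (size la))))))
  (λ v eq → ≡ᵇ-sound (sumV v) (size la) (proj₁ (∧-true {sumV v ≡ᵇ size la} eq)))

∑-pk-suc : ∀ N k (f : Vec ℕ (suc N) → ℤ) → ∑ (pk (suc N) k) f ≡ f (k V.∷ zeroV N) +ᶻ ∑ (pk N k) (λ v → f (0 V.∷ v))
∑-pk-suc N k f = trans (∑-∷ _ _ f) (cong₂ _+ᶻ_ (cong (λ z → f (k V.∷ z)) (tab N))
  (trans (∑-map _ (tabulate F.suc) f) (trans (∑-≡ (sym (LP.map-tabulate id F.suc)) _) (trans (∑-map F.suc (allFin N) _) (sym (∑-map _ (allFin N) _))))))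
  where tab : ∀ N → V.tabulate {n = N} (λ j → 0) ≡ zeroV N
        tab zero    = refl
        tab (suc N) = cong (0 V.∷_) (tab N)

pk-sym : ∀ N k → SymV (pk N k)
pk-sym N k j f = trans (∑-map (swapV j) (pk N k) f) (go N j f)
  where
  go : ∀ N j (f : Vec ℕ N → ℤ) → ∑ (pk N k) (λ v → f (swapV j v)) ≡ ∑ (pk N k) f
  go zero j f = ∑-[]-eq _ _
  go (suc zero) zero f = ∑-cong (pk 1 k) λ { (_ V.∷ V.[]) → refl }
  go (suc (suc N)) zero f = trans (two (λ v → f (swapV 0 v))) (trans (lem (f (0 V.∷ k V.∷ zeroV N)) (f (k V.∷ 0 V.∷ zeroV N)) (∑ (pk N k) (λ v → f (0 V.∷ 0 V.∷ v)))) (sym (two f)))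
    where two : ∀ (f : Vec ℕ (suc (suc N)) → ℤ) → ∑ (pk (suc (suc N)) k) f ≡ f (k V.∷ 0 V.∷ zeroV N) +ᶻ (f (0 V.∷ k V.∷ zeroV N) +ᶻ ∑ (pk N k) (λ v → f (0 V.∷ 0 V.∷ v)))
          two f = trans (∑-pk-suc (suc N) k f) (cong (f (k V.∷ 0 V.∷ zeroV N) +ᶻ_) (∑-pk-suc N k _))
          lem : ∀ x y z → x +ᶻ (y +ᶻ z) ≡ y +ᶻ (x +ᶻ z)
          lem = ℤS.solve-∀
  go (suc N) (suc j) f = trans (∑-pk-suc N k _) (trans (cong₂ _+ᶻ_ (cong (λ z → f (k V.∷ z)) (swapV-zero j)) (go N j (λ v → f (0 V.∷ v)))) (sym (∑-pk-suc N k f)))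

-- For k = 0 the polynomial would be the number of variables, which is not stable.
pkFamily : ∀ k → 1 ≤ k → VFamily k
pkFamily (suc k) _ = record
  { vmono = λ N → pk N (suc k)
  ; vmono-sym = λ N → pk-sym N (suc k)
  ; vmono-stab = λ N g → trans (∑-pk-suc N (suc k) _) (trans (ℤP.+-identityˡ _) (∑-cong (pk N (suc k)) λ v → ℤP.*-identityˡ (g v)))
  ; vmono-size = λ N v v∈ → let (i , _ , eq) = ∈-map⁻ _ v∈ in trans (cong sumV eq) (sz N i) }
  where
  nul : ∀ N → sumV (V.tabulate {n = N} (λ _ → 0)) ≡ 0
  nul zero    = refl
  nul (suc N) = nul N
  sz : ∀ N (i : Fin N) → sumV (V.tabulate {n = N} (λ j → if toℕ i ≡ᵇ toℕ j then suc k else 0)) ≡ suc k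
  sz (suc N) F.zero    = trans (cong (suc k +_) (nul N)) (ℕP.+-identityʳ (suc k))
  sz (suc N) (F.suc i) = sz N i

∑-mulM : ∀ {N} (A B : Monos N) f → ∑ (mulM A B) f ≡ ∑ A (λ a → ∑ B (λ b → f (addV a b)))
∑-mulM A B f = trans (∑-concatMap _ A f) (∑-cong A λ a → ∑-map (addV a) B f)

mulFamily : ∀ {d d′} → VFamily d → VFamily d′ → VFamily (d + d′)
mulFamily Fm Gm = record
  { vmono = λ N → mulM (F₁.vmono N) (G₁.vmono N)
  ; vmono-sym = λ N k f → trans (∑-map (swapV k) (mulM (F₁.vmono N) (G₁.vmono N)) f) (trans (∑-mulM (F₁.vmono N) (G₁.vmono N) _)
      (trans (∑-cong (F₁.vmono N) λ a → trans (∑-cong (G₁.vmono N) λ b → cong f (swapV-add k a b))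
                (trans (sym (∑-map (swapV k) (G₁.vmono N) _)) (G₁.vmono-sym N k _)))
      (trans (sym (∑-map (swapV k) (F₁.vmono N) _)) (trans (F₁.vmono-sym N k _) (sym (∑-mulM (F₁.vmono N) (G₁.vmono N) f))))))
  ; vmono-stab = λ N g → trans (∑-mulM (F₁.vmono (suc N)) (G₁.vmono (suc N)) _)
      (trans (∑-cong (F₁.vmono (suc N)) λ a → trans (∑-cong (G₁.vmono (suc N)) λ b → rs g a b) (∑-* (G₁.vmono (suc N)) (ι (hzV a)) _))
      (trans (∑-cong (F₁.vmono (suc N)) λ a → cong (ι (hzV a) *ᶻ_) (G₁.vmono-stab N (λ b → g (addV (V.tail a) b))))
      (trans (F₁.vmono-stab N (λ a → ∑ (G₁.vmono N) (λ b → g (addV a b)))) (sym (∑-mulM (F₁.vmono N) (G₁.vmono N) g)))))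
  ; vmono-size = λ N v v∈ → sz N v v∈ }
  where
  module F₁ = VFamily Fm
  module G₁ = VFamily Gm
  rs : ∀ {N} (g : Vec ℕ N → ℤ) (a b : Vec ℕ (suc N)) → ι (hzV (addV a b)) *ᶻ g (V.tail (addV a b)) ≡ ι (hzV a) *ᶻ (ι (hzV b) *ᶻ g (addV (V.tail a) (V.tail b)))
  rs g a@(_ V.∷ _) b@(_ V.∷ _) = trans (cong (λ z → ι z *ᶻ g (V.tail (addV a b))) (hzV-add a b)) (ι-∧* (hzV a) (hzV b) _)
  sz : ∀ N v → v ∈ mulM (F₁.vmono N) (G₁.vmono N) → sumV v ≡ _
  sz N v v∈ with Any.satisfied (∈-keep (F₁.vmono N) (∈-concatMap⁻ (λ a → map (addV a) (G₁.vmono N)) {xs = F₁.vmono N} v∈))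
    where ∈-keep : ∀ {P : Vec ℕ N → Set} xs → Any.Any P xs → Any.Any (λ x → x ∈ xs × P x) xs
          ∈-keep (x ∷ xs) (here px)  = here (here refl , px)
          ∈-keep (x ∷ xs) (there an) = there (Any.map (λ { (i , px) → there i , px }) (∈-keep xs an))
  ... | a , a∈ , v∈a with ∈-map⁻ (addV a) v∈a
  ...   | b , b∈ , refl = trans (sumV-add a b) (cong₂ _+_ (F₁.vmono-size N a a∈) (G₁.vmono-size N b b∈))

oneFamily : VFamily 0
oneFamily = record
  { vmono = oneM
  ; vmono-sym = λ N k f → trans (∑-one _ f) (trans (cong f (swapV-zero k)) (sym (∑-one _ f)))
  ; vmono-stab = λ N g → trans (∑-one _ _) (trans (ℤP.*-identityˡ _) (sym (∑-one _ g)))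
  ; vmono-size = λ { N _ (here refl) → sumV-zero N } }

-- Replaces the polynomials of a family by equal ones, so that afterwards they are `basisFn` by
-- computation.
coerceFamily : ∀ {d} (Fm : VFamily d) (M : ∀ N → Monos N) → (∀ N → VFamily.vmono Fm N ≡ M N) → VFamily d
coerceFamily {d} Fm M eq = record
  { vmono = M
  ; vmono-sym = λ N → subst SymV (eq N) (vmono-sym N)
  ; vmono-stab = λ N g → trans (cong (λ z → ∑ z _) (sym (eq (suc N)))) (trans (vmono-stab N g) (cong (λ z → ∑ z g) (eq N)))
  ; vmono-size = λ N v v∈ → vmono-size N v (subst (v ∈_) (sym (eq N)) v∈) }
  where open VFamily Fm

multFamily : (q : ∀ N → ℕ → Monos N) → (∀ k → 1 ≤ k → Σ (VFamily k) λ Fm → ∀ N → VFamily.vmono Fm N ≡ q N k) → ∀ la → All (1 ≤_) la →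
             Σ (VFamily (size la)) λ Fm → ∀ N → VFamily.vmono Fm N ≡ multiplicative (q N) la
multFamily q fam []       []       = oneFamily , λ N → refl
multFamily q fam (k ∷ la) (l ∷ al) = let (Fm , e₁) = fam k l ; (Gm , e₂) = multFamily q fam la al in
  mulFamily Fm Gm , λ N → cong₂ mulM (e₁ N) (e₂ N)

unl : ∀ N → List ℕ → Vec ℕ N
unl zero    _       = V.[]
unl (suc N) []      = 0 V.∷ unl N []
unl (suc N) (a ∷ l) = a V.∷ unl N l

unl-toList : ∀ {N} (v : Vec ℕ N) → unl N (V.toList v) ≡ v
unl-toList V.[]      = refl
unl-toList (a V.∷ v) = cong (a V.∷_) (unl-toList v)

-- Symmetry and stability are transported from Gelfand-Tsetlin patterns; `unl` turns their lists
-- back into vectors.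
schurFamily : ∀ la → IsPartition la → VFamily (size la)
schurFamily la pt = record
  { vmono = λ N → schur N la
  ; vmono-sym = λ N k f → trans (∑-map (swapV k) (schur N la) f) (trans (∑-cong (schur N la) λ v → cong f (trans (sym (unl-toList (swapV k v))) (cong (unl N) (toList-swap k v))))
      (trans (viaRL N (λ w → f (unl N (swapL k w)))) (trans (RL-sym N la bd k (λ w → f (unl N w))) (sym (trans (∑-cong (schur N la) λ v → cong f (sym (unl-toList v))) (viaRL N (λ w → f (unl N w))))))))
  ; vmono-stab = λ N g → trans (∑-cong (schur (suc N) la) λ { v@(_ V.∷ w) → cong (λ z → ι (hzV v) *ᶻ g z) (sym (unl-toList w)) })
      (trans (viaRL (suc N) (λ w → ι (hz w) *ᶻ g (unl N (tl w)))) (trans (RL-stab B la (partition-WD la pt) bd N (λ w → g (unl N w)))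
        (sym (trans (∑-cong (schur N la) λ v → cong g (sym (unl-toList v))) (viaRL N (λ w → g (unl N w)))))))
  ; vmono-size = λ N v v∈ → sz N v v∈ }
  where
  B = size la
  open GT B
  bd : Bdd la
  bd = parts-≤-size la ℕP.≤-refl
  viaRL : ∀ N (f : List ℕ → ℤ) → ∑ (schur N la) (λ v → f (V.toList v)) ≡ ∑ (RL N la) f
  viaRL N f = trans (sym (∑-map V.toList (schur N la) f)) (Schur.∑-schur B N la f (partition-pos la pt) bd)
  -- A monomial of the wrong degree would have a nonzero coefficient.
  sz : ∀ N v → v ∈ schur N la → sumV v ≡ B
  sz N v v∈ with sumV v ≟ B
  ... | yes eq = eq
  ... | no ne = ⊥-elim (nz (schur N la) v∈ (trans (viaRL N (λ w → ι (eqL (V.toList v) w)))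
          (∑-zero∈ (RL N la) λ w w∈ → cong ι (bool-not λ eq → ne (trans (cong size (eqL-sound (V.toList v) w eq)) (RL-size B N la w w∈))))))
    where
    nonneg : ∀ xs → ∃ λ n → ∑ xs (λ u → ι (eqL (V.toList v) (V.toList u))) ≡ pos n
    nonneg [] = 0 , ∑-[] _
    nonneg (u ∷ xs) with eqL (V.toList v) (V.toList {n = N} u) in eq | nonneg xs
    ... | true  | n , h = suc n , trans (∑-∷ u xs _) (cong₂ _+ᶻ_ (cong ι eq) h)
    ... | false | n , h = n , trans (∑-∷ u xs _) (cong₂ _+ᶻ_ (cong ι eq) h)
    nz : ∀ xs → v ∈ xs → ∑ xs (λ u → ι (eqL (V.toList v) (V.toList u))) ≢ pos 0
    nz (u ∷ xs) (here refl) z with nonneg xs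
    ... | n , h with trans (sym z) (trans (∑-∷ u xs _) (cong₂ _+ᶻ_ (cong ι (eqL-refl (V.toList v))) h))
    ...   | ()
    nz (u ∷ xs) (there v∈) z with eqL (V.toList v) (V.toList u) in eq | nonneg xs
    ... | false | _ = nz xs v∈ (trans (sym (trans (∑-∷ u xs _) (trans (cong₂ _+ᶻ_ (cong ι eq) refl) (ℤP.+-identityˡ _)))) z)
    ... | true  | n , h with trans (sym z) (trans (∑-∷ u xs _) (cong₂ _+ᶻ_ (cong ι eq) h))
    ...   | ()

basisFamily : ∀ F la → IsPartition la → Σ (VFamily (size la)) λ Fm → ∀ N → VFamily.vmono Fm N ≡ basisFn F N la
basisFamily Basis.s la pt = schurFamily la pt , λ N → refl
basisFamily Basis.m la pt = monomialFamily la , λ N → refl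
basisFamily Basis.p la pt = multFamily pk (λ { (suc k) l → pkFamily (suc k) l , λ N → refl }) la (partition-pos la pt)
basisFamily Basis.e la pt = multFamily ek (λ k _ → ekFamily k , λ N → refl) la (partition-pos la pt)
basisFamily Basis.h la pt = multFamily hk (λ k _ → hkFamily k , λ N → refl) la (partition-pos la pt)

-- The bases as sums over words

allN : ℕ → (ℕ → Bool) → Bool
allN zero    f = true
allN (suc n) f = f 0 ∧ allN n (f ∘ suc)

allN-cong : ∀ n {f g} → (∀ i → i < n → f i ≡ g i) → allN n f ≡ allN n g
allN-cong zero    eq = refl
allN-cong (suc n) eq = cong₂ _∧_ (eq 0 (s≤s z≤n)) (allN-cong n λ i lt → eq (suc i) (s≤s lt))

allN-sound : ∀ n f → allN n f ≡ true → ∀ i → i < n → f i ≡ true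
allN-sound (suc n) f eq zero    _        = proj₁ (∧-true {f 0} eq)
allN-sound (suc n) f eq (suc i) (s≤s lt) = allN-sound n (f ∘ suc) (proj₂ (∧-true {f 0} eq)) i lt

allN-intro : ∀ n f → (∀ i → i < n → f i ≡ true) → allN n f ≡ true
allN-intro zero    f eq = refl
allN-intro (suc n) f eq = ∧-intro (eq 0 (s≤s z≤n)) (allN-intro n (f ∘ suc) λ i lt → eq (suc i) (s≤s lt))

b2n : Bool → ℕ
b2n true  = 1
b2n false = 0

Rel₂ : Set
Rel₂ = ℕ → ℕ → Bool

shift : ℕ → Rel₂ → Rel₂
shift k R i j = R (k + i) (k + j)

-- Conditions on the entries of a filling of shape la, read row by row into positions 0, 1, …;
-- R i j compares the entries at positions i and j.
rowAdj : Rel₂ → ℕ → Bool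
rowAdj R k = allN (k ∸ 1) (λ c → R c (suc c))

rowsI : Rel₂ → List ℕ → Bool
rowsI R []      = true
rowsI R (k ∷ κ) = rowAdj R k ∧ rowsI (shift k R) κ

colsI : Rel₂ → List ℕ → Bool
colsI R []      = true
colsI R (k ∷ κ) = allN (hd κ) (λ c → R c (k + c)) ∧ colsI (shift k R) κ

-- For every v, exactly v · (multiplicity of v in la) entries occur exactly v times.
multI : Rel₂ → ℕ → List ℕ → Bool
multI Eq d la = allN d (λ v → sumTo d (λ i → b2n (sumTo d (λ j → b2n (Eq i j)) ≡ᵇ suc v)) ≡ᵇ suc v * countℕ (suc v) la)

orR : Rel₂ → Rel₂ → Rel₂
orR P Q i j = P i j ∨ Q i j

-- A monomial of h_k, e_k or p_k is a weakly increasing, strictly increasing or constant row, and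
-- the rows of a product are independent. For Schur functions the columns are tested as well. A
-- monomial of m_λ is a single sorted row whose letter multiplicities are the parts of λ.
Cond : Basis → List ℕ → Rel₂ → Rel₂ → Bool
Cond Basis.s la Lt Eq = rowsI (orR Lt Eq) la ∧ colsI Lt la
Cond Basis.m la Lt Eq = rowAdj (orR Lt Eq) (size la) ∧ multI Eq (size la) la
Cond Basis.p la Lt Eq = rowsI Eq la
Cond Basis.e la Lt Eq = rowsI Lt la
Cond Basis.h la Lt Eq = rowsI (orR Lt Eq) la

SameUpTo : ℕ → Rel₂ → Rel₂ → Set
SameUpTo n R R′ = ∀ i j → i < n → j < n → R i j ≡ R′ i j

rowAdj-cong : ∀ {R R′} k → SameUpTo k R R′ → rowAdj R k ≡ rowAdj R′ k
rowAdj-cong zero    eq = refl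
rowAdj-cong (suc k) eq = allN-cong k λ c lt → eq c (suc c) (ℕP.m<n⇒m<1+n lt) (s≤s lt)

same-left : ∀ {R R′ k} l → SameUpTo (k + l) R R′ → SameUpTo k R R′
same-left {k = k} l eq i j li lj = eq i j (ℕP.<-≤-trans li (ℕP.m≤m+n k l)) (ℕP.<-≤-trans lj (ℕP.m≤m+n k l))

same-right : ∀ {R R′} k {l} → SameUpTo (k + l) R R′ → SameUpTo l (shift k R) (shift k R′)
same-right k eq i j li lj = eq (k + i) (k + j) (ℕP.+-monoʳ-< k li) (ℕP.+-monoʳ-< k lj)

rowsI-cong : ∀ {R R′} κ → SameUpTo (size κ) R R′ → rowsI R κ ≡ rowsI R′ κ
rowsI-cong []      eq = refl
rowsI-cong (k ∷ κ) eq = cong₂ _∧_ (rowAdj-cong k (same-left (size κ) eq)) (rowsI-cong κ (same-right k eq))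

colsI-cong : ∀ {R R′} κ → WD κ → SameUpTo (size κ) R R′ → colsI R κ ≡ colsI R′ κ
colsI-cong []      wd       eq = refl
colsI-cong (k ∷ κ) (l , wd) eq = cong₂ _∧_
  (allN-cong (hd κ) λ c lt → eq c (k + c) (ℕP.<-≤-trans lt (ℕP.≤-trans l (ℕP.m≤m+n k (size κ)))) (ℕP.+-monoʳ-< k (ℕP.<-≤-trans lt (hd≤ κ))))
  (colsI-cong κ wd (same-right k eq))
  where hd≤ : ∀ κ → hd κ ≤ size κ
        hd≤ []      = z≤n
        hd≤ (k ∷ κ) = ℕP.m≤m+n k (size κ)

orR-cong : ∀ {n P P′ Q Q′} → SameUpTo n P P′ → SameUpTo n Q Q′ → SameUpTo n (orR P Q) (orR P′ Q′)
orR-cong e₁ e₂ i j li lj = cong₂ _∨_ (e₁ i j li lj) (e₂ i j li lj)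

multI-cong : ∀ {R R′} d la → SameUpTo d R R′ → multI R d la ≡ multI R′ d la
multI-cong d la eq = allN-cong d λ v _ → cong (_≡ᵇ suc v * countℕ (suc v) la) (sumTo-cong d λ i li → cong (λ z → b2n (z ≡ᵇ suc v)) (sumTo-cong d λ j lj → cong b2n (eq i j li lj)))

Cond-cong : ∀ F la {Lt Lt′ Eq Eq′} → WD la → SameUpTo (size la) Lt Lt′ → SameUpTo (size la) Eq Eq′ → Cond F la Lt Eq ≡ Cond F la Lt′ Eq′
Cond-cong Basis.s la wd e₁ e₂ = cong₂ _∧_ (rowsI-cong la (orR-cong e₁ e₂)) (colsI-cong la wd e₁)
Cond-cong Basis.m la wd e₁ e₂ = cong₂ _∧_ (rowAdj-cong (size la) (orR-cong e₁ e₂)) (multI-cong (size la) la e₂)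
Cond-cong Basis.p la wd e₁ e₂ = rowsI-cong la e₂
Cond-cong Basis.e la wd e₁ e₂ = rowsI-cong la e₁
Cond-cong Basis.h la wd e₁ e₂ = rowsI-cong la (orR-cong e₁ e₂)

onW : (ℕ → ℕ → Bool) → List ℕ → Rel₂
onW r w i j = r (nth 0 w i) (nth 0 w j)

-- Conditions are given only a strict order and an equality, so the weak order has to be assembled
-- from these.
leᵇ : ℕ → ℕ → Bool
leᵇ a b = (a <ᵇ b) ∨ (a ≡ᵇ b)

leᵇ-≤ᵇ : ∀ a b → leᵇ a b ≡ (a ≤ᵇ b)
leᵇ-≤ᵇ a b = bool-iff to from
  where
  to : leᵇ a b ≡ true → (a ≤ᵇ b) ≡ true
  to eq with a <ᵇ b in e₁
  ... | true  = ≤ᵇ-true (ℕP.<⇒≤ (<ᵇ-sound a b e₁))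
  ... | false = ≤ᵇ-true (ℕP.≤-reflexive (≡ᵇ-sound a b eq))
  from : (a ≤ᵇ b) ≡ true → leᵇ a b ≡ true
  from eq with a <ᵇ b in e₁
  ... | true  = refl
  ... | false with a ≟ b
  ...   | yes refl = ≡ᵇ-refl a
  ...   | no ne with trans (sym e₁) (<ᵇ-true (ℕP.≤∧≢⇒< (≤ᵇ-sound a b eq) ne))
  ...     | ()

adj : (ℕ → ℕ → Bool) → List ℕ → Bool
adj r (a ∷ b ∷ w) = r a b ∧ adj r (b ∷ w)
adj r _           = true

rowAdj-adj : ∀ r w → rowAdj (onW r w) (length w) ≡ adj r w
rowAdj-adj r []          = refl
rowAdj-adj r (a ∷ [])    = refl
rowAdj-adj r (a ∷ b ∷ w) = cong (r a b ∧_) (rowAdj-adj r (b ∷ w))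

adj-cong : ∀ {r r′ : ℕ → ℕ → Bool} → (∀ a b → r a b ≡ r′ a b) → ∀ w → adj r w ≡ adj r′ w
adj-cong eq []          = refl
adj-cong eq (a ∷ [])    = refl
adj-cong eq (a ∷ b ∷ w) = cong₂ _∧_ (eq a b) (adj-cong eq (b ∷ w))

winc-adj : ∀ w → adj leᵇ w ≡ weaklyIncᵇ w
winc-adj w = trans (adj-cong leᵇ-≤ᵇ w) (go w)
  where go : ∀ w → adj _≤ᵇ_ w ≡ weaklyIncᵇ w
        go []          = refl
        go (a ∷ [])    = refl
        go (a ∷ b ∷ w) = cong ((a ≤ᵇ b) ∧_) (go (b ∷ w))

nth-++ˡ : ∀ {A : Set} (d : A) u v i → i < length u → nth d (u ++ v) i ≡ nth d u i
nth-++ˡ d (x ∷ u) v zero    _        = refl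
nth-++ˡ d (x ∷ u) v (suc i) (s≤s lt) = nth-++ˡ d u v i lt

nth-++ʳ : ∀ {A : Set} (d : A) u v i → nth d (u ++ v) (length u + i) ≡ nth d v i
nth-++ʳ d []      v i = refl
nth-++ʳ d (x ∷ u) v i = nth-++ʳ d u v i

onW-left : ∀ r u v → SameUpTo (length u) (onW r (u ++ v)) (onW r u)
onW-left r u v i j li lj = cong₂ r (nth-++ˡ 0 u v i li) (nth-++ˡ 0 u v j lj)

onW-right : ∀ r u v n → SameUpTo n (shift (length u) (onW r (u ++ v))) (onW r v)
onW-right r u v n i j li lj = cong₂ r (nth-++ʳ 0 u v i) (nth-++ʳ 0 u v j)

addL : List ℕ → List ℕ → List ℕ
addL = zipWith _+_

toList-add : ∀ {N} (u v : Vec ℕ N) → V.toList (addV u v) ≡ addL (V.toList u) (V.toList v)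
toList-add V.[]      V.[]      = refl
toList-add (a V.∷ u) (b V.∷ v) = cong ((a + b) ∷_) (toList-add u v)

cont-++ : ∀ N u v → cont N (u ++ v) ≡ addL (cont N u) (cont N v)
cont-++ N u v = go (upTo N)
  where go : ∀ xs → map (λ i → countℕ i (u ++ v)) xs ≡ addL (map (λ i → countℕ i u) xs) (map (λ i → countℕ i v) xs)
        go []       = refl
        go (x ∷ xs) = cong₂ _∷_ (countℕ-++ x u v) (go xs)

cont-suc : ∀ N w → cont (suc N) w ≡ cont N w ∷ʳ countℕ N w
cont-suc N w = trans (cong (map g) (upTo-∷ʳ N)) (LP.map-++ g (upTo N) (N ∷ []))
  where g : ℕ → ℕ
        g i = countℕ i w

cont-top : ∀ N v a → All (_< N) v → cont (suc N) (v ++ replicate a N) ≡ cont N v ∷ʳ a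
cont-top N v a al = trans (cont-suc N (v ++ replicate a N)) (cong₂ _∷ʳ_
  (map-upTo-cong N λ i lt → trans (countℕ-++ i v (replicate a N)) (trans (cong (countℕ i v +_) (trans (countℕ-rep i a N) (cong (λ b → if b then a else 0) (≡ᵇ-≢ (ℕP.<⇒≢ lt))))) (ℕP.+-identityʳ _)))
  (trans (countℕ-++ N v (replicate a N)) (cong₂ _+_ (countℕ-none N v al) (trans (countℕ-rep N a N) (cong (λ b → if b then a else 0) (≡ᵇ-refl N))))))

allLe : ℕ → List ℕ → Bool
allLe b = all (_≤ᵇ b)

∑-words-restrict : ∀ {b b′} N (f : List ℕ → ℤ) → b ≤ b′ → ∑ (words (upTo (suc b′)) N) (λ w → ι (allLe b w) *ᶻ f w) ≡ ∑ (words (upTo (suc b)) N) f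
∑-words-restrict {b} {b′} zero f le = trans (∑-words-0 (upTo (suc b′)) _) (trans (ℤP.*-identityˡ _) (sym (∑-words-0 (upTo (suc b)) f)))
∑-words-restrict {b} {b′} (suc N) f le = trans (∑-words-suc (upTo (suc b′)) N _) (trans (∑-cong (upTo (suc b′)) λ x →
    trans (∑-cong (words (upTo (suc b′)) N) λ w → ι-∧* (x ≤ᵇ b) (allLe b w) (f (x ∷ w))) (trans (∑-* (words (upTo (suc b′)) N) (ι (x ≤ᵇ b)) _) (cong (ι (x ≤ᵇ b) *ᶻ_) (∑-words-restrict N (λ w → f (x ∷ w)) le))))
  (trans (∑-upTo-restrict _ le) (sym (∑-words-suc (upTo (suc b)) N f))))

allLe-size : ∀ b w → size w ≤ b → allLe b w ≡ true
allLe-size b []      le = refl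
allLe-size b (x ∷ w) le = ∧-intro (≤ᵇ-true (ℕP.≤-trans (ℕP.m≤m+n x (size w)) le)) (allLe-size b w (ℕP.≤-trans (ℕP.m≤n+m (size w) x) le))

compSum : ℕ → ℕ → (List ℕ → ℤ) → ℤ
compSum N k f = ∑ (words (upTo (suc k)) N) (λ α → ι (size α ≡ᵇ k) *ᶻ f α)

compSum-suc : ∀ N k f → compSum (suc N) k f ≡ ∑ (upTo (suc k)) (λ j → compSum N j (λ α → f (α ∷ʳ (k ∸ j))))
compSum-suc N k f = trans (∑-≡ (cong (words (upTo (suc k))) (ℕP.+-comm 1 N)) _) (trans (∑-words-+ (upTo (suc k)) N 1 _)
  (trans (∑-cong W λ α → trans (∑-words-suc (upTo (suc k)) 0 _) (trans (∑-cong (upTo (suc k)) λ c → ∑-words-0 (upTo (suc k)) _) (∑-upTo-rev (suc k) _)))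
  (trans (∑-swap W (upTo (suc k)) _) (∑-upTo-cong (suc k) λ j lt → trans (∑-cong W λ α → trans (cong (λ b → ι b *ᶻ f (α ∷ʳ (k ∸ j))) (sz α j (ℕP.≤-pred lt)))
      (trans (ι-cong (size α ≡ᵇ j) λ eq → sym (ι-true _ (allLe-size j α (ℕP.≤-reflexive (≡ᵇ-sound (size α) j eq))))) (ι-comm (size α ≡ᵇ j) (allLe j α) _)))
    (∑-words-restrict N _ (ℕP.≤-pred lt))))))
  where
  W = words (upTo (suc k)) N
  sz : ∀ α j → j ≤ k → (size (α ++ (k ∸ j) ∷ []) ≡ᵇ k) ≡ (size α ≡ᵇ j)
  sz α j le = bool-iff
    (λ eq → trans (cong (_≡ᵇ j) (ℕP.+-cancelʳ-≡ (k ∸ j) (size α) j (trans (sym (size-snoc α (k ∸ j))) (trans (≡ᵇ-sound (size (α ++ (k ∸ j) ∷ [])) k eq) (sym (ℕP.m+[n∸m]≡n le)))))) (≡ᵇ-refl j))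
    (λ eq → trans (cong (_≡ᵇ k) (trans (size-snoc α (k ∸ j)) (trans (cong (_+ (k ∸ j)) (≡ᵇ-sound (size α) j eq)) (ℕP.m+[n∸m]≡n le)))) (≡ᵇ-refl k))

-- A weakly increasing word is determined by its content, which can be any weak composition of its
-- length. Both sides are split according to the multiplicity of the largest letter.
∑-sorted : ∀ N k (f : List ℕ → ℤ) → ∑ (words (upTo N) k) (λ w → ι (weaklyIncᵇ w) *ᶻ f (cont N w)) ≡ compSum N k f
∑-sorted zero    zero    f = trans (∑-words-0 [] _) (sym (∑-words-0 (upTo 1) _))
∑-sorted zero    (suc k) f = trans (∑-[] _) (sym (∑-words-0 (upTo (suc (suc k))) _))
∑-sorted (suc N) k       f = trans (∑-splitTop N k (λ w → f (cont (suc N) w))) (trans (∑-cong (upTo (suc k)) λ j →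
    trans (∑-letters-cong N j λ v al _ → cong (λ z → ι (weaklyIncᵇ v) *ᶻ f z) (cont-top N v (k ∸ j) al)) (∑-sorted N j (λ α → f (α ∷ʳ (k ∸ j)))))
  (sym (compSum-suc N k f)))

∑-allVecs : ∀ N b (f : List ℕ → ℤ) → ∑ (allVecs N b) (λ v → f (V.toList v)) ≡ ∑ (words (upTo (suc b)) N) f
∑-allVecs zero    b f = trans (∑-one V.[] _) (sym (∑-words-0 (upTo (suc b)) f))
∑-allVecs (suc N) b f = trans (∑-allVecs-suc N b _) (trans (∑-cong (upTo (suc b)) λ x → ∑-allVecs N b (λ w → f (x ∷ w))) (sym (∑-words-suc (upTo (suc b)) N f)))

-- The case of one part; the multiplicative bases follow by concatenating rows, since contents add.
RowLemma : (∀ N → ℕ → Monos N) → (ℕ → ℕ → Bool) → Set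
RowLemma q r = ∀ N k (f : List ℕ → ℤ) → 1 ≤ k → ∑ (q N k) (λ v → f (V.toList v)) ≡ ∑ (words (upTo N) k) (λ w → ι (adj r w) *ᶻ f (cont N w))

hk-row : RowLemma hk leᵇ
hk-row N k f _ = trans (∑-filter (λ v → sumV v ≡ᵇ k) (allVecs N k) _) (trans (∑-allVecs N k (λ w → ι (size w ≡ᵇ k) *ᶻ f w))
  (trans (sym (∑-sorted N k f)) (∑-cong (words (upTo N) k) λ w → cong (λ b → ι b *ᶻ f (cont N w)) (sym (winc-adj w)))))

countℕ-∷ : ∀ i a w → countℕ i (a ∷ w) ≡ b2n (i ≡ᵇ a) + countℕ i w
countℕ-∷ i a w with i ≡ᵇ a
... | true  = refl
... | false = refl

countℕ-≤ : ∀ N i w → i < N → allLe 1 (cont N w) ≡ true → countℕ i w ≤ 1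
countℕ-≤ N i w lt eq = allMap (λ i → countℕ i w) N id eq i lt
  where
  allMap : ∀ (g : ℕ → ℕ) n k → all (_≤ᵇ 1) (map g (applyUpTo k n)) ≡ true → ∀ j → j < n → g (k j) ≤ 1
  allMap g (suc n) k eq zero    _        = ≤ᵇ-sound (g (k 0)) 1 (proj₁ (∧-true {g (k 0) ≤ᵇ 1} eq))
  allMap g (suc n) k eq (suc j) (s≤s lj) = allMap g n (k ∘ suc) (proj₂ (∧-true {g (k 0) ≤ᵇ 1} eq)) j lj

all-upTo : ∀ (g : ℕ → ℕ) N → (∀ i → i < N → g i ≤ 1) → allLe 1 (map g (upTo N)) ≡ true
all-upTo g N h = go N id h
  where go : ∀ n k → (∀ j → j < n → g (k j) ≤ 1) → allLe 1 (map g (applyUpTo k n)) ≡ true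
        go zero    k h = refl
        go (suc n) k h = ∧-intro (≤ᵇ-true (h 0 (s≤s z≤n))) (go n (k ∘ suc) λ j lj → h (suc j) (s≤s lj))

-- A sorted word is strictly increasing exactly when no letter is repeated.
strict-sorted : ∀ N w → All (_< N) w → adj _<ᵇ_ w ≡ (weaklyIncᵇ w ∧ allLe 1 (cont N w))
strict-sorted N w al = bool-iff
  (λ eq → ∧-intro (to-winc w eq) (all-upTo (λ i → countℕ i w) N λ i _ → to-count w eq i))
  (λ eq → let (a , b) = ∧-true {weaklyIncᵇ w} eq in from w a al λ i lt → countℕ-≤ N i w lt b)
  where
  to-winc : ∀ w → adj _<ᵇ_ w ≡ true → weaklyIncᵇ w ≡ true
  to-winc []          _  = refl
  to-winc (a ∷ [])    _  = refl
  to-winc (a ∷ b ∷ w) eq = let (x , y) = ∧-true {a <ᵇ b} eq in ∧-intro (≤ᵇ-true (ℕP.<⇒≤ (<ᵇ-sound a b x))) (to-winc (b ∷ w) y)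
  above : ∀ a w → adj _<ᵇ_ (a ∷ w) ≡ true → ∀ i → i ≤ a → countℕ i w ≡ 0
  above a []      _  i le = refl
  above a (b ∷ w) eq i le with ∧-true {a <ᵇ b} eq
  ... | x , y rewrite ≡ᵇ-≢ {i} {b} (ℕP.<⇒≢ (ℕP.≤-<-trans le (<ᵇ-sound a b x))) = above b w y i (ℕP.<⇒≤ (ℕP.≤-<-trans le (<ᵇ-sound a b x)))
  tail-adj : ∀ a w → adj _<ᵇ_ (a ∷ w) ≡ true → adj _<ᵇ_ w ≡ true
  tail-adj a []      _  = refl
  tail-adj a (b ∷ w) eq = proj₂ (∧-true {a <ᵇ b} eq)
  to-count : ∀ w → adj _<ᵇ_ w ≡ true → ∀ i → countℕ i w ≤ 1
  to-count []      _  i = z≤n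
  to-count (a ∷ w) eq i with i ≟ a
  ... | yes refl rewrite ≡ᵇ-refl i = s≤s (ℕP.≤-reflexive (above i w eq i ℕP.≤-refl))
  ... | no ne rewrite ≡ᵇ-≢ ne = to-count w (tail-adj a w eq) i
  from : ∀ w → weaklyIncᵇ w ≡ true → All (_< N) w → (∀ i → i < N → countℕ i w ≤ 1) → adj _<ᵇ_ w ≡ true
  from []          _  _        h = refl
  from (a ∷ [])    _  _        h = refl
  from (a ∷ b ∷ w) eq (lt ∷ al) h = let (x , y) = ∧-true {a ≤ᵇ b} eq in
    ∧-intro (<ᵇ-true (ℕP.≤∧≢⇒< (≤ᵇ-sound a b x) λ { refl → two a w (h a lt) })) (from (b ∷ w) y al λ i li → ℕP.≤-trans (more i a (b ∷ w)) (h i li))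
    where
    two : ∀ a w → countℕ a (a ∷ a ∷ w) ≤ 1 → ⊥
    two a w le with subst (_≤ 1) (trans (countℕ-∷ a a (a ∷ w)) (cong₂ _+_ (cong b2n (≡ᵇ-refl a)) (trans (countℕ-∷ a a w) (cong (λ b → b2n b + countℕ a w) (≡ᵇ-refl a))))) le
    ... | s≤s ()
    more : ∀ i a w → countℕ i w ≤ countℕ i (a ∷ w)
    more i a w with i ≡ᵇ a
    ... | true  = ℕP.n≤1+n _
    ... | false = ℕP.≤-refl

ek-row : RowLemma ek _<ᵇ_
ek-row N k f le = trans (∑-filter (λ v → sumV v ≡ᵇ k) (allVecs N 1) _) (trans (∑-allVecs N 1 (λ w → ι (size w ≡ᵇ k) *ᶻ f w))
  -- The exponents of e_k are bounded by 1, those of the sorted words by k. As 1 ≤ k, the former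
  -- form a sub-box, cut out by a condition on the content.
  (trans (sym (∑-words-restrict N _ le)) (trans (∑-cong (words (upTo (suc k)) N) λ α → ι-comm (allLe 1 α) (size α ≡ᵇ k) (f α))
  (trans (sym (∑-sorted N k (λ α → ι (allLe 1 α) *ᶻ f α))) (∑-letters-cong N k λ w al _ →
    trans (sym (ι-∧* (weaklyIncᵇ w) (allLe 1 (cont N w)) (f (cont N w)))) (cong (λ b → ι b *ᶻ f (cont N w)) (sym (strict-sorted N w al))))))))

pk-row : RowLemma pk _≡ᵇ_
pk-row N (suc k) f _ = trans (∑-map _ (allFin N) _) (trans (∑-cong (allFin N) λ i → cong f (trans (toList-tabulate N (λ j → if toℕ i ≡ᵇ j then suc k else 0)) (rep (toℕ i))))
  (trans (fins N (λ i → f (cont N (replicate (suc k) i)))) (sym (trans (∑-words-suc (upTo N) k _) (∑-upTo-cong N λ x lt → onlyEq k x lt (λ w → f (cont N (x ∷ w))))))))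
  where
  rep : ∀ i → map (λ j → if i ≡ᵇ j then suc k else 0) (upTo N) ≡ cont N (replicate (suc k) i)
  rep i = LP.map-cong (λ j → sym (trans (countℕ-rep j (suc k) i) (cong (λ b → if b then suc k else 0) (≡ᵇ-sym j i)))) (upTo N)
  fins : ∀ N (g : ℕ → ℤ) → ∑ (allFin N) (λ i → g (toℕ i)) ≡ ∑ (upTo N) g
  fins zero    g = trans (∑-[] _) (sym (∑-[] g))
  fins (suc N) g = trans (∑-∷ F.zero _ _) (trans (cong (g 0 +ᶻ_) (trans (∑-≡ (sym (LP.map-tabulate id F.suc)) _) (trans (∑-map F.suc (allFin N) _) (fins N (g ∘ suc))))) (sym (∑-upTo-suc N g)))
  onlyEq : ∀ k x → x < N → (g : List ℕ → ℤ) → ∑ (words (upTo N) k) (λ w → ι (adj _≡ᵇ_ (x ∷ w)) *ᶻ g w) ≡ g (replicate k x)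
  onlyEq zero    x lt g = trans (∑-words-0 (upTo N) _) (ℤP.*-identityˡ _)
  onlyEq (suc k) x lt g = trans (∑-words-suc (upTo N) k _) (trans (∑-cong (upTo N) λ y → trans (∑-cong (words (upTo N) k) λ w → ι-∧* (x ≡ᵇ y) (adj _≡ᵇ_ (y ∷ w)) (g (y ∷ w))) (∑-* (words (upTo N) k) (ι (x ≡ᵇ y)) _))
    (trans (∑-upTo-delta N x (λ y → ∑ (words (upTo N) k) (λ w → ι (adj _≡ᵇ_ (y ∷ w)) *ᶻ g (y ∷ w)))) (trans (ι-true _ (<ᵇ-true lt)) (onlyEq k x lt (λ w → g (x ∷ w))))))

rows-split : ∀ r u v k κ → length u ≡ k → rowsI (onW r (u ++ v)) (k ∷ κ) ≡ (adj r u ∧ rowsI (onW r v) κ)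
rows-split r u v _ κ refl = cong₂ _∧_ (trans (rowAdj-cong (length u) (onW-left r u v)) (rowAdj-adj r u)) (rowsI-cong κ (onW-right r u v (size κ)))

WordSum : ℕ → ℕ → (List ℕ → Bool) → (List ℕ → ℤ) → ℤ
WordSum N n c f = ∑ (words (upTo N) n) (λ w → ι (c w) *ᶻ f (cont N w))

mult-words : ∀ q r → RowLemma q r → ∀ N la (f : List ℕ → ℤ) → All (1 ≤_) la →
  ∑ (multiplicative (q N) la) (λ v → f (V.toList v)) ≡ WordSum N (size la) (λ w → rowsI (onW r w) la) f
mult-words q r row N [] f [] = trans (∑-one _ _) (trans (cong f (toList-zero N)) (sym (trans (∑-words-0 (upTo N) _) (ℤP.*-identityˡ _))))
  where toList-zero : ∀ N → V.toList (zeroV N) ≡ cont N []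
        toList-zero N = go N id
          where go : ∀ N k → V.toList (zeroV N) ≡ map (λ i → countℕ i []) (applyUpTo k N)
                go zero    k = refl
                go (suc N) k = cong (0 ∷_) (go N (k ∘ suc))
mult-words q r row N (k ∷ la) f (l ∷ al) = trans (∑-mulM (q N k) (multiplicative (q N) la) _)
  (trans (∑-cong (q N k) λ a → trans (∑-cong (multiplicative (q N) la) λ b → cong f (toList-add a b)) (mult-words q r row N la (λ w → f (addL (V.toList a) w)) al))
  (trans (row N k (λ α → WordSum N (size la) (λ w → rowsI (onW r w) la) (λ w → f (addL α w))) l)
  (sym (trans (∑-words-+ (upTo N) k (size la) _) (∑-letters-cong N k λ u _ len → trans (∑-cong (words (upTo N) (size la)) λ v →
      trans (cong₂ (λ b z → ι b *ᶻ f z) (rows-split r u v k la len) (cont-++ N u v)) (ι-∧* (adj r u) (rowsI (onW r v) la) _))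
    (∑-* (words (upTo N) (size la)) (ι (adj r u)) _))))))

colStrict-allN : ∀ r w → length w ≤ length r → colStrictᵇ r w ≡ allN (length w) (λ c → nth 0 r c <ᵇ nth 0 w c)
colStrict-allN []      []      le       = refl
colStrict-allN (_ ∷ _) []      le       = refl
colStrict-allN (a ∷ r) (b ∷ w) (s≤s le) = cong ((a <ᵇ b) ∧_) (colStrict-allN r w le)

schur-words : ∀ N la (f : List ℕ → ℤ) → IsPartition la →
  ∑ (schur N la) (λ v → f (V.toList v)) ≡ WordSum N (size la) (λ w → rowsI (onW leᵇ w) la ∧ colsI (onW _<ᵇ_ w) la) f
schur-words N la f pt = trans (sym (∑-map V.toList (schur N la) f)) (trans (∑-schur-SR N la f (partition-pos la pt))
  (top la (λ w → f (cont N w)) (partition-WD la pt)))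
  where
  S : List ℕ → List ℕ → Bool
  S κ w = rowsI (onW leᵇ w) κ ∧ colsI (onW _<ᵇ_ w) κ
  below : List ℕ → List ℕ → List ℕ → Bool
  below r κ w = allN (hd κ) (λ c → nth 0 r c <ᵇ nth 0 w c)
  S-split : ∀ u v k κ → length u ≡ k → hd κ ≤ k → S (k ∷ κ) (u ++ v) ≡ (weaklyIncᵇ u ∧ (below u κ v ∧ S κ v))
  S-split u v _ κ refl le = trans (cong₂ _∧_ (trans (rows-split leᵇ u v (length u) κ refl) (cong (_∧ rowsI (onW leᵇ v) κ) (winc-adj u)))
      (cong₂ _∧_ (allN-cong (hd κ) λ c lt → cong₂ _<ᵇ_ (nth-++ˡ 0 u v c (ℕP.<-≤-trans lt le)) (nth-++ʳ 0 u v c)) (colsI-right κ)))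
    (lem (weaklyIncᵇ u) (rowsI (onW leᵇ v) κ) (below u κ v) (colsI (onW _<ᵇ_ v) κ))
    where
    lem : ∀ a b c d → ((a ∧ b) ∧ (c ∧ d)) ≡ (a ∧ (c ∧ (b ∧ d)))
    lem false b     c     d = refl
    lem true  true  c     d = refl
    lem true  false true  d = refl
    lem true  false false d = refl
    cols-cong : ∀ {R R′ : Rel₂} κ → (∀ i j → R i j ≡ R′ i j) → colsI R κ ≡ colsI R′ κ
    cols-cong []      eq = refl
    cols-cong (k ∷ κ) eq = cong₂ _∧_ (allN-cong (hd κ) λ c _ → eq c (k + c)) (cols-cong κ λ i j → eq (k + i) (k + j))
    colsI-right : ∀ κ → colsI (shift (length u) (onW _<ᵇ_ (u ++ v))) κ ≡ colsI (onW _<ᵇ_ v) κ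
    colsI-right κ = cols-cong κ λ i j → cong₂ _<ᵇ_ (nth-++ʳ 0 u v i) (nth-++ʳ 0 u v j)
  next : ∀ r κ (g : List ℕ → ℤ) → hd κ ≤ length r → WD κ →
    SR N (colStrictᵇ r) κ (λ T → g (concat T)) ≡ ∑ (words (upTo N) (size κ)) (λ w → ι (below r κ w ∧ S κ w) *ᶻ g w)
  next r []      g le wd       = sym (trans (∑-words-0 (upTo N) _) (ℤP.*-identityˡ _))
  next r (k ∷ κ) g le (l , wd) = sym (trans (∑-words-+ (upTo N) k (size κ) _) (∑-letters-cong N k λ u _ len →
    trans (∑-cong (words (upTo N) (size κ)) λ v → trans (cong (λ b → ι b *ᶻ g (u ++ v)) (trans (cong₂ _∧_ (bel u v len) (S-split u v k κ len l)) (lem (colStrictᵇ r u) (weaklyIncᵇ u) (below u κ v ∧ S κ v))))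
        (trans (ι-∧* (weaklyIncᵇ u) (colStrictᵇ r u ∧ (below u κ v ∧ S κ v)) (g (u ++ v))) (cong (ι (weaklyIncᵇ u) *ᶻ_) (ι-∧* (colStrictᵇ r u) (below u κ v ∧ S κ v) (g (u ++ v))))))
      (trans (∑-* (words (upTo N) (size κ)) (ι (weaklyIncᵇ u)) _) (cong (ι (weaklyIncᵇ u) *ᶻ_) (trans (∑-* (words (upTo N) (size κ)) (ι (colStrictᵇ r u)) _)
        (cong (ι (colStrictᵇ r u) *ᶻ_) (sym (next u κ (λ w → g (u ++ w)) (ℕP.≤-trans l (ℕP.≤-reflexive (sym len))) wd))))))))
    where
    lem : ∀ a b c → (a ∧ (b ∧ c)) ≡ (b ∧ (a ∧ c))
    lem true  b     c = refl
    lem false true  c = refl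
    lem false false c = refl
    bel : ∀ u v → length u ≡ k → below r (k ∷ κ) (u ++ v) ≡ colStrictᵇ r u
    bel u v refl = trans (allN-cong (length u) λ c lt → cong (nth 0 r c <ᵇ_) (nth-++ˡ 0 u v c lt)) (sym (colStrict-allN r u le))
  top : ∀ κ (g : List ℕ → ℤ) → WD κ → SR N (const true) κ (λ T → g (concat T)) ≡ ∑ (words (upTo N) (size κ)) (λ w → ι (S κ w) *ᶻ g w)
  top []      g wd       = sym (trans (∑-words-0 (upTo N) _) (ℤP.*-identityˡ _))
  top (k ∷ κ) g (l , wd) = sym (trans (∑-words-+ (upTo N) k (size κ) _) (∑-letters-cong N k λ u _ len →
    trans (∑-cong (words (upTo N) (size κ)) λ v → trans (cong (λ b → ι b *ᶻ g (u ++ v)) (S-split u v k κ len l)) (ι-∧* (weaklyIncᵇ u) (below u κ v ∧ S κ v) (g (u ++ v))))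
      (trans (∑-* (words (upTo N) (size κ)) (ι (weaklyIncᵇ u)) _) (cong (ι (weaklyIncᵇ u) *ᶻ_) (trans (sym (next u κ (λ w → g (u ++ w)) (ℕP.≤-trans l (ℕP.≤-reflexive (sym len))) wd)) (sym (ℤP.*-identityˡ _)))))))

sumTo-+ : ∀ n (f g : ℕ → ℕ) → sumTo n (λ i → f i + g i) ≡ sumTo n f + sumTo n g
sumTo-+ zero    f g = refl
sumTo-+ (suc n) f g = trans (cong (f 0 + g 0 +_) (sumTo-+ n (f ∘ suc) (g ∘ suc))) (lem (f 0) (g 0) _ _)
  where lem : ∀ a b c d → a + b + (c + d) ≡ a + c + (b + d)
        lem = ℕS.solve-∀

sumTo-* : ∀ n c (f : ℕ → ℕ) → sumTo n (λ i → c * f i) ≡ c * sumTo n f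
sumTo-* zero    c f = sym (ℕP.*-zeroʳ c)
sumTo-* (suc n) c f = trans (cong (c * f 0 +_) (sumTo-* n c (f ∘ suc))) (sym (ℕP.*-distribˡ-+ c (f 0) _))

sumTo-0 : ∀ n → sumTo n (λ _ → 0) ≡ 0
sumTo-0 zero    = refl
sumTo-0 (suc n) = sumTo-0 n

sumTo-delta : ∀ n a (f : ℕ → ℕ) → a < n → sumTo n (λ i → b2n (i ≡ᵇ a) * f i) ≡ f a
sumTo-delta (suc n) zero    f lt       = trans (cong₂ _+_ (ℕP.+-identityʳ (f 0)) (sumTo-0 n)) (ℕP.+-identityʳ (f 0))
sumTo-delta (suc n) (suc a) f (s≤s lt) = sumTo-delta n a (f ∘ suc) lt

countℕ-sumTo : ∀ x w → sumTo (length w) (λ j → b2n (x ≡ᵇ nth 0 w j)) ≡ countℕ x w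
countℕ-sumTo x []      = refl
countℕ-sumTo x (a ∷ w) = trans (cong (b2n (x ≡ᵇ a) +_) (countℕ-sumTo x w)) (sym (countℕ-∷ x a w))

regroup : ∀ N w (φ : ℕ → ℕ) → All (_< N) w → sumTo (length w) (λ i → φ (nth 0 w i)) ≡ sumTo N (λ i → countℕ i w * φ i)
regroup N []      φ []        = sym (sumTo-0 N)
regroup N (a ∷ w) φ (lt ∷ al) = trans (cong₂ _+_ (sym (sumTo-delta N a φ lt)) (regroup N w φ al))
  (trans (sym (sumTo-+ N _ _)) (sumTo-cong N λ i _ → trans (sym (ℕP.*-distribʳ-+ (φ i) (b2n (i ≡ᵇ a)) (countℕ i w))) (cong (_* φ i) (sym (countℕ-∷ i a w)))))

countℕ-map : ∀ v (g : ℕ → ℕ) N → countℕ v (map g (upTo N)) ≡ sumTo N (λ i → b2n (g i ≡ᵇ v))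
countℕ-map v g N = go N id
  where go : ∀ n k → countℕ v (map g (applyUpTo k n)) ≡ sumTo n (λ i → b2n (g (k i) ≡ᵇ v))
        go zero    k = refl
        go (suc n) k = trans (countℕ-∷ v (g (k 0)) _) (cong₂ _+_ (cong b2n (≡ᵇ-sym v (g (k 0)))) (go n (k ∘ suc)))

-- Group the positions by their letter: a letter of multiplicity v accounts for v positions. Thus
-- the number of letters with a given multiplicity can be read off by comparing positions for
-- equality, without knowing the letters.
mult-count : ∀ N w v → All (_< N) w →
  sumTo (length w) (λ i → b2n (sumTo (length w) (λ j → b2n (onW _≡ᵇ_ w i j)) ≡ᵇ v)) ≡ v * countℕ v (cont N w)
mult-count N w v al = begin
  sumTo (length w) (λ i → b2n (sumTo (length w) (λ j → b2n (nth 0 w i ≡ᵇ nth 0 w j)) ≡ᵇ v))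
    ≡⟨ sumTo-cong (length w) (λ i _ → cong (λ z → b2n (z ≡ᵇ v)) (countℕ-sumTo (nth 0 w i) w)) ⟩
  sumTo (length w) (λ i → b2n (countℕ (nth 0 w i) w ≡ᵇ v))
    ≡⟨ regroup N w (λ a → b2n (countℕ a w ≡ᵇ v)) al ⟩
  sumTo N (λ i → countℕ i w * b2n (countℕ i w ≡ᵇ v))
    ≡⟨ sumTo-cong N (λ i _ → eqv (countℕ i w)) ⟩
  sumTo N (λ i → v * b2n (countℕ i w ≡ᵇ v))
    ≡⟨ sumTo-* N v _ ⟩
  v * sumTo N (λ i → b2n (countℕ i w ≡ᵇ v))
    ≡⟨ cong (v *_) (sym (countℕ-map v (λ i → countℕ i w) N)) ⟩
  v * countℕ v (cont N w) ∎
  where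
  open ≡-Reasoning
  eqv : ∀ c → c * b2n (c ≡ᵇ v) ≡ v * b2n (c ≡ᵇ v)
  eqv c with c ≟ v
  ... | yes refl = refl
  ... | no ne rewrite ≡ᵇ-≢ ne = trans (ℕP.*-zeroʳ c) (sym (ℕP.*-zeroʳ v))

*-suc-≡ᵇ : ∀ v a b → (suc v * a ≡ᵇ suc v * b) ≡ (a ≡ᵇ b)
*-suc-≡ᵇ v a b = bool-iff
  (λ eq → trans (cong (_≡ᵇ b) (ℕP.*-cancelˡ-≡ a b (suc v) (≡ᵇ-sound (suc v * a) (suc v * b) eq))) (≡ᵇ-refl b))
  (λ eq → trans (cong (λ z → suc v * z ≡ᵇ suc v * b) (≡ᵇ-sound a b eq)) (≡ᵇ-refl (suc v * b)))

all-upTo-allN : ∀ (q : ℕ → Bool) n → all q (map suc (upTo n)) ≡ allN n (q ∘ suc)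
all-upTo-allN q n = go n id
  where go : ∀ n k → all q (map suc (applyUpTo k n)) ≡ allN n (λ i → q (suc (k i)))
        go zero    k = refl
        go (suc n) k = cong (q (suc (k 0)) ∧_) (go n (k ∘ suc))

monomial-words : ∀ N la (f : List ℕ → ℤ) →
  ∑ (monomialSym N la) (λ v → f (V.toList v)) ≡ WordSum N (size la) (λ w → rowAdj (onW leᵇ w) (size la) ∧ multI (onW _≡ᵇ_ w) (size la) la) f
monomial-words N la f = trans (∑-filter (hasType la) (allVecs N d) _) (trans (∑-allVecs N d (λ w → ι ((size w ≡ᵇ d) ∧ all (q w) (map suc (upTo d))) *ᶻ f w))
  (trans (∑-cong (words (upTo (suc d)) N) λ α → ι-∧* (size α ≡ᵇ d) (all (q α) (map suc (upTo d))) (f α))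
  (trans (sym (∑-sorted N d (λ α → ι (all (q α) (map suc (upTo d))) *ᶻ f α))) (∑-letters-cong N d λ w al len →
    trans (sym (ι-∧* (weaklyIncᵇ w) (all (q (cont N w)) (map suc (upTo d))) (f (cont N w)))) (cong (λ b → ι b *ᶻ f (cont N w))
      (cong₂ _∧_ (trans (sym (winc-adj w)) (trans (sym (rowAdj-adj leᵇ w)) (cong (rowAdj (onW leᵇ w)) len)))
        (trans (all-upTo-allN (q (cont N w)) d) (allN-cong d λ v _ → per w al len v))))))))
  where
  d = size la
  q : List ℕ → ℕ → Bool
  q α v = countℕ v α ≡ᵇ countℕ v la
  per : ∀ w → All (_< N) w → length w ≡ d → ∀ v → q (cont N w) (suc v) ≡
        (sumTo d (λ i → b2n (sumTo d (λ j → b2n (onW _≡ᵇ_ w i j)) ≡ᵇ suc v)) ≡ᵇ suc v * countℕ (suc v) la)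
  per w al len v = sym (trans (cong (_≡ᵇ suc v * countℕ (suc v) la) (trans (cong (λ z → sumTo z (λ i → b2n (sumTo z (λ j → b2n (onW _≡ᵇ_ w i j)) ≡ᵇ suc v))) (sym len)) (mult-count N w (suc v) al)))
    (*-suc-≡ᵇ v (countℕ (suc v) (cont N w)) (countℕ (suc v) la)))

basis-words : ∀ F N la (f : List ℕ → ℤ) → IsPartition la →
  ∑ (basisFn F N la) (λ v → f (V.toList v)) ≡ WordSum N (size la) (λ w → Cond F la (onW _<ᵇ_ w) (onW _≡ᵇ_ w)) f
basis-words Basis.s N la f pt = schur-words N la f pt
basis-words Basis.m N la f pt = monomial-words N la f
basis-words Basis.p N la f pt = mult-words pk _≡ᵇ_ pk-row N la f (partition-pos la pt)
basis-words Basis.e N la f pt = mult-words ek _<ᵇ_ ek-row N la f (partition-pos la pt)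
basis-words Basis.h N la f pt = mult-words hk leᵇ hk-row N la f (partition-pos la pt)

-- Lexicographic order and plethysm as a sum over words

ltLex : List ℕ → List ℕ → Bool
ltLex (a ∷ u) (b ∷ v) = (a <ᵇ b) ∨ ((a ≡ᵇ b) ∧ ltLex u v)
ltLex _       _       = false

ltLex-head : ∀ {a b} u v → a < b → ltLex (a ∷ u) (b ∷ v) ≡ true
ltLex-head u v lt rewrite <ᵇ-true lt = refl

ltLex-tail : ∀ a u v → ltLex (a ∷ u) (a ∷ v) ≡ ltLex u v
ltLex-tail a u v rewrite <ᵇ-false (ℕP.≤-refl {a}) | ≡ᵇ-refl a = refl

ltLex-irrefl : ∀ u → ltLex u u ≡ false
ltLex-irrefl []      = refl
ltLex-irrefl (a ∷ u) = trans (ltLex-tail a u u) (ltLex-irrefl u)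

ltLex-asym : ∀ u v → ltLex u v ≡ true → ltLex v u ≡ false
ltLex-asym (a ∷ u) (b ∷ v) eq with a <ᵇ b in e₁
... | true rewrite <ᵇ-false {b} {a} (ℕP.<⇒≤ (<ᵇ-sound a b e₁)) | ≡ᵇ-≢ {b} {a} (λ z → ℕP.<⇒≢ (<ᵇ-sound a b e₁) (sym z)) = refl
... | false with ∧-true {a ≡ᵇ b} eq
...   | x , y with ≡ᵇ-sound a b x
...     | refl = trans (ltLex-tail a v u) (ltLex-asym u v y)

Srt : List (List ℕ) → Set
Srt []       = ⊤
Srt (u ∷ us) = All (λ v → ltLex u v ≡ true) us × Srt us

Srt-++ : ∀ us vs → Srt us → Srt vs → (∀ u v → u ∈ us → v ∈ vs → ltLex u v ≡ true) → Srt (us ++ vs)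
Srt-++ []       vs _        sv cr = sv
Srt-++ (u ∷ us) vs (al , su) sv cr = All.tabulate (λ {v} v∈ → pick v v∈) , Srt-++ us vs su sv λ x y x∈ y∈ → cr x y (there x∈) y∈
  where pick : ∀ v → v ∈ us ++ vs → ltLex u v ≡ true
        pick v v∈ with ∈-++⁻ us v∈
        ... | inj₁ i = All.lookup al i
        ... | inj₂ i = cr u v (here refl) i

Srt-map : ∀ a us → Srt us → Srt (map (a ∷_) us)
Srt-map a []       _        = tt
Srt-map a (u ∷ us) (al , s) = go us al , Srt-map a us s
  where go : ∀ us → All (λ v → ltLex u v ≡ true) us → All (λ v → ltLex (a ∷ u) v ≡ true) (map (a ∷_) us)
        go []       []       = []
        go (v ∷ us) (l ∷ al) = trans (ltLex-tail a u v) l ∷ go us al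

Srt-filter : ∀ q us → Srt us → Srt (filterᵇ q us)
Srt-filter q []       _        = tt
Srt-filter q (u ∷ us) (al , s) with q u
... | false = Srt-filter q us s
... | true  = go us al , Srt-filter q us s
  where go : ∀ us → All (λ v → ltLex u v ≡ true) us → All (λ v → ltLex u v ≡ true) (filterᵇ q us)
        go []       []       = []
        go (v ∷ us) (l ∷ al) with q v
        ... | true  = l ∷ go us al
        ... | false = go us al

heads∈ : ∀ xs (W : List (List ℕ)) v → v ∈ concatMap (λ x → map (x ∷_) W) xs → ∃ λ z → ∃ λ w → z ∈ xs × (v ≡ z ∷ w)
heads∈ (x ∷ xs) W v v∈ with ∈-++⁻ (map (x ∷_) W) v∈
... | inj₁ i = let (w , _ , eq) = ∈-map⁻ (x ∷_) i in x , w , here refl , eq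
... | inj₂ i = let (z , w , z∈ , eq) = heads∈ xs W v i in z , w , there z∈ , eq

Incr : List ℕ → Set
Incr []       = ⊤
Incr (x ∷ xs) = All (x <_) xs × Incr xs

Incr-upTo : ∀ n → Incr (upTo n)
Incr-upTo n = go n id (λ i j lt → lt)
  where
  al : ∀ n k x → (∀ i → x < k i) → All (x <_) (applyUpTo k n)
  al zero    k x h = []
  al (suc n) k x h = h 0 ∷ al n (k ∘ suc) x (h ∘ suc)
  go : ∀ n (k : ℕ → ℕ) → (∀ i j → i < j → k i < k j) → Incr (applyUpTo k n)
  go zero    k mono = tt
  go (suc n) k mono = al n (k ∘ suc) (k 0) (λ i → mono 0 (suc i) (s≤s z≤n)) , go n (k ∘ suc) λ i j lt → mono (suc i) (suc j) (s≤s lt)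

-- The recursive enumeration runs through the first letter in increasing order before anything else,
-- which is the lexicographic order.
Srt-words : ∀ xs n → Incr xs → Srt (words xs n)
Srt-words xs zero    inc = [] , tt
Srt-words xs (suc n) inc = go xs inc
  where
  W = words xs n
  sW : Srt W
  sW = Srt-words xs n inc
  go : ∀ ys → Incr ys → Srt (concatMap (λ x → map (x ∷_) W) ys)
  go []       _        = tt
  go (y ∷ ys) (al , i) = Srt-++ (map (y ∷_) W) _ (Srt-map y W sW) (go ys i) cross
    where
    cross : ∀ u v → u ∈ map (y ∷_) W → v ∈ concatMap (λ x → map (x ∷_) W) ys → ltLex u v ≡ true
    cross u v u∈ v∈ with ∈-map⁻ (y ∷_) u∈ | heads∈ ys W v v∈
    ... | u′ , _ , refl | z , w , z∈ , refl = ltLex-head u′ w (All.lookup al z∈)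

Srt-lt : ∀ us → Srt us → ∀ i j → i < j → j < length us → ltLex (nth [] us i) (nth [] us j) ≡ true
Srt-lt (u ∷ us) (al , s) zero    (suc j) _        (s≤s lj) = go us al j lj
  where go : ∀ us → All (λ v → ltLex u v ≡ true) us → ∀ j → j < length us → ltLex u (nth [] us j) ≡ true
        go (v ∷ us) (l ∷ al) zero    _        = l
        go (v ∷ us) (l ∷ al) (suc j) (s≤s lj) = go us al j lj
Srt-lt (u ∷ us) (al , s) (suc i) (suc j) (s≤s lt) (s≤s lj) = Srt-lt us s i j lt lj

-- Positions in a strictly sorted list compare as the entries do. The letters of outer words are
-- positions in the list of inner words, so they can be replaced by the inner words themselves.
Srt-<ᵇ : ∀ us → Srt us → ∀ i j → i < length us → j < length us → (i <ᵇ j) ≡ ltLex (nth [] us i) (nth [] us j)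
Srt-<ᵇ us s i j li lj with ℕP.<-cmp i j
... | tri< lt _ _   = trans (<ᵇ-true lt) (sym (Srt-lt us s i j lt lj))
... | tri≈ _ refl _ = trans (<ᵇ-false (ℕP.≤-refl {i})) (sym (ltLex-irrefl (nth [] us i)))
... | tri> _ _ gt   = trans (<ᵇ-false (ℕP.<⇒≤ gt)) (sym (ltLex-asym (nth [] us j) (nth [] us i) (Srt-lt us s j i gt li)))

Srt-≡ᵇ : ∀ us → Srt us → ∀ i j → i < length us → j < length us → (i ≡ᵇ j) ≡ eqL (nth [] us i) (nth [] us j)
Srt-≡ᵇ us s i j li lj = bool-iff (λ eq → trans (cong (λ z → eqL (nth [] us i) (nth [] us z)) (sym (≡ᵇ-sound i j eq))) (eqL-refl (nth [] us i))) from
  where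
  clash : ∀ {u v} → u ≡ v → ltLex u v ≡ true → ⊥
  clash {u} refl lt with trans (sym lt) (ltLex-irrefl u)
  ... | ()
  from : eqL (nth [] us i) (nth [] us j) ≡ true → (i ≡ᵇ j) ≡ true
  from eq with ℕP.<-cmp i j
  ... | tri< lt _ _   = ⊥-elim (clash (eqL-sound (nth [] us i) (nth [] us j) eq) (Srt-lt us s i j lt lj))
  ... | tri≈ _ refl _ = ≡ᵇ-refl i
  ... | tri> _ _ gt   = ⊥-elim (clash (sym (eqL-sound (nth [] us i) (nth [] us j) eq)) (Srt-lt us s j i gt li))

unl-add : ∀ N u v → length u ≡ N → length v ≡ N → unl N (addL u v) ≡ addV (unl N u) (unl N v)
unl-add zero    []      []      _  _  = refl
unl-add (suc N) (a ∷ u) (b ∷ v) e₁ e₂ = cong ((a + b) V.∷_) (unl-add N u v (ℕP.suc-injective e₁) (ℕP.suc-injective e₂))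

toList-unl : ∀ N u → length u ≡ N → V.toList (unl N u) ≡ u
toList-unl zero    []      _  = refl
toList-unl (suc N) (a ∷ u) eq = cong (a ∷_) (toList-unl N u (ℕP.suc-injective eq))

cont-length : ∀ N w → length (cont N w) ≡ N
cont-length N w = trans (LP.length-map (λ i → countℕ i w) (upTo N)) (LP.length-upTo N)

addV-zeroʳ : ∀ {N} (v : Vec ℕ N) → addV v (zeroV N) ≡ v
addV-zeroʳ V.[]      = refl
addV-zeroʳ (a V.∷ v) = cong₂ V._∷_ (ℕP.+-identityʳ a) (addV-zeroʳ v)

addV-zeroˡ : ∀ {N} (v : Vec ℕ N) → addV (zeroV N) v ≡ v
addV-zeroˡ V.[]      = refl
addV-zeroˡ (a V.∷ v) = cong (a V.∷_) (addV-zeroˡ v)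

subL-add : ∀ {N} (σs : List (Vec ℕ N)) α β → length α ≡ length β → subL σs (addL α β) ≡ addV (subL σs α) (subL σs β)
subL-add []       α       β       len = sym (addV-zeroˡ _)
subL-add (σ ∷ σs) []      []      len = sym (addV-zeroˡ _)
subL-add (σ ∷ σs) (a ∷ α) (b ∷ β) len = trans (cong₂ addV (dist σ) (subL-add σs α β (ℕP.suc-injective len))) (mix (V.map (a *_) σ) (V.map (b *_) σ) _ _)
  where
  dist : ∀ {N} (σ : Vec ℕ N) → V.map ((a + b) *_) σ ≡ addV (V.map (a *_) σ) (V.map (b *_) σ)
  dist V.[]      = refl
  dist (x V.∷ σ) = cong₂ V._∷_ (ℕP.*-distribʳ-+ x a b) (dist σ)
  mix : ∀ {N} (u v w z : Vec ℕ N) → addV (addV u v) (addV w z) ≡ addV (addV u w) (addV v z)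
  mix V.[] V.[] V.[] V.[] = refl
  mix (a V.∷ u) (b V.∷ v) (c V.∷ w) (d V.∷ z) = cong₂ V._∷_ (lem a b c d) (mix u v w z)
    where open import Data.Nat.Tactic.RingSolver using (solve-∀)
          lem : ∀ a b c d → a + b + (c + d) ≡ a + c + (b + d)
          lem = solve-∀

subL-zeros : ∀ {N} (σs : List (Vec ℕ N)) xs (k : ℕ → ℕ) → (∀ i → k i ≡ 0) → subL σs (map k xs) ≡ zeroV N
subL-zeros []       xs       k z = refl
subL-zeros (σ ∷ σs) []       k z = refl
subL-zeros (σ ∷ σs) (x ∷ xs) k z = trans (cong₂ addV (trans (cong (λ y → V.map (y *_) σ) (z x)) (nul σ)) (subL-zeros σs xs k z)) (addV-zeroˡ _)
  where nul : ∀ {N} (σ : Vec ℕ N) → V.map (0 *_) σ ≡ zeroV N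
        nul V.[]      = refl
        nul (x V.∷ σ) = cong (0 V.∷_) (nul σ)

subL-unit : ∀ {N} (σs : List (Vec ℕ N)) a → a < length σs → subL σs (cont (length σs) (a ∷ [])) ≡ nth (zeroV N) σs a
subL-unit (σ ∷ σs) a lt = trans (cong (λ z → subL (σ ∷ σs) (countℕ 0 (a ∷ []) ∷ z)) (trans (cong (map _) (sym (LP.map-upTo suc (length σs)))) (sym (LP.map-∘ (upTo (length σs)))))) (go a lt)
  where
  go : ∀ a → a < suc (length σs) → addV (V.map (countℕ 0 (a ∷ []) *_) σ) (subL σs (map (λ i → countℕ (suc i) (a ∷ [])) (upTo (length σs)))) ≡ nth _ (σ ∷ σs) a
  go zero    _        = trans (cong₂ addV (one σ) (subL-zeros σs (upTo (length σs)) _ λ _ → refl)) (addV-zeroʳ σ)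
    where one : ∀ {N} (σ : Vec ℕ N) → V.map (1 *_) σ ≡ σ
          one V.[]      = refl
          one (x V.∷ σ) = cong₂ V._∷_ (ℕP.*-identityˡ x) (one σ)
  go (suc a) (s≤s lt) = trans (cong₂ addV (nul σ) (trans (cong (subL σs) (LP.map-cong (λ i → trans (countℕ-∷ (suc i) (suc a) []) (sym (countℕ-∷ i a []))) (upTo (length σs)))) (subL-unit σs a lt))) (addV-zeroˡ _)
    where nul : ∀ {N} (σ : Vec ℕ N) → V.map (0 *_) σ ≡ zeroV N
          nul V.[]      = refl
          nul (x V.∷ σ) = cong (0 V.∷_) (nul σ)

nth-map : ∀ {A B : Set} (g : A → B) d₁ d₂ xs i → i < length xs → nth d₂ (map g xs) i ≡ g (nth d₁ xs i)
nth-map g d₁ d₂ (x ∷ xs) zero    _        = refl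
nth-map g d₁ d₂ (x ∷ xs) (suc i) (s≤s lt) = nth-map g d₁ d₂ xs i lt

map-nth : ∀ {A : Set} d (xs : List A) → map (nth d xs) (upTo (length xs)) ≡ xs
map-nth d []       = refl
map-nth d (x ∷ xs) = cong (x ∷_) (trans (cong (map _) (sym (LP.map-upTo suc (length xs)))) (trans (sym (LP.map-∘ (upTo (length xs)))) (map-nth d xs)))

-- Each letter of the outer word contributes the content of the inner word it points to, and
-- contents add under concatenation.
subL-word : ∀ N (C : List (List ℕ)) w → All (_< length C) w →
  subL (map (λ c → unl N (cont N c)) C) (cont (length C) w) ≡ unl N (cont N (concat (map (nth [] C) w)))
subL-word N C w al = trans (cong (λ z → subL σs (cont z w)) (sym (LP.length-map _ C))) (go w (subst (λ z → All (_< z) w) (sym (LP.length-map _ C)) al))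
  where
  σs = map (λ c → unl N (cont N c)) C
  M = length σs
  cont0 : unl N (cont N []) ≡ zeroV N
  cont0 = trans (cong (unl N) (zs N id)) (uz N)
    where
    zs : ∀ N (k : ℕ → ℕ) → map (λ i → countℕ i []) (applyUpTo k N) ≡ replicate N 0
    zs zero    k = refl
    zs (suc N) k = cong (0 ∷_) (zs N (k ∘ suc))
    uz : ∀ N → unl N (replicate N 0) ≡ zeroV N
    uz zero    = refl
    uz (suc N) = cong (0 V.∷_) (uz N)
  go : ∀ w → All (_< M) w → subL σs (cont M w) ≡ unl N (cont N (concat (map (nth [] C) w)))
  go [] [] = trans (subL-zeros σs (upTo M) _ λ _ → refl) (sym cont0)
  go (a ∷ w) (lt ∷ al) = trans (cong (subL σs) (cont-++ M (a ∷ []) w)) (trans (subL-add σs (cont M (a ∷ [])) (cont M w) (trans (cont-length M (a ∷ [])) (sym (cont-length M w))))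
    (trans (cong₂ addV (trans (subL-unit σs a lt) (nth-map _ [] (zeroV N) C a (subst (a <_) (LP.length-map _ C) lt))) (go w al))
    (trans (sym (unl-add N _ _ (cont-length N (nth [] C a)) (cont-length N (concat (map (nth [] C) w))))) (cong (unl N) (sym (cont-++ N (nth [] C a) _))))))

∑-words-map : ∀ {A B : Set} (g : A → B) xs n (f : List B → ℤ) → ∑ (words xs n) (λ w → f (map g w)) ≡ ∑ (words (map g xs) n) f
∑-words-map g xs zero    f = trans (∑-words-0 xs _) (sym (∑-words-0 (map g xs) f))
∑-words-map g xs (suc n) f = trans (∑-words-suc xs n _) (trans (∑-cong xs λ x → ∑-words-map g xs n (λ w → f (g x ∷ w))) (trans (sym (∑-map g xs _)) (sym (∑-words-suc (map g xs) n f))))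

∑-words-filter : ∀ {A : Set} (q : A → Bool) xs n (f : List A → ℤ) → ∑ (words (filterᵇ q xs) n) f ≡ ∑ (words xs n) (λ w → ι (all q w) *ᶻ f w)
∑-words-filter q xs zero    f = trans (∑-words-0 (filterᵇ q xs) f) (sym (trans (∑-words-0 xs _) (ℤP.*-identityˡ _)))
∑-words-filter q xs (suc n) f = trans (∑-words-suc (filterᵇ q xs) n f) (trans (∑-filter q xs _) (trans (∑-cong xs λ x →
  trans (cong (ι (q x) *ᶻ_) (∑-words-filter q xs n (λ w → f (x ∷ w)))) (trans (sym (∑-* (words xs n) (ι (q x)) _)) (∑-cong (words xs n) λ w → sym (ι-∧* (q x) (all q w) (f (x ∷ w))))))
  (sym (∑-words-suc xs n _))))

onC : (List ℕ → List ℕ → Bool) → List (List ℕ) → Rel₂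
onC r W i j = r (nth [] W i) (nth [] W j)

wordCond : Basis → List ℕ → List ℕ → Bool
wordCond G nu w = Cond G nu (onW _<ᵇ_ w) (onW _≡ᵇ_ w)

module _ (F G : Basis) (mu nu : List ℕ) (ptμ : IsPartition mu) (ptν : IsPartition nu) where
  private
    Fm : VFamily (size mu)
    Fm = let (fm , eq) = basisFamily F mu ptμ in coerceFamily fm (λ N → basisFn F N mu) eq
    Gm : VFamily (size nu)
    Gm = let (gm , eq) = basisFamily G nu ptν in coerceFamily gm (λ N → basisFn G N nu) eq

  pleth : VFamily (size mu * size nu)
  pleth = plethysmFamily Fm Gm

  substitute≡ : ∀ {N} (τs : Monos N) (β : Vec ℕ (length τs)) →
    foldr (V.zipWith _+_) (V.replicate N 0) (V.toList (V.zipWith (λ k τ → V.map (k *_) τ) β (V.fromList τs))) ≡ subL τs (V.toList β)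
  substitute≡ []       V.[]      = refl
  substitute≡ (τ ∷ τs) (b V.∷ β) = cong (addV (V.map (b *_) τ)) (substitute≡ τs β)

  plethysm≡ : ∀ N → plethysm F G mu nu N ≡ VFamily.vmono pleth N
  plethysm≡ N = LP.map-cong (substitute≡ (basisFn G N nu)) (basisFn F (length (basisFn G N nu)) mu)

  -- By symmetry of f the monomials of g may be replaced by the contents of the admissible inner
  -- words in lexicographic order. The outer condition on positions then becomes the lexicographic
  -- one on words, and choosing positions in the filtered list is choosing inner words that all
  -- satisfy the inner condition.
  ∑-plethysm : ∀ N (f : List ℕ → ℤ) → ∑ (VFamily.vmono pleth N) (λ v → f (V.toList v)) ≡
    ∑ (words (words (upTo N) (size nu)) (size mu)) (λ W → ι (all (wordCond G nu) W) *ᶻ (ι (Cond F mu (onC ltLex W) (onC eqL W)) *ᶻ f (cont N (concat W))))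
  ∑-plethysm N f = trans (∑-map _ (basisFn F (length τs) mu) _) (trans (Plethysm.PL-≋ Fm τσ (λ v → f (V.toList v)))
    (trans (basis-words F (length σs) mu (λ α → f (V.toList (subL σs α))) ptμ)
    (trans (∑-≡ (cong (λ z → words (upTo z) (size mu)) (LP.length-map g C)) _)
    (trans (∑-letters-cong M (size mu) λ w al len → cong₂ (λ b z → ι b *ᶻ f z) (cond w al len)
        (trans (cong (λ z → V.toList (subL σs (cont z w))) (LP.length-map g C)) (trans (cong V.toList (subL-word N C w al)) (toList-unl N _ (cont-length N (concat (map (nth [] C) w)))))))
    (trans (∑-words-map (nth [] C) (upTo M) (size mu) (λ W → ι (Cond F mu (onC ltLex W) (onC eqL W)) *ᶻ f (cont N (concat W))))
    (trans (∑-≡ (cong (λ z → words z (size mu)) (map-nth [] C)) _) (∑-words-filter (wordCond G nu) (words (upTo N) (size nu)) (size mu) _)))))))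
    where
    τs : Monos N
    τs = basisFn G N nu
    C : List (List ℕ)
    C = filterᵇ (wordCond G nu) (words (upTo N) (size nu))
    M = length C
    g : List ℕ → Vec ℕ N
    g c = unl N (cont N c)
    σs = map g C
    srt : Srt C
    srt = Srt-filter (wordCond G nu) (words (upTo N) (size nu)) (Srt-words (upTo N) (size nu) (Incr-upTo N))
    τσ : τs ≋ σs
    τσ f = trans (∑-cong τs λ v → cong f (sym (unl-toList v))) (trans (basis-words G N nu (λ w → f (unl N w)) ptν)
      (sym (trans (∑-map g C f) (∑-filter (wordCond G nu) (words (upTo N) (size nu)) _))))
    nth< : ∀ w → All (_< M) w → ∀ i → i < length w → nth 0 w i < M
    nth< (x ∷ w) (l ∷ al) zero    _        = l
    nth< (x ∷ w) (l ∷ al) (suc i) (s≤s lt) = nth< w al i lt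
    cond : ∀ w → All (_< M) w → length w ≡ size mu →
      Cond F mu (onW _<ᵇ_ w) (onW _≡ᵇ_ w) ≡ Cond F mu (onC ltLex (map (nth [] C) w)) (onC eqL (map (nth [] C) w))
    cond w al len = Cond-cong F mu (partition-WD mu ptμ)
      (λ i j li lj → trans (Srt-<ᵇ C srt _ _ (nth< w al i (in′ li)) (nth< w al j (in′ lj))) (sym (cong₂ ltLex (nth-map (nth [] C) 0 [] w i (in′ li)) (nth-map (nth [] C) 0 [] w j (in′ lj)))))
      (λ i j li lj → trans (Srt-≡ᵇ C srt _ _ (nth< w al i (in′ li)) (nth< w al j (in′ lj))) (sym (cong₂ eqL (nth-map (nth [] C) 0 [] w i (in′ li)) (nth-map (nth [] C) 0 [] w j (in′ lj)))))
      where in′ : ∀ {i} → i < size mu → i < length w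
            in′ lt = subst (_ <_) (sym len) lt

-- A calculus of computable predicates

sumTo-≡ : ∀ {i j} → i ≡ j → ∀ f → sumTo i f ≡ sumTo j f
sumTo-≡ refl f = refl

-- Machine expressions see the input length only through an extra variable; Tm has it as a constant.
data Tm : ℕ → Set where
  var : ∀ {k} → Fin k → Tm k
  𝟙 inputLength : ∀ {k} → Tm k
  _⊹_ _⊸_ : ∀ {k} → Tm k → Tm k → Tm k
  sumT : ∀ {k} → Tm k → Tm (suc k) → Tm k
  symT : ∀ {k} → Fin 6 → Tm k → Tm k

Input : Set
Input = List (Fin 5)

evalT : Input → ∀ {k} → Tm k → Vec ℕ k → ℕ
evalT x (var i)    ρ = V.lookup ρ i
evalT x 𝟙        ρ = 1
evalT x inputLength        ρ = length x
evalT x (a ⊹ b)    ρ = evalT x a ρ + evalT x b ρ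
evalT x (a ⊸ b)    ρ = evalT x a ρ ∸ evalT x b ρ
evalT x (sumT a b) ρ = sumTo (evalT x a ρ) (λ i → evalT x b (i V.∷ ρ))
evalT x (symT c a) ρ = symTest c (inputAt x (evalT x a ρ))

-- Binders add variables at the front, so the input length stays the last variable under any number
-- of them.
toExpr : ∀ {k} → Tm k → Expr (suc k)
toExpr (var i)        = Expr.var (F.inject₁ i)
toExpr 𝟙            = Expr.𝟙
toExpr {k} inputLength        = Expr.var (F.fromℕ k)
toExpr (a ⊹ b)        = toExpr a Expr.⊹ toExpr b
toExpr (a ⊸ b)        = toExpr a Expr.⊸ toExpr b
toExpr (sumT a b)     = Expr.sumE (toExpr a) (toExpr b)
toExpr (symT c a)     = Expr.symE c (toExpr a)

eval-toExpr : ∀ x {k} (t : Tm k) (ρ : Vec ℕ k) → eval (inputAt x) (toExpr t) (ρ V.∷ʳ length x) ≡ evalT x t ρ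
eval-toExpr x (var i) ρ = look i ρ
  where look : ∀ {k} (i : Fin k) (ρ : Vec ℕ k) {n} → V.lookup (ρ V.∷ʳ n) (F.inject₁ i) ≡ V.lookup ρ i
        look F.zero    (_ V.∷ _) = refl
        look (F.suc i) (_ V.∷ ρ) = look i ρ
eval-toExpr x 𝟙        ρ = refl
eval-toExpr x inputLength        ρ = last ρ
  where last : ∀ {k} (ρ : Vec ℕ k) {n} → V.lookup (ρ V.∷ʳ n) (F.fromℕ k) ≡ n
        last V.[]      = refl
        last (_ V.∷ ρ) = last ρ
eval-toExpr x (a ⊹ b)    ρ = cong₂ _+_ (eval-toExpr x a ρ) (eval-toExpr x b ρ)
eval-toExpr x (a ⊸ b)    ρ = cong₂ _∸_ (eval-toExpr x a ρ) (eval-toExpr x b ρ)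
eval-toExpr x (sumT a b) ρ = trans (sumTo-≡ (eval-toExpr x a ρ) _) (sumTo-cong (evalT x a ρ) λ i _ → eval-toExpr x b (i V.∷ ρ))
eval-toExpr x (symT c a) ρ = cong (λ z → symTest c (inputAt x z)) (eval-toExpr x a ρ)

liftF : ∀ {j k} → (Fin j → Fin k) → Fin (suc j) → Fin (suc k)
liftF r F.zero    = F.zero
liftF r (F.suc i) = F.suc (r i)

ren : ∀ {j k} → (Fin j → Fin k) → Tm j → Tm k
ren r (var i)    = var (r i)
ren r 𝟙        = 𝟙
ren r inputLength        = inputLength
ren r (a ⊹ b)    = ren r a ⊹ ren r b
ren r (a ⊸ b)    = ren r a ⊸ ren r b
ren r (sumT a b) = sumT (ren r a) (ren (liftF r) b)
ren r (symT c a) = symT c (ren r a)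

eval-ren : ∀ x {j k} (r : Fin j → Fin k) (t : Tm j) (ρ : Vec ℕ k) (ρ′ : Vec ℕ j) → (∀ i → V.lookup ρ (r i) ≡ V.lookup ρ′ i) →
           evalT x (ren r t) ρ ≡ evalT x t ρ′
eval-ren x r (var i)    ρ ρ′ eq = eq i
eval-ren x r 𝟙        ρ ρ′ eq = refl
eval-ren x r inputLength        ρ ρ′ eq = refl
eval-ren x r (a ⊹ b)    ρ ρ′ eq = cong₂ _+_ (eval-ren x r a ρ ρ′ eq) (eval-ren x r b ρ ρ′ eq)
eval-ren x r (a ⊸ b)    ρ ρ′ eq = cong₂ _∸_ (eval-ren x r a ρ ρ′ eq) (eval-ren x r b ρ ρ′ eq)
eval-ren x r (sumT a b) ρ ρ′ eq = trans (sumTo-≡ (eval-ren x r a ρ ρ′ eq) _)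
  (sumTo-cong (evalT x a ρ′) λ i _ → eval-ren x (liftF r) b (i V.∷ ρ) (i V.∷ ρ′) λ { F.zero → refl ; (F.suc l) → eq l })
eval-ren x r (symT c a) ρ ρ′ eq = cong (λ z → symTest c (inputAt x z)) (eval-ren x r a ρ ρ′ eq)

wk : ∀ {k} → Tm k → Tm (suc k)
wk = ren F.suc

-- Substitution lets a computable function be called with computed arguments; this is what the
-- combinators `app₀` to `app₃` use.
sub : ∀ {j k} → Vec (Tm k) j → Tm j → Tm k
sub σ (var i)    = V.lookup σ i
sub σ 𝟙        = 𝟙
sub σ inputLength        = inputLength
sub σ (a ⊹ b)    = sub σ a ⊹ sub σ b
sub σ (a ⊸ b)    = sub σ a ⊸ sub σ b
sub σ (sumT a b) = sumT (sub σ a) (sub (var F.zero V.∷ V.map wk σ) b)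
sub σ (symT c a) = symT c (sub σ a)

eval-sub : ∀ x {j k} (σ : Vec (Tm k) j) (t : Tm j) ρ → evalT x (sub σ t) ρ ≡ evalT x t (V.map (λ u → evalT x u ρ) σ)
eval-sub x σ (var i)    ρ = sym (VP.lookup-map i (λ u → evalT x u ρ) σ)
eval-sub x σ 𝟙        ρ = refl
eval-sub x σ inputLength        ρ = refl
eval-sub x σ (a ⊹ b)    ρ = cong₂ _+_ (eval-sub x σ a ρ) (eval-sub x σ b ρ)
eval-sub x σ (a ⊸ b)    ρ = cong₂ _∸_ (eval-sub x σ a ρ) (eval-sub x σ b ρ)
eval-sub x σ (sumT a b) ρ = trans (sumTo-≡ (eval-sub x σ a ρ) _) (sumTo-cong (evalT x a (V.map (λ u → evalT x u ρ) σ)) λ i _ →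
  trans (eval-sub x (var F.zero V.∷ V.map wk σ) b (i V.∷ ρ)) (cong (λ z → evalT x b (i V.∷ z))
    (trans (sym (VP.map-∘ (λ u → evalT x u (i V.∷ ρ)) wk σ)) (VP.map-cong (λ u → eval-ren x F.suc u (i V.∷ ρ) ρ λ _ → refl) σ))))
eval-sub x σ (symT c a) ρ = cong (λ z → symTest c (inputAt x z)) (eval-sub x σ a ρ)

record Comp {k : ℕ} (f : Input → Vec ℕ k → ℕ) : Set where
  constructor comp
  field
    tm : Tm k
    ok : ∀ x ρ → evalT x tm ρ ≡ f x ρ
open Comp

module _ {k : ℕ} where
  cvar : (i : Fin k) → Comp (λ x ρ → V.lookup ρ i)
  cvar i = comp (var i) λ x ρ → refl

  cone : Comp {k} (λ x ρ → 1)
  cone = comp 𝟙 λ x ρ → refl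

  clen : Comp {k} (λ x ρ → length x)
  clen = comp inputLength λ x ρ → refl

  infixl 6 _c+_ _c∸_
  infixl 7 _c*_
  infixr 5 _c∧_
  _c+_ : ∀ {f g : Input → Vec ℕ k → ℕ} → Comp f → Comp g → Comp (λ x ρ → f x ρ + g x ρ)
  a c+ b = comp (tm a ⊹ tm b) λ x ρ → cong₂ _+_ (ok a x ρ) (ok b x ρ)

  _c∸_ : ∀ {f g : Input → Vec ℕ k → ℕ} → Comp f → Comp g → Comp (λ x ρ → f x ρ ∸ g x ρ)
  a c∸ b = comp (tm a ⊸ tm b) λ x ρ → cong₂ _∸_ (ok a x ρ) (ok b x ρ)

  csum : ∀ {f : Input → Vec ℕ k → ℕ} {g : Input → Vec ℕ (suc k) → ℕ} → Comp f → Comp g → Comp (λ x ρ → sumTo (f x ρ) (λ i → g x (i V.∷ ρ)))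
  csum {f} a b = comp (sumT (tm a) (tm b)) λ x ρ → trans (sumTo-≡ (ok a x ρ) _) (sumTo-cong (f x ρ) λ i _ → ok b x (i V.∷ ρ))

  c0 : Comp {k} (λ x ρ → 0)
  c0 = comp (𝟙 ⊸ 𝟙) λ x ρ → refl

  csuc : ∀ {f : Input → Vec ℕ k → ℕ} → Comp f → Comp (λ x ρ → suc (f x ρ))
  csuc a = comp (𝟙 ⊹ tm a) λ x ρ → cong suc (ok a x ρ)

  _c*_ : ∀ {f g : Input → Vec ℕ k → ℕ} → Comp f → Comp g → Comp (λ x ρ → f x ρ * g x ρ)
  _c*_ {f} {g} a b = comp (sumT (tm a) (wk (tm b))) λ x ρ → trans (sumTo-≡ (ok a x ρ) _)
    (trans (sumTo-cong (f x ρ) λ i _ → trans (eval-ren x F.suc (tm b) (i V.∷ ρ) ρ λ _ → refl) (ok b x ρ)) (const-sum (f x ρ) (g x ρ)))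
    where const-sum : ∀ n c → sumTo n (λ _ → c) ≡ n * c
          const-sum zero    c = refl
          const-sum (suc n) c = cong (c +_) (const-sum n c)

  cB : ∀ {f g : Input → Vec ℕ k → ℕ} → Comp f → (∀ x ρ → f x ρ ≡ g x ρ) → Comp g
  cB a eq = comp (tm a) λ x ρ → trans (ok a x ρ) (eq x ρ)

  csym : ∀ (c : Fin 6) {f : Input → Vec ℕ k → ℕ} → Comp f → Comp (λ x ρ → b2n (toℕ c ≡ᵇ toℕ (inputAt x (f x ρ))))
  csym c a = comp (symT c (tm a)) λ x ρ → trans (cong (λ z → symTest c (inputAt x z)) (ok a x ρ)) (lem (toℕ c ≡ᵇ toℕ (inputAt x _)))
    where lem : ∀ b → (if b then 1 else 0) ≡ b2n b
          lem true  = refl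
          lem false = refl

  CompB : (Input → Vec ℕ k → Bool) → Set
  CompB p = Comp (λ x ρ → b2n (p x ρ))

  ceq : ∀ {f g : Input → Vec ℕ k → ℕ} → Comp f → Comp g → CompB (λ x ρ → f x ρ ≡ᵇ g x ρ)
  ceq {f} {g} a b = cB (cone c∸ ((a c∸ b) c+ (b c∸ a))) λ x ρ → lem (f x ρ) (g x ρ)
    where lem : ∀ a b → 1 ∸ ((a ∸ b) + (b ∸ a)) ≡ b2n (a ≡ᵇ b)
          lem zero    zero    = refl
          lem zero    (suc b) = ℕP.0∸n≡0 b
          lem (suc a) zero    = ℕP.0∸n≡0 (a + 0)
          lem (suc a) (suc b) = lem a b

  clt : ∀ {f g : Input → Vec ℕ k → ℕ} → Comp f → Comp g → CompB (λ x ρ → f x ρ <ᵇ g x ρ)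
  clt {f} {g} a b = cB (cone c∸ (cone c∸ (b c∸ a))) λ x ρ → lem (f x ρ) (g x ρ)
    where lem : ∀ a b → 1 ∸ (1 ∸ (b ∸ a)) ≡ b2n (a <ᵇ b)
          lem zero    zero    = refl
          lem zero    (suc b) = cong (1 ∸_) (ℕP.0∸n≡0 b)
          lem (suc a) zero    = refl
          lem (suc a) (suc b) = lem a b

  cnot : ∀ {p : Input → Vec ℕ k → Bool} → CompB p → CompB (λ x ρ → not (p x ρ))
  cnot {p} a = cB (cone c∸ a) λ x ρ → lem (p x ρ)
    where lem : ∀ b → 1 ∸ b2n b ≡ b2n (not b)
          lem true  = refl
          lem false = refl

  _c∧_ : ∀ {p q : Input → Vec ℕ k → Bool} → CompB p → CompB q → CompB (λ x ρ → p x ρ ∧ q x ρ)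
  _c∧_ {p} {q} a b = cB (a c* b) λ x ρ → lem (p x ρ) (q x ρ)
    where lem : ∀ a b → b2n a * b2n b ≡ b2n (a ∧ b)
          lem true  true  = refl
          lem true  false = refl
          lem false b     = refl

  _c∨_ : ∀ {p q : Input → Vec ℕ k → Bool} → CompB p → CompB q → CompB (λ x ρ → p x ρ ∨ q x ρ)
  _c∨_ {p} {q} a b = cB (cnot (cnot a c∧ cnot b)) λ x ρ → cong b2n (lem (p x ρ) (q x ρ))
    where lem : ∀ a b → not (not a ∧ not b) ≡ (a ∨ b)
          lem true  b     = refl
          lem false true  = refl
          lem false false = refl

-- A bounded universal quantifier is 1 minus the number of failures, truncated.
call : ∀ {k} {f : Input → Vec ℕ k → ℕ} {p : Input → Vec ℕ (suc k) → Bool} → Comp f → Comp (λ x ρ → b2n (p x ρ)) → CompB (λ x ρ → allN (f x ρ) (λ i → p x (i V.∷ ρ)))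
call {f = f} {p} a b = cB (cone c∸ csum a (cone c∸ b)) λ x ρ → lem (f x ρ) (λ i → p x (i V.∷ ρ))
  where
  pos∸ : ∀ n (f : ℕ → ℕ) → 1 ∸ (1 + sumTo n f) ≡ 0
  pos∸ n f = ℕP.0∸n≡0 (sumTo n f)
  lem : ∀ n (q : ℕ → Bool) → 1 ∸ sumTo n (λ i → 1 ∸ b2n (q i)) ≡ b2n (allN n q)
  lem zero    q = refl
  lem (suc n) q with q 0
  ... | true  = lem n (q ∘ suc)
  ... | false = pos∸ n _

app₁ : ∀ {k} {F : Input → ℕ → ℕ} {f : Input → Vec ℕ k → ℕ} → Comp {1} (λ x ρ → F x (V.lookup ρ F.zero)) → Comp f → Comp (λ x ρ → F x (f x ρ))
app₁ {F = F} c a = comp (sub (tm a V.∷ V.[]) (tm c)) λ x ρ → trans (eval-sub x (tm a V.∷ V.[]) (tm c) ρ) (trans (ok c x _) (cong (F x) (ok a x ρ)))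

app₂ : ∀ {k} {F : Input → ℕ → ℕ → ℕ} {f g : Input → Vec ℕ k → ℕ} → Comp {2} (λ x ρ → F x (V.lookup ρ F.zero) (V.lookup ρ (F.suc F.zero))) →
       Comp f → Comp g → Comp (λ x ρ → F x (f x ρ) (g x ρ))
app₂ {F = F} c a b = comp (sub (tm a V.∷ tm b V.∷ V.[]) (tm c)) λ x ρ → trans (eval-sub x (tm a V.∷ tm b V.∷ V.[]) (tm c) ρ)
  (trans (ok c x _) (cong₂ (F x) (ok a x ρ) (ok b x ρ)))

app₃ : ∀ {k} {F : Input → ℕ → ℕ → ℕ → ℕ} {f g h : Input → Vec ℕ k → ℕ} →
       Comp {3} (λ x ρ → F x (V.lookup ρ F.zero) (V.lookup ρ (F.suc F.zero)) (V.lookup ρ (F.suc (F.suc F.zero)))) →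
       Comp f → Comp g → Comp h → Comp (λ x ρ → F x (f x ρ) (g x ρ) (h x ρ))
app₃ {F = F} c a b d = comp (sub σ (tm c)) λ x ρ → trans (eval-sub x σ (tm c) ρ)
  (trans (ok c x _) (trans (cong₂ (λ y z → F x y z _) (ok a x ρ) (ok b x ρ)) (cong (F x _ _) (ok d x ρ))))
  where σ = tm a V.∷ tm b V.∷ tm d V.∷ V.[]

app₀ : ∀ {k} {f : Input → ℕ} → Comp {0} (λ x ρ → f x) → Comp {k} (λ x ρ → f x)
app₀ c = comp (sub V.[] (tm c)) λ x ρ → trans (eval-sub x V.[] (tm c) ρ) (ok c x V.[])

-- The bound holds for every larger exponent as well, so that two machines can share one.
DecidedInPolytime : (Input → Bool) → Set
DecidedInPolytime q = Σ TM λ M → Σ ℕ λ c₀ → ∀ c → c₀ ≤ c → PolyTimeDecider M c × (∀ x → acceptsᵇ M c x ≡ q x)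

computable-polytime : (q : Input → Bool) → Comp {0} (λ x ρ → b2n (q x)) → DecidedInPolytime q
computable-polytime q cq = machine , deg bound , λ c le → machine-polytime c le , λ x →
  trans (machine-accepts c le x) (trans (cong isPos (trans (eval-toExpr x (tm cq) V.[]) (ok cq x V.[]))) (b2n-pos (q x)))
  where
  open Decider (toExpr (tm cq))
  b2n-pos : ∀ b → isPos (b2n b) ≡ b
  b2n-pos true  = refl
  b2n-pos false = refl

-- The verifier

-- The input is λ;μ;ν; followed by a separator and the witness bits.  Section 0, 1, 2 is λ, μ, ν.
isS : Fin 6 → Input → ℕ → Bool
isS c x q = toℕ c ≡ᵇ toℕ (inputAt x q)

-- On the tape every input symbol is shifted by one: codes 1, 2, 3, 4 are the unary mark, the comma,
-- the semicolon and the separator. Code 2 also serves as the bit 1, but bits are read only behind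
-- the separator.
semis : Input → ℕ → ℕ
semis x q = sumTo q (λ l → b2n (isS (# 3) x l))

commas : Input → ℕ → ℕ → ℕ
commas x sec q = sumTo q (λ l → b2n (isS (# 2) x l ∧ (semis x l ≡ᵇ sec)))

part : Input → ℕ → ℕ → ℕ
part x sec r = sumTo (length x) (λ l → b2n (isS (# 1) x l ∧ ((semis x l ≡ᵇ sec) ∧ (commas x sec l ≡ᵇ r))))

rows : Input → ℕ → ℕ
rows x sec = commas x sec (length x)

-- A position counts while no separator has occurred up to and including it, so the count is the
-- position of the first separator.
sep : Input → ℕ
sep x = sumTo (length x) (λ l → b2n (allN (suc l) (λ q → not (isS (# 4) x q))))

bitAt : Input → ℕ → Bool
bitAt x q = isS (# 2) x (suc (sep x) + q)

psize : Input → ℕ → ℕ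
psize x sec = sumTo (rows x sec) (part x sec)

NN dd DD mm : Input → ℕ
NN x = rows x 0
dd x = psize x 1
DD x = psize x 2
mm x = dd x * DD x

-- Witness: |μ||ν| blocks of ℓ(λ) bits, each the unit vector of a letter, then one bit for each pair i < j < ℓ(λ).
block : Input → ℕ → ℕ → Bool
block x k i = bitAt x (k * NN x + i)

letter : Input → ℕ → ℕ
letter x k = sumTo (NN x) (λ i → i * b2n (block x k i))

oneHots : Input → Bool
oneHots x = allN (mm x) (λ k → sumTo (NN x) (λ i → b2n (block x k i)) ≡ᵇ 1)

-- The pairs i < j are stored row after row, row l having n - 1 - l of them. This is the offset of
-- row i, and for i = n the number of all pairs.
offT : ℕ → ℕ → ℕ
offT n i = sumTo i (λ l → n ∸ suc l)

tbit : Input → ℕ → ℕ → Bool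
tbit x i j = bitAt x (mm x * NN x + (offT (NN x) i + (j ∸ suc i)))

-- The recursive conditions unrolled into bounded quantifiers: partial sums of the row lengths serve
-- as offsets into the filling.
rowsF colsF : Rel₂ → ℕ → (ℕ → ℕ) → Bool
rowsF R ℓ row = allN ℓ (λ r → allN (row r ∸ 1) (λ c → R (sumTo r row + c) (sumTo r row + suc c)))
colsF R ℓ row = allN ℓ (λ r → allN (row (suc r)) (λ c → R (sumTo r row + c) (sumTo r row + (row r + c))))

rowF : Rel₂ → ℕ → Bool
rowF R d = allN (d ∸ 1) (λ c → R c (suc c))

multF : Rel₂ → ℕ → ℕ → (ℕ → ℕ) → Bool
multF Eq d ℓ row = allN d (λ v → sumTo d (λ i → b2n (sumTo d (λ j → b2n (Eq i j)) ≡ᵇ suc v)) ≡ᵇ suc v * sumTo ℓ (λ r → b2n (suc v ≡ᵇ row r)))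

CondF : Basis → ℕ → (ℕ → ℕ) → Rel₂ → Rel₂ → Bool
CondF Basis.s ℓ row Lt Eq = rowsF (orR Lt Eq) ℓ row ∧ colsF Lt ℓ row
CondF Basis.m ℓ row Lt Eq = rowF (orR Lt Eq) (sumTo ℓ row) ∧ multF Eq (sumTo ℓ row) ℓ row
CondF Basis.p ℓ row Lt Eq = rowsF Eq ℓ row
CondF Basis.e ℓ row Lt Eq = rowsF Lt ℓ row
CondF Basis.h ℓ row Lt Eq = rowsF (orR Lt Eq) ℓ row

lett : Input → ℕ → ℕ → ℕ
lett x k a = letter x (k * DD x + a)

-- Inner relations compare two letters within the k-th inner word, outer ones two whole inner words.
-- The lexicographic order asks for a position that decides; the existential quantifier is written
-- as a negated universal one.
inLt inEq lexLt lexEq : Input → ℕ → Rel₂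
inLt x k a b = lett x k a <ᵇ lett x k b
inEq x k a b = lett x k a ≡ᵇ lett x k b
lexLt x _ k k′ = not (allN (DD x) (λ q → not ((lett x k q <ᵇ lett x k′ q) ∧ allN q (λ l → lett x k l ≡ᵇ lett x k′ l))))
lexEq x _ k k′ = allN (DD x) (λ q → lett x k q ≡ᵇ lett x k′ q)

inner outer : Basis → Input → Bool
inner G x = allN (dd x) (λ k → CondF G (rows x 2) (part x 2) (inLt x k) (inEq x k))
outer F x = CondF F (rows x 1) (part x 1) (lexLt x 0) (lexEq x 0)

-- The exponent equation of the term of Φ selected by the pair bits, arranged without subtraction.
balance : Input → Bool
balance x = allN (NN x) (λ i → sumTo (mm x) (λ k → b2n (block x k i)) + sumTo i (λ j → b2n (tbit x j i))
                               ≡ᵇ part x 0 i + sumTo (NN x ∸ suc i) (λ j → b2n (tbit x i (suc i + j))))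

flips : Input → ℕ
flips x = sumTo (offT (NN x) (NN x)) (λ q → b2n (bitAt x (mm x * NN x + q)))

-- Some k ≤ c satisfies k + k = c, again as a negated bounded universal quantifier.
evenᵇ : ℕ → Bool
evenᵇ c = not (allN (suc c) (λ k → not (k + k ≡ᵇ c)))

-- The definition of #P ranges over witnesses of all lengths up to the bound; fixing the length
-- gives every term of the expansion a single witness.
lenOK : Input → Bool
lenOK x = length x ≡ᵇ suc (sep x) + (mm x * NN x + offT (NN x) (NN x))

accept : Basis → Basis → Input → Bool
accept F G x = lenOK x ∧ (oneHots x ∧ (inner G x ∧ (outer F x ∧ balance x)))

accept₊ accept₋ : Basis → Basis → Input → Bool
accept₊ F G x = accept F G x ∧ evenᵇ (flips x)
accept₋ F G x = accept F G x ∧ not (evenᵇ (flips x))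

-- Computability of the verifier

private
  v0 : ∀ {k} → Comp {suc k} (λ x ρ → V.lookup ρ F.zero)
  v0 = cvar F.zero
  v1 : ∀ {k} → Comp {suc (suc k)} (λ x ρ → V.lookup ρ (F.suc F.zero))
  v1 = cvar (F.suc F.zero)
  v2 : ∀ {k} → Comp {suc (suc (suc k))} (λ x ρ → V.lookup ρ (F.suc (F.suc F.zero)))
  v2 = cvar (F.suc (F.suc F.zero))
  v3 : ∀ {k} → Comp {suc (suc (suc (suc k)))} (λ x ρ → V.lookup ρ (F.suc (F.suc (F.suc F.zero))))
  v3 = cvar (F.suc (F.suc (F.suc F.zero)))

Comp₁ : (Input → ℕ → ℕ) → Set
Comp₁ f = Comp {1} (λ x ρ → f x (V.lookup ρ F.zero))

Comp₂ : (Input → ℕ → ℕ → ℕ) → Set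
Comp₂ f = Comp {2} (λ x ρ → f x (V.lookup ρ F.zero) (V.lookup ρ (F.suc F.zero)))

Comp₃ : (Input → ℕ → ℕ → ℕ → ℕ) → Set
Comp₃ f = Comp {3} (λ x ρ → f x (V.lookup ρ F.zero) (V.lookup ρ (F.suc F.zero)) (V.lookup ρ (F.suc (F.suc F.zero))))

csemis : Comp₁ semis
csemis = csum v0 (csym (# 3) v0)

ccommas : Comp₂ commas
ccommas = csum v1 (csym (# 2) v0 c∧ ceq (app₁ {F = semis} csemis v0) v1)

cpart : Comp₂ part
cpart = csum clen (csym (# 1) v0 c∧ (ceq (app₁ {F = semis} csemis v0) v1 c∧ ceq (app₂ {F = commas} ccommas v1 v0) v2))

crows : Comp₁ rows
crows = app₂ {F = commas} ccommas v0 clen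

csep : ∀ {k} → Comp {k} (λ x ρ → sep x)
csep = app₀ (csum clen (call (csuc v0) (cnot (csym (# 4) v0))))

cbit : Comp₁ (λ x q → b2n (bitAt x q))
cbit = csym (# 2) (csuc csep c+ v0)

cpsize : Comp₁ psize
cpsize = csum (app₁ {F = rows} crows v0) (app₂ {F = part} cpart v1 v0)

c1 c2 : ∀ {k} → Comp {k} _
c1 = csuc c0
c2 = csuc c1

cNN : ∀ {k} → Comp {k} (λ x ρ → NN x)
cNN = app₁ {F = rows} crows c0

cdd : ∀ {k} → Comp {k} (λ x ρ → dd x)
cdd = app₁ {F = psize} cpsize c1

cDD : ∀ {k} → Comp {k} (λ x ρ → DD x)
cDD = app₁ {F = psize} cpsize c2

cmm : ∀ {k} → Comp {k} (λ x ρ → mm x)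
cmm = cdd c* cDD

cblock : Comp₂ (λ x k i → b2n (block x k i))
cblock = app₁ {F = λ x q → b2n (bitAt x q)} cbit (v0 c* cNN c+ v1)

cletter : Comp₁ letter
cletter = csum cNN (v0 c* app₂ {F = λ x k i → b2n (block x k i)} cblock v1 v0)

coneHots : Comp {0} (λ x ρ → b2n (oneHots x))
coneHots = call cmm (ceq (csum cNN (app₂ {F = λ x k i → b2n (block x k i)} cblock v1 v0)) cone)

coffT : Comp₂ (λ x n i → offT n i)
coffT = csum v1 (v1 c∸ csuc v0)

ctbit : Comp₂ (λ x i j → b2n (tbit x i j))
ctbit = app₁ {F = λ x q → b2n (bitAt x q)} cbit (cmm c* cNN c+ (app₂ {F = λ x n i → offT n i} coffT cNN v0 c+ (v1 c∸ csuc v0)))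

clett : Comp₂ lett
clett = app₁ {F = letter} cletter (v0 c* cDD c+ v1)

CompR : (Input → ℕ → Rel₂) → Set
CompR R = Comp₃ (λ x k i j → b2n (R x k i j))

cinLt : CompR inLt
cinLt = clt (app₂ {F = lett} clett v0 v1) (app₂ {F = lett} clett v0 v2)

cinEq : CompR inEq
cinEq = ceq (app₂ {F = lett} clett v0 v1) (app₂ {F = lett} clett v0 v2)

clexLt : CompR lexLt
clexLt = cnot (call cDD (cnot (clt (app₂ {F = lett} clett v2 v0) (app₂ {F = lett} clett v3 v0) c∧
  call v0 (ceq (app₂ {F = lett} clett v3 v0) (app₂ {F = lett} clett (cvar (F.suc (F.suc (F.suc (F.suc F.zero))))) v0)))))

clexEq : CompR lexEq
clexEq = call cDD (ceq (app₂ {F = lett} clett v2 v0) (app₂ {F = lett} clett v3 v0))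

corR : ∀ {P Q} → CompR P → CompR Q → CompR (λ x k → orR (P x k) (Q x k))
corR a b = a c∨ b

module _ (sec : ℕ) (csec : ∀ {k} → Comp {k} (λ x ρ → sec)) where
  private
    crow : ∀ {k} {f : Input → Vec ℕ k → ℕ} → Comp f → Comp (λ x ρ → part x sec (f x ρ))
    crow a = app₂ {F = part} cpart csec a
    cnum : ∀ {k} → Comp {k} (λ x ρ → rows x sec)
    cnum = app₁ {F = rows} crows csec
    ctot : ∀ {k} → Comp {k} (λ x ρ → sumTo (rows x sec) (part x sec))
    ctot = app₁ {F = psize} cpsize csec
    coff : ∀ {k} {f : Input → Vec ℕ k → ℕ} → Comp f → Comp (λ x ρ → sumTo (f x ρ) (part x sec))
    coff a = csum a (crow v0)

  crowsF : ∀ {R} → CompR R → Comp₁ (λ x k → b2n (rowsF (R x k) (rows x sec) (part x sec)))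
  crowsF {R} cR = call cnum (call (crow v0 c∸ cone) (app₃ {F = λ x k i j → b2n (R x k i j)} cR v2 (coff v1 c+ v0) (coff v1 c+ csuc v0)))

  ccolsF : ∀ {R} → CompR R → Comp₁ (λ x k → b2n (colsF (R x k) (rows x sec) (part x sec)))
  ccolsF {R} cR = call cnum (call (crow (csuc v0)) (app₃ {F = λ x k i j → b2n (R x k i j)} cR v2 (coff v1 c+ v0) (coff v1 c+ (crow v1 c+ v0))))

  cCondF : ∀ B {Lt Eq} → CompR Lt → CompR Eq → Comp₁ (λ x k → b2n (CondF B (rows x sec) (part x sec) (Lt x k) (Eq x k)))
  cCondF Basis.s {Lt} {Eq} cl ce = crowsF {λ x k → orR (Lt x k) (Eq x k)} (corR {Lt} {Eq} cl ce) c∧ ccolsF {Lt} cl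
  cCondF Basis.m {Lt} {Eq} cl ce =
    call (ctot c∸ cone) (app₃ {F = λ x k i j → b2n (orR (Lt x k) (Eq x k) i j)} (corR {Lt} {Eq} cl ce) v1 v0 (csuc v0)) c∧
    call ctot (ceq (csum ctot (ceq (csum ctot (app₃ {F = λ x k i j → b2n (Eq x k i j)} ce v3 v1 v0)) (csuc v1)))
                   (csuc v0 c* csum cnum (ceq (csuc v1) (crow v0))))
  cCondF Basis.p {Lt} {Eq} cl ce = crowsF {Eq} ce
  cCondF Basis.e {Lt} {Eq} cl ce = crowsF {Lt} cl
  cCondF Basis.h {Lt} {Eq} cl ce = crowsF {λ x k → orR (Lt x k) (Eq x k)} (corR {Lt} {Eq} cl ce)

cinner : ∀ G → Comp {0} (λ x ρ → b2n (inner G x))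
cinner G = call cdd (app₁ {F = λ x k → b2n (CondF G (rows x 2) (part x 2) (inLt x k) (inEq x k))} (cCondF 2 c2 G {inLt} {inEq} cinLt cinEq) v0)

couter : ∀ F → Comp {0} (λ x ρ → b2n (outer F x))
couter F = app₁ {F = λ x k → b2n (CondF F (rows x 1) (part x 1) (lexLt x k) (lexEq x k))} (cCondF 1 c1 F {lexLt} {lexEq} clexLt clexEq) c0

cbalance : Comp {0} (λ x ρ → b2n (balance x))
cbalance = call cNN (ceq
  (csum cmm (app₂ {F = λ x k i → b2n (block x k i)} cblock v0 v1) c+ csum v0 (app₂ {F = λ x i j → b2n (tbit x i j)} ctbit v0 v1))
  (app₂ {F = part} cpart c0 v0 c+ csum (cNN c∸ csuc v0) (app₂ {F = λ x i j → b2n (tbit x i j)} ctbit v1 (csuc v1 c+ v0))))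

cflips : Comp {0} (λ x ρ → flips x)
cflips = csum (app₂ {F = λ x n i → offT n i} coffT cNN cNN) (app₁ {F = λ x q → b2n (bitAt x q)} cbit (cmm c* cNN c+ v0))

ceven : Comp₁ (λ x c → b2n (evenᵇ c))
ceven = cnot (call (csuc v0) (cnot (ceq (v0 c+ v0) v1)))

clenOK : Comp {0} (λ x ρ → b2n (lenOK x))
clenOK = ceq clen (csuc csep c+ (cmm c* cNN c+ app₂ {F = λ x n i → offT n i} coffT cNN cNN))

caccept : ∀ F G → Comp {0} (λ x ρ → b2n (accept F G x))
caccept F G = clenOK c∧ (coneHots c∧ (cinner G c∧ (couter F c∧ cbalance)))

caccept₊ : ∀ F G → Comp {0} (λ x ρ → b2n (accept₊ F G x))
caccept₊ F G = caccept F G c∧ app₁ {F = λ x c → b2n (evenᵇ c)} ceven cflips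

caccept₋ : ∀ F G → Comp {0} (λ x ρ → b2n (accept₋ F G x))
caccept₋ F G = caccept F G c∧ cnot (app₁ {F = λ x c → b2n (evenᵇ c)} ceven cflips)

-- Parsing the encoded triple

encS : List ℕ → List (Fin 5) → List (Fin 5)
encS []       y = # 2 ∷ y
encS (k ∷ la) y = replicate k (# 0) ++ (# 1 ∷ encS la y)

encPartition≡ : ∀ la y → map (_↑ˡ 2) (encPartition la) ++ y ≡ encS la y
encPartition≡ []       y = refl
encPartition≡ (k ∷ la) y = begin
  map (_↑ˡ 2) (((replicate k (# 0) ++ # 1 ∷ []) ++ rest) ++ # 2 ∷ []) ++ y
    ≡⟨ cong (λ z → map (_↑ˡ 2) z ++ y) (trans (LP.++-assoc (replicate k (# 0) ++ # 1 ∷ []) rest (# 2 ∷ [])) (LP.++-assoc (replicate k (# 0)) (# 1 ∷ []) _)) ⟩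
  map (_↑ˡ 2) (replicate k (# 0) ++ (# 1 ∷ encPartition la)) ++ y
    ≡⟨ cong (_++ y) (LP.map-++ (_↑ˡ 2) (replicate k (# 0)) _) ⟩
  (map (_↑ˡ 2) (replicate k (# 0)) ++ map (_↑ˡ 2) (# 1 ∷ encPartition la)) ++ y
    ≡⟨ trans (LP.++-assoc (map (_↑ˡ 2) (replicate k (# 0))) _ y) (cong₂ (λ a b → a ++ # 1 ∷ b) (LP.map-replicate (_↑ˡ 2) k (# 0)) (encPartition≡ la y)) ⟩
  replicate k (# 0) ++ (# 1 ∷ encS la y) ∎
  where
  open ≡-Reasoning
  rest : Word
  rest = concatMap (λ k → replicate k (# 0) ++ (# 1) ∷ []) la

bitSym : Bool → Fin 5
bitSym b = if b then # 1 else # 0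

pairEnc≡ : ∀ la mu nu u → pairEnc (encTriple la mu nu) u ≡ encS la (encS mu (encS nu (# 3 ∷ map bitSym u)))
pairEnc≡ la mu nu u = begin
  map (_↑ˡ 2) (encPartition la ++ encPartition mu ++ encPartition nu) ++ z
    ≡⟨ cong (_++ z) (trans (LP.map-++ (_↑ˡ 2) (encPartition la) _) (cong (map (_↑ˡ 2) (encPartition la) ++_) (LP.map-++ (_↑ˡ 2) (encPartition mu) _))) ⟩
  (map (_↑ˡ 2) (encPartition la) ++ (map (_↑ˡ 2) (encPartition mu) ++ map (_↑ˡ 2) (encPartition nu))) ++ z
    ≡⟨ trans (LP.++-assoc (map (_↑ˡ 2) (encPartition la)) _ z) (cong (map (_↑ˡ 2) (encPartition la) ++_) (LP.++-assoc (map (_↑ˡ 2) (encPartition mu)) _ z)) ⟩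
  map (_↑ˡ 2) (encPartition la) ++ (map (_↑ˡ 2) (encPartition mu) ++ (map (_↑ˡ 2) (encPartition nu) ++ z))
    ≡⟨ trans (encPartition≡ la _) (cong (encS la) (trans (encPartition≡ mu _) (cong (encS mu) (encPartition≡ nu z)))) ⟩
  encS la (encS mu (encS nu z)) ∎
  where
  open ≡-Reasoning
  z : List (Fin 5)
  z = # 3 ∷ map bitSym u

ch : Fin 6 → Fin 5 → Bool
ch c a = toℕ c ≡ᵇ suc (toℕ a)

-- The parsing functions started with s semicolons and c commas already seen.
commasA : ℕ → Input → ℕ → ℕ → ℕ
commasA s₀ y sec q = sumTo q (λ l → b2n (isS (# 2) y l ∧ (s₀ + semis y l ≡ᵇ sec)))

partA : ℕ → ℕ → Input → ℕ → ℕ → ℕ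
partA s₀ c y sec r = sumTo (length y) (λ l → b2n (isS (# 1) y l ∧ ((s₀ + semis y l ≡ᵇ sec) ∧ (c + commasA s₀ y sec l ≡ᵇ r))))

commasA-∷ : ∀ s₀ a y sec q → commasA s₀ (a ∷ y) sec (suc q) ≡ b2n (ch (# 2) a ∧ (s₀ ≡ᵇ sec)) + commasA (s₀ + b2n (ch (# 3) a)) y sec q
commasA-∷ s₀ a y sec q = cong₂ _+_ (cong (λ z → b2n (ch (# 2) a ∧ (z ≡ᵇ sec))) (ℕP.+-identityʳ s₀))
  (sumTo-cong q λ l _ → cong (λ z → b2n (isS (# 2) y l ∧ (z ≡ᵇ sec))) (sym (ℕP.+-assoc s₀ _ _)))

partA-∷ : ∀ s₀ c a y sec r → partA s₀ c (a ∷ y) sec r ≡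
  b2n (ch (# 1) a ∧ ((s₀ ≡ᵇ sec) ∧ (c ≡ᵇ r))) + partA (s₀ + b2n (ch (# 3) a)) (c + b2n (ch (# 2) a ∧ (s₀ ≡ᵇ sec))) y sec r
partA-∷ s₀ c a y sec r = cong₂ _+_ (cong₂ (λ z w → b2n (ch (# 1) a ∧ ((z ≡ᵇ sec) ∧ (w ≡ᵇ r)))) (ℕP.+-identityʳ s₀) (ℕP.+-identityʳ c))
  (sumTo-cong (length y) λ l _ → cong₂ (λ z w → b2n (isS (# 1) y l ∧ ((z ≡ᵇ sec) ∧ (w ≡ᵇ r)))) (sym (ℕP.+-assoc s₀ _ _))
    (trans (cong (c +_) (commasA-∷ s₀ a y sec l)) (sym (ℕP.+-assoc c _ _))))

∧-false : ∀ b → (b ∧ false) ≡ false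
∧-false true  = refl
∧-false false = refl

late : ∀ s₀ sec n → sec < s₀ → (s₀ + n ≡ᵇ sec) ≡ false
late s₀ sec n lt = ≡ᵇ-≢ λ eq → ℕP.<⇒≱ lt (ℕP.≤-trans (ℕP.m≤m+n s₀ n) (ℕP.≤-reflexive eq))

partA-late : ∀ s₀ c y sec r → sec < s₀ → partA s₀ c y sec r ≡ 0
partA-late s₀ c y sec r lt = trans (sumTo-cong (length y) λ l _ → cong b2n (trans (cong (λ b → isS (# 1) y l ∧ (b ∧ (c + commasA s₀ y sec l ≡ᵇ r))) (late s₀ sec (semis y l) lt)) (∧-false _))) (sumTo-0 (length y))

commasA-late : ∀ s₀ y sec q → sec < s₀ → commasA s₀ y sec q ≡ 0
commasA-late s₀ y sec q lt = trans (sumTo-cong q λ l _ → cong b2n (trans (cong (isS (# 2) y l ∧_) (late s₀ sec (semis y l) lt)) (∧-false _))) (sumTo-0 q)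

partA-ones : ∀ s₀ c k y sec r → partA s₀ c (replicate k (# 0) ++ y) sec r ≡ b2n ((s₀ ≡ᵇ sec) ∧ (c ≡ᵇ r)) * k + partA s₀ c y sec r
partA-ones s₀ c zero    y sec r = cong (_+ partA s₀ c y sec r) (sym (ℕP.*-zeroʳ (b2n ((s₀ ≡ᵇ sec) ∧ (c ≡ᵇ r)))))
partA-ones s₀ c (suc k) y sec r = trans (partA-∷ s₀ c (# 0) (replicate k (# 0) ++ y) sec r)
  (trans (cong₂ (λ a b → B + partA a b (replicate k (# 0) ++ y) sec r) (ℕP.+-identityʳ s₀) (ℕP.+-identityʳ c))
  (trans (cong (B +_) (partA-ones s₀ c k y sec r)) (trans (sym (ℕP.+-assoc B (B * k) _)) (cong (_+ partA s₀ c y sec r) (sym (ℕP.*-suc B k))))))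
  where B = b2n ((s₀ ≡ᵇ sec) ∧ (c ≡ᵇ r))

commasA-ones : ∀ s₀ k y sec → commasA s₀ (replicate k (# 0) ++ y) sec (length (replicate k (# 0) ++ y)) ≡ commasA s₀ y sec (length y)
commasA-ones s₀ zero    y sec = refl
commasA-ones s₀ (suc k) y sec = trans (commasA-∷ s₀ (# 0) (replicate k (# 0) ++ y) sec (length (replicate k (# 0) ++ y)))
  (trans (cong (λ a → commasA a (replicate k (# 0) ++ y) sec (length (replicate k (# 0) ++ y))) (ℕP.+-identityʳ s₀)) (commasA-ones s₀ k y sec))

partA-comma : ∀ s₀ c y sec r → partA s₀ c (# 1 ∷ y) sec r ≡ partA s₀ (c + b2n (s₀ ≡ᵇ sec)) y sec r
partA-comma s₀ c y sec r = trans (partA-∷ s₀ c (# 1) y sec r) (cong (λ a → partA a (c + b2n (s₀ ≡ᵇ sec)) y sec r) (ℕP.+-identityʳ s₀))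

partA-semi : ∀ s₀ c y sec r → partA s₀ c (# 2 ∷ y) sec r ≡ partA (suc s₀) c y sec r
partA-semi s₀ c y sec r = trans (partA-∷ s₀ c (# 2) y sec r) (cong₂ (λ a b → partA a b y sec r) (ℕP.+-comm s₀ 1) (ℕP.+-identityʳ c))

commasA-comma : ∀ s₀ y sec → commasA s₀ (# 1 ∷ y) sec (suc (length y)) ≡ b2n (s₀ ≡ᵇ sec) + commasA s₀ y sec (length y)
commasA-comma s₀ y sec = trans (commasA-∷ s₀ (# 1) y sec (length y)) (cong (λ a → b2n (s₀ ≡ᵇ sec) + commasA a y sec (length y)) (ℕP.+-identityʳ s₀))

commasA-semi : ∀ s₀ y sec → commasA s₀ (# 2 ∷ y) sec (suc (length y)) ≡ commasA (suc s₀) y sec (length y)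
commasA-semi s₀ y sec = trans (commasA-∷ s₀ (# 2) y sec (length y)) (cong (λ a → commasA a y sec (length y)) (ℕP.+-comm s₀ 1))

-- The part with index r of a list whose first part has index c, written as the sum that a
-- left-to-right scan accumulates.
sel : ℕ → List ℕ → ℕ → ℕ
sel c []       r = 0
sel c (k ∷ la) r = b2n (c ≡ᵇ r) * k + sel (suc c) la r

sel-low : ∀ c la r → r < c → sel c la r ≡ 0
sel-low c []       r lt = refl
sel-low c (k ∷ la) r lt rewrite ≡ᵇ-≢ {c} {r} (λ eq → ℕP.<⇒≢ lt (sym eq)) = sel-low (suc c) la r (ℕP.m<n⇒m<1+n lt)

sel-nth : ∀ c la r → sel c la (c + r) ≡ nth 0 la r
sel-nth c []       r = refl
sel-nth c (k ∷ la) zero rewrite ℕP.+-identityʳ c | ≡ᵇ-refl c = trans (cong (k + 0 +_) (sel-low (suc c) la c ℕP.≤-refl)) (trans (ℕP.+-identityʳ _) (ℕP.+-identityʳ k))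
sel-nth c (k ∷ la) (suc r) rewrite ≡ᵇ-≢ {c} {c + suc r} (λ eq → ℕP.m≢1+m+n c (trans eq (ℕP.+-suc c r))) = trans (cong (sel (suc c) la) (ℕP.+-suc c r)) (sel-nth (suc c) la r)

-- Inside the section wanted, the marks of a part count exactly when r commas of that section
-- precede them; the semicolon then ends the section, and what follows is scanned with a later
-- section number.
part-in : ∀ c la y sec r → partA sec c (encS la y) sec r ≡ sel c la r + partA (suc sec) (c + length la) y sec r
part-in c []       y sec r = trans (partA-semi sec c y sec r) (cong (λ z → partA (suc sec) z y sec r) (sym (ℕP.+-identityʳ c)))
part-in c (k ∷ la) y sec r = trans (partA-ones sec c k (# 1 ∷ encS la y) sec r) (trans (cong₂ (λ a b → b2n (a ∧ (c ≡ᵇ r)) * k + b) (≡ᵇ-refl sec)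
    (trans (partA-comma sec c (encS la y) sec r) (trans (cong (λ z → partA sec z (encS la y) sec r) (trans (cong (λ b → c + b2n b) (≡ᵇ-refl sec)) (ℕP.+-comm c 1))) (part-in (suc c) la y sec r))))
  (trans (sym (ℕP.+-assoc (b2n (c ≡ᵇ r) * k) _ _)) (cong (λ z → b2n (c ≡ᵇ r) * k + sel (suc c) la r + partA (suc sec) z y sec r) (sym (ℕP.+-suc c (length la))))))

part-skip : ∀ s₀ c la y sec r → s₀ ≢ sec → partA s₀ c (encS la y) sec r ≡ partA (suc s₀) c y sec r
part-skip s₀ c []       y sec r ne = partA-semi s₀ c y sec r
part-skip s₀ c (k ∷ la) y sec r ne = trans (partA-ones s₀ c k (# 1 ∷ encS la y) sec r) (trans (cong (λ b → b2n (b ∧ (c ≡ᵇ r)) * k + partA s₀ c (# 1 ∷ encS la y) sec r) (≡ᵇ-≢ ne))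
  (trans (partA-comma s₀ c (encS la y) sec r) (trans (cong (λ z → partA s₀ z (encS la y) sec r) (trans (cong (λ b → c + b2n b) (≡ᵇ-≢ ne)) (ℕP.+-identityʳ c))) (part-skip s₀ c la y sec r ne))))

rowsA : ℕ → Input → ℕ → ℕ
rowsA s₀ y sec = commasA s₀ y sec (length y)

rows-in : ∀ la y sec → rowsA sec (encS la y) sec ≡ length la + rowsA (suc sec) y sec
rows-in []       y sec = commasA-semi sec y sec
rows-in (k ∷ la) y sec = trans (commasA-ones sec k (# 1 ∷ encS la y) sec) (trans (commasA-comma sec (encS la y) sec) (cong₂ (λ b z → b2n b + z) (≡ᵇ-refl sec) (rows-in la y sec)))

rows-skip : ∀ s₀ la y sec → s₀ ≢ sec → rowsA s₀ (encS la y) sec ≡ rowsA (suc s₀) y sec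
rows-skip s₀ []       y sec ne = commasA-semi s₀ y sec
rows-skip s₀ (k ∷ la) y sec ne = trans (commasA-ones s₀ k (# 1 ∷ encS la y) sec) (trans (commasA-comma s₀ (encS la y) sec) (trans (cong (λ b → b2n b + rowsA s₀ (encS la y) sec) (≡ᵇ-≢ ne)) (rows-skip s₀ la y sec ne)))

sep-++ : ∀ (w : Word) y → sep (map (_↑ˡ 2) w ++ (# 3 ∷ y)) ≡ length w
sep-++ []      y = trans (sumTo-cong (length y) λ l _ → refl) (sumTo-0 (length y))
sep-++ (a ∷ w) y = trans (cong₂ _+_ (cong (λ b → b2n (not b ∧ true)) (no4 a))
    (sumTo-cong (length (map (_↑ˡ 2) w ++ (# 3 ∷ y))) λ l _ → cong (λ b → b2n (not b ∧ allN (suc l) (λ q → not (isS (# 4) (map (_↑ˡ 2) w ++ (# 3 ∷ y)) q)))) (no4 a)))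
  (cong suc (sep-++ w y))
  where no4 : ∀ (a : Fin 3) → ch (# 4) (a ↑ˡ 2) ≡ false
        no4 F.zero                 = refl
        no4 (F.suc F.zero)         = refl
        no4 (F.suc (F.suc F.zero)) = refl

isS-bits : ∀ u q → isS (# 2) (map bitSym u) q ≡ nth false u q
isS-bits []          q       = refl
isS-bits (true ∷ u)  zero    = refl
isS-bits (false ∷ u) zero    = refl
isS-bits (b ∷ u)     (suc q) = isS-bits u q

isS-++ : ∀ c (y z : Input) q → isS c (y ++ z) (length y + q) ≡ isS c z q
isS-++ c []      z q = refl
isS-++ c (a ∷ y) z q = isS-++ c y z q

bitAt-pair : ∀ w u q → bitAt (pairEnc w u) q ≡ nth false u q
bitAt-pair w u q = trans (cong (λ z → isS (# 2) (pairEnc w u) (suc z + q)) (sep-++ w (map bitSym u)))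
  (trans (cong (isS (# 2) (pairEnc w u)) (trans (sym (ℕP.+-suc (length w) q)) (cong (_+ suc q) (sym (LP.length-map (_↑ˡ 2) w)))))
  (trans (isS-++ (# 2) (map (_↑ˡ 2) w) (# 3 ∷ map bitSym u) (suc q)) (isS-bits u q)))

length-pair : ∀ w u → length (pairEnc w u) ≡ suc (length w) + length u
length-pair w u = trans (LP.length-++ (map (_↑ˡ 2) w)) (trans (cong₂ (λ a b → a + suc b) (LP.length-map (_↑ˡ 2) w) (LP.length-map bitSym u)) (ℕP.+-suc (length w) (length u)))

module Parsed (la mu nu : List ℕ) (u : List Bool) where
  x : Input
  x = pairEnc (encTriple la mu nu) u

  private
    z : Input
    z = # 3 ∷ map bitSym u
    via : ∀ {A : Set} (f : Input → A) → f x ≡ f (encS la (encS mu (encS nu z)))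
    via f = cong f (pairEnc≡ la mu nu u)

  rows-0 : rows x 0 ≡ length la
  rows-0 = trans (via (λ y → rows y 0)) (trans (rows-in la (encS mu (encS nu z)) 0) (trans (cong (length la +_) (commasA-late 1 (encS mu (encS nu z)) 0 (length (encS mu (encS nu z))) (s≤s z≤n))) (ℕP.+-identityʳ _)))

  rows-1 : rows x 1 ≡ length mu
  rows-1 = trans (via (λ y → rows y 1)) (trans (rows-skip 0 la (encS mu (encS nu z)) 1 (λ ())) (trans (rows-in mu (encS nu z) 1)
    (trans (cong (length mu +_) (commasA-late 2 (encS nu z) 1 (length (encS nu z)) (s≤s (s≤s z≤n)))) (ℕP.+-identityʳ _))))

  rows-2 : rows x 2 ≡ length nu
  rows-2 = trans (via (λ y → rows y 2)) (trans (rows-skip 0 la (encS mu (encS nu z)) 2 (λ ())) (trans (rows-skip 1 mu (encS nu z) 2 (λ ())) (trans (rows-in nu z 2)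
    (trans (cong (length nu +_) (commasA-late 3 z 2 (length z) (s≤s (s≤s (s≤s z≤n))))) (ℕP.+-identityʳ _)))))

  part-0 : ∀ r → part x 0 r ≡ nth 0 la r
  part-0 r = trans (via (λ y → part y 0 r)) (trans (part-in 0 la (encS mu (encS nu z)) 0 r) (trans (cong₂ _+_ (sel-nth 0 la r) (partA-late 1 (length la) (encS mu (encS nu z)) 0 r (s≤s z≤n))) (ℕP.+-identityʳ _)))

  part-1 : ∀ r → part x 1 r ≡ nth 0 mu r
  part-1 r = trans (via (λ y → part y 1 r)) (trans (part-skip 0 0 la (encS mu (encS nu z)) 1 r (λ ())) (trans (part-in 0 mu (encS nu z) 1 r)
    (trans (cong₂ _+_ (sel-nth 0 mu r) (partA-late 2 (length mu) (encS nu z) 1 r (s≤s (s≤s z≤n)))) (ℕP.+-identityʳ _))))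

  part-2 : ∀ r → part x 2 r ≡ nth 0 nu r
  part-2 r = trans (via (λ y → part y 2 r)) (trans (part-skip 0 0 la (encS mu (encS nu z)) 2 r (λ ())) (trans (part-skip 1 0 mu (encS nu z) 2 r (λ ())) (trans (part-in 0 nu z 2 r)
    (trans (cong₂ _+_ (sel-nth 0 nu r) (partA-late 3 (length nu) z 2 r (s≤s (s≤s (s≤s z≤n))))) (ℕP.+-identityʳ _)))))

-- Sums over bit strings and the sign

bools : List Bool
bools = false ∷ true ∷ []

BS : ℕ → List (List Bool)
BS n = words bools n

∑-bools : ∀ f → ∑ bools f ≡ f false +ᶻ f true
∑-bools f = trans (∑-∷ false (true ∷ []) f) (cong (f false +ᶻ_) (∑-one true f))

∑-BS-suc : ∀ n f → ∑ (BS (suc n)) f ≡ ∑ (BS n) (λ c → f (false ∷ c)) +ᶻ ∑ (BS n) (λ c → f (true ∷ c))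
∑-BS-suc n f = trans (∑-words-suc bools n f) (∑-bools _)

∑-bitStrings : ∀ n f → ∑ (bitStrings n) f ≡ ∑ (BS n) f
∑-bitStrings zero    f = refl
∑-bitStrings (suc n) f = trans (∑-concatMap _ (bitStrings n) f) (trans (∑-cong (bitStrings n) λ u → trans (∑-∷ (false ∷ u) _ f) (cong (f (false ∷ u) +ᶻ_) (∑-one (true ∷ u) f)))
  (trans (∑-bitStrings n _) (trans (∑-+ (BS n) _ _) (sym (∑-BS-suc n f)))))

∑-bitStringsUpTo : ∀ b l f → l ≤ b → ∑ (bitStringsUpTo b) (λ u → ι (length u ≡ᵇ l) *ᶻ f u) ≡ ∑ (BS l) f
∑-bitStringsUpTo b l f le = trans (∑-concatMap bitStrings (upTo (suc b)) _) (trans (∑-cong (upTo (suc b)) λ n → trans (∑-bitStrings n _)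
    (trans (∑-words-cong bools n λ u _ len → cong (λ z → ι z *ᶻ f u) (trans (cong (_≡ᵇ l) len) (≡ᵇ-sym n l))) (∑-* (BS n) (ι (l ≡ᵇ n)) f)))
  (trans (∑-upTo-delta (suc b) l (λ n → ∑ (BS n) f)) (ι-true _ (<ᵇ-true (s≤s le)))))

cntB : List Bool → ℕ
cntB []      = 0
cntB (b ∷ c) = b2n b + cntB c

sgnB : List Bool → ℤ
sgnB []          = pos 1
sgnB (false ∷ c) = sgnB c
sgnB (true ∷ c)  = -ᶻ sgnB c

sgnB-++ : ∀ c t → sgnB (c ++ t) ≡ sgnB c *ᶻ sgnB t
sgnB-++ []          t = sym (ℤP.*-identityˡ (sgnB t))
sgnB-++ (false ∷ c) t = sgnB-++ c t
sgnB-++ (true ∷ c)  t = trans (cong -ᶻ_ (sgnB-++ c t)) (ℤP.neg-distribˡ-* (sgnB c) (sgnB t))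

parity : ℕ → Bool
parity zero    = true
parity (suc n) = not (parity n)

not-not : ∀ b → not (not b) ≡ b
not-not true  = refl
not-not false = refl

even-parity : ∀ c → evenᵇ c ≡ parity c
even-parity c = bool-iff to from
  where
  par-dbl : ∀ k → parity (k + k) ≡ true
  par-dbl zero    = refl
  par-dbl (suc k) = trans (cong (not ∘ parity) (ℕP.+-suc k k)) (trans (not-not (parity (k + k))) (par-dbl k))
  half : ∀ c → ∃ λ k → (k + k ≡ c) ⊎ (suc (k + k) ≡ c)
  half zero    = 0 , inj₁ refl
  half (suc c) with half c
  ... | k , inj₁ eq = k , inj₂ (cong suc eq)
  ... | k , inj₂ eq = suc k , inj₁ (cong suc (trans (ℕP.+-suc k k) eq))
  P : ℕ → Bool
  P k = not (k + k ≡ᵇ c)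
  find : ∀ n (q : ℕ → Bool) → allN n q ≡ false → ∃ λ i → q i ≡ false
  find (suc n) q eq with q 0 in e₀
  ... | false = 0 , e₀
  ... | true  = let (i , e₁) = find n (q ∘ suc) eq in suc i , e₁
  to : evenᵇ c ≡ true → parity c ≡ true
  to eq = let (k , e₁) = find (suc c) P (trans (sym (not-not _)) (cong not eq)) in
    trans (cong parity (sym (≡ᵇ-sound (k + k) c (trans (sym (not-not _)) (cong not e₁))))) (par-dbl k)
  from : parity c ≡ true → evenᵇ c ≡ true
  from eq with half c
  ... | k , inj₂ e₁ with trans (sym eq) (trans (cong parity (sym e₁)) (cong not (par-dbl k)))
  ...   | ()
  from eq | k , inj₁ e₁ = cong not (bool-not λ al → contra (trans (sym (allN-sound (suc c) P al k (s≤s (ℕP.≤-trans (ℕP.m≤m+n k k) (ℕP.≤-reflexive e₁)))))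
                            (cong not (trans (cong (_≡ᵇ c) e₁) (≡ᵇ-refl c)))))
    where contra : true ≡ false → ⊥
          contra ()

-- The sign is the even indicator minus the odd one, which is how the difference of the two counting
-- functions produces it.
sgnB-parity : ∀ t → sgnB t ≡ ι (parity (cntB t)) -ᶻ ι (not (parity (cntB t)))
sgnB-parity []          = refl
sgnB-parity (false ∷ t) = sgnB-parity t
sgnB-parity (true ∷ t)  = trans (cong -ᶻ_ (sgnB-parity t)) (lem (parity (cntB t)))
  where lem : ∀ b → -ᶻ (ι b -ᶻ ι (not b)) ≡ ι (not b) -ᶻ ι (not (not b))
        lem true  = refl
        lem false = refl

-- The product over pairs as a signed sum over bit strings

subB : ∀ {n} → Vec ℤ n → List Bool → Vec ℤ n
subB V.[]      _           = V.[]
subB (b V.∷ v) []          = b V.∷ v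
subB (b V.∷ v) (false ∷ c) = b V.∷ subB v c
subB (b V.∷ v) (true ∷ c)  = (b -ᶻ pos 1) V.∷ subB v c

-- Expanding the factors: a set bit takes -x_j/x_0, which contributes a sign, lowers the entry of
-- x_j and raises l.
E-bits : ∀ {n} l (v : Vec ℤ n) K → E l v K ≡ ∑ (BS n) (λ c → sgnB c *ᶻ K (l +ᶻ pos (cntB c)) (subB v c))
E-bits l V.[]      K = sym (trans (∑-words-0 bools _) (trans (ℤP.*-identityˡ _) (cong (λ z → K z V.[]) (ℤP.+-identityʳ l))))
E-bits {suc n} l (b V.∷ v) K = trans (cong₂ _-ᶻ_ (E-bits l v (K ▸ b)) (E-bits (l +ᶻ pos 1) v (K ▸ (b -ᶻ pos 1))))
  (sym (trans (∑-BS-suc n _) (cong (∑ (BS n) (λ c → sgnB c *ᶻ K (l +ᶻ pos (cntB c)) (b V.∷ subB v c)) +ᶻ_)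
    (trans (∑-cong (BS n) λ c → trans (sym (ℤP.neg-distribˡ-* (sgnB c) _)) (cong (λ z → -ᶻ (sgnB c *ᶻ K z ((b -ᶻ pos 1) V.∷ subB v c))) (sym (ℤP.+-assoc l (pos 1) (pos (cntB c)))))) (∑-neg (BS n) _)))))

-- The exponent at which X is evaluated when t selects the factors: the first n bits treat the pairs
-- of the first variable, the remaining bits those of the later ones.
flipV : ∀ {n} → Vec ℤ n → List Bool → Vec ℤ n
flipV V.[] t = V.[]
flipV {suc n} (l V.∷ v) t = (l +ᶻ pos (cntB (take n t))) V.∷ flipV (subB v (take n t)) (drop n t)

take-++ : ∀ {A : Set} n (c t : List A) → length c ≡ n → take n (c ++ t) ≡ c
take-++ zero    []      t _  = refl
take-++ (suc n) (b ∷ c) t eq = cong (b ∷_) (take-++ n c t (ℕP.suc-injective eq))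

drop-++ : ∀ {A : Set} n (c t : List A) → length c ≡ n → drop n (c ++ t) ≡ t
drop-++ zero    []      t _  = refl
drop-++ (suc n) (b ∷ c) t eq = drop-++ n c t (ℕP.suc-injective eq)

Φ-bits : ∀ {n} (v : Vec ℤ n) X → Φ v X ≡ ∑ (BS (offT n n)) (λ t → sgnB t *ᶻ X (flipV v t))
Φ-bits V.[] X = sym (trans (∑-words-0 bools _) (ℤP.*-identityˡ _))
Φ-bits {suc n} (l V.∷ v) X = trans (E-bits l v _) (trans (∑-words-cong bools n λ c _ len → trans (cong (sgnB c *ᶻ_) (Φ-bits {n} (subB v c) _))
    (trans (sym (∑-* (BS (offT n n)) (sgnB c) _)) (∑-cong (BS (offT n n)) λ t → trans (sym (ℤP.*-assoc (sgnB c) (sgnB t) _))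
      (cong₂ _*ᶻ_ (sym (sgnB-++ c t)) (cong X (cong₂ (λ a b → (l +ᶻ pos (cntB a)) V.∷ flipV (subB v a) b) (sym (take-++ n c t len)) (sym (drop-++ n c t len))))))))
  (sym (∑-words-+ bools n (offT n n) _)))

cntB-take : ∀ n t → n ≤ length t → sumTo n (λ j → b2n (nth false t j)) ≡ cntB (take n t)
cntB-take zero    t       le       = refl
cntB-take (suc n) (b ∷ t) (s≤s le) = cong (b2n b +_) (cntB-take n t le)

nth-take : ∀ n (t : List Bool) i → i < n → nth false (take n t) i ≡ nth false t i
nth-take (suc n) []      i       lt       = refl
nth-take (suc n) (b ∷ t) zero    lt       = refl
nth-take (suc n) (b ∷ t) (suc i) (s≤s lt) = nth-take n t i lt

nth-drop : ∀ n (t : List Bool) q → nth false t (n + q) ≡ nth false (drop n t) q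
nth-drop zero    t       q = refl
nth-drop (suc n) []      q = refl
nth-drop (suc n) (b ∷ t) q = nth-drop n t q

tb : ℕ → List Bool → ℕ → ℕ → Bool
tb n t i j = nth false t (offT n i + (j ∸ suc i))

-- `G` is the content, `A` the partition, and `I i` counts how often exponent i has already been
-- lowered by pairs treated before. Carrying `I` makes the statement inductive, and with all
-- lowerings on the left it is an equation in ℕ.
Balanced : ℕ → (ℕ → ℕ) → (ℕ → ℕ) → (ℕ → ℕ) → List Bool → Bool
Balanced n G A I t = allN n (λ i → G i + (I i + sumTo i (λ j → b2n (tb n t j i))) ≡ᵇ A i + sumTo (n ∸ suc i) (λ j → b2n (tb n t i (suc i + j))))

dv : ∀ {n} → Vec ℕ n → Vec ℕ n → Vec ℤ n
dv = V.zipWith (λ l i → pos l -ᶻ pos i)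

addB : ∀ {n} → Vec ℕ n → List Bool → Vec ℕ n
addB V.[]      _       = V.[]
addB (i V.∷ v) []      = i V.∷ v
addB (i V.∷ v) (b ∷ c) = (i + b2n b) V.∷ addB v c

subB-dv : ∀ {n} (la inn : Vec ℕ n) c → subB (dv la inn) c ≡ dv la (addB inn c)
subB-dv V.[]       V.[]        c           = refl
subB-dv (l V.∷ la) (i V.∷ inn) []          = refl
subB-dv (l V.∷ la) (i V.∷ inn) (false ∷ c) = cong₂ V._∷_ (cong (λ z → pos l -ᶻ pos z) (sym (ℕP.+-identityʳ i))) (subB-dv la inn c)
subB-dv (l V.∷ la) (i V.∷ inn) (true ∷ c)  = cong₂ V._∷_ (lem (pos l) (pos i)) (subB-dv la inn c)
  where lem : ∀ l i → (l -ᶻ i) -ᶻ pos 1 ≡ l -ᶻ (i +ᶻ pos 1)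
        lem = ℤS.solve-∀

nthV : ∀ {n} → Vec ℕ n → ℕ → ℕ
nthV v = nth 0 (V.toList v)

nthV-addB : ∀ {n} (inn : Vec ℕ n) c i → i < n → nthV (addB inn c) i ≡ nthV inn i + b2n (nth false c i)
nthV-addB (x V.∷ inn) []      i       lt       = sym (ℕP.+-identityʳ _)
nthV-addB (x V.∷ inn) (b ∷ c) zero    lt       = refl
nthV-addB (x V.∷ inn) (b ∷ c) (suc i) (s≤s lt) = nthV-addB inn c i lt

eqzn-balance : ∀ l i c g → eqzn ((pos l -ᶻ pos i) +ᶻ pos c) g ≡ (g + (i + 0) ≡ᵇ l + c)
eqzn-balance l i c g = bool-iff
  (λ eq → trans (cong (λ z → g + z ≡ᵇ l + c) (ℕP.+-identityʳ i)) (trans (cong (_≡ᵇ l + c) (ℤP.+-injective (trans (cong (_+ᶻ pos i) (sym (eqzn-sound ((pos l -ᶻ pos i) +ᶻ pos c) g eq))) (lem (pos l) (pos i) (pos c))))) (≡ᵇ-refl (l + c))))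
  (λ eq → trans (cong (λ z → eqzn z g) (trans (lem₂ (pos l) (pos i) (pos c)) (trans (cong (λ z → pos z -ᶻ pos i) (trans (sym (≡ᵇ-sound (g + (i + 0)) (l + c) eq)) (cong (g +_) (ℕP.+-identityʳ i)))) (lem₃ (pos g) (pos i))))) (≡ᵇ-refl g))
  where
  lem : ∀ l i c → ((l -ᶻ i) +ᶻ c) +ᶻ i ≡ l +ᶻ c
  lem = ℤS.solve-∀
  lem₂ : ∀ l i c → (l -ᶻ i) +ᶻ c ≡ (l +ᶻ c) -ᶻ i
  lem₂ = ℤS.solve-∀
  lem₃ : ∀ g i → (g +ᶻ i) -ᶻ i ≡ g
  lem₃ = ℤS.solve-∀

-- The bits of the first row raise the first exponent and, by `addB`, are entered into `I` for the
-- others; deleting them shifts all later offsets by n, which is what `dr` accounts for.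
flip-balanced : ∀ {n} (la inn : Vec ℕ n) γ t → length γ ≡ n → length t ≡ offT n n →
  eqZ (flipV (dv la inn) t) γ ≡ Balanced n (nth 0 γ) (nthV la) (nthV inn) t
flip-balanced V.[] V.[] [] t _ _ = refl
flip-balanced {suc n} (l V.∷ la) (i V.∷ inn) (g ∷ γ) t lenγ lent = cong₂ _∧_
  (trans (eqzn-balance l i (cntB (take n t)) g) (cong (λ z → g + (i + 0) ≡ᵇ l + z) (sym (cntB-take n t (ℕP.≤-trans (ℕP.m≤m+n n (offT n n)) (ℕP.≤-reflexive (sym lent)))))))
  (trans (cong (λ z → eqZ (flipV z (drop n t)) γ) (subB-dv la inn (take n t)))
  (trans (flip-balanced la (addB inn (take n t)) γ (drop n t) (ℕP.suc-injective lenγ) (trans (LP.length-drop n t) (trans (cong (_∸ n) lent) (ℕP.m+n∸m≡n n (offT n n)))))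
  (allN-cong n λ j lt → cong₂ (λ a b → nth 0 γ j + a ≡ᵇ nthV la j + b)
    (trans (cong₂ _+_ (trans (nthV-addB inn (take n t) j lt) (cong (λ z → nthV inn j + b2n z) (nth-take n t j lt)))
             (sumTo-cong j λ q _ → cong b2n (dr (offT n q) (j ∸ suc q))))
      (ℕP.+-assoc (nthV inn j) _ _))
    (sumTo-cong (n ∸ suc j) λ q _ → cong b2n (dr (offT n j) (suc j + q ∸ suc j))))))
  where dr : ∀ a b → nth false (drop n t) (a + b) ≡ nth false t (n + a + b)
        dr a b = trans (sym (nth-drop n t (a + b))) (cong (nth false t) (sym (ℕP.+-assoc n a b)))

-- Unit-vector blocks and the unrolled conditions

onehot : ℕ → ℕ → List Bool
onehot zero    _       = []
onehot (suc N) zero    = true ∷ replicate N false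
onehot (suc N) (suc i) = false ∷ onehot N i

onehot-length : ∀ N i → length (onehot N i) ≡ N
onehot-length zero    i       = refl
onehot-length (suc N) zero    = cong suc (LP.length-replicate N)
onehot-length (suc N) (suc i) = cong suc (onehot-length N i)

onehot-nth : ∀ N a i → a < N → nth false (onehot N a) i ≡ (a ≡ᵇ i)
onehot-nth (suc N) zero    zero    lt       = refl
onehot-nth (suc N) zero    (suc i) lt       = rep N i
  where rep : ∀ N i → nth false (replicate N false) i ≡ false
        rep zero    i       = refl
        rep (suc N) zero    = refl
        rep (suc N) (suc i) = rep N i
onehot-nth (suc N) (suc a) zero    lt       = refl
onehot-nth (suc N) (suc a) (suc i) (s≤s lt) = onehot-nth N a i lt

∑-none : ∀ N f → ∑ (BS N) (λ c → ι (cntB c ≡ᵇ 0) *ᶻ f c) ≡ f (replicate N false)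
∑-none zero    f = trans (∑-words-0 bools _) (ℤP.*-identityˡ _)
∑-none (suc N) f = trans (∑-BS-suc N _) (trans (cong₂ _+ᶻ_ (∑-none N (λ c → f (false ∷ c))) (∑-zero (BS N) λ c → refl)) (ℤP.+-identityʳ _))

∑-onehot : ∀ N f → ∑ (BS N) (λ c → ι (cntB c ≡ᵇ 1) *ᶻ f c) ≡ ∑ (upTo N) (λ i → f (onehot N i))
∑-onehot zero    f = trans (∑-words-0 bools _) (sym (∑-[] _))
∑-onehot (suc N) f = trans (∑-BS-suc N _) (trans (ℤP.+-comm (∑ (BS N) (λ c → ι (cntB c ≡ᵇ 1) *ᶻ f (false ∷ c))) (∑ (BS N) (λ c → ι (cntB c ≡ᵇ 0) *ᶻ f (true ∷ c))))
  (trans (cong₂ _+ᶻ_ (∑-none N (λ c → f (true ∷ c))) (∑-onehot N (λ c → f (false ∷ c)))) (sym (∑-upTo-suc N _))))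

oneHot : ℕ → ℕ → List Bool → Bool
oneHot N k u = allN k (λ j → sumTo N (λ i → b2n (nth false u (j * N + i))) ≡ᵇ 1)

cntB-++ : ∀ N c v → length c ≡ N → sumTo N (λ i → b2n (nth false (c ++ v) i)) ≡ cntB c
cntB-++ zero    []      v _  = refl
cntB-++ (suc N) (b ∷ c) v eq = cong (b2n b +_) (cntB-++ N c v (ℕP.suc-injective eq))

-- A block of N bits with exactly one set bit is a letter below N, so strings of k such blocks are
-- words of length k, each occurring once.
∑-blocks : ∀ N k f → ∑ (BS (k * N)) (λ u → ι (oneHot N k u) *ᶻ f u) ≡ ∑ (words (upTo N) k) (λ w → f (concatMap (onehot N) w))
∑-blocks N zero    f = trans (∑-words-0 bools _) (trans (ℤP.*-identityˡ _) (sym (∑-words-0 (upTo N) _)))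
∑-blocks N (suc k) f = trans (∑-words-+ bools N (k * N) _) (trans (∑-words-cong bools N λ c _ len → trans (∑-cong (BS (k * N)) λ v →
      trans (cong (λ z → ι z *ᶻ f (c ++ v)) (split c v len)) (ι-∧* (cntB c ≡ᵇ 1) (oneHot N k v) (f (c ++ v))))
    (trans (∑-* (BS (k * N)) (ι (cntB c ≡ᵇ 1)) _) (cong (ι (cntB c ≡ᵇ 1) *ᶻ_) (∑-blocks N k (λ v → f (c ++ v))))))
  (trans (∑-onehot N _) (sym (∑-words-suc (upTo N) k _))))
  where
  split : ∀ c v → length c ≡ N → oneHot N (suc k) (c ++ v) ≡ ((cntB c ≡ᵇ 1) ∧ oneHot N k v)
  split c v len = cong₂ _∧_ (cong (_≡ᵇ 1) (cntB-++ N c v len)) (allN-cong k λ j _ → cong (_≡ᵇ 1) (sumTo-cong N λ i _ → cong b2n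
    (trans (cong (nth false (c ++ v)) (trans (ℕP.+-assoc N (j * N) i) (cong (_+ (j * N + i)) (sym len)))) (nth-++ʳ false c v (j * N + i)))))

blocks-length : ∀ N w → length (concatMap (onehot N) w) ≡ length w * N
blocks-length N []      = refl
blocks-length N (a ∷ w) = trans (LP.length-++ (onehot N a)) (cong₂ _+_ (onehot-length N a) (blocks-length N w))

blocks-nth : ∀ N w k i → All (_< N) w → k < length w → i < N → nth false (concatMap (onehot N) w) (k * N + i) ≡ (nth 0 w k ≡ᵇ i)
blocks-nth N (a ∷ w) zero    i (l ∷ al) lk       li = trans (nth-++ˡ false (onehot N a) _ i (ℕP.<-≤-trans li (ℕP.≤-reflexive (sym (onehot-length N a))))) (onehot-nth N a i l)
blocks-nth N (a ∷ w) (suc k) i (l ∷ al) (s≤s lk) li = trans (cong (nth false (onehot N a ++ concatMap (onehot N) w)) (trans (ℕP.+-assoc N (k * N) i) (cong (_+ (k * N + i)) (sym (onehot-length N a)))))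
  (trans (nth-++ʳ false (onehot N a) _ (k * N + i)) (blocks-nth N w k i al lk li))

∑-words-* : ∀ {A : Set} (xs : List A) d D f → ∑ (words xs (d * D)) f ≡ ∑ (words (words xs D) d) (λ W → f (concat W))
∑-words-* xs zero    D f = trans (∑-words-0 xs f) (sym (∑-words-0 (words xs D) _))
∑-words-* xs (suc d) D f = trans (∑-words-+ xs D (d * D) f) (trans (∑-cong (words xs D) λ u → ∑-words-* xs d D (λ v → f (u ++ v))) (sym (∑-words-suc (words xs D) d _)))

nth-concat : ∀ D W k a → All (λ c → length c ≡ D) W → k < length W → a < D → nth 0 (concat W) (k * D + a) ≡ nth 0 (nth [] W k) a
nth-concat D (c ∷ W) zero    a (l ∷ al) lk       la = nth-++ˡ 0 c (concat W) a (ℕP.<-≤-trans la (ℕP.≤-reflexive (sym l)))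
nth-concat D (c ∷ W) (suc k) a (l ∷ al) (s≤s lk) la = trans (cong (nth 0 (c ++ concat W)) (trans (ℕP.+-assoc D (k * D) a) (cong (_+ (k * D + a)) (sym l))))
  (trans (nth-++ʳ 0 c (concat W) (k * D + a)) (nth-concat D W k a al lk la))

allN-cong₂ : ∀ {i j f g} → i ≡ j → (∀ l → l < j → f l ≡ g l) → allN i f ≡ allN j g
allN-cong₂ refl eq = allN-cong _ eq

sumTo-nth : ∀ la → sumTo (length la) (nth 0 la) ≡ size la
sumTo-nth []       = refl
sumTo-nth (k ∷ la) = cong (k +_) (sumTo-nth la)

rowsF-rowsI : ∀ R la → rowsF R (length la) (nth 0 la) ≡ rowsI R la
rowsF-rowsI R []       = refl
rowsF-rowsI R (k ∷ la) = cong (rowAdj R k ∧_) (trans (allN-cong (length la) λ r _ → allN-cong (nth 0 la r ∸ 1) λ c _ →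
  cong₂ R (ℕP.+-assoc k _ c) (ℕP.+-assoc k _ (suc c))) (rowsF-rowsI (shift k R) la))

colsF-colsI : ∀ R la → colsF R (length la) (nth 0 la) ≡ colsI R la
colsF-colsI R []       = refl
colsF-colsI R (k ∷ la) = cong₂ _∧_ (hd-nth la) (trans (allN-cong (length la) λ r _ → allN-cong (nth 0 la (suc r)) λ c _ →
  cong₂ R (ℕP.+-assoc k _ c) (ℕP.+-assoc k _ (nth 0 la r + c))) (colsF-colsI (shift k R) la))
  where hd-nth : ∀ la → allN (nth 0 la 0) (λ c → R c (k + c)) ≡ allN (hd la) (λ c → R c (k + c))
        hd-nth []      = refl
        hd-nth (_ ∷ _) = refl

countℕ-nth : ∀ v la → sumTo (length la) (λ r → b2n (v ≡ᵇ nth 0 la r)) ≡ countℕ v la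
countℕ-nth v la = countℕ-sumTo v la

CondF-Cond : ∀ B la {Lt Eq} → CondF B (length la) (nth 0 la) Lt Eq ≡ Cond B la Lt Eq
CondF-Cond Basis.s la {Lt} {Eq} = cong₂ _∧_ (rowsF-rowsI (orR Lt Eq) la) (colsF-colsI Lt la)
CondF-Cond Basis.m la {Lt} {Eq} = trans (cong (λ d → rowF (orR Lt Eq) d ∧ multF Eq d (length la) (nth 0 la)) (sumTo-nth la))
  (cong (rowAdj (orR Lt Eq) (size la) ∧_) (allN-cong (size la) λ v _ → cong (λ z → sumTo (size la) (λ i → b2n (sumTo (size la) (λ j → b2n (Eq i j)) ≡ᵇ suc v)) ≡ᵇ suc v * z) (countℕ-nth (suc v) la)))
CondF-Cond Basis.p la {Lt} {Eq} = rowsF-rowsI Eq la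
CondF-Cond Basis.e la {Lt} {Eq} = rowsF-rowsI Lt la
CondF-Cond Basis.h la {Lt} {Eq} = rowsF-rowsI (orR Lt Eq) la

CondF-row : ∀ B ℓ {row row′} {Lt Eq} → (∀ r → row r ≡ row′ r) → CondF B ℓ row Lt Eq ≡ CondF B ℓ row′ Lt Eq
CondF-row B ℓ {row} {row′} {Lt} {Eq} eq = go B
  where
  off : ∀ r → sumTo r row ≡ sumTo r row′
  off r = sumTo-cong r λ i _ → eq i
  rw : ∀ R → rowsF R ℓ row ≡ rowsF R ℓ row′
  rw R = allN-cong ℓ λ r _ → allN-cong₂ (cong (_∸ 1) (eq r)) λ c _ → cong (λ z → R (z + c) (z + suc c)) (off r)
  cl : ∀ R → colsF R ℓ row ≡ colsF R ℓ row′
  cl R = allN-cong ℓ λ r _ → allN-cong₂ (eq (suc r)) λ c _ → cong₂ (λ z y → R (z + c) (z + (y + c))) (off r) (eq r)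
  go : ∀ B → CondF B ℓ row Lt Eq ≡ CondF B ℓ row′ Lt Eq
  go Basis.s = cong₂ _∧_ (rw (orR Lt Eq)) (cl Lt)
  go Basis.m = trans (cong (λ d → rowF (orR Lt Eq) d ∧ multF Eq d ℓ row) (off ℓ)) (cong (rowF (orR Lt Eq) (sumTo ℓ row′) ∧_)
    (allN-cong (sumTo ℓ row′) λ v _ → cong (λ z → sumTo (sumTo ℓ row′) (λ i → b2n (sumTo (sumTo ℓ row′) (λ j → b2n (Eq i j)) ≡ᵇ suc v)) ≡ᵇ suc v * z) (sumTo-cong ℓ λ r _ → cong (λ z → b2n (suc v ≡ᵇ z)) (eq r))))
  go Basis.p = rw Eq
  go Basis.e = rw Lt
  go Basis.h = rw (orR Lt Eq)

-- Either the first letters decide, with position 0 as the witness, or they agree and the search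
-- continues in the tails; if the first letter of a is larger, no later position has an equal
-- prefix.
lex-form : ∀ a b → length a ≡ length b →
  not (allN (length a) (λ q → not ((nth 0 a q <ᵇ nth 0 b q) ∧ allN q (λ l → nth 0 a l ≡ᵇ nth 0 b l)))) ≡ ltLex a b
lex-form []      []      _   = refl
lex-form (x ∷ a) (y ∷ b) len with x <ᵇ y in e₁
... | true  = refl
... | false with x ≡ᵇ y in e₂
...   | true  = lex-form a b (ℕP.suc-injective len)
...   | false = cong not (allN-intro (length a) _ λ q _ → cong not (∧-f (nth 0 a q <ᵇ nth 0 b q)))
  where ∧-f : ∀ b → (b ∧ false) ≡ false
        ∧-f true  = refl
        ∧-f false = refl

eq-form : ∀ a b → length a ≡ length b → allN (length a) (λ q → nth 0 a q ≡ᵇ nth 0 b q) ≡ eqL a b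
eq-form []      []      _   = refl
eq-form (x ∷ a) (y ∷ b) len = cong ((x ≡ᵇ y) ∧_) (eq-form a b (ℕP.suc-injective len))

all-allN : ∀ {A : Set} (q : A → Bool) d W → allN (length W) (λ k → q (nth d W k)) ≡ all q W
all-allN q d []      = refl
all-allN q d (c ∷ W) = cong (q c ∧_) (all-allN q d W)

-- Counting accepted witnesses

+-≡ᵇ : ∀ a b c → (a + b ≡ᵇ a + c) ≡ (b ≡ᵇ c)
+-≡ᵇ zero    b c = refl
+-≡ᵇ (suc a) b c = +-≡ᵇ a b c

mul-lt : ∀ {k d a D} → k < d → a < D → k * D + a < d * D
mul-lt {k} {d} {a} {D} lk la = ℕP.<-≤-trans (ℕP.+-monoʳ-< (k * D) la) (ℕP.≤-trans (ℕP.≤-reflexive (ℕP.+-comm (k * D) D)) (ℕP.*-monoˡ-≤ D lk))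

words-mem : ∀ {A : Set} (xs : List A) n c → c ∈ words xs n → (length c ≡ n) × All (_∈ xs) c
words-mem xs zero    c (here refl) = refl , []
words-mem xs (suc n) c c∈ = go xs c∈ (λ z z∈ → z∈)
  where
  go : ∀ ys → c ∈ concatMap (λ y → map (y ∷_) (words xs n)) ys → (∀ z → z ∈ ys → z ∈ xs) → (length c ≡ suc n) × All (_∈ xs) c
  go (y ∷ ys) c∈ h with ∈-++⁻ (map (y ∷_) (words xs n)) c∈
  ... | inj₂ i = go ys i λ z z∈ → h z (there z∈)
  ... | inj₁ i with ∈-map⁻ (y ∷_) i
  ...   | c′ , c′∈ , refl = let (l , al) = words-mem xs n c′ c′∈ in cong suc l , h y (here refl) ∷ al

module Parse (la mu nu : List ℕ) (u : List Bool) where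
  open Parsed la mu nu u public

  N d D m′ tri : ℕ
  N = length la
  d = size mu
  D = size nu
  m′ = d * D
  tri = offT N N

  dd-val : dd x ≡ d
  dd-val = trans (sumTo-≡ rows-1 _) (trans (sumTo-cong (length mu) λ r _ → part-1 r) (sumTo-nth mu))

  DD-val : DD x ≡ D
  DD-val = trans (sumTo-≡ rows-2 _) (trans (sumTo-cong (length nu) λ r _ → part-2 r) (sumTo-nth nu))

  mm-val : mm x ≡ m′
  mm-val = cong₂ _*_ dd-val DD-val

  bit-val : ∀ q → bitAt x q ≡ nth false u q
  bit-val q = bitAt-pair (encTriple la mu nu) u q

  lenOK-val : lenOK x ≡ (length u ≡ᵇ m′ * N + tri)
  lenOK-val = trans (cong₂ _≡ᵇ_ (length-pair w u) (cong₂ (λ a b → suc a + b) (sep-++ w (map bitSym u)) (cong₂ (λ a b → a * b + offT b b) mm-val rows-0)))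
    (+-≡ᵇ (suc (length w)) (length u) (m′ * N + tri))
    where w = encTriple la mu nu

  block-bit : ∀ k i → block x k i ≡ nth false u (k * N + i)
  block-bit k i = trans (cong (λ z → bitAt x (k * z + i)) rows-0) (bit-val (k * N + i))

  tbit-bit : ∀ i j → tbit x i j ≡ nth false u (m′ * N + (offT N i + (j ∸ suc i)))
  tbit-bit i j = trans (cong₂ (λ a b → bitAt x (a * b + (offT b i + (j ∸ suc i)))) mm-val rows-0) (bit-val _)

module Blocks (la mu nu : List ℕ) (v t : List Bool) (lenv : length v ≡ (size mu * size nu) * length la) where
  open Parse la mu nu (v ++ t)

  oneHots-val : oneHots x ≡ oneHot N m′ v
  oneHots-val = allN-cong₂ mm-val λ k lk → cong (_≡ᵇ 1) (trans (sumTo-≡ rows-0 _) (sumTo-cong N λ i li → cong b2n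
    (trans (block-bit k i) (nth-++ˡ false v t (k * N + i) (ℕP.<-≤-trans (mul-lt lk li) (ℕP.≤-reflexive (sym lenv)))))))

  late-bit : ∀ q → nth false (v ++ t) (m′ * N + q) ≡ nth false t q
  late-bit q = trans (cong (λ z → nth false (v ++ t) (z + q)) (sym lenv)) (nth-++ʳ false v t q)

  flips-val : length t ≡ tri → flips x ≡ cntB t
  flips-val lent = trans (trans (sumTo-≡ (cong (λ z → offT z z) rows-0) _) (sumTo-cong tri λ q _ → cong b2n
      (trans (cong₂ (λ a b → bitAt x (a * b + q)) mm-val rows-0) (trans (bit-val (m′ * N + q)) (late-bit q)))))
    (trans (cntB-take tri t (ℕP.≤-reflexive (sym lent))) (cong cntB (LP.take-all tri t (ℕP.≤-reflexive lent))))

-- A witness that passes the length and block tests encodes a list W of inner words together with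
-- the pair bits t; here the remaining tests are evaluated on it.
module Witness (la mu nu : List ℕ) (ptμ : IsPartition mu) (ptν : IsPartition nu) (W : List (List ℕ)) (t : List Bool)
               (lenW : length W ≡ size mu) (lens : All (λ c → length c ≡ size nu) W) (al : All (_< length la) (concat W))
               (lent : length t ≡ offT (length la) (length la)) where

  private
    w = concat W
    v = concatMap (onehot (length la)) w
    lenw : length w ≡ size mu * size nu
    lenw = trans (len-concat W lens) (cong (_* size nu) lenW)
      where len-concat : ∀ W → All (λ c → length c ≡ size nu) W → length (concat W) ≡ length W * size nu
            len-concat []      []       = refl
            len-concat (c ∷ W) (l ∷ ls) = trans (LP.length-++ c) (cong₂ _+_ l (len-concat W ls))

  lenv : length v ≡ (size mu * size nu) * length la
  lenv = trans (blocks-length (length la) w) (cong (_* length la) lenw)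

  open Parse la mu nu (v ++ t)
  open Blocks la mu nu v t lenv using (late-bit)

  block-val : ∀ k i → k < m′ → i < N → block x k i ≡ (nth 0 w k ≡ᵇ i)
  block-val k i lk li = trans (block-bit k i) (trans (nth-++ˡ false v t (k * N + i) (ℕP.<-≤-trans (mul-lt lk li) (ℕP.≤-reflexive (sym lenv))))
    (blocks-nth N w k i al (ℕP.<-≤-trans lk (ℕP.≤-reflexive (sym lenw))) li))

  letter-val : ∀ k → k < m′ → letter x k ≡ nth 0 w k
  letter-val k lk = trans (sumTo-≡ rows-0 _) (trans (sumTo-cong N λ i li → trans (cong (λ b → i * b2n b) (trans (block-val k i lk li) (≡ᵇ-sym (nth 0 w k) i))) (ℕP.*-comm i _))
    (sumTo-delta N (nth 0 w k) id (nth< w al k (ℕP.<-≤-trans lk (ℕP.≤-reflexive (sym lenw))))))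
    where nth< : ∀ w → All (_< N) w → ∀ k → k < length w → nth 0 w k < N
          nth< (a ∷ w) (l ∷ al) zero    _        = l
          nth< (a ∷ w) (l ∷ al) (suc k) (s≤s lt) = nth< w al k lt

  lett-val : ∀ k a → k < d → a < D → lett x k a ≡ nth 0 (nth [] W k) a
  lett-val k a lk la = trans (cong (λ z → letter x (k * z + a)) DD-val) (trans (letter-val (k * D + a) (mul-lt lk la))
    (nth-concat D W k a lens (ℕP.<-≤-trans lk (ℕP.≤-reflexive (sym lenW))) la))

  row-length : ∀ k → k < d → length (nth [] W k) ≡ D
  row-length k lk = go W lens k (ℕP.<-≤-trans lk (ℕP.≤-reflexive (sym lenW)))
    where go : ∀ W → All (λ c → length c ≡ size nu) W → ∀ k → k < length W → length (nth [] W k) ≡ size nu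
          go (c ∷ W) (l ∷ ls) zero    _        = l
          go (c ∷ W) (l ∷ ls) (suc k) (s≤s lt) = go W ls k lt

  CondF-val : ∀ B sec ka {ℓ} {Lt Eq Lt′ Eq′ : Rel₂} → IsPartition ka → ℓ ≡ length ka → (∀ r → part x sec r ≡ nth 0 ka r) →
    SameUpTo (size ka) Lt Lt′ → SameUpTo (size ka) Eq Eq′ → CondF B ℓ (part x sec) Lt Eq ≡ Cond B ka Lt′ Eq′
  CondF-val B sec ka pt refl rowEq e₁ e₂ = trans (CondF-row B (length ka) rowEq) (trans (CondF-Cond B ka) (Cond-cong B ka (partition-WD ka pt) e₁ e₂))

  inner-val : ∀ G → inner G x ≡ all (wordCond G nu) W
  inner-val G = trans (allN-cong₂ (trans dd-val (sym lenW)) λ k lk → let lk′ = ℕP.<-≤-trans lk (ℕP.≤-reflexive lenW) in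
      CondF-val G 2 nu ptν rows-2 part-2
        (λ i j li lj → cong₂ _<ᵇ_ (lett-val k i lk′ li) (lett-val k j lk′ lj))
        (λ i j li lj → cong₂ _≡ᵇ_ (lett-val k i lk′ li) (lett-val k j lk′ lj)))
    (all-allN (wordCond G nu) [] W)

  outer-val : ∀ F → outer F x ≡ Cond F mu (onC ltLex W) (onC eqL W)
  outer-val F = CondF-val F 1 mu ptμ rows-1 part-1 ltEq eqEq
    where
    ltEq : SameUpTo d (lexLt x 0) (onC ltLex W)
    ltEq i j li lj = trans (cong not (allN-cong₂ (trans DD-val (sym (row-length i li))) λ q lq → let lq′ = ℕP.<-≤-trans lq (ℕP.≤-reflexive (row-length i li)) in
        cong not (cong₂ _∧_ (cong₂ _<ᵇ_ (lett-val i q li lq′) (lett-val j q lj lq′))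
          (allN-cong q λ l ll → cong₂ _≡ᵇ_ (lett-val i l li (ℕP.<-trans ll lq′)) (lett-val j l lj (ℕP.<-trans ll lq′))))))
      (lex-form (nth [] W i) (nth [] W j) (trans (row-length i li) (sym (row-length j lj))))
    eqEq : SameUpTo d (lexEq x 0) (onC eqL W)
    eqEq i j li lj = trans (allN-cong₂ (trans DD-val (sym (row-length i li))) λ q lq → let lq′ = ℕP.<-≤-trans lq (ℕP.≤-reflexive (row-length i li)) in
        cong₂ _≡ᵇ_ (lett-val i q li lq′) (lett-val j q lj lq′))
      (eq-form (nth [] W i) (nth [] W j) (trans (row-length i li) (sym (row-length j lj))))

  balance-val : balance x ≡ eqZ (flipV (zvec la) t) (cont N w)
  balance-val = trans (allN-cong₂ rows-0 λ i li → cong₂ _≡ᵇ_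
      (cong₂ _+_ (trans (sumTo-≡ mm-val _) (trans (sumTo-cong m′ λ k lk → cong b2n (trans (block-val k i lk li) (≡ᵇ-sym (nth 0 w k) i)))
                   (trans (sumTo-≡ (sym lenw) _) (trans (countℕ-sumTo i w) (sym (cont-nth i li))))))
        (trans (sumTo-cong i λ j _ → cong b2n (tb-val j i)) (sym (cong (_+ sumTo i (λ j → b2n (tb N t j i))) (zero-nth N i)))))
      (cong₂ _+_ (trans (part-0 i) (cong (λ z → nth 0 z i) (sym (VP.toList∘fromList la))))
        (trans (sumTo-≡ (cong (_∸ suc i) rows-0) _) (sumTo-cong (N ∸ suc i) λ j _ → cong b2n (tb-val i (suc i + j))))))
    (trans (sym (flip-balanced (V.fromList la) (zeroV N) (cont N w) t (cont-length N w) lent)) (cong (λ z → eqZ (flipV z t) (cont N w)) (dv0 (V.fromList la))))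
    where
    tb-val : ∀ i j → tbit x i j ≡ tb N t i j
    tb-val i j = trans (tbit-bit i j) (late-bit (offT N i + (j ∸ suc i)))
    zero-nth : ∀ N i → nthV (zeroV N) i ≡ 0
    zero-nth zero    i       = refl
    zero-nth (suc N) zero    = refl
    zero-nth (suc N) (suc i) = zero-nth N i
    cont-nth : ∀ i → i < N → nth 0 (cont N w) i ≡ countℕ i w
    cont-nth i li = trans (nth-map (λ i → countℕ i w) 0 0 (upTo N) i (subst (i <_) (sym (LP.length-upTo N)) li)) (cong (λ z → countℕ z w) (nth-up N id i li))
      where
      open import Data.List using (applyUpTo)
      nth-up : ∀ N (k : ℕ → ℕ) i → i < N → nth 0 (applyUpTo k N) i ≡ k i
      nth-up (suc N) k zero    _        = refl
      nth-up (suc N) k (suc i) (s≤s lt) = nth-up N (k ∘ suc) i lt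
    dv0 : ∀ {n} (v : Vec ℕ n) → dv v (zeroV n) ≡ V.map pos v
    dv0 V.[]      = refl
    dv0 (a V.∷ v) = cong₂ V._∷_ (ℤP.+-identityʳ (pos a)) (dv0 v)

module Count (F G : Basis) (la mu nu : List ℕ) (ptμ : IsPartition mu) (ptν : IsPartition nu) where
  private
    N = length la
    d = size mu
    D = size nu
    tri = offT N N
    total-bits = (d * D) * N + tri
    inp : List Bool → Input
    inp u = pairEnc (encTriple la mu nu) u

  sg : Input → ℤ
  sg x = ι (evenᵇ (flips x)) -ᶻ ι (not (evenᵇ (flips x)))

  core : List Bool → ℤ
  core u = ι (inner G (inp u)) *ᶻ (ι (outer F (inp u)) *ᶻ (ι (balance (inp u)) *ᶻ sg (inp u)))

  signed : ∀ u → ι (accept₊ F G (inp u)) -ᶻ ι (accept₋ F G (inp u)) ≡ ι (length u ≡ᵇ total-bits) *ᶻ (ι (oneHots (inp u)) *ᶻ core u)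
  signed u = trans (cong₂ _-ᶻ_ (ι-∧ (accept F G x) (evenᵇ (flips x))) (ι-∧ (accept F G x) (not (evenᵇ (flips x)))))
    (trans (cong (λ z → z *ᶻ ι (evenᵇ (flips x)) -ᶻ z *ᶻ ι (not (evenᵇ (flips x)))) (trans (ι-∧ (lenOK x) _) (cong₂ _*ᶻ_ (cong ι (Parse.lenOK-val la mu nu u))
        (trans (ι-∧ (oneHots x) _) (cong (ι (oneHots x) *ᶻ_) (trans (ι-∧ (inner G x) _) (cong (ι (inner G x) *ᶻ_) (ι-∧ (outer F x) (balance x)))))))))
      (ring (ι (length u ≡ᵇ total-bits)) (ι (oneHots x)) (ι (inner G x)) (ι (outer F x)) (ι (balance x)) (ι (evenᵇ (flips x))) (ι (not (evenᵇ (flips x))))))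
    where
    x = inp u
    ring : ∀ l o i u b p q → (l *ᶻ (o *ᶻ (i *ᶻ (u *ᶻ b)))) *ᶻ p -ᶻ (l *ᶻ (o *ᶻ (i *ᶻ (u *ᶻ b)))) *ᶻ q ≡ l *ᶻ (o *ᶻ (i *ᶻ (u *ᶻ (b *ᶻ (p -ᶻ q)))))
    ring = ℤS.solve-∀

  private
    Fam = pleth F G mu nu ptμ ptν
    term : List ℕ → ℤ
    term γ = ∑ (BS tri) (λ t → ι (eqZ (flipV (zvec la) t) γ) *ᶻ sgnB t)

  -- For fixed letters only the balance and the sign depend on the pair bits, so both word
  -- conditions come out of the sum over them.
  core-sum : ∀ W → All (_∈ words (upTo N) D) W → length W ≡ d →
    ∑ (BS tri) (λ t → core (concatMap (onehot N) (concat W) ++ t)) ≡ ι (all (wordCond G nu) W) *ᶻ (ι (Cond F mu (onC ltLex W) (onC eqL W)) *ᶻ term (cont N (concat W)))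
  core-sum W mem lenW = trans (∑-words-cong bools tri λ t _ lent → per t lent) (trans (∑-* (BS tri) (ι (all (wordCond G nu) W)) _)
    (cong (ι (all (wordCond G nu) W) *ᶻ_) (∑-* (BS tri) (ι (Cond F mu (onC ltLex W) (onC eqL W))) _)))
    where
    lens : ∀ {W} → All (_∈ words (upTo N) D) W → All (λ c → length c ≡ D) W
    lens []        = []
    lens (c∈ ∷ cs) = proj₁ (words-mem (upTo N) D _ c∈) ∷ lens cs
    letters : ∀ {W} → All (_∈ words (upTo N) D) W → All (_< N) (concat W)
    letters []        = []
    letters (c∈ ∷ cs) = app (proj₂ (words-mem (upTo N) D _ c∈)) (letters cs)
      where app : ∀ {u v} → All (_∈ upTo N) u → All (_< N) v → All (_< N) (u ++ v)
            app []       bs = bs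
            app (a ∷ as) bs = ∈-upTo a ∷ app as bs
    per : ∀ t → length t ≡ tri → core (concatMap (onehot N) (concat W) ++ t) ≡
          ι (all (wordCond G nu) W) *ᶻ (ι (Cond F mu (onC ltLex W) (onC eqL W)) *ᶻ (ι (eqZ (flipV (zvec la) t) (cont N (concat W))) *ᶻ sgnB t))
    per t lent = cong₂ (λ a z → ι a *ᶻ z) (inner-val G) (cong₂ (λ a z → ι a *ᶻ z) (outer-val F) (cong₂ (λ a z → ι a *ᶻ z) balance-val
        (trans (cong (λ c → ι (evenᵇ c) -ᶻ ι (not (evenᵇ c))) (flips-val lent)) (trans (cong (λ b → ι b -ᶻ ι (not b)) (even-parity (cntB t))) (sym (sgnB-parity t))))))
      where
      open Witness la mu nu ptμ ptν W t lenW (lens mem) (letters mem) lent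
      open Blocks la mu nu (concatMap (onehot N) (concat W)) t lenv using (flips-val)

  -- After the length test the witness splits into letter blocks and pair bits. The blocks become
  -- words grouped into |μ| inner words, whose weighted sum is the plethysm in ℓ(λ) variables;
  -- exchanging the two sums leaves the expansion of `Φ` over the pair bits.
  signed-count : ∀ b → total-bits ≤ b →
    ∑ (bitStringsUpTo b) (λ u → ι (accept₊ F G (inp u)) -ᶻ ι (accept₋ F G (inp u))) ≡ Expansion.schurCoef (toFamily Fam) la
  signed-count b le = begin
    ∑ (bitStringsUpTo b) (λ u → ι (accept₊ F G (inp u)) -ᶻ ι (accept₋ F G (inp u)))
      ≡⟨ ∑-cong (bitStringsUpTo b) signed ⟩
    ∑ (bitStringsUpTo b) (λ u → ι (length u ≡ᵇ total-bits) *ᶻ (ι (oneHots (inp u)) *ᶻ core u))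
      ≡⟨ ∑-bitStringsUpTo b total-bits _ le ⟩
    ∑ (BS total-bits) (λ u → ι (oneHots (inp u)) *ᶻ core u)
      ≡⟨ ∑-words-+ bools ((d * D) * N) tri _ ⟩
    ∑ (BS ((d * D) * N)) (λ v → ∑ (BS tri) (λ t → ι (oneHots (inp (v ++ t))) *ᶻ core (v ++ t)))
      ≡⟨ ∑-words-cong bools ((d * D) * N) (λ v _ lenv → trans (∑-cong (BS tri) λ t → cong (λ z → ι z *ᶻ core (v ++ t)) (Blocks.oneHots-val la mu nu v t lenv)) (∑-* (BS tri) (ι (oneHot N (d * D) v)) _)) ⟩
    ∑ (BS ((d * D) * N)) (λ v → ι (oneHot N (d * D) v) *ᶻ ∑ (BS tri) (λ t → core (v ++ t)))
      ≡⟨ ∑-blocks N (d * D) _ ⟩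
    ∑ (words (upTo N) (d * D)) (λ w → ∑ (BS tri) (λ t → core (concatMap (onehot N) w ++ t)))
      ≡⟨ ∑-words-* (upTo N) d D _ ⟩
    ∑ (words (words (upTo N) D) d) (λ W → ∑ (BS tri) (λ t → core (concatMap (onehot N) (concat W) ++ t)))
      ≡⟨ ∑-words-cong (words (upTo N) D) d (λ W mem lenW → core-sum W mem lenW) ⟩
    ∑ (words (words (upTo N) D) d) (λ W → ι (all (wordCond G nu) W) *ᶻ (ι (Cond F mu (onC ltLex W) (onC eqL W)) *ᶻ term (cont N (concat W))))
      ≡⟨ sym (∑-plethysm F G mu nu ptμ ptν N term) ⟩
    ∑ (VFamily.vmono Fam N) (λ v → term (V.toList v))
      ≡⟨ ∑-swap (VFamily.vmono Fam N) (BS tri) _ ⟩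
    ∑ (BS tri) (λ t → ∑ (VFamily.vmono Fam N) (λ v → ι (eqZ (flipV (zvec la) t) (V.toList v)) *ᶻ sgnB t))
      ≡⟨ ∑-cong (BS tri) (λ t → trans (∑-cong (VFamily.vmono Fam N) λ v → ℤP.*-comm (ι (eqZ (flipV (zvec la) t) (V.toList v))) (sgnB t))
           (trans (∑-* (VFamily.vmono Fam N) (sgnB t) _) (cong (sgnB t *ᶻ_) (sym (∑-map V.toList (VFamily.vmono Fam N) _))))) ⟩
    ∑ (BS tri) (λ t → sgnB t *ᶻ coefV (map V.toList (VFamily.vmono Fam N)) (flipV (zvec la) t))
      ≡⟨ sym (Φ-bits (zvec la) (coefV (map V.toList (VFamily.vmono Fam N)))) ⟩
    Φ (zvec la) (coefV (map V.toList (VFamily.vmono Fam N))) ∎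
    where open ≡-Reasoning

  enc-size : ∀ ka → (size ka ≤ length (encPartition ka)) × (length ka ≤ length (encPartition ka))
  enc-size []       = z≤n , z≤n
  enc-size (k ∷ ka) = let (a , b) = enc-size ka in
    ℕP.≤-trans (ℕP.+-monoʳ-≤ k (ℕP.≤-trans a (ℕP.n≤1+n _))) (ℕP.≤-reflexive (sym lenE)) , ℕP.≤-trans (ℕP.≤-trans (s≤s b) (ℕP.m≤n+m _ k)) (ℕP.≤-reflexive (sym lenE))
    where
    lenE : length (encPartition (k ∷ ka)) ≡ k + suc (length (encPartition ka))
    lenE = trans (cong length (trans (LP.++-assoc (replicate k (# 0) ++ # 1 ∷ []) _ (# 2 ∷ [])) (LP.++-assoc (replicate k (# 0)) (# 1 ∷ []) (encPartition ka))))
      (trans (LP.length-++ (replicate k (# 0))) (cong (_+ suc (length (encPartition ka))) (LP.length-replicate k)))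

  -- The witness has |μ||ν|ℓ(λ) letter bits and at most ℓ(λ)² pair bits, each of the three numbers
  -- being at most the length n of the encoding. Thus n³ + n² bounds it, and `deg` assigns this the
  -- exponent 3 + 2 + 1 = 6.
  bits-bound : ∀ c → 6 ≤ c → total-bits ≤ timeBound c (length (encTriple la mu nu))
  bits-bound c le = ℕP.≤-trans (ℕP.+-mono-≤ (ℕP.*-mono-≤ (ℕP.*-mono-≤ dn Dn) Nn) (ℕP.≤-trans (tri≤ N N) (ℕP.*-mono-≤ Nn Nn)))
    (ℕP.≤-trans (PB-pow (:X :* :X :* :X :+ :X :* :X) n) (pow-mono n le))
    where
    n = length (encTriple la mu nu)
    lenE : n ≡ length (encPartition la) + (length (encPartition mu) + length (encPartition nu))
    lenE = trans (LP.length-++ (encPartition la)) (cong (length (encPartition la) +_) (LP.length-++ (encPartition mu)))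
    Nn : N ≤ n
    Nn = ℕP.≤-trans (proj₂ (enc-size la)) (ℕP.≤-trans (ℕP.m≤m+n _ _) (ℕP.≤-reflexive (sym lenE)))
    dn : d ≤ n
    dn = ℕP.≤-trans (proj₁ (enc-size mu)) (ℕP.≤-trans (ℕP.≤-trans (ℕP.m≤m+n _ (length (encPartition nu))) (ℕP.m≤n+m _ (length (encPartition la)))) (ℕP.≤-reflexive (sym lenE)))
    Dn : D ≤ n
    Dn = ℕP.≤-trans (proj₁ (enc-size nu)) (ℕP.≤-trans (ℕP.≤-trans (ℕP.m≤n+m _ (length (encPartition mu))) (ℕP.m≤n+m _ (length (encPartition la)))) (ℕP.≤-reflexive (sym lenE)))
    tri≤ : ∀ a b → offT a b ≤ b * a
    tri≤ a b = sum≤ b (λ l → a ∸ suc l) λ l → ℕP.m∸n≤m a (suc l)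
      where sum≤ : ∀ b f → (∀ l → f l ≤ a) → sumTo b f ≤ b * a
            sum≤ zero    f h = z≤n
            sum≤ (suc b) f h = ℕP.+-mono-≤ (h 0) (sum≤ b (f ∘ suc) (h ∘ suc))

-- Existence, uniqueness and counting of the coefficients

opaque
  unfolding ∑
  sumℤ-∑ : {A : Set} (xs : List A) (f : A → ℤ) → sumℤ (map f xs) ≡ ∑ xs f
  sumℤ-∑ []       f = refl
  sumℤ-∑ (x ∷ xs) f = cong (f x +ᶻ_) (sumℤ-∑ xs f)

countMono-coefL : ∀ {N} (α : Vec ℕ N) M → pos (countMono α M) ≡ coefL (map V.toList M) (V.toList α)
countMono-coefL α M = trans (length-filter (eqVecᵇ α) M) (trans (∑-cong M λ v → cong ι (eqVec-eqL α v)) (sym (∑-map V.toList M _)))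
  where eqVec-eqL : ∀ {N} (u v : Vec ℕ N) → eqVecᵇ u v ≡ eqL (V.toList u) (V.toList v)
        eqVec-eqL V.[]      V.[]      = refl
        eqVec-eqL (a V.∷ u) (b V.∷ v) = cong ((a ≡ᵇ b) ∧_) (eqVec-eqL u v)

-- A formula on all triples of lists; that μ and ν are partitions enters only when it is identified
-- with the coefficient of the plethysm family.
plethysmCoeff : Basis → Basis → List ℕ → List ℕ → List ℕ → ℤ
plethysmCoeff F G la mu nu = Φ (zvec la) (coefV (map V.toList (plethysm F G mu nu (length la))))

module _ (F G : Basis) (mu nu : List ℕ) (ptμ : IsPartition mu) (ptν : IsPartition nu) where
  open Expansion (toFamily (pleth F G mu nu ptμ ptν))

  plethysmCoeff≡ : ∀ la → plethysmCoeff F G la mu nu ≡ schurCoef la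
  plethysmCoeff≡ la = cong (λ z → Φ (zvec la) (coefV (map V.toList z))) (plethysm≡ F G mu nu ptμ ptν (length la))

  isExpansion : IsSchurExpansionOfPlethysm F G mu nu (λ la → plethysmCoeff F G la mu nu)
  isExpansion = (λ la _ ne → trans (plethysmCoeff≡ la) (schurCoef-size la ne)) , λ N α → begin
    pos (countMono α (plethysm F G mu nu N))
      ≡⟨ trans (countMono-coefL α (plethysm F G mu nu N)) (cong (λ z → coefL (map V.toList z) (V.toList α)) (plethysm≡ F G mu nu ptμ ptν N)) ⟩
    coefL (Family.mono Fm N) (V.toList α)
      ≡⟨ cong (λ z → coefL (Family.mono Fm z) (V.toList α)) (sym (VP.length-toList α)) ⟩
    coefL (Family.mono Fm (length (V.toList α))) (V.toList α)
      ≡⟨ expansion (V.toList α) ⟩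
    ∑ (partitionsOf degree) (λ κ → schurCoef κ *ᶻ coefL (map V.toList (schur (length (V.toList α)) κ)) (V.toList α))
      ≡⟨ ∑-cong (partitionsOf degree) (λ κ → cong₂ _*ᶻ_ (sym (plethysmCoeff≡ κ)) (trans (cong (λ z → coefL (map V.toList (schur z κ)) (V.toList α)) (VP.length-toList α)) (sym (countMono-coefL α (schur N κ))))) ⟩
    ∑ (partitionsOf degree) (λ κ → plethysmCoeff F G κ mu nu *ᶻ pos (countMono α (schur N κ)))
      ≡⟨ sym (sumℤ-∑ (partitionsOf degree) _) ⟩
    sumℤ (map (λ κ → plethysmCoeff F G κ mu nu *ᶻ pos (countMono α (schur N κ))) (partitionsOf degree)) ∎
    where
    open ≡-Reasoning
    Fm = toFamily (pleth F G mu nu ptμ ptν)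
    degree = size mu * size nu

  -- Outside the degree |μ||ν| the definition itself forces zero; inside it the coefficient is
  -- recovered by the functional. This lets the counting argument apply to any function satisfying
  -- the definition.
  expansion-unique : ∀ c → IsSchurExpansionOfPlethysm F G mu nu c → ∀ la → IsPartition la → c la ≡ schurCoef la
  expansion-unique c (off , ex) la pt with size la ≟ size mu * size nu
  ... | no ne = trans (off la pt ne) (sym (schurCoef-size la ne))
  ... | yes sz = unique c eqn la pt sz
    where
    Fm = toFamily (pleth F G mu nu ptμ ptν)
    eqn : ∀ α → coefL (Family.mono Fm (length α)) α ≡ ∑ (partitionsOf (size mu * size nu)) (λ κ → c κ *ᶻ coefL (map V.toList (schur (length α) κ)) α)
    eqn α = trans (sym (trans (countMono-coefL (V.fromList α) (plethysm F G mu nu (length α))) (cong₂ (λ z y → coefL (map V.toList z) y) (plethysm≡ F G mu nu ptμ ptν (length α)) (VP.toList∘fromList α))))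
      (trans (ex (length α) (V.fromList α)) (trans (sumℤ-∑ (partitionsOf (size mu * size nu)) _) (∑-cong (partitionsOf (size mu * size nu)) λ κ → cong (c κ *ᶻ_)
        (trans (countMono-coefL (V.fromList α) (schur (length α) κ)) (cong (coefL (map V.toList (schur (length α) κ))) (VP.toList∘fromList α))))))

gapP : ∀ F G → DecidedInPolytime (accept₊ F G) → DecidedInPolytime (accept₋ F G) →
       ∀ a → IsPlethysmCoeff F G a → IsGapPTriple a
gapP F G (M₊ , c₊ , ok₊) (M₋ , c₋ , ok₋) a isCoeff =
  g M₊ , g M₋ , (M₊ , c , proj₁ (ok₊ c le₊) , λ _ → refl) , (M₋ , c , proj₁ (ok₋ c le₋) , λ _ → refl) , value
  where
  c : ℕ
  -- One exponent serves three purposes: the running times of both machines and the length of the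
  -- witnesses. It also bounds the witness strings over which both counts are taken, so that they
  -- can be subtracted term by term.
  c = c₊ + (c₋ + 6)
  le₊ : c₊ ≤ c
  le₊ = ℕP.m≤m+n c₊ _
  le₋ : c₋ ≤ c
  le₋ = ℕP.≤-trans (ℕP.m≤m+n c₋ 6) (ℕP.m≤n+m _ c₊)
  le₆ : 6 ≤ c
  le₆ = ℕP.≤-trans (ℕP.m≤n+m 6 c₋) (ℕP.m≤n+m _ c₊)
  g : TM → Word → ℕ
  g M w = length (filterᵇ (λ u → acceptsᵇ M c (pairEnc w u)) (bitStringsUpTo (timeBound c (length w))))
  g-sum : ∀ M (q : Input → Bool) → (∀ x → acceptsᵇ M c x ≡ q x) → ∀ w → pos (g M w) ≡ ∑ (bitStringsUpTo (timeBound c (length w))) (λ u → ι (q (pairEnc w u)))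
  g-sum M q acc w = trans (length-filter _ (bitStringsUpTo (timeBound c (length w)))) (∑-cong (bitStringsUpTo (timeBound c (length w))) λ u → cong ι (acc (pairEnc w u)))
  value : ∀ la mu nu → IsPartition la → IsPartition mu → IsPartition nu →
          a la mu nu ≡ pos (g M₊ (encTriple la mu nu)) -ᶻ pos (g M₋ (encTriple la mu nu))
  value la mu nu ptλ ptμ ptν = trans (expansion-unique F G mu nu ptμ ptν (λ κ → a κ mu nu) (isCoeff mu nu ptμ ptν) la ptλ)
    (sym (trans (cong₂ _-ᶻ_ (g-sum M₊ (accept₊ F G) (proj₂ (ok₊ c le₊)) w) (g-sum M₋ (accept₋ F G) (proj₂ (ok₋ c le₋)) w))
      (trans (sym (∑-minus (bitStringsUpTo (timeBound c (length w))) _ _))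
        (Count.signed-count F G la mu nu ptμ ptν (timeBound c (length w)) (Count.bits-bound F G la mu nu ptμ ptν c le₆)))))
    where w = encTriple la mu nu

-- Existence is included so that the second clause is not vacuous; the second clause then covers
-- every function that has the right values on partitions.
theorem1p5 : (F G : Basis) →
    Σ (List ℕ → List ℕ → List ℕ → ℤ) (IsPlethysmCoeff F G) ×
    (∀ (a : List ℕ → List ℕ → List ℕ → ℤ) → IsPlethysmCoeff F G a → IsGapPTriple a)
theorem1p5 F G = (plethysmCoeff F G , λ mu nu ptμ ptν → isExpansion F G mu nu ptμ ptν) ,
  gapP F G (computable-polytime (accept₊ F G) (caccept₊ F G)) (computable-polytime (accept₋ F G) (caccept₋ F G))
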